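{- An NC-path-tree graph $G$ has a Hamiltonian cycle if and only if it is 2-connected and has at least three vertices. Also, when this is the case, for each plane layout of the clique NC-path-tree model $T$ of $G$, a distinct Hamiltonian cycle of $G$ can be constructed in linear time.
   Context: All graphs are simple, loopless, undirected and connected. For a graph with $n$ vertices and $m$ edges, linear time means $O(n+m)$. A graph is 2-connected if it is connected and has no cut-vertex. A Hamiltonian cycle of $G$ is a cycle of $G$ containing every vertex of $G$. A path-tree model of $G$ is a pair $(\{P_v\}_{v\in V(G)},T)$ where each $P_v$ is a path (possibly a single node), $T=\bigcup_{v}P_v$ is a tree, and for distinct $u,v$, $uv\in E(G)$ if and only if $P_u$ and $P_v$ share a node. Two paths $P_u,P_v$ are non-crossing if both $P_u\setminus P_v$ and $P_v\setminus P_u$ (obtained by deleting the nodes of the other path) are connected, where the empty set counts as connected. The model is an NC-path-tree model if the paths are pairwise non-crossing, and $G$ is an NC-path-tree graph if it has such a model. The model is a clique model if the nodes $x$ of $T$ are in bijection with the maximal cliques of $G$ via $x\mapsto\{v\in V(G):x\in P_v\}$; each NC-path-tree graph has a unique clique NC-path-tree model, which is referred to by its host tree $T$. A plane layout of the tree $T$ is a crossing-free drawing of $T$ in the plane, described by a cyclic order of the edges around each node of $T$. -}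

module Defs where

open import Data.Bool.Base using (Bool; true; false; _∧_; if_then_else_)
open import Data.Empty using (⊥)
open import Data.Fin.Base as Fin using (Fin; toℕ)
open import Data.Fin.Properties as Fin using ()
open import Data.Fin.Subset as Subset using (Subset)
open import Data.List.Base using
  (List; []; _∷_; _++_; _∷ʳ_; map; filter; length; concat; reverse;
   allFin; applyUpTo; cartesianProduct)
open import Data.List.Membership.Propositional using (_∈_; _∉_)
open import Data.List.Relation.Unary.Linked using (Linked)
open import Data.List.Relation.Unary.Unique.Propositional using (Unique)
open import Data.List.Scans.Base using (scanl)
open import Data.Nat.Base using (ℕ; zero; suc; pred; _+_; _*_; _≤_; _≡ᵇ_; _<ᵇ_)
open import Data.Product.Base using (Σ; ∃; ∃₂; _×_; _,_; proj₁; proj₂)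
open import Data.Sum.Base using (_⊎_)
open import Data.Vec.Base as Vec using ()
open import Function.Base using (_∘_)
open import Function.Bundles using (_⇔_)
open import Function.Definitions using (Injective)
open import Level using (0ℓ)
open import Relation.Binary.Construct.Closure.ReflexiveTransitive using (Star)
open import Relation.Binary.Core using (Rel)
open import Relation.Binary.Definitions using (Symmetric; Decidable)
open import Relation.Binary.PropositionalEquality.Core using (_≡_; _≢_)
open import Relation.Nullary.Decidable.Core using (does; _×-dec_)
open import Relation.Nullary.Negation.Core using (¬_)
open import Relation.Unary using (Pred)
import Data.List.Membership.DecPropositional as DecMembership

private
  variable
    n : ℕ

------------------------------------------------------------------------
-- Graphs

record Graph (n : ℕ) : Set₁ where
  infix 4 _~_ _~?_
  field
    _~_      : Rel (Fin n) 0ℓ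
    _~?_     : Decidable _~_
    ~-sym    : Symmetric _~_
    ~-irrefl : ∀ {v} → ¬ (v ~ v)

open Graph

edges : Graph n → List (Fin n × Fin n)
edges {n} G =
  filter (λ e → (proj₁ e Fin.<? proj₂ e) ×-dec _~?_ G (proj₁ e) (proj₂ e))
         (cartesianProduct (allFin n) (allFin n))

-- The number of vertices plus the number of edges.
size : Graph n → ℕ
size {n} G = n + length (edges G)

-- The graph with adjacency R is connected once every vertex outside S has been
-- deleted; the empty graph counts as connected.
ConnectedOn : {A : Set} → Rel A 0ℓ → Pred A 0ℓ → Set
ConnectedOn R S =
  ∀ {x y} → S x → S y → Star (λ a b → R a b × S a × S b) x y

Connected : Graph n → Set
Connected G = ∀ u v → Star (_~_ G) u v

CutVertex : Graph n → Fin n → Set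
CutVertex G v = ¬ ConnectedOn (_~_ G) (_≢ v)

TwoConnected : Graph n → Set
TwoConnected G = Connected G × (∀ v → ¬ CutVertex G v)

IsPath : Graph n → List (Fin n) → Set
IsPath G xs = xs ≢ [] × Unique xs × Linked (_~_ G) xs

-- A cycle is listed from any of its vertices, in either direction of traversal.
IsCycle : Graph n → List (Fin n) → Set
IsCycle G []       = ⊥
IsCycle G (x ∷ xs) =
  3 ≤ length (x ∷ xs) × Unique (x ∷ xs) × Linked (_~_ G) (x ∷ xs ∷ʳ x)

IsHamiltonianCycle : Graph n → List (Fin n) → Set
IsHamiltonianCycle G C = IsCycle G C × (∀ v → v ∈ C)

IsTree : Graph n → Set
IsTree G = Connected G × (∀ C → ¬ IsCycle G C)

IsClique : Graph n → Subset n → Set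
IsClique G K = ∀ {u v} → u Subset.∈ K → v Subset.∈ K → u ≢ v → _~_ G u v

IsMaximalClique : Graph n → Subset n → Set
IsMaximalClique G K =
  IsClique G K × (∀ K′ → IsClique G K′ → K Subset.⊆ K′ → K′ Subset.⊆ K)

-- Equality of lists read as cyclic sequences.  For lists of cycles this is
-- equality of directed cycles; as an undirected cycle, xs is also reverse xs.
infix 4 _↻_
_↻_ : {A : Set} → Rel (List A) 0ℓ
xs ↻ ys = ∃₂ λ ps qs → xs ≡ ps ++ qs × ys ≡ qs ++ ps

------------------------------------------------------------------------
-- Path-tree models

-- The edges of the path listed by xs.
PathEdge : {A : Set} → List A → Rel A 0ℓ
PathEdge xs x y = Consecutive x y ⊎ Consecutive y x
  where
  Consecutive : Rel _ 0ℓ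
  Consecutive a b = ∃₂ λ ps qs → xs ≡ ps ++ a ∷ b ∷ qs

record PathTreeModel (G : Graph n) : Set₁ where
  field
    {t}           : ℕ
    tree          : Graph t
    isTree        : IsTree tree
    path          : Fin n → List (Fin t)
    isPath        : ∀ v → IsPath tree (path v)
    -- The tree is the union of the paths.
    nodes-covered : ∀ x → ∃ λ v → x ∈ path v
    edges-covered : ∀ {x y} → _~_ tree x y → ∃ λ v → PathEdge (path v) x y
    represents    : ∀ {u v} → u ≢ v →
                    _~_ G u v ⇔ (∃ λ x → x ∈ path u × x ∈ path v)

  bag : Fin t → Subset n
  bag x = Vec.tabulate (λ v → does (x ∈? path v))
    where open DecMembership (Fin._≟_ {t}) using (_∈?_)

open PathTreeModel

module _ {G : Graph n} where

  IsNonCrossing : PathTreeModel G → Set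
  IsNonCrossing M =
    ∀ u v → ConnectedOn (PathEdge (path M u))
                        (λ x → x ∈ path M u × x ∉ path M v)

  IsCliqueModel : PathTreeModel G → Set
  IsCliqueModel M =
    (∀ x → IsMaximalClique G (bag M x)) ×
    Injective _≡_ _≡_ (bag M) ×
    (∀ K → IsMaximalClique G K → ∃ λ x → bag M x ≡ K)

IsNCPathTreeGraph : Graph n → Set₁
IsNCPathTreeGraph G = Σ (PathTreeModel G) IsNonCrossing

------------------------------------------------------------------------
-- Plane layouts

-- In a simple graph an edge at x is determined by its other end, so the cyclic
-- order of the edges around x is given as a list of the neighbours of x.  The
-- starting point of each list is immaterial: layouts are compared by _≈ᴸ_.
record PlaneLayout {t} (T : Graph t) : Set where
  field
    order      : Fin t → List (Fin t)
    unique     : ∀ x → Unique (order x)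
    neighbours : ∀ x y → y ∈ order x ⇔ _~_ T x y

open PlaneLayout

module _ {t} {T : Graph t} where

  infix 4 _≈ᴸ_
  _≈ᴸ_ : Rel (PlaneLayout T) 0ℓ
  L ≈ᴸ L′ = ∀ x → order L x ↻ order L′ x

  -- Reflecting the plane reverses every cyclic order.  Mirror images may only be
  -- told apart by the direction in which a cycle is traversed: the 3-sun, whose
  -- clique tree is a star with three leaves, has two layouts but, up to
  -- direction, only one Hamiltonian cycle.
  MirrorImages : Rel (PlaneLayout T) 0ℓ
  MirrorImages L L′ = ∀ x → order L x ↻ reverse (order L′ x)

------------------------------------------------------------------------
-- Random access machines

-- Structured programs for a unit-cost RAM whose memory consists of finitely
-- many banks of cells (banks can be interleaved in a single memory).  The only
-- arithmetic is successor and predecessor, so a computation of k steps produces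
-- no number larger than the input numbers plus O(k), and the unit cost hides no
-- computation on long words.  Evaluating the expressions of a fixed program
-- takes constant time, which is why only commands and tests are counted.

data Expr : Set where
  lit       : ℕ → Expr
  succ prec : Expr → Expr
  read      : (bank : ℕ) → Expr → Expr

infix 7 _≐_ _≺_
data Test : Set where
  _≐_ _≺_ : Expr → Expr → Test

infixr 5 _⨟_
data Program : Set where
  skip    : Program
  store   : (bank : ℕ) → (address value : Expr) → Program
  _⨟_     : Program → Program → Program
  if      : Test → Program → Program → Program
  while   : Test → Program → Program

Memory : Set
Memory = (bank cell : ℕ) → ℕ

⟦_⟧ : Expr → Memory → ℕ
⟦ lit k ⟧    μ = k
⟦ succ e ⟧   μ = suc (⟦ e ⟧ μ)
⟦ prec e ⟧   μ = pred (⟦ e ⟧ μ)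
⟦ read b e ⟧ μ = μ b (⟦ e ⟧ μ)

⟦_⟧ᵗ : Test → Memory → Bool
⟦ e ≐ e′ ⟧ᵗ μ = ⟦ e ⟧ μ ≡ᵇ ⟦ e′ ⟧ μ
⟦ e ≺ e′ ⟧ᵗ μ = ⟦ e ⟧ μ <ᵇ ⟦ e′ ⟧ μ

write : ℕ → ℕ → ℕ → Memory → Memory
write b i k μ b′ i′ = if (b ≡ᵇ b′) ∧ (i ≡ᵇ i′) then k else μ b′ i′

-- P , μ ⇓[ k ] ν : started in μ, P halts in ν after k steps.
infix 4 _,_⇓[_]_
data _,_⇓[_]_ : Program → Memory → ℕ → Memory → Set where
  ⇓-skip   : ∀ {μ} → skip , μ ⇓[ 1 ] μ
  ⇓-store  : ∀ {b i e μ} →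
             store b i e , μ ⇓[ 1 ] write b (⟦ i ⟧ μ) (⟦ e ⟧ μ) μ
  ⇓-seq    : ∀ {P Q μ ν ξ k l} →
             P , μ ⇓[ k ] ν → Q , ν ⇓[ l ] ξ → P ⨟ Q , μ ⇓[ k + l ] ξ
  ⇓-then   : ∀ {c P Q μ ν k} → ⟦ c ⟧ᵗ μ ≡ true →
             P , μ ⇓[ k ] ν → if c P Q , μ ⇓[ suc k ] ν
  ⇓-else   : ∀ {c P Q μ ν k} → ⟦ c ⟧ᵗ μ ≡ false →
             Q , μ ⇓[ k ] ν → if c P Q , μ ⇓[ suc k ] ν
  ⇓-stop   : ∀ {c P μ} → ⟦ c ⟧ᵗ μ ≡ false → while c P , μ ⇓[ 1 ] μ
  ⇓-loop   : ∀ {c P μ ν ξ k l} → ⟦ c ⟧ᵗ μ ≡ true →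
             P , μ ⇓[ k ] ν → while c P , ν ⇓[ l ] ξ →
             while c P , μ ⇓[ suc (k + l) ] ξ

------------------------------------------------------------------------
-- Input and output

-- A family of lists occupies two banks: the concatenation of the lists, and
-- before it the positions at which they start, followed by the total length.
listBanks : List (List ℕ) → List (List ℕ)
listBanks xss = scanl _+_ 0 (map length xss) ∷ concat xss ∷ []

familyBanks : ∀ {k l} → (Fin k → List (Fin l)) → List (List ℕ)
familyBanks f = listBanks (map (map toℕ ∘ f) (allFin _))

-- Cells beyond the end of a list hold 0.
cell : List ℕ → ℕ → ℕ
cell []       i       = 0
cell (x ∷ xs) zero    = x
cell (x ∷ xs) (suc i) = cell xs i

load : List (List ℕ) → Memory
load []         b       = cell []
load (xs ∷ xss) zero    = cell xs
load (xs ∷ xss) (suc b) = load xss b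

adjacencyLists : Graph n → Fin n → List (Fin n)
adjacencyLists {n} G v = filter (_~?_ G v) (allFin n)

-- Bank 0 holds the numbers of vertices and nodes, banks 1 and 2 the graph,
-- banks 3 and 4 the layout of the tree, and banks 5 and 6 the paths.
input : (G : Graph n) (M : PathTreeModel G) → PlaneLayout (tree M) → Memory
input {n} G M L = load
  ( (n ∷ t M ∷ [])
  ∷ familyBanks (adjacencyLists G)
  ++ familyBanks (order L)
  ++ familyBanks (path M) )

outputBank : ℕ
outputBank = 7

_Outputs_From_Within_ : Program → List (Fin n) → Memory → ℕ → Set
A Outputs C From μ Within s =
  ∃₂ λ k ν → (A , μ ⇓[ k ] ν) × k ≤ s ×
             applyUpTo (ν outputBank) (length C) ≡ map toℕ C

{-# OPTIONS --safe #-}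
module Submission where

-- Root the clique tree at a leaf.  The tour of a plane layout descends along the
-- tree: into a gap between two consecutive vertices p, q of the cycle whose paths
-- share the edge above a node y, it puts the vertices with top node y, and among
-- p, these vertices and q there is a gap for every child of y.  If no path passes
-- through y, then each edge below y carries at least two vertices with top node y,
-- because G is 2-connected.  If some path passes through y, then, the paths being
-- non-crossing and the bags maximal cliques, either y has one child, and a new
-- vertex replaces the one of p, q that reaches less deep, or y has exactly three
-- neighbours and every path through y consists of y and two of them; then p and q
-- have to turn to different children.  Every leaf of the tree has vertices of its
-- own, and the tour meets them in the order in which the layout shows the leaves:
-- this determines the layout.  The number of nodes is at most n, and the total
-- length of the paths is at most n + m, since a vertex v and a node x of its path
-- are determined by v and the newest vertex at x, which are adjacent or equal.
--
-- For a model that need not be a clique model, a Hamiltonian cycle is obtained by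
-- inserting the vertices of the claw-free chordal graph G one by one, in a perfect
-- elimination order.

open import Defs
open import Data.Bool.Base using (true; false; T; if_then_else_)
open import Data.Empty using (⊥; ⊥-elim)
open import Data.Fin.Base as Fin using (Fin; toℕ; zero; suc)
import Data.Fin.Properties as Fin
import Data.Fin.Subset as Subset
import Data.Fin.Subset.Properties as Subset
open import Data.List.Base hiding (lookup; find; sum)
import Data.List.Properties as List
open import Data.List.Membership.Propositional using (_∈_; _∉_; find)
open import Data.List.Membership.Propositional.Properties
import Data.List.Membership.DecPropositional as DecMembership
open import Data.List.Relation.Binary.Permutation.Propositional as ↭ using (_↭_; ↭-sym; ↭-trans; ↭-refl)
import Data.List.Relation.Binary.Permutation.Propositional.Properties as ↭
import Data.List.Relation.Binary.Permutation.Setoid.Properties as ↭ˢ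
open import Data.List.Relation.Unary.All as All using (All; []; _∷_)
import Data.List.Relation.Unary.All.Properties as All
open import Data.List.Relation.Unary.AllPairs as AllPairs using (AllPairs; []; _∷_)
import Data.List.Relation.Unary.AllPairs.Properties as AllPairs
open import Data.List.Relation.Unary.Any as Any using (Any; here; there)
import Data.List.Relation.Unary.Any.Properties as Any
open import Data.List.Relation.Unary.Linked as Linked using (Linked; []; [-]; _∷_)
open import Data.List.Relation.Unary.Unique.Propositional using (Unique)
import Data.List.Relation.Unary.Unique.Propositional.Properties as Unique
import Data.List.Scans.Base as Scans
open import Data.Maybe.Base using (Maybe; just; nothing)
import Data.Maybe.Properties as Maybe
open import Data.Nat.Base
open import Data.Nat.ListAction using (sum)
open import Data.Nat.Properties
open import Data.Nat.Tactic.RingSolver using (solve-∀)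
open import Data.Product.Base using (Σ; ∃; ∃₂; _×_; _,_; proj₁; proj₂)
open import Data.Sum.Base as Sum using (_⊎_; inj₁; inj₂)
import Data.Sum.Properties as Sum
open import Data.Unit.Base using (⊤; tt)
import Data.Vec.Base as Vec
import Data.Vec.Properties as Vec
open import Function.Base using (_∘_; id; case_of_)
open import Function.Bundles using (_⇔_; mk⇔; Equivalence)
open import Level using (0ℓ)
open import Relation.Binary.Construct.Closure.ReflexiveTransitive as Star using (Star; ε; _◅_; _◅◅_)
open import Relation.Binary.Core using (Rel)
open import Relation.Binary.Definitions using (tri<; tri≈; tri>)
open import Relation.Binary.PropositionalEquality hiding ([_])
open import Relation.Nullary using (¬_; Dec; yes; no; contradiction; does)
open import Relation.Nullary.Decidable using (_×-dec_; ¬?; dec-true; decidable-stable)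
open import Relation.Unary using (Pred; Decidable)

-- The obstacle is that a gap must be prepared before the tour sees what lies below it: at a node
-- with two children that some path passes, `p` and `q` must already turn to different children.
-- Paths through such a node have three nodes, so `p` and `q` belong to one group, and it suffices
-- to choose the first two members of each group well: the largest key first, the smallest of the
-- others second. This replaces sorting and keeps the time linear. Above a single child the
-- condition is that one known end of the gap reaches deep enough. A new vertex reaches at least as
-- deep as the older ones, so a lone new vertex becomes the deep end of the next gap; `Side` records
-- which end this is. The root is a leaf because no path passes through a leaf: the descent starts
-- without a surrounding gap. Vertices living only at the root end every tour, so rotated tours can
-- be aligned. The equivalence admits models whose bags are neither maximal nor distinct. Arguments
-- that take a vertex from the difference of two bags fail there, hence the separate proof.

private
  variable
    A B C : Set
    n m k : ℕ

-- Rooted trees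

unique-++ˡ : ∀ (xs : List A) {ys} → Unique (xs ++ ys) → Unique xs
unique-++ˡ []       _        = []
unique-++ˡ (x ∷ xs) (p ∷ ps) = All.++⁻ˡ xs p ∷ unique-++ˡ xs ps

unique-++ʳ : ∀ (xs : List A) {ys} → Unique (xs ++ ys) → Unique ys
unique-++ʳ []       u        = u
unique-++ʳ (x ∷ xs) (_ ∷ ps) = unique-++ʳ xs ps

unique-++-disjoint : ∀ (xs : List A) {ys z} → Unique (xs ++ ys) → z ∈ xs → z ∉ ys
unique-++-disjoint (x ∷ xs) (p ∷ _) (here refl) z∈ys = All.lookup p (∈-++⁺ʳ xs z∈ys) refl
unique-++-disjoint (x ∷ xs) (_ ∷ u) (there z∈)  z∈ys = unique-++-disjoint xs u z∈ z∈ys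

unique-resp-↭ : ∀ {xs ys : List A} → xs ↭ ys → Unique xs → Unique ys
unique-resp-↭ p = ↭ˢ.Unique-resp-↭ (setoid _) (↭.↭⇒↭ₛ p)

unique-⊆-length : ∀ {xs ys : List A} → Unique xs → (∀ {x} → x ∈ xs → x ∈ ys) →
                  length xs ≤ length ys
unique-⊆-length {xs = []} _ _ = z≤n
unique-⊆-length {xs = x ∷ xs} (p ∷ u) xs⊆ys with ∈-∃++ (xs⊆ys (here refl))
... | as , bs , refl = begin
  suc (length xs)             ≤⟨ s≤s (unique-⊆-length u λ {z} z∈ → drop-x z∈ (∈-++⁻ as (xs⊆ys (there z∈)))) ⟩
  suc (length (as ++ bs))     ≡⟨ cong suc (List.length-++ as) ⟩
  suc (length as + length bs) ≡⟨ sym (+-suc _ _) ⟩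
  length as + suc (length bs) ≡⟨ sym (List.length-++ as) ⟩
  length (as ++ x ∷ bs)       ∎
  where
  open ≤-Reasoning
  drop-x : ∀ {z} → z ∈ xs → z ∈ as ⊎ z ∈ x ∷ bs → z ∈ as ++ bs
  drop-x z∈ (inj₁ z∈as)         = ∈-++⁺ˡ z∈as
  drop-x z∈ (inj₂ (there z∈bs)) = ∈-++⁺ʳ as z∈bs
  drop-x z∈ (inj₂ (here refl))  = contradiction z∈ (All.All¬⇒¬Any p)

unique-same-length : ∀ {xs ys : List A} → Unique xs → Unique ys →
                     (∀ {x} → x ∈ xs → x ∈ ys) → (∀ {x} → x ∈ ys → x ∈ xs) →
                     length xs ≡ length ys
unique-same-length u v f g = ≤-antisym (unique-⊆-length u f) (unique-⊆-length v g)

unique-Fin-length : ∀ {xs : List (Fin n)} → Unique xs → length xs ≤ n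
unique-Fin-length {n} {xs} u =
  subst (length xs ≤_) (List.length-tabulate {n = n} id) (unique-⊆-length u (λ {x} _ → ∈-allFin x))

unique-split : ∀ {x : A} as {bs cs ds} → Unique (as ++ x ∷ bs) →
               as ++ x ∷ bs ≡ cs ++ x ∷ ds → as ≡ cs × bs ≡ ds
unique-split []       {cs = []}     u refl = refl , refl
unique-split []       {cs = c ∷ cs} (p ∷ u) refl = contradiction (∈-insert cs) (All.All¬⇒¬Any p)
unique-split (a ∷ as) {cs = []}     (p ∷ u) refl = contradiction (∈-insert as) (All.All¬⇒¬Any p)
unique-split (a ∷ as) {cs = c ∷ cs} (p ∷ u) e with List.∷-injective e
... | refl , e′ with unique-split as u e′
...   | refl , refl = refl , refl

module _ {R : Rel A 0ℓ} where

  linked-++ˡ : ∀ xs {ys} → Linked R (xs ++ ys) → Linked R xs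
  linked-++ˡ []           _       = []
  linked-++ˡ (x ∷ [])     _       = [-]
  linked-++ˡ (x ∷ y ∷ xs) (p ∷ l) = p ∷ linked-++ˡ (y ∷ xs) l

  linked-++ʳ : ∀ xs {ys} → Linked R (xs ++ ys) → Linked R ys
  linked-++ʳ []       l = l
  linked-++ʳ (x ∷ xs) l = linked-++ʳ xs (Linked.tail l)

  linked-join : ∀ xs {a ys} → Linked R (xs ++ a ∷ []) → Linked R (a ∷ ys) →
                Linked R (xs ++ a ∷ ys)
  linked-join []           _       m = m
  linked-join (x ∷ [])     (p ∷ _) m = p ∷ m
  linked-join (x ∷ y ∷ xs) (p ∷ l) m = p ∷ linked-join (y ∷ xs) l m

  linked-mid : ∀ xs {a b ys} → Linked R (xs ++ a ∷ b ∷ ys) → R a b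
  linked-mid []       (p ∷ _) = p
  linked-mid (x ∷ xs) l       = linked-mid xs (Linked.tail l)

  module _ {Q : Pred A 0ℓ} (Q? : Decidable Q) where

    Crossing : List A → Set
    Crossing xs = ∃₂ λ c d → c ∈ xs × d ∈ xs × Q c × ¬ Q d × (R c d ⊎ R d c)

    -- A discrete intermediate value argument. With `Q` a subtree, it produces the edge by which a
    -- path leaves that subtree.
    crossing : ∀ {xs a b} → Linked R xs → a ∈ xs → b ∈ xs → Q a → ¬ Q b → Crossing xs
    crossing l a∈ b∈ = go l (a∈ , b∈)
      where
      weaken : ∀ {x xs} → Crossing xs → Crossing (x ∷ xs)
      weaken (c , d , c∈ , d∈ , rest) = c , d , there c∈ , there d∈ , rest

      go : ∀ {xs a b} → Linked R xs → a ∈ xs × b ∈ xs → Q a → ¬ Q b → Crossing xs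
      go l (here refl , here refl) qa qb = contradiction qa qb
      go [-] (here refl , there ()) qa qb
      go [-] (there () , _) qa qb
      go {xs = x ∷ y ∷ _} (p ∷ l) (here refl , there b∈) qa qb with Q? y
      ... | yes qy = weaken (go l (here refl , b∈) qy qb)
      ... | no ¬qy = x , y , here refl , there (here refl) , qa , ¬qy , inj₁ p
      go {xs = x ∷ y ∷ _} (p ∷ l) (there a∈ , here refl) qa qb with Q? y
      ... | yes qy = y , x , there (here refl) , here refl , qy , qb , inj₂ p
      ... | no ¬qy = weaken (go l (a∈ , here refl) qa ¬qy)
      go (p ∷ l) (there a∈ , there b∈) qa qb = weaken (go l (a∈ , b∈) qa qb)

-- If both pieces of the rotation were non-empty, each would end one of the two lists and hence end
-- in `a`, so `a` would occur twice.
↻-unique-last : ∀ {xs ys : List A} {a} → Unique (xs ++ a ∷ []) →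
                (xs ++ a ∷ []) ↻ (ys ++ a ∷ []) → xs ≡ ys
↻-unique-last {xs = xs} {ys} {a} u (ps , qs , e₁ , e₂) = go (initLast ps) (initLast qs) e₁ e₂
  where
  go : ∀ {ps qs} → InitLast ps → InitLast qs → xs ++ a ∷ [] ≡ ps ++ qs → ys ++ a ∷ [] ≡ qs ++ ps → xs ≡ ys
  go [] _ refl e₂ = sym (List.∷ʳ-injectiveˡ _ _ (trans e₂ (List.++-identityʳ _)))
  go (ps ∷ʳ′ p) [] e₁ e₂ = List.∷ʳ-injectiveˡ _ _ (trans e₁ (trans (List.++-identityʳ _) (sym e₂)))
  go (ps ∷ʳ′ p) (qs ∷ʳ′ q) e₁ e₂
    with List.∷ʳ-injectiveʳ xs ((ps ∷ʳ p) ++ qs) (trans e₁ (sym (List.++-assoc (ps ∷ʳ p) qs (q ∷ []))))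
       | List.∷ʳ-injectiveʳ ys ((qs ∷ʳ q) ++ ps) (trans e₂ (sym (List.++-assoc (qs ∷ʳ q) ps (p ∷ []))))
  ... | refl | refl =
    ⊥-elim (unique-++-disjoint (ps ∷ʳ a) (subst Unique e₁ u) (∈-insert ps) (∈-insert qs))

module TreePaths {t} (T : Graph t) where
  open Graph T
  open DecMembership (Fin._≟_ {t}) using (_∈?_)

  data Path : Fin t → Fin t → List (Fin t) → Set where
    stop : ∀ {x} → Path x x (x ∷ [])
    step : ∀ {x y z zs} → x ~ z → Path z y zs → Path x y (x ∷ zs)

  path-head : ∀ {x y zs} → Path x y zs → x ∈ zs
  path-head stop       = here refl
  path-head (step _ _) = here refl

  path-last : ∀ {x y zs} → Path x y zs → y ∈ zs
  path-last stop       = here refl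
  path-last (step _ p) = there (path-last p)

  cut : ∀ {x y z zs} → Path z y zs → x ∈ zs → ∃₂ λ ps ws → zs ≡ ps ++ ws × Path x y ws
  cut p@stop       (here refl) = [] , _ , refl , p
  cut p@(step _ _) (here refl) = [] , _ , refl , p
  cut (step _ p)   (there x∈) with cut p x∈
  ... | ps , ws , refl , q = _ ∷ ps , ws , refl , q

  module _ {S : Pred (Fin t) 0ℓ} where

    Walk : Rel (Fin t) 0ℓ
    Walk = Star (λ a b → a ~ b × S a × S b)

    -- Loop erasure: if `x` already occurs on the shortened rest, everything before that occurrence
    -- is dropped.
    erase : ∀ {x y} → Walk x y → S x → ∃ λ zs → Path x y zs × Unique zs × All S zs
    erase ε sx = _ , stop , [] ∷ [] , sx ∷ []
    erase {x} ((x~z , sx , sz) ◅ w) _ with erase w sz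
    ... | zs , p , u , s with x ∈? zs
    ...   | no x∉ = _ , step x~z p , All.¬Any⇒All¬ _ x∉ ∷ u , sx ∷ s
    ...   | yes x∈ with cut p x∈
    ...     | ps , ws , refl , q = ws , q , unique-++ʳ ps u , All.++⁻ʳ ps s

    path⇒walk : ∀ {x y zs} → Path x y zs → All S zs → Walk x y
    path⇒walk stop s = ε
    path⇒walk (step x~z p) (sx ∷ s) =
      (x~z , sx , All.lookup s (path-head p)) ◅ path⇒walk p s

    walk-sym : ∀ {x y} → Walk x y → Walk y x
    walk-sym = Star.reverse (λ (e , sa , sb) → ~-sym e , sb , sa)

  path-linked : ∀ {x y zs a} → Path x y zs → y ~ a → Linked _~_ (zs ∷ʳ a)
  path-linked stop y~a = y~a ∷ [-]
  path-linked (step x~z p@stop) y~a = x~z ∷ path-linked p y~a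
  path-linked (step x~z p@(step _ _)) y~a = x~z ∷ path-linked p y~a

  -- For `b ≢ b′` the loop-erased walk has at least two nodes and misses `a`, so together with `a`
  -- it would be a cycle.
  acyclic : (∀ C → ¬ IsCycle T C) → ∀ {a b b′} → a ~ b → a ~ b′ → Walk {_≢ a} b b′ → b ≡ b′
  acyclic noCycle {a} {b} {b′} a~b a~b′ w with b Fin.≟ b′
  ... | yes e = e
  ... | no b≢b′ with erase w (λ { refl → ~-irrefl a~b })
  ...   | zs , p , u , s = ⊥-elim (noCycle (a ∷ zs)
            (long p b≢b′ , (All.map (λ ne e → ne (sym e)) s ∷ u) , prepend p (path-linked p (~-sym a~b′))))
    where
    long : ∀ {zs} → Path b b′ zs → b ≢ b′ → 3 ≤ suc (length zs)
    long stop ne = contradiction refl ne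
    long (step _ stop) ne = s≤s (s≤s (s≤s z≤n))
    long (step _ (step _ p)) ne = s≤s (s≤s (s≤s z≤n))
    prepend : ∀ {zs} → Path b b′ zs → Linked _~_ (zs ∷ʳ a) → Linked _~_ (a ∷ zs ∷ʳ a)
    prepend stop       l = a~b ∷ l
    prepend (step _ _) l = a~b ∷ l

  path-unique : (∀ C → ¬ IsCycle T C) → ∀ {x r xs ys} → Path x r xs → Unique xs →
                Path x r ys → Unique ys → xs ≡ ys
  path-unique nc stop u stop v = refl
  path-unique nc stop u (step _ q) (v ∷ _) = contradiction (path-last q) (All.All¬⇒¬Any v)
  path-unique nc (step _ p) (u ∷ _) stop v = contradiction (path-last p) (All.All¬⇒¬Any u)
  path-unique nc (step x~z p) (x∉ ∷ u) (step x~z′ q) (x∉′ ∷ v)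
    with acyclic nc x~z x~z′ (path⇒walk p (All.map ≢-sym x∉) ◅◅ walk-sym (path⇒walk q (All.map ≢-sym x∉′)))
  ... | refl = cong (_ ∷_) (path-unique nc p u q v)

record Rooting {t} (T : Graph t) (r : Fin t) : Set where
  open Graph T
  field
    parent      : Fin t → Maybe (Fin t)
    depth       : Fin t → ℕ
    depth<      : ∀ x → depth x < t
    parent-root : parent r ≡ nothing
    root-only   : ∀ {x} → parent x ≡ nothing → x ≡ r
    parent-edge : ∀ {x p} → parent x ≡ just p → x ~ p
    depth-suc   : ∀ {x p} → parent x ≡ just p → depth x ≡ suc (depth p)
    edge        : ∀ {x y} → x ~ y → parent x ≡ just y ⊎ parent y ≡ just x

module _ {t} (T : Graph t) (isTree : IsTree T) (r : Fin t) where
  open Graph T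
  open TreePaths T
  open DecMembership (Fin._≟_ {t}) using (_∈?_)

  private
    noCycle = proj₂ isTree

    branch : ∀ x → ∃ λ zs → Path x r zs × Unique zs × All (λ _ → ⊤) zs
    branch x = erase (Star.map (λ e → e , tt , tt) (proj₁ isTree x r)) tt

    second : List (Fin t) → Maybe (Fin t)
    second (_ ∷ y ∷ _) = just y
    second _           = nothing

    nodes : Fin t → List (Fin t)
    nodes x = proj₁ (branch x)

    nodes-≡ : ∀ {x zs} → Path x r zs → Unique zs → nodes x ≡ zs
    nodes-≡ {x} p u = let (_ , q , v , _) = branch x in path-unique noCycle q v p u

    nodes-step : ∀ {x y} → x ~ y → x ∉ nodes y → nodes x ≡ x ∷ nodes y
    nodes-step {x} {y} x~y x∉ = let (_ , q , v , _) = branch y in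
      nodes-≡ (step x~y q) (All.¬Any⇒All¬ _ x∉ ∷ v)

    second-nodes : ∀ y → ∃ λ zs → nodes y ≡ y ∷ zs
    second-nodes y with branch y
    ... | _ , stop , _ = _ , refl
    ... | _ , step _ _ , _ = _ , refl

    parent-nodes : ∀ {x p} → second (nodes x) ≡ just p → x ~ p × nodes x ≡ x ∷ nodes p
    parent-nodes {x} {p} e with branch x
    parent-nodes {x} {p} () | _ , stop , u , _
    parent-nodes {x} {p} refl | _ , step x~z q@stop , (_ ∷ u) , _ = x~z , cong (x ∷_) (sym (nodes-≡ q u))
    parent-nodes {x} {p} refl | _ , step x~z q@(step _ _) , (_ ∷ u) , _ = x~z , cong (x ∷_) (sym (nodes-≡ q u))

    parent-step : ∀ {x y} → nodes x ≡ x ∷ nodes y → second (nodes x) ≡ just y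
    parent-step {x} {y} e with second-nodes y
    ... | zs , e′ = cong second (trans e (cong (x ∷_) e′))

    -- Of two adjacent nodes, one misses the branch of the other: if each lay on the other's branch,
    -- each branch would be a suffix of the other, so the branches would coincide and have the same
    -- first node.
    nodes-edge : ∀ {x y} → x ~ y → second (nodes x) ≡ just y ⊎ second (nodes y) ≡ just x
    nodes-edge {x} {y} x~y with x ∈? nodes y
    ... | no x∉ = inj₁ (parent-step (nodes-step x~y x∉))
    ... | yes x∈ with y ∈? nodes x
    ...   | no y∉ = inj₂ (parent-step (nodes-step (~-sym x~y) y∉))
    ...   | yes y∈ with cut (proj₁ (proj₂ (branch y))) x∈ | cut (proj₁ (proj₂ (branch x))) y∈
    ...     | ps , ws , e , p | qs , zs , e′ , q
              with nodes-≡ p (unique-++ʳ ps (subst Unique e (proj₁ (proj₂ (proj₂ (branch y))))))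
                 | nodes-≡ q (unique-++ʳ qs (subst Unique e′ (proj₁ (proj₂ (proj₂ (branch x))))))
    ...       | refl | refl = ⊥-elim (~-irrefl (subst (_~ y) x≡y x~y))
      where
      ps≡[] : ∀ (ps : List (Fin t)) qs {as bs} → as ≡ ps ++ bs → bs ≡ qs ++ as → ps ≡ []
      ps≡[] []       qs _ _ = refl
      ps≡[] (p ∷ ps) qs {as} {bs} a b = contradiction len (<⇒≢ (m<n+m (length as) {suc (length ps + length qs)} (s≤s z≤n)))
        where
        len : length as ≡ suc (length ps + length qs) + length as
        len = trans (cong length (trans a (cong ((p ∷ ps) ++_) b)))
                (cong suc (trans (List.length-++ ps) (trans (cong (length ps +_) (List.length-++ qs)) (sym (+-assoc (length ps) _ _)))))
      x≡y : x ≡ y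
      x≡y = let (_ , a) = second-nodes x ; (_ , b) = second-nodes y in
        List.∷-injectiveˡ (trans (sym a) (trans (sym (trans e (cong (_++ nodes x) (ps≡[] ps qs e e′)))) b))

  rooting : Rooting T r
  rooting = record
    { parent      = λ x → second (nodes x)
    ; depth       = λ x → pred (length (nodes x))
    ; depth<      = λ x → let (_ , p , u , _) = branch x in pred-< p (unique-Fin-length u)
    ; parent-root = cong second (nodes-≡ stop ([] ∷ []))
    ; root-only   = λ {x} → only (proj₁ (proj₂ (branch x)))
    ; parent-edge = λ e → proj₁ (parent-nodes e)
    ; depth-suc   = λ {x} {p} e → let (_ , a) = second-nodes p in
                      trans (cong (pred ∘ length) (proj₂ (parent-nodes e)))
                            (subst (λ l → length l ≡ suc (pred (length l))) (sym a) refl)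
    ; edge        = nodes-edge
    }
    where
    pred-< : ∀ {x zs m} → Path x r zs → length zs ≤ m → pred (length zs) < m
    pred-< stop       l = l
    pred-< (step _ _) l = l
    only : ∀ {x zs} → Path x r zs → second zs ≡ nothing → x ≡ r
    only stop _ = refl
    only (step _ stop) ()
    only (step _ (step _ _)) ()

module Rooted {t} {T : Graph t} {r : Fin t} (R : Rooting T r) where
  open Graph T
  open Rooting R

  infix 4 _≼_ _≼?_
  -- `z ≼ x` means that `z` lies in the subtree of `x`; going up in this order is going towards the
  -- root.
  _≼_ : Rel (Fin t) 0ℓ
  _≼_ = Star (λ c p → parent c ≡ just p)

  ≼-depth : ∀ {z x} → z ≼ x → depth x ≤ depth z
  ≼-depth ε = ≤-refl
  ≼-depth (e ◅ w) = ≤-trans (≼-depth w) (≤-trans (n≤1+n _) (≤-reflexive (sym (depth-suc e))))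

  parent-< : ∀ {c p} → parent c ≡ just p → depth p < depth c
  parent-< e = ≤-reflexive (sym (depth-suc e))

  kid⋡ : ∀ {c p} → parent c ≡ just p → ¬ p ≼ c
  kid⋡ e w = <⇒≱ (parent-< e) (≼-depth w)

  parent-≢ : ∀ {c p} → parent c ≡ just p → c ≢ p
  parent-≢ e refl = <-irrefl refl (parent-< e)

  same-parent : ∀ {c p q} → parent c ≡ just p → parent c ≡ just q → p ≡ q
  same-parent e e′ = Maybe.just-injective (trans (sym e) e′)

  ≼-antisym : ∀ {z x} → z ≼ x → x ≼ z → z ≡ x
  ≼-antisym ε w = refl
  ≼-antisym (e ◅ w) w′ = contradiction (≤-trans (parent-< e) (≼-depth w′)) (≤⇒≯ (≼-depth w))

  _≼?_ : ∀ z x → Dec (z ≼ x)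
  z ≼? x = go (depth z) z ≤-refl
    where
    go : ∀ k z → depth z ≤ k → Dec (z ≼ x)
    go k z d with z Fin.≟ x
    ... | yes refl = yes ε
    ... | no z≢x with parent z in e
    ...   | nothing = no λ { ε → z≢x refl ; (e′ ◅ w) → case trans (sym e) e′ of λ () }
    go zero z d | no z≢x | just p = contradiction (≤-trans (parent-< e) d) λ ()
    go (suc k) z d | no z≢x | just p with go k p (s≤s⁻¹ (≤-trans (parent-< e) d))
    ... | yes w = yes (e ◅ w)
    ... | no ¬w = no λ { ε → z≢x refl ; (e′ ◅ w) → ¬w (subst (_≼ x) (same-parent e′ e) w) }

  ≼-same-depth : ∀ {z c d} → z ≼ c → z ≼ d → depth c ≡ depth d → c ≡ d
  ≼-same-depth ε ε _ = refl
  ≼-same-depth ε (_◅_ {j = j} e w) eq = contradiction (subst (_≤ depth j) (sym eq) (≼-depth w)) (<⇒≱ (parent-< e))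
  ≼-same-depth (_◅_ {j = j} e w) ε eq = contradiction (subst (_≤ depth j) eq (≼-depth w)) (<⇒≱ (parent-< e))
  ≼-same-depth (e ◅ w) (e′ ◅ w′) eq with same-parent e e′
  ... | refl = ≼-same-depth w w′ eq

  kids-disjoint : ∀ {z x c d} → parent c ≡ just x → parent d ≡ just x → z ≼ c → z ≼ d → c ≡ d
  kids-disjoint e e′ w w′ = ≼-same-depth w w′ (trans (depth-suc e) (sym (depth-suc e′)))

  ≼-chain : ∀ {z x y} → z ≼ x → z ≼ y → x ≼ y ⊎ y ≼ x
  ≼-chain ε w = inj₁ w
  ≼-chain w ε = inj₂ w
  ≼-chain (e ◅ w) (e′ ◅ w′) with same-parent e e′
  ... | refl = ≼-chain w w′

  kid-towards : ∀ {z x} → z ≼ x → z ≢ x → ∃ λ c → parent c ≡ just x × z ≼ c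
  kid-towards ε ne = contradiction refl ne
  kid-towards {x = x} (_◅_ {j = p} e w) ne with p Fin.≟ x
  ... | yes refl = _ , e , ε
  ... | no p≢x with kid-towards w p≢x
  ...   | c , ec , p≼c = c , ec , e ◅ p≼c

  ≼-root : ∀ z → z ≼ r
  ≼-root z = go (depth z) z ≤-refl
    where
    go : ∀ k z → depth z ≤ k → z ≼ r
    go k z d with parent z in e
    ... | nothing = subst (z ≼_) (root-only e) ε
    go zero z d | just p = contradiction (≤-trans (parent-< e) d) λ ()
    go (suc k) z d | just p = e ◅ go k p (s≤s⁻¹ (≤-trans (parent-< e) d))

  nbr-kid : ∀ {a y} → a ~ y → parent y ≢ just a → parent a ≡ just y
  nbr-kid a~y ne with edge a~y
  ... | inj₁ e = e
  ... | inj₂ e = contradiction e ne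

  nbr-⋠ : ∀ {a b y} → a ~ y → parent b ≡ just y → a ≢ b → ¬ a ≼ b
  nbr-⋠ a~y eb ne w with edge a~y
  ... | inj₁ ea = ne (kids-disjoint ea eb ε w)
  ... | inj₂ ey = <⇒≱ (<-trans (parent-< ey) (parent-< eb)) (≼-depth w)

  leave : ∀ {a b x} → a ~ b → a ≼ x → ¬ b ≼ x → a ≡ x × parent x ≡ just b
  leave a~b w ¬w with edge a~b
  ... | inj₂ e = contradiction (e ◅ w) ¬w
  leave a~b ε ¬w | inj₁ e = refl , e
  leave a~b (e′ ◅ w) ¬w | inj₁ e = contradiction (subst (_≼ _) (same-parent e′ e) w) ¬w

  -- The only edge between the subtree of `x` and the rest of the tree joins `x` to its parent, so a
  -- path that meets both sides contains both ends of this edge.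
  enter-subtree : ∀ {xs a b x} → Linked _~_ xs → a ∈ xs → b ∈ xs → a ≼ x → ¬ b ≼ x →
                  x ∈ xs × ∃ λ p → parent x ≡ just p × p ∈ xs
  enter-subtree {x = x} l a∈ b∈ w ¬w with crossing (_≼? x) l a∈ b∈ w ¬w
  ... | c , d , c∈ , d∈ , wc , ¬wd , cd with leave (sym-edge cd) wc ¬wd
    where
    sym-edge : ∀ {c d} → c ~ d ⊎ d ~ c → c ~ d
    sym-edge (inj₁ e) = e
    sym-edge (inj₂ e) = ~-sym e
  ...   | refl , e = c∈ , d , e , d∈

  -- A node outside the subtree of `m` would force the parent of `m` into the list. Thus a path has
  -- a top node, and any measure that decreases towards the root, such as depth or rank, finds it.
  top-all : ∀ {xs m} → Linked _~_ xs → m ∈ xs → (∀ {p} → parent m ≡ just p → p ∉ xs) →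
            ∀ {z} → z ∈ xs → z ≼ m
  top-all {m = m} l m∈ no-parent {z} z∈ with z ≼? m
  ... | yes w = w
  ... | no ¬w with enter-subtree l m∈ z∈ ε ¬w
  ...   | _ , p , e , p∈ = contradiction p∈ (no-parent e)

  between : ∀ {xs m x z} → Linked _~_ xs → m ∈ xs → z ∈ xs → z ≼ x → x ≼ m → x ∈ xs
  between {m = m} {x} l m∈ z∈ z≼x x≼m with m Fin.≟ x
  ... | yes refl = m∈
  ... | no m≢x = proj₁ (enter-subtree l z∈ m∈ z≼x (λ m≼x → m≢x (≼-antisym m≼x x≼m)))

  -- A linked list that misses y stays in one component of T − y.
  one-side : ∀ {xs y b w x} → Linked _~_ xs → y ∉ xs → parent b ≡ just y →
             w ∈ xs → x ∈ xs → w ≼ b → x ≼ b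
  one-side {b = b} {x = x} l y∉ e w∈ x∈ w≼b with x ≼? b
  ... | yes x≼b = x≼b
  ... | no ¬x≼b with enter-subtree l w∈ x∈ w≼b ¬x≼b
  ...   | _ , p , e′ , p∈ = contradiction (subst (_∈ _) (same-parent e′ e) p∈) y∉

  one-nbr : ∀ {xs y a b} → Linked _~_ xs → y ∉ xs → a ∈ xs → b ∈ xs → a ~ y → b ~ y → a ≡ b
  one-nbr {y = y} {a} {b} l y∉ a∈ b∈ a~y b~y with a Fin.≟ b
  ... | yes e = e
  ... | no a≢b with edge a~y
  ...   | inj₁ ea = contradiction (one-side l y∉ ea a∈ b∈ ε) (nbr-⋠ b~y ea (≢-sym a≢b))
  ...   | inj₂ ey = contradiction (one-side l y∉ eb b∈ a∈ ε) (nbr-⋠ a~y eb a≢b)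
    where
    eb = nbr-kid b~y (λ e → a≢b (same-parent ey e))

-- Paths of a model in the rooted host tree, and the consequences of non-crossing.

module Models {n} {G : Graph n} (M : PathTreeModel G) where
  open Graph G
  open PathTreeModel M public
  open Graph tree public using () renaming (_~_ to _~ᵀ_; ~-sym to ~ᵀ-sym; ~-irrefl to ~ᵀ-irrefl)
  open DecMembership (Fin._≟_ {t}) public using (_∈?_)

  infix 4 _∋_
  _∋_ : Fin n → Fin t → Set
  v ∋ x = x ∈ path v

  path-linked : ∀ v → Linked _~ᵀ_ (path v)
  path-linked v = proj₂ (proj₂ (isPath v))

  path-uniq : ∀ v → Unique (path v)
  path-uniq v = proj₁ (proj₂ (isPath v))

  ∈-bag⁺ : ∀ {v x} → v ∋ x → v Subset.∈ bag x
  ∈-bag⁺ {v} {x} v∋x = Vec.lookup⇒[]= v (bag x) (trans (Vec.lookup∘tabulate _ v) (dec-true (x ∈? path v) v∋x))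

  ∈-bag⁻ : ∀ {v x} → v Subset.∈ bag x → v ∋ x
  ∈-bag⁻ {v} {x} v∈ with x ∈? path v | trans (sym (Vec.lookup∘tabulate (λ v → does (x ∈? path v)) v)) (Vec.[]=⇒lookup v∈)
  ... | yes p | _ = p
  ... | no _  | ()

  share⇒~ : ∀ {u v x} → u ≢ v → u ∋ x → v ∋ x → u ~ v
  share⇒~ u≢v p q = Equivalence.from (represents u≢v) (_ , p , q)

  ~⇒share : ∀ {u v} → u ~ v → ∃ λ x → u ∋ x × v ∋ x
  ~⇒share u~v = Equivalence.to (represents (λ { refl → ~-irrefl u~v })) u~v

  path-≢[] : ∀ v → ∃ λ x → v ∋ x
  path-≢[] v with path v | proj₁ (isPath v)
  ... | []    | ne = contradiction refl ne
  ... | x ∷ _ | _  = x , here refl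

  edge-vertex : ∀ {x y} → x ~ᵀ y → ∃ λ v → v ∋ x × v ∋ y
  edge-vertex e with edges-covered e
  ... | v , inj₁ (ps , qs , eq) = v , subst (_ ∈_) (sym eq) (∈-insert ps) , subst (_ ∈_) (sym eq) (∈-++⁺ʳ ps (there (here refl)))
  ... | v , inj₂ (ps , qs , eq) = v , subst (_ ∈_) (sym eq) (∈-++⁺ʳ ps (there (here refl))) , subst (_ ∈_) (sym eq) (∈-insert ps)

  module NonCrossing (nc : IsNonCrossing M) where

    -- If `u` missed both `a` and `b`, these would lie in `path v` without `path u`, which is
    -- connected along edges of `path v`. But a walk that starts in `l` can leave it only through
    -- `y`, and `y` belongs to `u`.
    nc-split : ∀ {u v y l m a b} → path v ≡ l ++ y ∷ m → a ∈ l → b ∈ m → u ∋ y → u ∋ a ⊎ u ∋ b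
    nc-split {u} {v} {y} {l} {m} {a} {b} e a∈ b∈ u∋y with a ∈? path u | b ∈? path u
    ... | yes p | _ = inj₁ p
    ... | no _  | yes q = inj₂ q
    ... | no ¬p | no ¬q = ⊥-elim (unique-++-disjoint l uniq (stay (nc v u (v∋a , ¬p) (v∋b , ¬q)) a∈) (there b∈))
      where
      uniq : Unique (l ++ y ∷ m)
      uniq = subst Unique e (path-uniq v)
      v∋a = subst (a ∈_) (sym e) (∈-++⁺ˡ a∈)
      v∋b = subst (b ∈_) (sym e) (∈-++⁺ʳ l (there b∈))
      consecutive : ∀ {c d} → PathEdge (path v) c d → c ∈ l → d ∉ path u → d ∈ l
      consecutive {c} {d} (inj₁ (ps , qs , e′)) c∈ d∉ with ∈-∃++ c∈
      ... | l₁ , l₂ , refl with unique-split l₁ (subst Unique (List.++-assoc l₁ (c ∷ l₂) (y ∷ m)) uniq)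
                                  (trans (sym (List.++-assoc l₁ (c ∷ l₂) (y ∷ m))) (trans (sym e) e′))
      ...   | refl , e″ with l₂
      ...     | [] = contradiction (subst (_∈ path u) (List.∷-injectiveˡ e″) u∋y) d∉
      ...     | x ∷ l₃ = ∈-++⁺ʳ l₁ (there (here (sym (List.∷-injectiveˡ e″))))
      consecutive {c} {d} (inj₂ (ps , qs , e′)) c∈ d∉ with ∈-∃++ c∈
      ... | l₁ , l₂ , refl with unique-split l₁ {cs = ps ++ d ∷ []} (subst Unique (List.++-assoc l₁ (c ∷ l₂) (y ∷ m)) uniq)
                                  (trans (sym (List.++-assoc l₁ (c ∷ l₂) (y ∷ m))) (trans (sym e) (trans e′ (sym (List.++-assoc ps (d ∷ []) (c ∷ qs))))))
      ...   | refl , _ = ∈-++⁺ˡ (∈-insert ps)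
      stay : ∀ {c d} → Star (λ a b → PathEdge (path v) a b × (a ∈ path v × a ∉ path u) × (b ∈ path v × b ∉ path u)) c d →
             c ∈ l → d ∈ l
      stay ε c∈ = c∈
      stay ((pe , _ , (_ , d∉)) ◅ w) c∈ = stay w (consecutive pe c∈ d∉)

    module _ {r} (R : Rooting tree r) where
      open Rooting R
      open Rooted R

      -- A part of a path that misses `y` stays in one component of the tree without `y`. As `w` and
      -- `x` are in different components, `y` lies between them on `v`, and `nc-split` applies.
      nc-kid : ∀ {u v y b w x} → parent b ≡ just y → w ≼ b → ¬ x ≼ b → x ≢ y →
               u ∋ y → v ∋ y → v ∋ x → v ∋ w → u ∋ x ⊎ u ∋ w
      nc-kid {u} {v} {y} {b} {w} {x} e w≼b ¬x≼b x≢y u∋y v∋y v∋x v∋w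
        with ∈-∃++ v∋y
      ... | l , m , eq = go (∈-++⁻ l (subst (x ∈_) eq v∋x)) (∈-++⁻ l (subst (w ∈_) eq v∋w))
        where
        lk = subst (Linked _~ᵀ_) eq (path-linked v)
        uq = subst Unique eq (path-uniq v)
        y∉l : y ∉ l
        y∉l y∈ = unique-++-disjoint l uq y∈ (here refl)
        y∉m : y ∉ m
        y∉m y∈ = unique-++-disjoint (l ++ y ∷ []) (subst Unique (sym (List.++-assoc l (y ∷ []) m)) uq) (∈-insert l) y∈
        go : x ∈ l ⊎ x ∈ y ∷ m → w ∈ l ⊎ w ∈ y ∷ m → u ∋ x ⊎ u ∋ w
        go (inj₂ (here x≡y)) _ = contradiction x≡y x≢y
        go _ (inj₂ (here refl)) = contradiction w≼b (kid⋡ e)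
        go (inj₁ x∈) (inj₁ w∈) = contradiction (one-side (linked-++ˡ l lk) y∉l e w∈ x∈ w≼b) ¬x≼b
        go (inj₁ x∈) (inj₂ (there w∈)) = nc-split eq x∈ w∈ u∋y
        go (inj₂ (there x∈)) (inj₁ w∈) with nc-split {u} eq w∈ x∈ u∋y
        ... | inj₁ p = inj₂ p
        ... | inj₂ p = inj₁ p
        go (inj₂ (there x∈)) (inj₂ (there w∈)) =
          contradiction (one-side (Linked.tail (linked-++ʳ l lk)) y∉m e w∈ x∈ w≼b) ¬x≼b

      nc-nbrs : ∀ {u v y a b} → a ~ᵀ y → b ~ᵀ y → a ≢ b → u ∋ y → v ∋ y → v ∋ a → v ∋ b → u ∋ a ⊎ u ∋ b
      nc-nbrs a~y b~y a≢b u∋y v∋y v∋a v∋b with edge a~y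
      ... | inj₁ ea = Sum.swap (nc-kid ea ε (nbr-⋠ b~y ea (≢-sym a≢b)) (λ { refl → ~ᵀ-irrefl b~y }) u∋y v∋y v∋b v∋a)
      ... | inj₂ ey = nc-kid eb ε (nbr-⋠ a~y eb a≢b) (λ { refl → ~ᵀ-irrefl a~y }) u∋y v∋y v∋a v∋b
        where eb = nbr-kid b~y (λ e → a≢b (same-parent ey e))

      -- `w` lies one step beyond `c`, on a path that comes from `a` through `y`. At least one of
      -- `a` and `c` is a child of `y` and supplies the subtree for `nc-kid`.
      nc-far : ∀ {u v y a c w} → a ~ᵀ y → c ~ᵀ y → a ≢ c → w ~ᵀ c → w ≢ y →
               u ∋ y → v ∋ y → v ∋ a → v ∋ w → u ∋ a ⊎ u ∋ w
      nc-far a~y c~y a≢c w~c w≢y u∋y v∋y v∋a v∋w with edge c~y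
      ... | inj₁ ec = nc-kid ec (nbr-kid w~c (λ e → w≢y (same-parent e ec)) ◅ ε) (nbr-⋠ a~y ec a≢c)
                        (λ { refl → ~ᵀ-irrefl a~y }) u∋y v∋y v∋a v∋w
      ... | inj₂ ey = Sum.swap (nc-kid ea ε far w≢y u∋y v∋y v∋w v∋a)
        where
        ea = nbr-kid a~y (λ e → a≢c (same-parent e ey))
        far : ¬ _ ≼ _
        far w≼a with edge w~c
        ... | inj₁ ew = <⇒≱ (≤-<-trans (≤-reflexive (trans (depth-suc ew) (sym (depth-suc ey)))) (parent-< ea)) (≼-depth w≼a)
        ... | inj₂ ec = <⇒≱ (<-trans (parent-< ec) (<-trans (parent-< ey) (parent-< ea))) (≼-depth w≼a)

      -- Each of the two parts into which `y` cuts the path contains at most one neighbour of `y`.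
      no-three : ∀ {v y a b c} → v ∋ y → v ∋ a → v ∋ b → v ∋ c → a ~ᵀ y → b ~ᵀ y → c ~ᵀ y →
                 a ≢ b → a ≢ c → b ≢ c → ⊥
      no-three {v} {y} {a} {b} {c} v∋y v∋a v∋b v∋c a~y b~y c~y a≢b a≢c b≢c with ∈-∃++ v∋y
      ... | l , m , eq = go (side a~y v∋a) (side b~y v∋b) (side c~y v∋c)
        where
        lk = subst (Linked _~ᵀ_) eq (path-linked v)
        uq = subst Unique eq (path-uniq v)
        y∉l : y ∉ l
        y∉l y∈ = unique-++-disjoint l uq y∈ (here refl)
        y∉m : y ∉ m
        y∉m y∈ = unique-++-disjoint (l ++ y ∷ []) (subst Unique (sym (List.++-assoc l (y ∷ []) m)) uq) (∈-insert l) y∈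
        side : ∀ {d} → d ~ᵀ y → v ∋ d → d ∈ l ⊎ d ∈ m
        side d~y v∋d with ∈-++⁻ l (subst (_ ∈_) eq v∋d)
        ... | inj₁ p = inj₁ p
        ... | inj₂ (there q) = inj₂ q
        ... | inj₂ (here refl) = ⊥-elim (~ᵀ-irrefl d~y)
        L : ∀ {d e} → d ∈ l → e ∈ l → d ~ᵀ y → e ~ᵀ y → d ≡ e
        L = one-nbr (linked-++ˡ l lk) y∉l
        R′ : ∀ {d e} → d ∈ m → e ∈ m → d ~ᵀ y → e ~ᵀ y → d ≡ e
        R′ = one-nbr (Linked.tail (linked-++ʳ l lk)) y∉m
        go : a ∈ l ⊎ a ∈ m → b ∈ l ⊎ b ∈ m → c ∈ l ⊎ c ∈ m → ⊥
        go (inj₁ p) (inj₁ q) _ = a≢b (L p q a~y b~y)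
        go (inj₁ p) (inj₂ q) (inj₁ s) = a≢c (L p s a~y c~y)
        go (inj₁ p) (inj₂ q) (inj₂ s) = b≢c (R′ q s b~y c~y)
        go (inj₂ p) (inj₂ q) _ = a≢b (R′ p q a~y b~y)
        go (inj₂ p) (inj₁ q) (inj₂ s) = a≢c (R′ p s a~y c~y)
        go (inj₂ p) (inj₁ q) (inj₁ s) = b≢c (L q s b~y c~y)

-- Non-crossing clique models

module CliqueModels {n} {G : Graph n} (M : PathTreeModel G) (nc : IsNonCrossing M)
                    (cm : IsCliqueModel M) (tc : TwoConnected G)
                    {r} (R : Rooting (PathTreeModel.tree M) r) where
  open Graph G
  open Models M
  open NonCrossing nc
  open Rooting R
  open Rooted R

  -- Otherwise `bag x` would be contained in the clique `bag y`; being maximal it would equal it,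
  -- against injectivity. This is the source of vertices that live at a node but not at its
  -- neighbour.
  bag-differs : ∀ {x y} → x ≢ y → ∃ λ u → u ∋ x × ¬ u ∋ y
  bag-differs {x} {y} x≢y with Fin.any? (λ u → (x ∈? path u) ×-dec ¬? (y ∈? path u))
  ... | yes found = found
  ... | no none = contradiction (proj₁ (proj₂ cm) (Subset.⊆-antisym x⊆y (proj₂ (proj₁ cm x) (bag y) (proj₁ (proj₁ cm y)) x⊆y))) x≢y
    where
    x⊆y : bag x Subset.⊆ bag y
    x⊆y {v} v∈ = ∈-bag⁺ (decidable-stable (y ∈? path v) (λ v∌y → none (v , ∈-bag⁻ v∈ , v∌y)))

  -- A single vertex `s` on the edge would be a cut-vertex, separating a vertex `u` that has `x` but
  -- not `y` from a vertex `w` that has `y` but not `x`. A walk from `u` that avoids `s` never gets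
  -- below the edge, since the path with which it did so would use the edge itself.
  two-on-edge : ∀ {x y} → parent y ≡ just x →
                ∃₂ λ s s′ → s ≢ s′ × (s ∋ x × s ∋ y) × (s′ ∋ x × s′ ∋ y)
  two-on-edge {x} {y} e with edge-vertex (~ᵀ-sym (parent-edge e))
  ... | s , s∋x , s∋y with Fin.any? (λ s′ → ¬? (s Fin.≟ s′) ×-dec ((x ∈? path s′) ×-dec (y ∈? path s′)))
  ...   | yes (s′ , ne , q) = s , s′ , ne , (s∋x , s∋y) , q
  ...   | no none with bag-differs (≢-sym (parent-≢ e)) | bag-differs (parent-≢ e)
  ...     | u , u∋x , u∌y | w , w∋y , w∌x =
            ⊥-elim (proj₂ tc s (λ connected →
              let (z , w∋z , z⋠y) = reach (connected {u} {w} (λ { refl → u∌y s∋y }) (λ { refl → w∌x s∋x })) (x , u∋x , kid⋡ e)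
                  (_ , p , e′ , w∋p) = enter-subtree (path-linked w) w∋y w∋z ε z⋠y
              in w∌x (subst (w ∋_) (same-parent e′ e) w∋p)))
    where
    Outside : Fin n → Set
    Outside v = ∃ λ z → v ∋ z × ¬ z ≼ y
    reach : ∀ {u w} → Star (λ a b → a ~ b × a ≢ s × b ≢ s) u w → Outside u → Outside w
    reach ε o = o
    reach ((a~b , a≢s , _) ◅ star) (z , a∋z , z⋠y) with ~⇒share a~b
    ... | z′ , a∋z′ , b∋z′ with z′ ≼? y
    ...   | no z′⋠y = reach star (z′ , b∋z′ , z′⋠y)
    ...   | yes z′≼y with enter-subtree (path-linked _) a∋z′ a∋z z′≼y z⋠y
    ...     | a∋y , p , e′ , a∋p =
              ⊥-elim (none (_ , ≢-sym a≢s , subst (_ ∋_) (same-parent e′ e) a∋p , a∋y))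

  -- Each two of the three neighbours are joined by a path through `y`. By non-crossing, a path
  -- through `y` contains one end of each such pair, hence two of `a`, `b`, `c`; a fourth neighbour
  -- of `y` would lie on a path with three neighbours of `y`.
  record Branching (y a b c : Fin t) : Set where
    field
      a~y : a ~ᵀ y
      b~y : b ~ᵀ y
      c~y : c ~ᵀ y
      a≢b : a ≢ b
      a≢c : a ≢ c
      b≢c : b ≢ c
      ab  : ∃ λ u → u ∋ y × u ∋ a × u ∋ b
      ac  : ∃ λ u → u ∋ y × u ∋ a × u ∋ c
      bc  : ∃ λ u → u ∋ y × u ∋ b × u ∋ c

    two-of : ∀ {u} → u ∋ y → (u ∋ a × u ∋ b) ⊎ (u ∋ a × u ∋ c) ⊎ (u ∋ b × u ∋ c)
    two-of u∋y with ab | ac | bc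
    ... | v , v∋y , va , vb | w , w∋y , wa , wc | x , x∋y , xb , xc
        with nc-nbrs R a~y b~y a≢b u∋y v∋y va vb | nc-nbrs R a~y c~y a≢c u∋y w∋y wa wc | nc-nbrs R b~y c~y b≢c u∋y x∋y xb xc
    ... | inj₁ p | _ | inj₁ q = inj₁ (p , q)
    ... | inj₁ p | _ | inj₂ q = inj₂ (inj₁ (p , q))
    ... | inj₂ p | inj₁ q | _ = inj₁ (q , p)
    ... | inj₂ p | inj₂ q | _ = inj₂ (inj₂ (p , q))

    nbrs : ∀ {d} → d ~ᵀ y → d ≡ a ⊎ d ≡ b ⊎ d ≡ c
    nbrs {d} d~y with d Fin.≟ a | d Fin.≟ b | d Fin.≟ c | edge-vertex d~y
    ... | yes e | _ | _ | _ = inj₁ e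
    ... | _ | yes e | _ | _ = inj₂ (inj₁ e)
    ... | _ | _ | yes e | _ = inj₂ (inj₂ e)
    ... | no d≢a | no d≢b | no d≢c | u , u∋d , u∋y with two-of u∋y
    ...   | inj₁ (p , q) = ⊥-elim (no-three R u∋y u∋d p q d~y a~y b~y d≢a d≢b a≢b)
    ...   | inj₂ (inj₁ (p , q)) = ⊥-elim (no-three R u∋y u∋d p q d~y a~y c~y d≢a d≢c a≢c)
    ...   | inj₂ (inj₂ (p , q)) = ⊥-elim (no-three R u∋y u∋d p q d~y b~y c~y d≢b d≢c b≢c)

    swap-ab : Branching y b a c
    swap-ab = record { a~y = b~y ; b~y = a~y ; c~y = c~y ; a≢b = ≢-sym a≢b ; a≢c = b≢c ; b≢c = a≢c
                     ; ab = let (u , p , q , s) = ab in u , p , s , q ; ac = bc ; bc = ac }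

    swap-bc : Branching y a c b
    swap-bc = record { a~y = a~y ; b~y = c~y ; c~y = b~y ; a≢b = a≢c ; a≢c = a≢b ; b≢c = ≢-sym b≢c
                     ; ab = ac ; ac = ab ; bc = let (u , p , q , s) = bc in u , p , s , q }

    private
      -- Suppose that `u` goes from `a` through `y` and `c` on to `w`. A vertex `k` at `c` but not
      -- at `w` must contain `y`, hence `a` or `b`. If it contains `b`, it crosses `u`. If it
      -- contains `a`, then `m`, which joins `b` and `c`, must contain `w` to avoid crossing `u`,
      -- and then `k` crosses `m`.
      end-at-c : ∀ {a b} → a ~ᵀ y → b ~ᵀ y → a ≢ b → a ≢ c → b ≢ c → (∃ λ u → u ∋ y × u ∋ b × u ∋ c) →
                 (∀ {u} → u ∋ y → u ∋ c → u ∋ a ⊎ u ∋ b) →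
                 ∀ {u w} → u ∋ y → u ∋ a → u ∋ c → w ~ᵀ c → w ≢ y → ¬ u ∋ w
      end-at-c {a} {b} a~y b~y a≢b a≢c b≢c (m , m∋y , m∋b , m∋c) other {u} {w} u∋y u∋a u∋c w~c w≢y u∋w
        with bag-differs {c} {w} (λ { refl → ~ᵀ-irrefl w~c })
      ... | k , k∋c , k∌w with nc-nbrs R {k} (~ᵀ-sym c~y) w~c (≢-sym w≢y) k∋c u∋c u∋y u∋w
      ...   | inj₂ k∋w = k∌w k∋w
      ...   | inj₁ k∋y with other k∋y k∋c
      ...     | inj₂ k∋b with nc-far R {k} a~y c~y a≢c w~c w≢y k∋y u∋y u∋a u∋w
      ...       | inj₁ k∋a = no-three R k∋y k∋a k∋b k∋c a~y b~y c~y a≢b a≢c b≢c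
      ...       | inj₂ k∋w = k∌w k∋w
      end-at-c {a} {b} a~y b~y a≢b a≢c b≢c (m , m∋y , m∋b , m∋c) other {u} {w} u∋y u∋a u∋c w~c w≢y u∋w
          | k , k∋c , k∌w | inj₁ k∋y | inj₁ k∋a with nc-far R {m} a~y c~y a≢c w~c w≢y m∋y u∋y u∋a u∋w
      ...       | inj₁ m∋a = no-three R m∋y m∋a m∋b m∋c a~y b~y c~y a≢b a≢c b≢c
      ...       | inj₂ m∋w with nc-far R {k} b~y c~y b≢c w~c w≢y k∋y m∋y m∋b m∋w
      ...         | inj₁ k∋b = no-three R k∋y k∋a k∋b k∋c a~y b~y c~y a≢b a≢c b≢c
      ...         | inj₂ k∋w = k∌w k∋w

      other : ∀ {u} → u ∋ y → u ∋ c → u ∋ a ⊎ u ∋ b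
      other u∋y u∋c with two-of u∋y
      ... | inj₁ (p , _) = inj₁ p
      ... | inj₂ (inj₁ (p , _)) = inj₁ p
      ... | inj₂ (inj₂ (p , _)) = inj₂ p

    ends-at-c : ∀ {u w} → u ∋ y → u ∋ c → w ~ᵀ c → w ≢ y → ¬ u ∋ w
    ends-at-c u∋y u∋c w~c w≢y with other u∋y u∋c
    ... | inj₁ u∋a = end-at-c a~y b~y a≢b a≢c b≢c bc other u∋y u∋a u∋c w~c w≢y
    ... | inj₂ u∋b = end-at-c b~y a~y (≢-sym a≢b) b≢c a≢c ac (λ p q → Sum.swap (other p q)) u∋y u∋b u∋c w~c w≢y

  -- Say that `w`, a vertex on the edge to `c`, contains `a`. A vertex at `y` but not at `a` may
  -- cross neither `v` nor `w`, so it joins `b` and `c` and completes the triangle. Hence one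
  -- passing path and a third neighbour suffice.
  branching : ∀ {y a b c v} → a ~ᵀ y → b ~ᵀ y → c ~ᵀ y → a ≢ b → a ≢ c → b ≢ c →
              v ∋ y → v ∋ a → v ∋ b → Branching y a b c
  branching {y} {a} {b} {c} {v} a~y b~y c~y a≢b a≢c b≢c v∋y v∋a v∋b with edge-vertex c~y
  ... | w , w∋c , w∋y = go (nc-nbrs R a~y b~y a≢b w∋y v∋y v∋a v∋b)
    where
    third : ∀ {a b} → a ~ᵀ y → b ~ᵀ y → a ≢ b → a ≢ c → v ∋ a → v ∋ b → w ∋ a → ∃ λ u → u ∋ y × u ∋ b × u ∋ c
    third {a} {b} a~y b~y a≢b a≢c v∋a v∋b w∋a with bag-differs {y} {a} (λ { refl → ~ᵀ-irrefl a~y })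
    ... | u , u∋y , u∌a with nc-nbrs R {u} a~y b~y a≢b u∋y v∋y v∋a v∋b | nc-nbrs R {u} a~y c~y a≢c u∋y w∋y w∋a w∋c
    ...   | inj₂ u∋b | inj₂ u∋c = u , u∋y , u∋b , u∋c
    ...   | inj₁ u∋a | _ = contradiction u∋a u∌a
    ...   | _ | inj₁ u∋a = contradiction u∋a u∌a
    go : w ∋ a ⊎ w ∋ b → Branching y a b c
    go (inj₁ w∋a) = record
      { a~y = a~y ; b~y = b~y ; c~y = c~y ; a≢b = a≢b ; a≢c = a≢c ; b≢c = b≢c
      ; ab = v , v∋y , v∋a , v∋b ; ac = w , w∋y , w∋a , w∋c ; bc = third a~y b~y a≢b a≢c v∋a v∋b w∋a }
    go (inj₂ w∋b) = record
      { a~y = a~y ; b~y = b~y ; c~y = c~y ; a≢b = a≢b ; a≢c = a≢c ; b≢c = b≢c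
      ; ab = v , v∋y , v∋a , v∋b ; ac = third b~y a~y (≢-sym a≢b) b≢c v∋b v∋a w∋b ; bc = w , w∋y , w∋b , w∋c }

-- The tour of a plane layout

before after : Fin m → List (Fin m) → List (Fin m)
before p []       = []
before p (x ∷ xs) = if does (x Fin.≟ p) then [] else x ∷ before p xs
after p []       = []
after p (x ∷ xs) = if does (x Fin.≟ p) then xs else after p xs

before-after : ∀ {p : Fin m} {xs} → p ∈ xs → xs ≡ before p xs ++ p ∷ after p xs
before-after {p = p} {x ∷ xs} p∈ with x Fin.≟ p
before-after {p = p} {x ∷ xs} p∈ | yes refl = refl
before-after {p = p} {x ∷ xs} (here refl) | no ¬e = contradiction refl ¬e
before-after {p = p} {x ∷ xs} (there p∈)  | no ¬e = cong (x ∷_) (before-after p∈)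

index : Fin m → List (Fin m) → ℕ
index x []       = 0
index x (y ∷ ys) = if does (y Fin.≟ x) then 0 else suc (index x ys)

index-≡ : ∀ {x : Fin m} as {bs} → x ∉ as → index x (as ++ x ∷ bs) ≡ length as
index-≡ {x = x} [] x∉ with x Fin.≟ x
... | yes _ = refl
... | no ne = contradiction refl ne
index-≡ {x = x} (a ∷ as) x∉ with a Fin.≟ x
... | yes refl = contradiction (here refl) x∉
... | no _     = cong suc (index-≡ as (x∉ ∘ there))

rotation : Maybe (Fin m) → List (Fin m) → List (Fin m)
rotation nothing  ys = ys
rotation (just p) ys = after p ys ++ before p ys

-- The children of every node; a table rather than a function, so that pointwise
-- equal tables are equal.
kidsTable : (Fin m → Maybe (Fin m)) → (Fin m → List (Fin m)) → Vec.Vec (List (Fin m)) m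
kidsTable parent order = Vec.tabulate (λ x → rotation (parent x) (order x))

data Side : Set where
  left right : Side

module Tour {n t} (path : Fin n → List (Fin t)) (r : Fin t) (parent : Fin t → Maybe (Fin t))
            (depth : Fin t → ℕ) (table : Vec.Vec (List (Fin t)) t) where

  kids : Fin t → List (Fin t)
  kids = Vec.lookup table

  -- The rank grows from parents to children and from each child to the next.
  rankIn : ℕ → Fin t → ℕ
  rankIn zero    x = 0
  rankIn (suc k) x with parent x
  ... | nothing = 0
  ... | just p  = rankIn k p + suc (index x (kids p))

  rank : Fin t → ℕ
  rank x = rankIn (depth x) x

  -- State of one pass along a path. Parents have smaller rank than children, so the lowest node is
  -- the top of the path and the second lowest is the first child that the path enters; `key` is the
  -- highest rank met.
  record Scan : Set where
    constructor scanned
    field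
      lowest : Fin t
      second : Maybe (Fin t)
      key    : ℕ
  open Scan

  scanSecond : Maybe (Fin t) → Fin t → Maybe (Fin t)
  scanSecond nothing  c = just c
  scanSecond (just d) c = if rank c <ᵇ rank d then just c else just d

  scanStep : Scan → Fin t → Scan
  scanStep (scanned a b k) c =
    scanned (if rank c <ᵇ rank a then c else a)
            (if rank c <ᵇ rank a then just a else scanSecond b c)
            (if k <ᵇ rank c then rank c else k)

  scan : List (Fin t) → Scan
  scan []       = scanned r nothing 0
  scan (x ∷ xs) = foldl scanStep (scanned x nothing (rank x)) xs

  homeOf : Scan → Fin t ⊎ Fin t
  homeOf (scanned a nothing  _) = inj₁ a
  homeOf (scanned a (just c) _) = inj₂ c

  -- Vertices living at one node belong to that node; any other vertex belongs
  -- to the edge on which its path leaves its top node (to the earlier child if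
  -- it leaves on both sides), and this edge is named by its lower end.
  home : Fin n → Fin t ⊎ Fin t
  home v = homeOf (scan (path v))

  keyOf : Fin n → ℕ
  keyOf v = key (scan (path v))

  _≟ʰ_ : (h h′ : Fin t ⊎ Fin t) → Dec (h ≡ h′)
  _≟ʰ_ = Sum.≡-dec Fin._≟_ Fin._≟_

  insertSecond : Fin n → List (Fin n) → List (Fin n)
  insertSecond u []       = u ∷ []
  insertSecond u (s ∷ vs) = if keyOf s <ᵇ keyOf u then s ∷ u ∷ vs else u ∷ s ∷ vs

  -- The first vertex has the largest key, the second the smallest of the others.
  insert : Fin n → List (Fin n) → List (Fin n)
  insert v []       = v ∷ []
  insert v (f ∷ vs) = if keyOf f <ᵇ keyOf v then v ∷ insertSecond f vs
                                            else f ∷ insertSecond v vs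

  singlesIn groupIn : List (Fin n) → Fin t → List (Fin n)
  singlesIn vs x = filter (λ v → home v ≟ʰ inj₁ x) vs
  groupIn   vs c = foldr insert [] (filter (λ v → home v ≟ʰ inj₂ c) vs)

  -- Reversed, since the program treats the vertices in increasing order: the vertex treated last is
  -- the outermost one in `foldr` and the first in a list of singles, so `group` and `singles` equal
  -- the lists that it stores.
  vertices : List (Fin n)
  vertices = reverse (allFin n)

  singles group : Fin t → List (Fin n)
  singles = singlesIn vertices
  group   = groupIn vertices

  -- The side for the gap between the first two members of a group. With one child below, the first
  -- member has the largest key and is the deep one; at a branching, `turn` of `Gap` asks for
  -- `right`.
  sideOf : Fin t → Side
  sideOf c with kids c
  ... | _ ∷ _ ∷ _ = right
  ... | _         = left

  -- With a lone new vertex `v`, the gap that remains lies between `v` and the deeper of the two old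
  -- neighbours, and `v` is its deep end, so the side flips. An empty group occurs at the second
  -- child of a turn, where the conditions on the side are void and `left` is a mere choice.
  segmentWith : (Side → List (Fin n)) → Side → List (Fin n) → Side → List (Fin n)
  segmentWith inside c-side []           side  = inside left
  segmentWith inside c-side (v ∷ [])     left  = inside right ++ v ∷ []
  segmentWith inside c-side (v ∷ [])     right = v ∷ inside left
  segmentWith inside c-side (f ∷ s ∷ vs) side  = f ∷ inside c-side ++ s ∷ vs

  -- The number is fuel. The children are listed backwards: the first member of a group has the
  -- largest key and turns to the later child, and a stack onto which the children are pushed in
  -- order releases them in this order.
  insideIn : ℕ → Fin t → Side → List (Fin n)
  insideIn zero    x side = []
  insideIn (suc k) x side =
    concat (reverse (map (λ c → segmentWith (insideIn k c) (sideOf c) (group c) side) (kids x)))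
    ++ singles x

  -- What the tour lists between two neighbouring vertices of the cycle whose
  -- paths share the edge above x.  Side tells which of the two reaches deeper.
  inside : Fin t → Side → List (Fin n)
  inside x = insideIn (t ∸ depth x) x

  segment : Side → Fin t → List (Fin n)
  segment side c = segmentWith (inside c) (sideOf c) (group c) side

  tour : List (Fin n)
  tour = inside r left

  insertSecond-↭ : ∀ u vs → insertSecond u vs ↭ u ∷ vs
  insertSecond-↭ u []       = ↭-refl
  insertSecond-↭ u (s ∷ vs) with keyOf s <ᵇ keyOf u
  ... | true  = ↭.swap s u ↭-refl
  ... | false = ↭-refl

  insert-↭ : ∀ v vs → insert v vs ↭ v ∷ vs
  insert-↭ v []       = ↭-refl
  insert-↭ v (f ∷ vs) with keyOf f <ᵇ keyOf v
  ... | true  = ↭.prep v (insertSecond-↭ f vs)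
  ... | false = ↭-trans (↭.prep f (insertSecond-↭ v vs)) (↭.swap f v ↭-refl)

  foldr-insert-↭ : ∀ vs → foldr insert [] vs ↭ vs
  foldr-insert-↭ []       = ↭-refl
  foldr-insert-↭ (v ∷ vs) = ↭-trans (insert-↭ v _) (↭.prep v (foldr-insert-↭ vs))

  ∈-vertices : ∀ v → v ∈ vertices
  ∈-vertices v = Any.reverse⁺ (∈-allFin v)

  unique-vertices : Unique vertices
  unique-vertices = unique-resp-↭ (↭-sym (↭.↭-reverse _)) (Unique.tabulate⁺ id)

  ∈-singles⁺ : ∀ {v x} → home v ≡ inj₁ x → v ∈ singles x
  ∈-singles⁺ {v} {x} e = ∈-filter⁺ (λ v → home v ≟ʰ inj₁ x) (∈-vertices v) e

  ∈-singles⁻ : ∀ {v x} → v ∈ singles x → home v ≡ inj₁ x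
  ∈-singles⁻ {v} {x} v∈ = proj₂ (∈-filter⁻ (λ v → home v ≟ʰ inj₁ x) {xs = vertices} v∈)

  ∈-group⁺ : ∀ {v c} → home v ≡ inj₂ c → v ∈ group c
  ∈-group⁺ {v} {c} e = ↭.∈-resp-↭ (↭-sym (foldr-insert-↭ _)) (∈-filter⁺ (λ v → home v ≟ʰ inj₂ c) (∈-vertices v) e)

  ∈-group⁻ : ∀ {v c} → v ∈ group c → home v ≡ inj₂ c
  ∈-group⁻ {v} {c} v∈ = proj₂ (∈-filter⁻ (λ v → home v ≟ʰ inj₂ c) {xs = vertices} (↭.∈-resp-↭ (foldr-insert-↭ _) v∈))

  unique-singles : ∀ x → Unique (singles x)
  unique-singles x = AllPairs.filter⁺ (λ v → home v ≟ʰ inj₁ x) unique-vertices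

  unique-group : ∀ c → Unique (group c)
  unique-group c = unique-resp-↭ (↭-sym (foldr-insert-↭ _)) (AllPairs.filter⁺ (λ v → home v ≟ʰ inj₂ c) unique-vertices)

  data Extremal : List (Fin n) → Set where
    []  : Extremal []
    [-] : ∀ {f} → Extremal (f ∷ [])
    ext : ∀ {f s vs} → All (λ v → keyOf v ≤ keyOf f) (s ∷ vs) → All (λ v → keyOf s ≤ keyOf v) vs →
          Extremal (f ∷ s ∷ vs)

  <ᵇ-true : ∀ {a b} → (a <ᵇ b) ≡ true → a < b
  <ᵇ-true {a} {b} e = <ᵇ⇒< a b (subst T (sym e) tt)

  <ᵇ-false : ∀ {a b} → (a <ᵇ b) ≡ false → b ≤ a
  <ᵇ-false {a} {b} e = ≮⇒≥ (λ a<b → subst T e (<⇒<ᵇ a<b))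

  extremal-second : ∀ {f} u vs → keyOf u ≤ keyOf f → Extremal (f ∷ vs) → Extremal (f ∷ insertSecond u vs)
  extremal-second u [] u≤f _ = ext (u≤f ∷ []) []
  extremal-second u (s ∷ vs) u≤f (ext (s≤f ∷ vs≤f) s≤vs) with keyOf s <ᵇ keyOf u in e
  ... | true  = ext (s≤f ∷ u≤f ∷ vs≤f) (<⇒≤ (<ᵇ-true e) ∷ s≤vs)
  ... | false = ext (u≤f ∷ s≤f ∷ vs≤f) (<ᵇ-false e ∷ All.map (≤-trans (<ᵇ-false e)) s≤vs)

  extremal-head : ∀ {f v} vs → keyOf f ≤ keyOf v → Extremal (f ∷ vs) → Extremal (v ∷ vs)
  extremal-head [] f≤v _ = [-]
  extremal-head (s ∷ vs) f≤v (ext vs≤f s≤vs) = ext (All.map (λ q → ≤-trans q f≤v) vs≤f) s≤vs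

  extremal-insert : ∀ v vs → Extremal vs → Extremal (insert v vs)
  extremal-insert v [] _ = [-]
  extremal-insert v (f ∷ vs) x with keyOf f <ᵇ keyOf v in e
  ... | true  = extremal-second f vs (<⇒≤ (<ᵇ-true e)) (extremal-head vs (<⇒≤ (<ᵇ-true e)) x)
  ... | false = extremal-second v vs (<ᵇ-false e) x

  extremal-group : ∀ c → Extremal (group c)
  extremal-group c = go (filter (λ v → home v ≟ʰ inj₂ c) vertices)
    where
    go : ∀ vs → Extremal (foldr insert [] vs)
    go []       = []
    go (v ∷ vs) = extremal-insert v _ (go vs)

  record ScanSpec (xs : List (Fin t)) (s : Scan) : Set where
    field
      lowest-∈     : lowest s ∈ xs
      lowest-≤     : ∀ {z} → z ∈ xs → rank (lowest s) ≤ rank z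
      second-none  : second s ≡ nothing → ∀ {z} → z ∈ xs → z ≡ lowest s
      second-∈     : ∀ {c} → second s ≡ just c → c ∈ xs
      second-≢     : ∀ {c} → second s ≡ just c → c ≢ lowest s
      second-≤     : ∀ {c} → second s ≡ just c → ∀ {z} → z ∈ xs → z ≢ lowest s → rank c ≤ rank z
      key-≥        : ∀ {z} → z ∈ xs → rank z ≤ key s
      key-attained : ∃ λ z → z ∈ xs × key s ≡ rank z

  scanStep-spec : ∀ {xs s c} → c ∉ xs → ScanSpec xs s → ScanSpec (xs ∷ʳ c) (scanStep s c)
  scanStep-spec {xs} {scanned a b k} {c} c∉ sp = go
    where
    open ScanSpec sp
    old : ∀ {z} → z ∈ xs → z ∈ xs ∷ʳ c
    old = ∈-++⁺ˡ
    new : c ∈ xs ∷ʳ c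
    new = ∈-insert xs
    split : ∀ {z} → z ∈ xs ∷ʳ c → z ∈ xs ⊎ z ≡ c
    split z∈ with ∈-++⁻ xs z∈
    ... | inj₁ p = inj₁ p
    ... | inj₂ (here e) = inj₂ e
    key≥ : ∀ {z} → z ∈ xs ∷ʳ c → rank z ≤ (if k <ᵇ rank c then rank c else k)
    key≥ z∈ with k <ᵇ rank c in e | split z∈
    ... | true  | inj₁ p = ≤-trans (key-≥ p) (<⇒≤ (<ᵇ-true e))
    ... | true  | inj₂ refl = ≤-refl
    ... | false | inj₁ p = key-≥ p
    ... | false | inj₂ refl = <ᵇ-false e
    key-att : ∃ λ z → z ∈ xs ∷ʳ c × (if k <ᵇ rank c then rank c else k) ≡ rank z
    key-att with k <ᵇ rank c
    ... | true  = c , new , refl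
    ... | false = let (z , z∈ , e) = key-attained in z , old z∈ , e
    go : ScanSpec (xs ∷ʳ c) (scanStep (scanned a b k) c)
    go with rank c <ᵇ rank a in e
    ... | true = record
      { lowest-∈ = new
      ; lowest-≤ = λ z∈ → case split z∈ of λ
          { (inj₁ p) → ≤-trans (<⇒≤ (<ᵇ-true e)) (lowest-≤ p) ; (inj₂ refl) → ≤-refl }
      ; second-none = λ ()
      ; second-∈ = λ { refl → old lowest-∈ }
      ; second-≢ = λ { refl refl → c∉ lowest-∈ }
      ; second-≤ = λ { refl z∈ z≢ → case split z∈ of λ
          { (inj₁ p) → lowest-≤ p ; (inj₂ q) → contradiction q z≢ } }
      ; key-≥ = key≥ ; key-attained = key-att }
    ... | false = record
      { lowest-∈ = old lowest-∈
      ; lowest-≤ = λ z∈ → case split z∈ of λ { (inj₁ p) → lowest-≤ p ; (inj₂ refl) → <ᵇ-false e }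
      ; second-none = λ q → ⊥-elim (some b q)
      ; second-∈ = λ q → ∈s b refl q
      ; second-≢ = λ q → ≢s b refl q
      ; second-≤ = λ q z∈ z≢ → ≤s b refl q (split z∈) z≢
      ; key-≥ = key≥ ; key-attained = key-att }
      where
      some : ∀ b → scanSecond b c ≢ nothing
      some nothing ()
      some (just d) q with rank c <ᵇ rank d
      some (just d) () | true
      some (just d) () | false
      ∈s : ∀ b′ {d} → b ≡ b′ → scanSecond b′ c ≡ just d → d ∈ xs ∷ʳ c
      ∈s nothing e refl = new
      ∈s (just d) e q with rank c <ᵇ rank d
      ∈s (just d) e refl | true  = new
      ∈s (just d) e refl | false = old (second-∈ e)
      ≢s : ∀ b′ {d} → b ≡ b′ → scanSecond b′ c ≡ just d → d ≢ a
      ≢s nothing e refl refl = c∉ lowest-∈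
      ≢s (just d) e q with rank c <ᵇ rank d
      ≢s (just d) e refl | true = λ { refl → c∉ lowest-∈ }
      ≢s (just d) e refl | false = second-≢ e
      ≤s : ∀ b′ {d z} → b ≡ b′ → scanSecond b′ c ≡ just d → z ∈ xs ⊎ z ≡ c → z ≢ a → rank d ≤ rank z
      ≤s nothing e refl (inj₁ p) z≢ = contradiction (second-none e p) z≢
      ≤s nothing e refl (inj₂ refl) z≢ = ≤-refl
      ≤s (just d) e q z∈ z≢ with rank c <ᵇ rank d in e′
      ≤s (just d) e refl (inj₁ p) z≢ | true = ≤-trans (<⇒≤ (<ᵇ-true e′)) (second-≤ e p z≢)
      ≤s (just d) e refl (inj₂ refl) z≢ | true = ≤-refl
      ≤s (just d) e refl (inj₁ p) z≢ | false = second-≤ e p z≢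
      ≤s (just d) e refl (inj₂ refl) z≢ | false = <ᵇ-false e′

  scan-spec : ∀ {xs x} → x ∈ xs → Unique xs → ScanSpec xs (scan xs)
  scan-spec {x ∷ xs} _ u = go (x ∷ []) xs u start
    where
    start : ScanSpec (x ∷ []) (scanned x nothing (rank x))
    start = record
      { lowest-∈ = here refl
      ; lowest-≤ = λ { (here refl) → ≤-refl }
      ; second-none = λ { _ (here refl) → refl }
      ; second-∈ = λ () ; second-≢ = λ () ; second-≤ = λ ()
      ; key-≥ = λ { (here refl) → ≤-refl }
      ; key-attained = x , here refl , refl }
    go : ∀ done todo {s} → Unique (done ++ todo) → ScanSpec done s → ScanSpec (done ++ todo) (foldl scanStep s todo)
    go done [] u sp = subst (λ l → ScanSpec l _) (sym (List.++-identityʳ done)) sp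
    go done (c ∷ todo) u sp = subst (λ l → ScanSpec l _) (List.++-assoc done (c ∷ []) todo)
      (go (done ∷ʳ c) todo (subst Unique (sym (List.++-assoc done (c ∷ []) todo)) u)
          (scanStep-spec (λ c∈ → unique-++-disjoint done u c∈ (here refl)) sp))

∸-step : ∀ {d t} → d < t → t ∸ d ≡ suc (t ∸ suc d)
∸-step {zero}  {suc t} _       = refl
∸-step {suc d} {suc t} (s≤s l) = ∸-step l

module LayoutFacts {n t} {T : Graph t} {r} (R : Rooting T r) (L : PlaneLayout T)
                   (path : Fin n → List (Fin t)) where
  open Graph T
  open Rooting R
  open Rooted R
  open PlaneLayout L
  open Tour path r parent depth (kidsTable parent order)

  private
    ∈-order⁺ : ∀ {x y} → x ~ y → y ∈ order x
    ∈-order⁺ = Equivalence.from (neighbours _ _)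
    ∈-order⁻ : ∀ {x y} → y ∈ order x → x ~ y
    ∈-order⁻ = Equivalence.to (neighbours _ _)

  order-around : ∀ {x p} → parent x ≡ just p → order x ≡ before p (order x) ++ p ∷ after p (order x)
  order-around e = before-after (∈-order⁺ (parent-edge e))

  kids-just : ∀ {x p} → parent x ≡ just p → kids x ≡ after p (order x) ++ before p (order x)
  kids-just {x} e = trans (Vec.lookup∘tabulate _ x) (cong (λ m → rotation m (order x)) e)

  order-↭ : ∀ {x p} → parent x ≡ just p → order x ↭ p ∷ kids x
  order-↭ {x} {p} e = ↭-trans (↭.↭-reflexive (order-around e))
    (↭-trans (↭.shift p (before p (order x)) (after p (order x)))
      (↭.prep p (↭-trans (↭.++-comm (before p (order x)) _) (↭.↭-reflexive (sym (kids-just e))))))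

  order-root : ∀ {x} → parent x ≡ nothing → kids x ≡ order x
  order-root {x} e = trans (Vec.lookup∘tabulate _ x) (cong (λ m → rotation m (order x)) e)

  ∈-kids⁺ : ∀ {c x} → parent c ≡ just x → c ∈ kids x
  ∈-kids⁺ {c} {x} e with parent x in eq
  ... | nothing = subst (c ∈_) (sym (order-root eq)) (∈-order⁺ (~-sym (parent-edge e)))
  ... | just p with ↭.∈-resp-↭ (order-↭ eq) (∈-order⁺ (~-sym (parent-edge e)))
  ...   | here refl = contradiction (<-trans (parent-< eq) (parent-< e)) (<-irrefl refl)
  ...   | there c∈ = c∈

  unique-kids : ∀ x → Unique (kids x)
  unique-kids x = go (parent x) refl
    where
    go : ∀ m → parent x ≡ m → Unique (kids x)
    go nothing  e = subst Unique (sym (order-root e)) (unique x)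
    go (just p) e = AllPairs.tail (unique-resp-↭ (order-↭ e) (unique x))

  ∈-kids⁻ : ∀ {c x} → c ∈ kids x → parent c ≡ just x
  ∈-kids⁻ {c} {x} c∈ = go (parent x) refl
    where
    go : ∀ m → parent x ≡ m → parent c ≡ just x
    go nothing e = nbr-kid (~-sym (∈-order⁻ (subst (c ∈_) (order-root e) c∈))) (λ e′ → case trans (sym e) e′ of λ ())
    go (just p) e = nbr-kid (~-sym (∈-order⁻ (↭.∈-resp-↭ (↭-sym (order-↭ e)) (there c∈))))
      (λ e′ → unique-head (same-parent e e′))
      where
      unique-head : p ≢ c
      unique-head refl = All.All¬⇒¬Any (AllPairs.head (unique-resp-↭ (order-↭ e) (unique x))) c∈

  rank-kid : ∀ {c x} → parent c ≡ just x → rank c ≡ rank x + suc (index c (kids x))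
  rank-kid {c} {x} e rewrite depth-suc e | e = refl

  rank-parent-< : ∀ {c x} → parent c ≡ just x → rank x < rank c
  rank-parent-< {c} {x} e = subst (rank x <_) (sym (rank-kid e)) (m<m+n (rank x) (s≤s z≤n))

  rank-≼ : ∀ {z x} → z ≼ x → rank x ≤ rank z
  rank-≼ ε = ≤-refl
  rank-≼ (e ◅ w) = ≤-trans (rank-≼ w) (<⇒≤ (rank-parent-< e))

  rank-≺ : ∀ {z x} → z ≼ x → z ≢ x → rank x < rank z
  rank-≺ ε ne = contradiction refl ne
  rank-≺ (e ◅ w) _ = ≤-<-trans (rank-≼ w) (rank-parent-< e)

  rank-siblings : ∀ {x as c bs d} → kids x ≡ as ++ c ∷ bs → d ∈ bs → rank c < rank d
  rank-siblings {x} {as} {c} {bs} {d} eq d∈ with ∈-∃++ d∈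
  ... | cs , ds , refl = subst₂ _<_ (sym (rank-kid (∈-kids⁻ c∈))) (sym (rank-kid (∈-kids⁻ d∈′)))
        (+-monoʳ-< (rank x) (s≤s (subst₂ _<_ (sym ic) (sym id′) lt)))
    where
    u : Unique (as ++ c ∷ cs ++ d ∷ ds)
    u = subst Unique eq (unique-kids x)
    eq′ : as ++ c ∷ cs ++ d ∷ ds ≡ (as ++ c ∷ cs) ++ d ∷ ds
    eq′ = sym (List.++-assoc as (c ∷ cs) (d ∷ ds))
    c∈ : c ∈ kids x
    c∈ = subst (c ∈_) (sym eq) (∈-insert as)
    d∈′ : d ∈ kids x
    d∈′ = subst (d ∈_) (sym eq) (∈-++⁺ʳ as (there d∈))
    ic : index c (kids x) ≡ length as
    ic = trans (cong (index c) eq) (index-≡ as (λ c∈as → unique-++-disjoint as u c∈as (here refl)))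
    id′ : index d (kids x) ≡ length (as ++ c ∷ cs)
    id′ = trans (cong (index d) (trans eq eq′))
            (index-≡ (as ++ c ∷ cs) (λ q → unique-++-disjoint (as ++ c ∷ cs) (subst Unique eq′ u) q (here refl)))
    lt : length as < length (as ++ c ∷ cs)
    lt = subst (length as <_) (sym (List.length-++ as)) (m<m+n (length as) (s≤s z≤n))

  -- Ranks are not injective on the tree; they distinguish nodes only along branches and among
  -- siblings.
  siblings-< : ∀ {x c d} → parent c ≡ just x → parent d ≡ just x → c ≢ d → rank c ≤ rank d → rank c < rank d
  siblings-< {x} {c} {d} ec ed c≢d le with ∈-∃++ (∈-kids⁺ ec)
  ... | as , bs , eq with ∈-++⁻ as (subst (d ∈_) eq (∈-kids⁺ ed))
  ...   | inj₂ (here e) = contradiction (sym e) c≢d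
  ...   | inj₂ (there d∈) = rank-siblings eq d∈
  ...   | inj₁ d∈ with ∈-∃++ d∈
  ...     | as₁ , as₂ , refl = contradiction le (<⇒≱ (rank-siblings (trans eq (List.++-assoc as₁ (d ∷ as₂) (c ∷ bs))) (∈-insert as₂)))

  sideOf-left : ∀ {c z} → kids c ≡ z ∷ [] → sideOf c ≡ left
  sideOf-left {c} e with kids c
  sideOf-left refl | _ = refl

  sideOf-right : ∀ {c a b ds} → kids c ≡ a ∷ b ∷ ds → sideOf c ≡ right
  sideOf-right {c} e with kids c
  sideOf-right refl | _ = refl

  -- The fuel `t ∸ depth x` is positive and drops by exactly one per generation, so `inside`
  -- satisfies the recursion without fuel.
  inside-≡ : ∀ x side → inside x side ≡ concat (reverse (map (segment side) (kids x))) ++ singles x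
  inside-≡ x side rewrite ∸-step (depth< x) =
    cong (λ l → concat (reverse l) ++ singles x) (List.map-cong-local (All.tabulate λ {c} c∈ →
      cong (λ d → segmentWith (insideIn (t ∸ d) c) (sideOf c) (group c) side) (sym (depth-suc (∈-kids⁻ c∈)))))

module HomeFacts {n} {G : Graph n} (M : PathTreeModel G) {r} (R : Rooting (PathTreeModel.tree M) r)
                 (L : PlaneLayout (PathTreeModel.tree M)) where
  open Models M
  open Rooting R
  open Rooted R
  open PlaneLayout L
  open Tour path r parent depth (kidsTable parent order) public
  open LayoutFacts R L path public

  private
    spec : ∀ v → ScanSpec (path v) (scan (path v))
    spec v = scan-spec (proj₂ (path-≢[] v)) (path-uniq v)

    all-≼-lowest : ∀ v {z} → v ∋ z → z ≼ Scan.lowest (scan (path v))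
    all-≼-lowest v = top-all (path-linked v) lowest-∈ (λ e p∈ → <⇒≱ (rank-parent-< e) (lowest-≤ p∈))
      where open ScanSpec (spec v)

  home-single⁻ : ∀ {v x} → home v ≡ inj₁ x → v ∋ x × (∀ {z} → v ∋ z → z ≡ x)
  home-single⁻ {v} e with scan (path v) | spec v
  home-single⁻ {v} refl | Tour.scanned a nothing k | sp = lowest-∈ , second-none refl
    where open ScanSpec sp

  -- The second lowest node lies below some child `d` of the top node. The path contains `d` by
  -- convexity, and `d` has smaller rank than everything strictly below it, so it is the second
  -- lowest node itself.
  home-group⁻ : ∀ {v c} → home v ≡ inj₂ c → ∃ λ y → parent c ≡ just y × v ∋ y × v ∋ c ×
                (∀ {z} → v ∋ z → z ≼ y) ×
                (∀ {d} → parent d ≡ just y → v ∋ d → d ≢ c → rank c < rank d)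
  home-group⁻ {v} e with scan (path v) | spec v | all-≼-lowest v
  home-group⁻ {v} {c} refl | Tour.scanned a (just c) k | sp | all≼
    with kid-towards (all≼ (second-∈ refl)) (second-≢ refl)
    where open ScanSpec sp
  ... | d , ed , c≼d with c Fin.≟ d
  ...   | no c≢d = contradiction (rank-≺ c≼d c≢d) (≤⇒≯ (second-≤ refl
                     (between (path-linked v) lowest-∈ (second-∈ refl) c≼d (ed ◅ ε)) (parent-≢ ed)))
    where open ScanSpec sp
  ...   | yes refl = a , ed , lowest-∈ , second-∈ refl , all≼ ,
                     λ e′ v∋d d≢c → siblings-< ed e′ (≢-sym d≢c) (second-≤ refl v∋d (parent-≢ e′))
    where open ScanSpec sp

  home-single⁺ : ∀ {v x} → (∀ {z} → v ∋ z → z ≡ x) → home v ≡ inj₁ x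
  home-single⁺ {v} only with home v in eq
  ... | inj₁ y = cong inj₁ (only (proj₁ (home-single⁻ eq)))
  ... | inj₂ c with home-group⁻ {v} eq
  ...   | y , ec , v∋y , v∋c , _ = contradiction (trans (only v∋c) (sym (only v∋y))) (parent-≢ ec)

  home-group⁺ : ∀ {v c y} → parent c ≡ just y → v ∋ c → v ∋ y → (∀ {p} → parent y ≡ just p → ¬ v ∋ p) →
                (∀ {d} → parent d ≡ just y → v ∋ d → d ≢ c → rank c < rank d) → home v ≡ inj₂ c
  home-group⁺ {v} {c} {y} ec v∋c v∋y no-parent first with home v in eq
  ... | inj₁ x = contradiction (trans (proj₂ (home-single⁻ eq) v∋c) (sym (proj₂ (home-single⁻ eq) v∋y))) (parent-≢ ec)
  ... | inj₂ c′ with home-group⁻ {v} eq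
  ...   | y′ , ec′ , v∋y′ , v∋c′ , all≼ , first′
          with ≼-antisym (all≼ v∋y) (top-all (path-linked v) v∋y no-parent v∋y′)
  ...     | refl with c′ Fin.≟ c
  ...       | yes refl = refl
  ...       | no c′≢c = contradiction (first ec′ v∋c′ c′≢c) (<⇒≯ (first′ ec v∋c (≢-sym c′≢c)))

  key-≥ : ∀ {v z} → v ∋ z → rank z ≤ keyOf v
  key-≥ {v} = ScanSpec.key-≥ (spec v)

  key-attained : ∀ v → ∃ λ z → v ∋ z × keyOf v ≡ rank z
  key-attained v = ScanSpec.key-attained (spec v)

-- Neighbouring vertices of the tour share a node.

module TourCycle {n} {G : Graph n} (M : PathTreeModel G) (nc : IsNonCrossing M)
                 (cm : IsCliqueModel M) (tc : TwoConnected G)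
                 {r} (R : Rooting (PathTreeModel.tree M) r) (L : PlaneLayout (PathTreeModel.tree M)) where
  open Graph G
  open Models M
  open NonCrossing nc
  open Rooting R
  open Rooted R
  open CliqueModels M nc cm tc R
  open HomeFacts M R L

  -- Unlike adjacency this admits equal vertices, so that distinctness, which follows from the tour
  -- having no repetitions, stays out of the induction.
  Share : Rel (Fin n) 0ℓ
  Share u v = ∃ λ x → u ∋ x × v ∋ x

  -- Lists of vertices of the bag of y, in which linked lists with both ends in
  -- the bag may be spliced.
  data Block (y : Fin t) : List (Fin n) → Set where
    []   : Block y []
    _∷_  : ∀ {v l} → v ∋ y → Block y l → Block y (v ∷ l)
    fill : ∀ {f mid s l} → f ∋ y → Linked Share (f ∷ mid ++ s ∷ []) → Block y (s ∷ l) →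
           Block y (f ∷ mid ++ s ∷ l)

  block-head : ∀ {y v l} → Block y (v ∷ l) → v ∋ y
  block-head (v∋y ∷ _)      = v∋y
  block-head (fill f∋y _ _) = f∋y

  block-linked : ∀ {y l} → Block y l → Linked Share l
  block-linked []                   = []
  block-linked {l = _ ∷ []} (p ∷ _) = [-]
  block-linked {y} {l = _ ∷ _ ∷ _} (p ∷ b) = (y , p , block-head b) ∷ block-linked b
  block-linked (fill {f} {mid} p l b) = linked-join (f ∷ mid) l (block-linked b)

  block-++ : ∀ {y l m} → Block y l → Block y m → Block y (l ++ m)
  block-++ [] c = c
  block-++ (p ∷ b) c = p ∷ block-++ b c
  block-++ {y} {m = m} (fill {f} {mid} {s} {l} p k b) c =
    subst (λ z → Block y (f ∷ z)) (sym (List.++-assoc mid (s ∷ l) m)) (fill p k (block-++ b c))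

  block-concat : ∀ {y ls} → All (Block y) ls → Block y (concat ls)
  block-concat []       = []
  block-concat (b ∷ bs) = block-++ b (block-concat bs)

  block-all : ∀ {y l} → (∀ {v} → v ∈ l → v ∋ y) → Block y l
  block-all {l = []}    f = []
  block-all {l = v ∷ l} f = f (here refl) ∷ block-all (f ∘ there)

  pick : Side → Fin n → Fin n → Fin n
  pick left  p q = p
  pick right p q = q

  -- The invariant of the descent. By `deep`, one known end of the gap reaches the only child
  -- whenever any vertex on the edge does. The condition `turn` cannot be repaired further down: at
  -- a branching the two ends must go to different children, in the order in which the tour lists
  -- these.
  record Gap (x y : Fin t) (side : Side) (p q : Fin n) : Set where
    field
      up   : parent y ≡ just x
      p∋x  : p ∋ x
      p∋y  : p ∋ y
      q∋x  : q ∋ x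
      q∋y  : q ∋ y
      deep : ∀ {z v} → kids y ≡ z ∷ [] → v ∋ x → v ∋ y → v ∋ z → pick side p q ∋ z
      turn : ∀ {c d} → kids y ≡ c ∷ d ∷ [] → Branching y x c d → side ≡ right × p ∋ d × q ∋ c

  Below : Fin t → Set
  Below y = ∀ {c side p q} → Gap y c side p q → Linked Share (p ∷ inside c side ++ q ∷ [])

  singles∋ : ∀ {v y} → v ∈ singles y → v ∋ y
  singles∋ v∈ = proj₁ (home-single⁻ (∈-singles⁻ v∈))

  group∋ : ∀ {v c y} → parent c ≡ just y → v ∈ group c → v ∋ y × v ∋ c × (∀ {z} → v ∋ z → z ≼ y)
  group∋ {v} ec v∈ with home-group⁻ {v} (∈-group⁻ v∈)
  ... | y , ec′ , v∋y , v∋c , all≼ , _ with same-parent ec ec′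
  ...   | refl = v∋y , v∋c , all≼

  nbr-cases : ∀ {a y x} → parent y ≡ just x → a ~ᵀ y → a ≡ x ⊎ a ∈ kids y
  nbr-cases ey a~y with edge a~y
  ... | inj₁ ea  = inj₂ (∈-kids⁺ ea)
  ... | inj₂ ey′ = inj₁ (same-parent ey′ ey)

  kid~ : ∀ {c y} → parent c ≡ just y → c ~ᵀ y
  kid~ = parent-edge

  group-head : ∀ {c f s rest v} → group c ≡ f ∷ s ∷ rest → v ∈ group c → keyOf v ≤ keyOf f
  group-head {c} e v∈ with group c | extremal-group c
  group-head refl (here refl) | _ | _ = ≤-refl
  group-head refl (there v∈)  | _ | Tour.ext all≤ _ = All.lookup all≤ v∈

  group-second : ∀ {c f s rest v} → group c ≡ f ∷ s ∷ rest → v ∈ group c → v ≢ f → keyOf s ≤ keyOf v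
  group-second {c} e v∈ v≢f with group c | extremal-group c
  group-second refl (here refl) v≢f | _ | _ = contradiction refl v≢f
  group-second refl (there (here refl)) v≢f | _ | _ = ≤-refl
  group-second refl (there (there v∈))  v≢f | _ | Tour.ext _ all≤ = All.lookup all≤ v∈

  module _ {c y c₁ c₂} (br : Branching c y c₁ c₂) (ec : parent c ≡ just y)
           (e₁ : parent c₁ ≡ just c) (e₂ : parent c₂ ≡ just c) where
    open Branching br
    private
      at-y : Branching c c₁ c₂ y
      at-y = Branching.swap-bc (Branching.swap-ab br)
      at-c₁ : Branching c y c₂ c₁
      at-c₁ = Branching.swap-bc br

    -- The three neighbours of a branching play equal parts, so `ends-at-c` applies with the parent
    -- as the end: such a path has `y` as its top node and enters no other child of `y`.
    stays-at-y : ∀ {u w} → u ∋ c → u ∋ y → w ~ᵀ y → u ∋ w → w ≡ c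
    stays-at-y {w = w} u∋c u∋y w~y u∋w with w Fin.≟ c
    ... | yes e = e
    ... | no w≢c = ⊥-elim (Branching.ends-at-c at-y u∋c u∋y w~y w≢c u∋w)

    no-grandparent : ∀ {u p} → u ∋ c → u ∋ y → parent y ≡ just p → ¬ u ∋ p
    no-grandparent u∋c u∋y ey u∋p with stays-at-y u∋c u∋y (~ᵀ-sym (parent-edge ey)) u∋p
    ... | refl = <-irrefl refl (<-trans (parent-< ey) (parent-< ec))

    branching-home : ∀ {u} → u ∋ c → u ∋ y → home u ≡ inj₂ c
    branching-home u∋c u∋y = home-group⁺ ec u∋c u∋y (no-grandparent u∋c u∋y)
      (λ ed u∋d d≢c → contradiction (stays-at-y u∋c u∋y (kid~ ed) u∋d) d≢c)

    -- A path through `y`, `c` and `c₁` ends at `y` and at `c₁`, so it has no further node and `c₁`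
    -- is its deepest; the key therefore tells to which child it turns.
    branching-key : ∀ {u} → u ∋ c → u ∋ y → u ∋ c₁ → keyOf u ≤ rank c₁
    branching-key {u} u∋c u∋y u∋c₁ with key-attained u
    ... | z , u∋z , eq = subst (_≤ rank c₁) (sym eq) (bound u∋z)
      where
      up-to : ∀ {z m} → u ∋ m → u ∋ z → z ≼ m → z ≢ m → ∃ λ d → parent d ≡ just m × u ∋ d × z ≼ d
      up-to u∋m u∋z z≼m z≢m with kid-towards z≼m z≢m
      ... | d , ed , z≼d = d , ed , between (path-linked u) u∋m u∋z z≼d (ed ◅ ε) , z≼d
      bound : ∀ {z} → u ∋ z → rank z ≤ rank c₁
      bound {z} u∋z with z Fin.≟ y
      ... | yes refl = rank-≼ (e₁ ◅ ec ◅ ε)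
      ... | no z≢y with up-to u∋y u∋z (top-all (path-linked u) u∋y (no-grandparent u∋c u∋y) u∋z) z≢y
      ...   | d , ed , u∋d , z≼d with stays-at-y u∋c u∋y (kid~ ed) u∋d
      ...     | refl with z Fin.≟ c
      ...       | yes refl = rank-≼ (e₁ ◅ ε)
      ...       | no z≢c with up-to u∋c u∋z z≼d z≢c
      ...         | d , ed′ , u∋d′ , z≼d′ with nbrs (kid~ ed′)
      ...           | inj₁ refl = contradiction (ec ◅ ε) (kid⋡ ed′)
      ...           | inj₂ (inj₂ refl) = ⊥-elim (no-three R u∋c u∋y u∋c₁ u∋d′ a~y b~y c~y a≢b a≢c b≢c)
      ...           | inj₂ (inj₁ refl) with z Fin.≟ c₁
      ...             | yes refl = ≤-refl
      ...             | no z≢c₁ with up-to u∋c₁ u∋z z≼d′ z≢c₁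
      ...               | g , eg , u∋g , _ = ⊥-elim (Branching.ends-at-c at-c₁ u∋c u∋c₁ (kid~ eg)
                            (λ { refl → <-irrefl refl (<-trans (parent-< e₁) (parent-< eg)) }) u∋g)

  -- With one child `z`, a vertex with top node `y` competes with `f` for the largest key, and a
  -- vertex from above `y` that reaches `z` would cross `f` if `f` missed `z`. At a branching all
  -- vertices on the edge have home `c` and their keys tell the two children apart, so the largest
  -- key turns to the later child and the smallest of the others to the earlier one.
  group-gap : ∀ {c y f s rest} → parent c ≡ just y → group c ≡ f ∷ s ∷ rest →
              (∀ {u d} → u ∋ y → u ∋ c → parent d ≡ just y → u ∋ d → d ≡ c) →
              Gap y c (sideOf c) f s
  group-gap {c} {y} {f} {s} {rest} ec eq no-apex = record
    { up = ec ; p∋x = proj₁ F ; p∋y = proj₁ (proj₂ F) ; q∋x = proj₁ S ; q∋y = proj₁ (proj₂ S)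
    ; deep = λ {z} {v} ek v∋y v∋c v∋z → subst (λ side → pick side f s ∋ z) (sym (sideOf-left ek)) (deep-f ek v∋y v∋c v∋z)
    ; turn = λ ek br → sideOf-right ek , turn ek br }
    where
    f∈ : f ∈ group c
    f∈ = subst (f ∈_) (sym eq) (here refl)
    s∈ : s ∈ group c
    s∈ = subst (s ∈_) (sym eq) (there (here refl))
    F = group∋ ec f∈
    S = group∋ ec s∈
    f∋c = proj₁ (proj₂ F)

    deep-f : ∀ {z v} → kids c ≡ z ∷ [] → v ∋ y → v ∋ c → v ∋ z → f ∋ z
    deep-f {z} {v} ek v∋y v∋c v∋z = go (parent y) refl
      where
      ez : parent z ≡ just c
      ez = ∈-kids⁻ (subst (z ∈_) (sym ek) (here refl))
      same-top : (∀ {p} → parent y ≡ just p → ¬ v ∋ p) → f ∋ z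
      -- `f` has a node `w` of rank at least that of `z`. By `no-apex` it lies below `c`; it is not
      -- `c` itself, and `z` is the only child there, so `f` passes through `z`.
      same-top top with key-attained f
      ... | w , f∋w , e-key = reach (kid-towards (proj₂ (proj₂ F) f∋w) (λ { refl → <⇒≱ (rank-parent-< ec) (≤-trans (<⇒≤ (rank-parent-< ez)) z≤w) }))
        where
        z≤w : rank z ≤ rank w
        z≤w = ≤-trans (key-≥ v∋z) (≤-trans
          (group-head eq (∈-group⁺ (home-group⁺ ec v∋c v∋y top (λ ed v∋d d≢c → contradiction (no-apex v∋y v∋c ed v∋d) d≢c))))
          (≤-reflexive e-key))
        reach : (∃ λ d → parent d ≡ just y × w ≼ d) → f ∋ z
        reach (d , ed , w≼d) with no-apex (proj₁ F) f∋c ed (between (path-linked f) (proj₁ F) f∋w w≼d (ed ◅ ε))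
        ... | refl with kid-towards w≼d (λ { refl → <⇒≱ (rank-parent-< ez) z≤w })
        ...   | z′ , ez′ , w≼z′ with subst (z′ ∈_) ek (∈-kids⁺ ez′)
        ...     | here refl = between (path-linked f) f∋c f∋w w≼z′ (ez ◅ ε)
      go : ∀ m → parent y ≡ m → f ∋ z
      go nothing ey = same-top (λ ey′ → case trans (sym ey) ey′ of λ ())
      go (just x) ey with x ∈? path v
      ... | no v∌x = same-top (λ ey′ v∋p → v∌x (subst (v ∋_) (same-parent ey′ ey) v∋p))
      ... | yes v∋x with nc-kid R {f} {v} ez ε (λ x≼z → <⇒≱ (<-trans (parent-< ey) (<-trans (parent-< ec) (parent-< ez))) (≼-depth x≼z))
                           (λ { refl → <-irrefl refl (<-trans (parent-< ey) (parent-< ec)) }) f∋c v∋c v∋x v∋z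
      ...   | inj₂ f∋z = f∋z
      ...   | inj₁ f∋x = contradiction (proj₂ (proj₂ F) f∋x) (kid⋡ ey)

    turn : ∀ {c₁ c₂} → kids c ≡ c₁ ∷ c₂ ∷ [] → Branching c y c₁ c₂ → f ∋ c₂ × s ∋ c₁
    turn {c₁} {c₂} ek br with Branching.ab br | Branching.ac br
    ... | u₁ , u₁∋c , u₁∋y , u₁∋c₁ | u₂ , u₂∋c , u₂∋y , u₂∋c₂ = f∋c₂ , s∋c₁
      where
      e₁ : parent c₁ ≡ just c
      e₁ = ∈-kids⁻ (subst (c₁ ∈_) (sym ek) (here refl))
      e₂ : parent c₂ ≡ just c
      e₂ = ∈-kids⁻ (subst (c₂ ∈_) (sym ek) (there (here refl)))
      c₁<c₂ : rank c₁ < rank c₂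
      c₁<c₂ = rank-siblings {as = []} ek (here refl)
      open Branching br
      either : ∀ {u} → u ∋ c → u ∋ y → u ∋ c₁ ⊎ u ∋ c₂
      either u∋c u∋y with two-of u∋c
      ... | inj₁ (_ , p) = inj₁ p
      ... | inj₂ (inj₁ (_ , p)) = inj₂ p
      ... | inj₂ (inj₂ (p , _)) = inj₁ p
      low : ∀ {u} → u ∋ c → u ∋ y → u ∋ c₁ → keyOf u ≤ rank c₁
      low = branching-key br ec e₁ e₂
      in-group : ∀ {u} → u ∋ c → u ∋ y → u ∈ group c
      in-group u∋c u∋y = ∈-group⁺ (branching-home br ec e₁ e₂ u∋c u∋y)
      f∋c₂ : f ∋ c₂
      f∋c₂ with either f∋c (proj₁ F)
      ... | inj₂ p = p
      ... | inj₁ p = contradiction (≤-trans (key-≥ u₂∋c₂) (≤-trans (group-head eq (in-group u₂∋c u₂∋y)) (low f∋c (proj₁ F) p))) (<⇒≱ c₁<c₂)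
      s∋c₁ : s ∋ c₁
      s∋c₁ with either (proj₁ (proj₂ S)) (proj₁ S)
      ... | inj₁ p = p
      -- `u₁` turns to `c₁` and hence is not `f`, so the choice of `s` as the smallest of the others
      -- bounds the key of `s` by that of `u₁`.
      ... | inj₂ p = contradiction
              (≤-trans (key-≥ p) (≤-trans (group-second eq (in-group u₁∋c u₁∋y)
                (λ { refl → no-three R u₁∋c u₁∋y u₁∋c₁ f∋c₂ a~y b~y c~y a≢b a≢c b≢c })) (low u₁∋c u₁∋y u₁∋c₁)))
              (<⇒≱ c₁<c₂)

  Transit : Fin t → Set
  Transit y = ∃ λ v → ∃₂ λ a b → (a ~ᵀ y × b ~ᵀ y × a ≢ b) × (v ∋ y × v ∋ a × v ∋ b)

  transit? : ∀ y → Dec (Transit y)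
  transit? y = Fin.any? λ v → Fin.any? λ a → Fin.any? λ b →
    (tree._~?_ a y ×-dec (tree._~?_ b y ×-dec ¬? (a Fin.≟ b))) ×-dec
    ((y ∈? path v) ×-dec ((a ∈? path v) ×-dec (b ∈? path v)))
    where module tree = Graph tree

  module _ {y} (¬transit : ¬ Transit y) where

    split-home : ∀ {c v} → parent c ≡ just y → v ∋ y → v ∋ c → home v ≡ inj₂ c
    split-home ec v∋y v∋c = home-group⁺ ec v∋c v∋y
      (λ ey v∋p → ¬transit (_ , _ , _ , (~ᵀ-sym (parent-edge ey) , kid~ ec , (λ { refl → <-irrefl refl (<-trans (parent-< ey) (parent-< ec)) })) , v∋y , v∋p , v∋c))
      (λ ed v∋d d≢c → ⊥-elim (¬transit (_ , _ , _ , (kid~ ed , kid~ ec , d≢c) , v∋y , v∋d , v∋c)))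

    -- Here every vertex on the edge has home `c`, and `two-on-edge` provides two of them: the group
    -- supplies both ends of a gap of its own.
    split-group : ∀ {c} → parent c ≡ just y → ∃₂ λ f s → ∃ λ rest → group c ≡ f ∷ s ∷ rest
    split-group {c} ec with two-on-edge ec
    ... | s , s′ , s≢s′ , (s∋y , s∋c) , (s′∋y , s′∋c) = go (group c) (∈-group⁺ (split-home ec s∋y s∋c)) (∈-group⁺ (split-home ec s′∋y s′∋c))
      where
      go : ∀ g → s ∈ g → s′ ∈ g → ∃₂ λ f s → ∃ λ rest → g ≡ f ∷ s ∷ rest
      go (f ∷ []) (here refl) (here refl) = contradiction refl s≢s′
      go (f ∷ s ∷ rest) _ _ = f , s , rest , refl

    split-segment : ∀ {c} side → Below y → parent c ≡ just y → Block y (segment side c)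
    split-segment {c} side below ec with split-group ec
    ... | f , s , rest , eq rewrite eq =
      fill (mem (here refl)) (below (group-gap ec eq no-apex)) (block-all (mem ∘ there))
      where
      mem : ∀ {v} → v ∈ f ∷ s ∷ rest → v ∋ y
      mem v∈ = proj₁ (group∋ ec (subst (_ ∈_) (sym eq) v∈))
      no-apex : ∀ {u d} → u ∋ y → u ∋ c → parent d ≡ just y → u ∋ d → d ≡ c
      no-apex {d = d} u∋y u∋c ed u∋d with d Fin.≟ c
      ... | yes e = e
      ... | no d≢c = ⊥-elim (¬transit (_ , _ , _ , (kid~ ed , kid~ ec , d≢c) , u∋y , u∋d , u∋c))

    split-block : ∀ side → Below y → Block y (inside y side)
    split-block side below = subst (Block y) (sym (inside-≡ y side))
      (block-++ (block-concat (↭.All-resp-↭ (↭-sym (↭.↭-reverse _)) (All.map⁺ (All.tabulate (λ c∈ → split-segment side below (∈-kids⁻ c∈))))))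
                (block-all singles∋))

  -- Non-crossing with `v₀` makes every vertex at `y` contain `x` or `z`, so nothing lives at `y`
  -- alone. A vertex at `y` but not at `x` exists by maximality and must contain `z`: the group of
  -- `z` is never empty. If it has one member, that member and the deep one of `p` and `q` bound the
  -- gap below.
  chain-block : ∀ {x y z side p q v} → Below y → Gap x y side p q → kids y ≡ z ∷ [] →
                v ∋ x → v ∋ y → v ∋ z → Block y (p ∷ inside y side ++ q ∷ [])
  chain-block {x} {y} {z} {side} {p} {q} {v₀} below gap ek v₀∋x v₀∋y v₀∋z =
    subst (λ l → Block y (p ∷ l ++ q ∷ [])) (sym inside-y) (whole side (group z) refl (deep ek v₀∋x v₀∋y v₀∋z))
    where
    open Gap gap
    ez : parent z ≡ just y
    ez = ∈-kids⁻ (subst (z ∈_) (sym ek) (here refl))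
    x~y : x ~ᵀ y
    x~y = ~ᵀ-sym (parent-edge up)
    x≢z : x ≢ z
    x≢z refl = <-irrefl refl (<-trans (parent-< up) (parent-< ez))
    through : ∀ {u} → u ∋ y → u ∋ x ⊎ u ∋ z
    through u∋y = nc-nbrs R x~y (kid~ ez) x≢z u∋y v₀∋y v₀∋x v₀∋z
    no-singles : singles y ≡ []
    no-singles with singles y in eq
    ... | [] = refl
    ... | v ∷ _ with home-single⁻ (∈-singles⁻ (subst (v ∈_) (sym eq) (here refl)))
    ...   | v∋y , only with through v∋y
    ...     | inj₁ v∋x = contradiction (only v∋x) (≢-sym (parent-≢ up))
    ...     | inj₂ v∋z = contradiction (only v∋z) (parent-≢ ez)
    inside-y : inside y side ≡ segment side z
    inside-y = trans (inside-≡ y side) (trans (cong₂ (λ ks ss → concat (reverse (map (segment side) ks)) ++ ss) ek no-singles)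
                 (trans (List.++-identityʳ _) (List.++-identityʳ _)))
    no-apex : ∀ {u d} → u ∋ y → u ∋ z → parent d ≡ just y → u ∋ d → d ≡ z
    no-apex _ _ ed _ with subst (_ ∈_) ek (∈-kids⁺ ed)
    ... | here refl = refl
    z-home : ∀ {u} → u ∋ y → u ∋ z → ¬ u ∋ x → home u ≡ inj₂ z
    z-home u∋y u∋z u∌x = home-group⁺ ez u∋z u∋y (λ ey u∋p → u∌x (subst (_ ∋_) (same-parent ey up) u∋p))
      (λ ed u∋d d≢z → contradiction (no-apex u∋y u∋z ed u∋d) d≢z)
    not-empty : group z ≢ []
    not-empty e with bag-differs {y} {x} (parent-≢ up)
    ... | u , u∋y , u∌x with through u∋y
    ...   | inj₁ u∋x = u∌x u∋x
    ...   | inj₂ u∋z with subst (u ∈_) e (∈-group⁺ (z-home u∋y u∋z u∌x))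
    ...     | ()
    -- A new vertex reaches at least as deep as all that live higher up.
    new-deep : ∀ {u w v} → group z ≡ u ∷ [] → kids z ≡ w ∷ [] → v ∋ y → v ∋ z → v ∋ w → u ∋ w
    new-deep {u} {w} {v} eg ew v∋y v∋z v∋w with x ∈? path v
    ... | no v∌x with subst (v ∈_) eg (∈-group⁺ (z-home v∋y v∋z v∌x))
    ...   | here refl = v∋w
    new-deep {u} {w} {v} eg ew v∋y v∋z v∋w | yes v∋x
        with nc-kid R {u} {v} e-w ε (λ x≼w → <⇒≱ (<-trans (parent-< up) (<-trans (parent-< ez) (parent-< e-w))) (≼-depth x≼w))
               x≢z (proj₁ (proj₂ U)) v∋z v∋x v∋w
      where
      e-w : parent w ≡ just z
      e-w = ∈-kids⁻ (subst (w ∈_) (sym ew) (here refl))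
      U = group∋ ez (subst (u ∈_) (sym eg) (here refl))
    ...   | inj₂ u∋w = u∋w
    ...   | inj₁ u∋x = contradiction (proj₂ (proj₂ (group∋ ez (subst (u ∈_) (sym eg) (here refl)))) u∋x) (kid⋡ up)
    -- In a branching at `z` a path through `z` and `y` ends at `y`, whereas `u` goes on to `x`; so
    -- the turn condition is void.
    no-turn : ∀ {u c d} {A : Set} → u ∋ x → u ∋ y → u ∋ z → kids z ≡ c ∷ d ∷ [] → Branching z y c d → A
    no-turn {u} {c} {d} u∋x u∋y u∋z ek′ br =
      ⊥-elim (no-grandparent br ez (∈-kids⁻ (subst (c ∈_) (sym ek′) (here refl)))
               (∈-kids⁻ (subst (d ∈_) (sym ek′) (there (here refl)))) u∋z u∋y up u∋x)
    whole : ∀ side g → group z ≡ g → pick side p q ∋ z → Block y (p ∷ segmentWith (inside z) (sideOf z) g side ++ q ∷ [])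
    whole side [] e _ = contradiction e not-empty
    -- The deep end of the gap between `p` and `u` is on the right, since `u` is the newer vertex.
    whole left (u ∷ []) e p∋z = subst (λ l → Block y (p ∷ l)) (sym (List.++-assoc (inside z right) (u ∷ []) (q ∷ [])))
      (fill p∋y (below (record
        { up = ez ; p∋x = p∋y ; p∋y = p∋z ; q∋x = proj₁ U ; q∋y = proj₁ (proj₂ U)
        ; deep = λ ew v∋y v∋z v∋w → new-deep e ew v∋y v∋z v∋w
        ; turn = no-turn p∋x p∋y p∋z })) (proj₁ U ∷ q∋y ∷ []))
      where U = group∋ ez (subst (u ∈_) (sym e) (here refl))
    whole right (u ∷ []) e q∋z =
      p∋y ∷ fill (proj₁ U) (below (record
        { up = ez ; p∋x = proj₁ U ; p∋y = proj₁ (proj₂ U) ; q∋x = q∋y ; q∋y = q∋z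
        ; deep = λ ew v∋y v∋z v∋w → new-deep e ew v∋y v∋z v∋w
        ; turn = no-turn q∋x q∋y q∋z })) (q∋y ∷ [])
      where U = group∋ ez (subst (u ∈_) (sym e) (here refl))
    whole side (f ∷ s ∷ rest) e _ =
      p∋y ∷ subst (λ l → Block y (f ∷ l)) (sym (List.++-assoc (inside z (sideOf z)) (s ∷ rest) (q ∷ [])))
        (fill (mem (here refl)) (below (group-gap ez e no-apex)) (block-++ (block-all (mem ∘ there)) (q∋y ∷ [])))
      where
      mem : ∀ {v} → v ∈ f ∷ s ∷ rest → v ∋ y
      mem v∈ = proj₁ (group∋ ez (subst (_ ∈_) (sym e) v∈))

  -- Vertices with top node `y` contain both children and therefore belong to the earlier one, `c₁`.
  -- Listed backwards, this gives `p`, the inside of `c₂`, the first member of the group of `c₁`,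
  -- the inside of `c₁`, the other members, `q`. The first member of the group ends the gap at `c₂`
  -- and begins the one at `c₁`.
  turn-block : ∀ {x y c₁ c₂ side p q} → Below y → Gap x y side p q → kids y ≡ c₁ ∷ c₂ ∷ [] →
               Branching y x c₁ c₂ → Block y (p ∷ inside y side ++ q ∷ [])
  turn-block {x} {y} {c₁} {c₂} {side} {p} {q} below gap ek br with Gap.turn gap ek br
  ... | refl , p∋c₂ , q∋c₁ =
    subst (λ l → Block y (p ∷ l)) (sym (trans (cong (_++ q ∷ []) inside-y)
      (List.++-assoc (inside c₂ left) (segment right c₁) (q ∷ [])))) (whole (group c₁) refl)
    where
    open Gap gap
    open Branching br
    e₁ : parent c₁ ≡ just y
    e₁ = ∈-kids⁻ (subst (c₁ ∈_) (sym ek) (here refl))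
    e₂ : parent c₂ ≡ just y
    e₂ = ∈-kids⁻ (subst (c₂ ∈_) (sym ek) (there (here refl)))
    c₁<c₂ : rank c₁ < rank c₂
    c₁<c₂ = rank-siblings {as = []} ek (here refl)
    no-singles : singles y ≡ []
    no-singles with singles y in eq
    ... | [] = refl
    ... | v ∷ _ with home-single⁻ (∈-singles⁻ (subst (v ∈_) (sym eq) (here refl)))
    ...   | v∋y , only with two-of v∋y
    ...     | inj₁ (v∋x , _) = contradiction (only v∋x) (≢-sym (parent-≢ up))
    ...     | inj₂ (inj₁ (v∋x , _)) = contradiction (only v∋x) (≢-sym (parent-≢ up))
    ...     | inj₂ (inj₂ (v∋c₁ , _)) = contradiction (only v∋c₁) (parent-≢ e₁)
    kid-of-y : ∀ {d} → parent d ≡ just y → d ≡ c₁ ⊎ d ≡ c₂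
    kid-of-y ed with subst (_ ∈_) ek (∈-kids⁺ ed)
    ... | here e = inj₁ e
    ... | there (here e) = inj₂ e
    both : ∀ {c u} → parent c ≡ just y → u ∈ group c → u ∋ c₁ × u ∋ c₂
    both ec u∈ with group∋ ec u∈
    ... | u∋y , _ , all≼ with two-of u∋y
    ...   | inj₁ (u∋x , _) = contradiction (all≼ u∋x) (kid⋡ up)
    ...   | inj₂ (inj₁ (u∋x , _)) = contradiction (all≼ u∋x) (kid⋡ up)
    ...   | inj₂ (inj₂ q) = q
    empty₂ : group c₂ ≡ []
    empty₂ with group c₂ in eq
    ... | [] = refl
    ... | u ∷ _ with home-group⁻ {u} (∈-group⁻ (subst (u ∈_) (sym eq) (here refl))) | both e₂ (subst (u ∈_) (sym eq) (here refl))
    ...   | y′ , ec′ , _ , _ , _ , first | u∋c₁ , _ with same-parent e₂ ec′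
    ...     | refl = contradiction (first e₁ u∋c₁ b≢c) (<⇒≯ c₁<c₂)
    full₁ : group c₁ ≢ []
    full₁ e with bc
    ... | u , u∋y , u∋c₁ , u∋c₂ with subst (u ∈_) e (∈-group⁺ (home-group⁺ e₁ u∋c₁ u∋y
              (λ ey u∋p → no-three R u∋y (subst (u ∋_) (same-parent ey up) u∋p) u∋c₁ u∋c₂ a~y b~y c~y a≢b a≢c b≢c)
              (λ ed u∋d d≢c₁ → case kid-of-y ed of λ { (inj₁ e) → contradiction e d≢c₁ ; (inj₂ refl) → c₁<c₂ })))
    ...   | ()
    inside-y : inside y right ≡ inside c₂ left ++ segment right c₁
    inside-y = trans (inside-≡ y right) (trans (cong₂ (λ ks ss → concat (reverse (map (segment right) ks)) ++ ss) ek no-singles)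
      (trans (List.++-identityʳ _) (trans (cong (λ l → segment right c₂ ++ l) (List.++-identityʳ _))
        (cong (λ g → segmentWith (inside c₂) (sideOf c₂) g right ++ segment right c₁) empty₂))))
    -- All paths through y and c end at c, so every condition on deeper nodes is void.
    shallow : ∀ {c d u p q side} → parent c ≡ just y → parent d ≡ just y → Branching y x d c →
              u ∋ y → u ∋ c → (u ∋ x ⊎ u ∋ d) → p ∋ y → p ∋ c → q ∋ y → q ∋ c → Gap y c side p q
    shallow {c} {d} {u} ec ed br′ u∋y u∋c third p∋y p∋c q∋y q∋c = record
      { up = ec ; p∋x = p∋y ; p∋y = p∋c ; q∋x = q∋y ; q∋y = q∋c
      ; deep = λ {z} ek′ v∋y v∋c v∋z → let ez = ∈-kids⁻ (subst (z ∈_) (sym ek′) (here refl)) in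
          ⊥-elim (Branching.ends-at-c br′ v∋y v∋c (kid~ ez) (λ { refl → <-irrefl refl (<-trans (parent-< ez) (parent-< ec)) }) v∋z)
      ; turn = λ {a} {b} ek′ br″ → ⊥-elim (clash third br″ (∈-kids⁻ (subst (a ∈_) (sym ek′) (here refl)))
                 (∈-kids⁻ (subst (b ∈_) (sym ek′) (there (here refl))))) }
      where
      clash : u ∋ x ⊎ u ∋ d → ∀ {a b} → Branching c y a b → parent a ≡ just c → parent b ≡ just c → ⊥
      clash (inj₁ u∋x) br″ ea eb = no-grandparent br″ ec ea eb u∋c u∋y up u∋x
      clash (inj₂ u∋d) br″ ea eb = contradiction (sym (stays-at-y br″ ec ea eb u∋c u∋y (kid~ ed) u∋d)) (≢-sym (Branching.b≢c br′))
    br₁ : Branching y x c₂ c₁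
    br₁ = swap-bc
    whole : ∀ g → group c₁ ≡ g → Block y (p ∷ inside c₂ left ++ (segmentWith (inside c₁) (sideOf c₁) g right ++ q ∷ []))
    whole [] e = contradiction e full₁
    whole (u ∷ []) e =
      fill p∋y (below (shallow e₂ e₁ br p∋y p∋c₂ (inj₁ p∋x) p∋y p∋c₂ (proj₁ U) (proj₂ (both e₁ u∈))))
        (fill (proj₁ U) (below (shallow e₁ e₂ br₁ q∋y q∋c₁ (inj₁ q∋x) (proj₁ U) (proj₁ (both e₁ u∈)) q∋y q∋c₁)) (q∋y ∷ []))
      where
      u∈ : u ∈ group c₁
      u∈ = subst (u ∈_) (sym e) (here refl)
      U = group∋ e₁ u∈
    whole (f ∷ s ∷ rest) e =
      fill p∋y (below (shallow e₂ e₁ br p∋y p∋c₂ (inj₁ p∋x) p∋y p∋c₂ (mem (here refl)) (proj₂ (both e₁ (grp (here refl))))))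
        (subst (λ l → Block y (f ∷ l)) (sym (List.++-assoc (inside c₁ (sideOf c₁)) (s ∷ rest) (q ∷ [])))
          (fill (mem (here refl)) (below (shallow e₁ e₂ br₁ q∋y q∋c₁ (inj₁ q∋x) (mem (here refl)) (proj₁ (both e₁ (grp (here refl))))
                                                  (mem (there (here refl))) (proj₁ (both e₁ (grp (there (here refl)))))))
                (block-++ (block-all (mem ∘ there)) (q∋y ∷ []))))
      where
      grp : ∀ {v} → v ∈ f ∷ s ∷ rest → v ∈ group c₁
      grp = subst (_ ∈_) (sym e)
      mem : ∀ {v} → v ∈ f ∷ s ∷ rest → v ∋ y
      mem v∈ = proj₁ (group∋ e₁ (grp v∈))

  inside-block : ∀ {x y side p q} → Below y → Gap x y side p q → Block y (p ∷ inside y side ++ q ∷ [])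
  inside-block {x} {y} {side} {p} {q} below gap with transit? y
  ... | no ¬transit = Gap.p∋y gap ∷ block-++ (split-block ¬transit side below) (Gap.q∋y gap ∷ [])
  ... | yes (v , a , b , (a~y , b~y , a≢b) , (v∋y , v∋a , v∋b)) = go (kids y) refl
    where
    open Gap gap
    x~y : x ~ᵀ y
    x~y = ~ᵀ-sym (parent-edge up)
    pair : ∀ {a b d} → Branching y a b d → ∀ {p q} → p ~ᵀ y → q ~ᵀ y → p ≢ q → ∃ λ u → u ∋ y × u ∋ p × u ∋ q
    pair br p~y q~y p≢q with Branching.nbrs br p~y | Branching.nbrs br q~y
    ... | inj₁ refl | inj₁ refl = contradiction refl p≢q
    ... | inj₁ refl | inj₂ (inj₁ refl) = Branching.ab br
    ... | inj₁ refl | inj₂ (inj₂ refl) = Branching.ac br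
    ... | inj₂ (inj₁ refl) | inj₁ refl = let (u , p , q , s) = Branching.ab br in u , p , s , q
    ... | inj₂ (inj₁ refl) | inj₂ (inj₁ refl) = contradiction refl p≢q
    ... | inj₂ (inj₁ refl) | inj₂ (inj₂ refl) = Branching.bc br
    ... | inj₂ (inj₂ refl) | inj₁ refl = let (u , p , q , s) = Branching.ac br in u , p , s , q
    ... | inj₂ (inj₂ refl) | inj₂ (inj₁ refl) = let (u , p , q , s) = Branching.bc br in u , p , s , q
    ... | inj₂ (inj₂ refl) | inj₂ (inj₂ refl) = contradiction refl p≢q
    -- Of any three neighbours at least one differs from both `a` and `b`, so the passing path `v`
    -- extends to a branching.
    third : ∀ {d e f} → d ~ᵀ y → e ~ᵀ y → f ~ᵀ y → d ≢ e → d ≢ f → e ≢ f → ∃ λ d → Branching y a b d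
    third {d} {e} {f} d~y e~y f~y d≢e d≢f e≢f with a Fin.≟ d | b Fin.≟ d | a Fin.≟ e | b Fin.≟ e
    ... | no p | no q | _ | _ = d , branching a~y b~y d~y a≢b p q v∋y v∋a v∋b
    ... | _ | _ | no p | no q = e , branching a~y b~y e~y a≢b p q v∋y v∋a v∋b
    ... | yes refl | _ | yes refl | _ = contradiction refl d≢e
    ... | _ | yes refl | _ | yes refl = contradiction refl d≢e
    ... | yes refl | _ | _ | yes refl = f , branching a~y b~y f~y a≢b d≢f e≢f v∋y v∋a v∋b
    ... | _ | yes refl | yes refl | _ = f , branching a~y b~y f~y a≢b e≢f d≢f v∋y v∋a v∋b
    branching-at : ∀ {c d} → c ~ᵀ y → d ~ᵀ y → x ≢ c → x ≢ d → c ≢ d → Branching y x c d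
    branching-at c~y d~y x≢c x≢d c≢d with third x~y c~y d~y x≢c x≢d c≢d
    ... | _ , br with pair br x~y c~y x≢c
    ...   | u , u∋y , u∋x , u∋c = branching x~y c~y d~y x≢c x≢d c≢d u∋y u∋x u∋c
    go : ∀ ks → kids y ≡ ks → Block y (p ∷ inside y side ++ q ∷ [])
    go [] ek with nbr-cases up a~y | nbr-cases up b~y
    ... | inj₁ refl | inj₁ refl = contradiction refl a≢b
    ... | inj₂ a∈ | _ = contradiction (subst (a ∈_) ek a∈) λ ()
    ... | _ | inj₂ b∈ = contradiction (subst (b ∈_) ek b∈) λ ()
    go (z ∷ []) ek with nbr-cases up a~y | nbr-cases up b~y
    ... | inj₁ refl | inj₁ refl = contradiction refl a≢b
    ... | inj₁ refl | inj₂ b∈ with subst (b ∈_) ek b∈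
    ...   | here refl = chain-block below gap ek v∋a v∋y v∋b
    go (z ∷ []) ek | inj₂ a∈ | inj₁ refl with subst (a ∈_) ek a∈
    ...   | here refl = chain-block below gap ek v∋b v∋y v∋a
    go (z ∷ []) ek | inj₂ a∈ | inj₂ b∈ with subst (a ∈_) ek a∈ | subst (b ∈_) ek b∈
    ...   | here refl | here refl = contradiction refl a≢b
    go (c ∷ d ∷ ks) ek with branching-at (kid~ ec) (kid~ ed) (x≢ ec) (x≢ ed) c≢d
      where
      in-kids : ∀ {e} → e ∈ c ∷ d ∷ ks → parent e ≡ just y
      in-kids e∈ = ∈-kids⁻ (subst (_ ∈_) (sym ek) e∈)
      ec = in-kids (here refl)
      ed = in-kids (there (here refl))
      x≢ : ∀ {e} → parent e ≡ just y → x ≢ e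
      x≢ ee refl = <-irrefl refl (<-trans (parent-< up) (parent-< ee))
      c≢d : c ≢ d
      c≢d refl = All.All¬⇒¬Any (AllPairs.head (subst Unique ek (unique-kids y))) (here refl)
    go (c ∷ d ∷ []) ek | br = turn-block below gap ek br
    -- A third child would be a fourth neighbour of a branching.
    go (c ∷ d ∷ e ∷ ks) ek | br with ∈-kids⁻ {e} {y} (subst (e ∈_) (sym ek) (there (there (here refl)))) | subst Unique ek (unique-kids y)
    ... | ee | (_ ∷ c≢e ∷ _) ∷ (d≢e ∷ _) ∷ _ with Branching.nbrs br (kid~ ee)
    ...   | inj₁ refl = contradiction (<-trans (parent-< up) (parent-< ee)) (<-irrefl refl)
    ...   | inj₂ (inj₁ refl) = contradiction refl c≢e
    ...   | inj₂ (inj₂ refl) = contradiction refl d≢e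

  inside-linked : ∀ k {x y side p q} → t ≤ depth y + k → Gap x y side p q →
                  Linked Share (p ∷ inside y side ++ q ∷ [])
  inside-linked zero {y = y} le gap =
    contradiction (≤-trans le (≤-reflexive (+-identityʳ (depth y)))) (<⇒≱ (depth< y))
  inside-linked (suc k) {y = y} le gap =
    block-linked (inside-block (λ {c} g → inside-linked k (≤-trans le (≤-reflexive
      (trans (+-suc (depth y) k) (cong (_+ k) (sym (depth-suc (Gap.up g))))))) g) gap)

  below : ∀ y → Below y
  below y {c} g = inside-linked t (m≤n+m t (depth c)) g

-- Permutations of concatenations, and the vertex set of the tour.

concat-↭ : ∀ {xss yss : List (List A)} → xss ↭ yss → concat xss ↭ concat yss
concat-↭ ↭.refl = ↭-refl
concat-↭ (↭.prep xs p) = ↭.++⁺ˡ xs (concat-↭ p)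
concat-↭ (↭.swap xs ys p) = ↭-trans (↭.↭-reflexive (sym (List.++-assoc xs ys _)))
  (↭-trans (↭.++⁺ (↭.++-comm xs ys) (concat-↭ p)) (↭.↭-reflexive (List.++-assoc ys xs _)))
concat-↭ (↭.trans p q) = ↭-trans (concat-↭ p) (concat-↭ q)

concat-map-↭ : ∀ {f g : A → List B} xs → (∀ {x} → x ∈ xs → f x ↭ g x) →
               concat (map f xs) ↭ concat (map g xs)
concat-map-↭ []       p = ↭-refl
concat-map-↭ (x ∷ xs) p = ↭.++⁺ (p (here refl)) (concat-map-↭ xs (p ∘ there))

concatMap-concatMap : ∀ (f : B → List C) (g : A → List B) xs →
                      concatMap f (concatMap g xs) ≡ concatMap (concatMap f ∘ g) xs
concatMap-concatMap f g []       = refl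
concatMap-concatMap f g (x ∷ xs) =
  trans (List.concatMap-++ f (g x) (concatMap g xs)) (cong (concatMap f (g x) ++_) (concatMap-concatMap f g xs))

unique-map : ∀ {f : A → B} {xs} → Unique xs → (∀ {x y} → x ∈ xs → y ∈ xs → f x ≡ f y → x ≡ y) →
             Unique (map f xs)
unique-map []      inj = []
unique-map {xs = x ∷ xs} (x∉ ∷ u) inj =
  All.map⁺ (All.tabulate λ y∈ e → All.lookup x∉ y∈ (inj (here refl) (there y∈) e)) ∷
  unique-map u (λ p q → inj (there p) (there q))

unique-concatMap : ∀ {f : A → List B} {xs} → Unique xs → (∀ x → x ∈ xs → Unique (f x)) →
                   (∀ {x y z} → x ∈ xs → y ∈ xs → z ∈ f x → z ∈ f y → x ≡ y) → Unique (concatMap f xs)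
unique-concatMap [] _ _ = []
unique-concatMap {f = f} {x ∷ xs} (x∉ ∷ u) each disjoint =
  Unique.++⁺ (each x (here refl)) (unique-concatMap u (λ y y∈ → each y (there y∈)) (λ p q → disjoint (there p) (there q)))
    (λ {z} (z∈x , z∈) → let (y , y∈ , z∈y) = find (∈-concatMap⁻ f {xs = xs} z∈) in
      All.lookup x∉ y∈ (disjoint (here refl) (there y∈) z∈x z∈y))

linked-≢-closed : ∀ {x : A} {xs} → Unique (x ∷ xs) → xs ≢ [] → Linked _≢_ (x ∷ xs ∷ʳ x)
linked-≢-closed {xs = []}     _ ne = contradiction refl ne
linked-≢-closed {x = x} {y ∷ ys} (x∉ ∷ u) _ = All.head x∉ ∷ go y ys (All.All¬⇒¬Any x∉) u
  where
  go : ∀ y ys → x ∉ y ∷ ys → Unique (y ∷ ys) → Linked _≢_ (y ∷ ys ∷ʳ x)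
  go y []       x∉ _ = (λ { refl → x∉ (here refl) }) ∷ [-]
  go y (z ∷ ys) x∉ (p ∷ u) = All.head p ∷ go z ys (x∉ ∘ there) u

module LayoutNodes {n t} {T : Graph t} {r} (R : Rooting T r) (L : PlaneLayout T)
                   (path : Fin n → List (Fin t)) where
  open Rooting R
  open Rooted R
  open PlaneLayout L
  open Tour path r parent depth (kidsTable parent order)
  open LayoutFacts R L path

  nodesIn : ℕ → Fin t → List (Fin t)
  nodesIn zero    x = []
  nodesIn (suc k) x = x ∷ concatMap (nodesIn k) (kids x)

  nodes below : Fin t → List (Fin t)
  nodes x = nodesIn (t ∸ depth x) x
  below x = concatMap nodes (kids x)

  nodes-≡ : ∀ x → nodes x ≡ x ∷ below x
  nodes-≡ x rewrite ∸-step (depth< x) =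
    cong (λ l → x ∷ concat l) (List.map-cong-local (All.tabulate λ {c} c∈ →
      cong (λ d → nodesIn (t ∸ d) c) (sym (depth-suc (∈-kids⁻ c∈)))))

  -- Induction from the leaves to the root; depths stay below `t`, so fuel `t` never runs out.
  from-below : (P : Pred (Fin t) 0ℓ) → (∀ x → (∀ {c} → parent c ≡ just x → P c) → P x) → ∀ x → P x
  from-below P step x = go t (m≤n+m t (depth x))
    where
    go : ∀ k {x} → t ≤ depth x + k → P x
    go zero {x} le = contradiction (≤-trans le (≤-reflexive (+-identityʳ (depth x)))) (<⇒≱ (depth< x))
    go (suc k) {x} le = step x (λ {c} e → go k (≤-trans le (≤-reflexive
      (trans (+-suc (depth x) k) (cong (_+ k) (sym (depth-suc e)))))))

  ∈-below⁻ : ∀ {x z} → z ∈ below x → ∃ λ c → parent c ≡ just x × z ∈ nodes c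
  ∈-below⁻ {x} z∈ = let (c , c∈ , z∈c) = find (∈-concatMap⁻ nodes {xs = kids x} z∈) in c , ∈-kids⁻ c∈ , z∈c

  ∈-below⁺ : ∀ {x c z} → parent c ≡ just x → z ∈ nodes c → z ∈ below x
  ∈-below⁺ {x} e z∈ = ∈-concat⁺′ z∈ (∈-map⁺ nodes (∈-kids⁺ e))

  ∈-nodes⁻ : ∀ x {z} → z ∈ nodes x → z ≼ x
  ∈-nodes⁻ = from-below (λ x → ∀ {z} → z ∈ nodes x → z ≼ x) λ x rec z∈ → go x rec (subst (_ ∈_) (nodes-≡ x) z∈)
    where
    go : ∀ x → (∀ {c} → parent c ≡ just x → ∀ {z} → z ∈ nodes c → z ≼ c) → ∀ {z} → z ∈ x ∷ below x → z ≼ x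
    go x rec (here refl) = ε
    go x rec (there z∈) = let (c , e , z∈c) = ∈-below⁻ z∈ in rec e z∈c ◅◅ (e ◅ ε)

  ∈-nodes⁺ : ∀ x {z} → z ≼ x → z ∈ nodes x
  ∈-nodes⁺ = from-below (λ x → ∀ {z} → z ≼ x → z ∈ nodes x) λ x rec {z} z≼x → subst (z ∈_) (sym (nodes-≡ x)) (go x rec z≼x)
    where
    go : ∀ x → (∀ {c} → parent c ≡ just x → ∀ {z} → z ≼ c → z ∈ nodes c) → ∀ {z} → z ≼ x → z ∈ x ∷ below x
    go x rec {z} z≼x with z Fin.≟ x
    ... | yes e = here e
    ... | no z≢x = let (c , e , z≼c) = kid-towards z≼x z≢x in there (∈-below⁺ e (rec e z≼c))

  unique-nodes : ∀ x → Unique (nodes x)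
  unique-nodes = from-below (Unique ∘ nodes) λ x rec → subst Unique (sym (nodes-≡ x))
    (All.¬Any⇒All¬ _ (λ x∈ → let (c , e , x∈c) = ∈-below⁻ x∈ in kid⋡ e (∈-nodes⁻ c x∈c)) ∷
     unique-concatMap (unique-kids x) (λ c c∈ → rec (∈-kids⁻ c∈))
       (λ c∈ d∈ z∈c z∈d → kids-disjoint (∈-kids⁻ c∈) (∈-kids⁻ d∈) (∈-nodes⁻ _ z∈c) (∈-nodes⁻ _ z∈d)))

  length-nodes : ∀ x → length (nodes x) ≤ t
  length-nodes x = unique-Fin-length (unique-nodes x)

  bucket : Fin t → List (Fin n)
  bucket c = group c ++ singles c

  segmentWith-↭ : ∀ {f : Side → List (Fin n)} {m} s g side → (∀ s → f s ↭ m) → segmentWith f s g side ↭ g ++ m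
  segmentWith-↭ s [] side p = p left
  segmentWith-↭ s (v ∷ []) left  p = ↭-trans (↭.++⁺ʳ (v ∷ []) (p right)) (↭.++-comm _ (v ∷ []))
  segmentWith-↭ s (v ∷ []) right p = ↭.prep v (p left)
  segmentWith-↭ {f} {m} s (u ∷ w ∷ vs) side p = ↭.prep u (↭-trans (↭.++-comm (f s) (w ∷ vs)) (↭.++⁺ˡ (w ∷ vs) (p s)))

  -- Sides and placement only permute. Hence the tour misses no vertex and repeats none for reasons
  -- that do not involve sharing of nodes.
  segment-↭ : ∀ c side → segment side c ↭ concatMap bucket (nodes c)
  segment-↭ = from-below (λ c → ∀ side → segment side c ↭ concatMap bucket (nodes c)) λ c rec side →
    ↭-trans (segmentWith-↭ (sideOf c) (group c) side (inside-↭ c rec))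
      (↭-trans (↭.++⁺ˡ (group c) (↭.++-comm _ (singles c)))
        (↭.↭-reflexive (trans (sym (List.++-assoc (group c) (singles c) _)) (cong (concatMap bucket) (sym (nodes-≡ c))))))
    where
    inside-↭ : ∀ c → (∀ {d} → parent d ≡ just c → ∀ side → segment side d ↭ concatMap bucket (nodes d)) →
               ∀ side → inside c side ↭ concatMap bucket (below c) ++ singles c
    inside-↭ c rec side = ↭-trans (↭.↭-reflexive (inside-≡ c side)) (↭.++⁺ʳ (singles c)
      (↭-trans (concat-↭ (↭.↭-reverse (map (segment side) (kids c)))) (↭-trans (concat-map-↭ (kids c) (λ d∈ → rec (∈-kids⁻ d∈) side))
        (↭.↭-reflexive (sym (concatMap-concatMap bucket nodes (kids c)))))))

module TourHamiltonian {n} {G : Graph n} (M : PathTreeModel G)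
                 {r} (R : Rooting (PathTreeModel.tree M) r) (L : PlaneLayout (PathTreeModel.tree M)) where
  open Graph G
  open Models M
  open Rooting R
  open Rooted R
  open HomeFacts M R L
  open LayoutNodes R L path

  unique-bucket : ∀ c → Unique (bucket c)
  unique-bucket c = Unique.++⁺ (unique-group c) (unique-singles c)
    (λ (p , q) → case trans (sym (∈-group⁻ p)) (∈-singles⁻ q) of λ ())

  bucket-home : ∀ {c v} → v ∈ bucket c → home v ≡ inj₁ c ⊎ home v ≡ inj₂ c
  bucket-home {c} v∈ with ∈-++⁻ (group c) v∈
  ... | inj₁ p = inj₂ (∈-group⁻ p)
  ... | inj₂ q = inj₁ (∈-singles⁻ q)

  bucket-disjoint : ∀ {c d v} → v ∈ bucket c → v ∈ bucket d → c ≡ d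
  bucket-disjoint p q with bucket-home p | bucket-home q
  ... | inj₁ e | inj₁ e′ = Sum.inj₁-injective (trans (sym e) e′)
  ... | inj₂ e | inj₂ e′ = Sum.inj₂-injective (trans (sym e) e′)
  ... | inj₁ e | inj₂ e′ = case trans (sym e) e′ of λ ()
  ... | inj₂ e | inj₁ e′ = case trans (sym e) e′ of λ ()

  group-root : group r ≡ []
  group-root with group r in eq
  ... | [] = refl
  ... | v ∷ _ with home-group⁻ {v} (∈-group⁻ (subst (v ∈_) (sym eq) (here refl)))
  ...   | y , e , _ = case trans (sym parent-root) e of λ ()

  tour-↭ : tour ↭ concatMap bucket (nodes r)
  tour-↭ = ↭-trans (↭.↭-reflexive (sym (cong (λ g → segmentWith (inside r) (sideOf r) g left) group-root)))
             (segment-↭ r left)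

  unique-tour : Unique tour
  unique-tour = unique-resp-↭ (↭-sym tour-↭) (unique-concatMap (unique-nodes r) (λ c _ → unique-bucket c)
                  (λ _ _ → bucket-disjoint))

  ∈-tour : ∀ v → v ∈ tour
  ∈-tour v = ↭.∈-resp-↭ (↭-sym tour-↭) (go (home v) refl)
    where
    go : ∀ h → home v ≡ h → v ∈ concatMap bucket (nodes r)
    go (inj₁ x) e = ∈-concat⁺′ (∈-++⁺ʳ (group x) (∈-singles⁺ e)) (∈-map⁺ bucket (∈-nodes⁺ r (≼-root x)))
    go (inj₂ c) e = ∈-concat⁺′ (∈-++⁺ˡ (∈-group⁺ e)) (∈-map⁺ bucket (∈-nodes⁺ r (≼-root c)))

  length-tour : length tour ≡ n
  length-tour = trans (unique-same-length unique-tour (Unique.tabulate⁺ id) (λ {x} _ → ∈-allFin x) (λ {x} _ → ∈-tour x))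
                      (List.length-tabulate {n = n} id)

  module _ (nc : IsNonCrossing M) (cm : IsCliqueModel M) (tc : TwoConnected G) (3≤n : 3 ≤ n)
           (leaf : ∀ {a b} → a ~ᵀ r → b ~ᵀ r → a ≡ b) where
    open TourCycle M nc cm tc R L hiding (below)
    private module C = TourCycle M nc cm tc R L

    tour-block : Block r tour
    -- The root is a leaf, so no path has two of its neighbours.
    tour-block = split-block (λ { (_ , _ , _ , (a~r , b~r , a≢b) , _) → a≢b (leaf a~r b~r) }) left (C.below r)

    tour-hamiltonian : IsHamiltonianCycle G tour
    tour-hamiltonian = closed tour (subst (3 ≤_) (sym length-tour) 3≤n) unique-tour tour-block , ∈-tour
      where
      closed : ∀ l → 3 ≤ length l → Unique l → Block r l → IsCycle G l
      -- The block is continued with its own first vertex, which lies in the bag of `r` as well;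
      -- this closes the cycle. Sharing becomes adjacency because neighbours on the closed list
      -- differ.
      closed (x ∷ xs) 3≤ u b = 3≤ , u ,
        Linked.zipWith (λ { (ne , (_ , p , q)) → share⇒~ ne p q })
          (linked-≢-closed u (λ { refl → case 3≤ of λ { (s≤s ()) } }) , block-linked (block-++ b (block-head b ∷ [])))

-- The size of a clique model is linear in the size of the graph.

module Counting {n} {G : Graph n} (M : PathTreeModel G) (nc : IsNonCrossing M)
                (cm : IsCliqueModel M) (tc : TwoConnected G)
                {r} (R : Rooting (PathTreeModel.tree M) r) where
  open Graph G
  open Models M
  open Rooting R
  open Rooted R
  open CliqueModels M nc cm tc R

  -- The bag of `x` is not contained in that of its parent, and a path at `x` that misses the parent
  -- has `x` as its top. Choosing one such vertex per node is injective, since a path has only one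
  -- top.
  topmost : ∀ x → ∃ λ u → u ∋ x × (∀ {z} → u ∋ z → z ≼ x)
  topmost x = go (parent x) refl
    where
    go : ∀ m → parent x ≡ m → ∃ λ u → u ∋ x × (∀ {z} → u ∋ z → z ≼ x)
    go nothing e with nodes-covered x
    ... | u , u∋x = u , u∋x , top-all (path-linked u) u∋x (λ e′ → case trans (sym e) e′ of λ ())
    go (just p) e with bag-differs {x} {p} (parent-≢ e)
    ... | u , u∋x , u∌p = u , u∋x , top-all (path-linked u) u∋x (λ e′ u∋p → u∌p (subst (u ∋_) (same-parent e′ e) u∋p))

  newest : Fin t → Fin n
  newest x = proj₁ (topmost x)

  newest∋ : ∀ x → newest x ∋ x
  newest∋ x = proj₁ (proj₂ (topmost x))

  newest-≼ : ∀ x {z} → newest x ∋ z → z ≼ x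
  newest-≼ x = proj₂ (proj₂ (topmost x))

  newest-injective : ∀ {x y} → newest x ≡ newest y → x ≡ y
  newest-injective {x} {y} e = ≼-antisym (newest-≼ y (subst (_∋ x) e (newest∋ x)))
                                         (newest-≼ x (subst (_∋ y) (sym e) (newest∋ y)))

  nodes≤vertices : t ≤ n
  nodes≤vertices = subst (_≤ n) (trans (List.length-map newest (allFin t)) (List.length-tabulate {n = t} id))
    (unique-Fin-length (Unique.map⁺ newest-injective (Unique.tabulate⁺ {n = t} id)))

  private
    Code : Set
    Code = Fin n ⊎ (Fin n × Fin n)

    ordered : Fin n → Fin n → Fin n × Fin n
    ordered u v with Fin.<-cmp u v
    ... | tri< _ _ _ = u , v
    ... | _          = v , u

    ordered-edge : ∀ {u v} → u ~ v → ordered u v ∈ edges G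
    ordered-edge {u} {v} u~v with Fin.<-cmp u v
    ... | tri< lt _ _ = ∈-filter⁺ _ (∈-cartesianProduct⁺ (∈-allFin u) (∈-allFin v)) (lt , u~v)
    ... | tri> _ _ gt = ∈-filter⁺ _ (∈-cartesianProduct⁺ (∈-allFin v) (∈-allFin u)) (gt , ~-sym u~v)
    ... | tri≈ _ refl _ = ⊥-elim (~-irrefl u~v)

    ordered-≡ : ∀ {u v u′ v′} → ordered u v ≡ ordered u′ v′ → (u ≡ u′ × v ≡ v′) ⊎ (u ≡ v′ × v ≡ u′)
    ordered-≡ {u} {v} {u′} {v′} e with Fin.<-cmp u v | Fin.<-cmp u′ v′
    ordered-≡ refl | tri< _ _ _ | tri< _ _ _ = inj₁ (refl , refl)
    ordered-≡ refl | tri< _ _ _ | tri≈ _ _ _ = inj₂ (refl , refl)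
    ordered-≡ refl | tri< _ _ _ | tri> _ _ _ = inj₂ (refl , refl)
    ordered-≡ refl | tri≈ _ _ _ | tri< _ _ _ = inj₂ (refl , refl)
    ordered-≡ refl | tri≈ _ _ _ | tri≈ _ _ _ = inj₁ (refl , refl)
    ordered-≡ refl | tri≈ _ _ _ | tri> _ _ _ = inj₁ (refl , refl)
    ordered-≡ refl | tri> _ _ _ | tri< _ _ _ = inj₂ (refl , refl)
    ordered-≡ refl | tri> _ _ _ | tri≈ _ _ _ = inj₁ (refl , refl)
    ordered-≡ refl | tri> _ _ _ | tri> _ _ _ = inj₁ (refl , refl)

    code : Fin n × Fin t → Code
    code (v , x) with v Fin.≟ newest x
    ... | yes _ = inj₁ v
    ... | no  _ = inj₂ (ordered v (newest x))

    -- If two incidences gave the same edge with the roles exchanged, `v` would be newest at `y` and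
    -- `w` at `x`, so each of `x` and `y` would lie below the other. Then they coincide and `v` is
    -- newest at `x`, which the first form of the code covers.
    code-injective : ∀ {v x w y} → v ∋ x → w ∋ y → code (v , x) ≡ code (w , y) → (v , x) ≡ (w , y)
    code-injective {v} {x} {w} {y} v∋x w∋y e with v Fin.≟ newest x | w Fin.≟ newest y
    code-injective v∋x w∋y refl | yes p | yes q with newest-injective (trans (sym p) q)
    ... | refl = refl
    code-injective v∋x w∋y () | yes p | no q
    code-injective v∋x w∋y () | no p | yes q
    code-injective {v} {x} {w} {y} v∋x w∋y e | no p | no q with ordered-≡ (Sum.inj₂-injective e)
    ... | inj₁ (refl , e′) with newest-injective e′
    ...   | refl = refl
    code-injective {v} {x} {w} {y} v∋x w∋y e | no p | no q | inj₂ (refl , refl)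
      with ≼-antisym (newest-≼ y v∋x) (newest-≼ x w∋y)
    ... | refl = contradiction refl p

    incidences : List (Fin n × Fin t)
    incidences = concatMap (λ v → map (v ,_) (path v)) (allFin n)

    ∈-incidences : ∀ {v x} → (v , x) ∈ incidences → v ∋ x
    ∈-incidences {v} {x} i∈ with find (∈-concatMap⁻ (λ v → map (v ,_) (path v)) {xs = allFin n} i∈)
    ... | w , _ , i∈w with ∈-map⁻ (w ,_) i∈w
    ...   | y , y∈ , refl = y∈

    unique-incidences : Unique incidences
    unique-incidences = unique-concatMap (Unique.tabulate⁺ id)
      (λ v _ → Unique.map⁺ (cong proj₂) (path-uniq v))
      (λ {v} {w} _ _ p q → trans (sym (first v p)) (first w q))
      where
      first : ∀ v {i} → i ∈ map (v ,_) (path v) → proj₁ i ≡ v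
      first v i∈ with ∈-map⁻ (v ,_) i∈
      ... | _ , _ , refl = refl

    codes : List Code
    codes = map inj₁ (allFin n) ++ map inj₂ (edges G)

    code-∈ : ∀ {v x} → v ∋ x → code (v , x) ∈ codes
    code-∈ {v} {x} v∋x with v Fin.≟ newest x
    ... | yes _ = ∈-++⁺ˡ (∈-map⁺ inj₁ (∈-allFin v))
    ... | no ne = ∈-++⁺ʳ (map inj₁ (allFin n)) (∈-map⁺ inj₂ (ordered-edge (share⇒~ ne v∋x (newest∋ x))))

  incidences≤size : sum (map (length ∘ path) (allFin n)) ≤ size G
  incidences≤size = begin
    sum (map (length ∘ path) (allFin n)) ≡⟨ cong sum (List.map-cong (λ v → sym (List.length-map (v ,_) (path v))) (allFin n)) ⟩
    sum (map (λ v → length (map (v ,_) (path v))) (allFin n)) ≡⟨ cong sum (List.map-∘ (allFin n)) ⟩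
    sum (map length (map (λ v → map (v ,_) (path v)) (allFin n))) ≡⟨ sym (length-concat′ (map (λ v → map (v ,_) (path v)) (allFin n))) ⟩
    length incidences                    ≡⟨ sym (List.length-map code incidences) ⟩
    length (map code incidences)         ≤⟨ unique-⊆-length
      (unique-map unique-incidences (λ p q → code-injective (∈-incidences p) (∈-incidences q)))
      (λ c∈ → let (i , i∈ , e) = ∈-map⁻ code c∈ in subst (_∈ codes) (sym e) (code-∈ (∈-incidences i∈))) ⟩
    length codes                         ≡⟨ trans (List.length-++ (map inj₁ (allFin n)))
      (cong₂ _+_ (trans (List.length-map inj₁ (allFin n)) (List.length-tabulate {n = n} id)) (List.length-map inj₂ (edges G))) ⟩
    size G                               ∎
    where
    open ≤-Reasoning
    length-concat′ : ∀ {A : Set} (xss : List (List A)) → length (concat xss) ≡ sum (map length xss)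
    length-concat′ []         = refl
    length-concat′ (xs ∷ xss) = trans (List.length-++ xs) (cong (length xs +_) (length-concat′ xss))

-- Recovering the layout from its tour

mapMaybe-concat : ∀ (f : A → Maybe B) xss → mapMaybe f (concat xss) ≡ concat (map (mapMaybe f) xss)
mapMaybe-concat f []         = refl
mapMaybe-concat f (xs ∷ xss) = trans (List.mapMaybe-++ f xs (concat xss)) (cong (mapMaybe f xs ++_) (mapMaybe-concat f xss))

mapMaybe-∷ʳ : ∀ (f : A → Maybe B) xs x → mapMaybe f (xs ∷ʳ x) ≡ mapMaybe f xs ++ mapMaybe f (x ∷ [])
mapMaybe-∷ʳ f xs x = List.mapMaybe-++ f xs (x ∷ [])

reverse-mapMaybe : ∀ (f : A → Maybe B) xs → mapMaybe f (reverse xs) ≡ reverse (mapMaybe f xs)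
reverse-mapMaybe f []       = refl
reverse-mapMaybe f (x ∷ xs) rewrite List.unfold-reverse x xs | mapMaybe-∷ʳ f (reverse xs) x | reverse-mapMaybe f xs with f x
... | just y  = sym (List.unfold-reverse y (mapMaybe f xs))
... | nothing = List.++-identityʳ _

mapMaybe-none : ∀ {f : A → Maybe B} {xs} → (∀ {x} → x ∈ xs → f x ≡ nothing) → mapMaybe f xs ≡ []
mapMaybe-none {xs = []} p = refl
mapMaybe-none {f = f} {x ∷ xs} p rewrite p (here refl) = mapMaybe-none (p ∘ there)

∈-mapMaybe⁺ : ∀ {f : A → Maybe B} {xs x y} → x ∈ xs → f x ≡ just y → y ∈ mapMaybe f xs
∈-mapMaybe⁺ {f = f} (here refl) e rewrite e = here refl
∈-mapMaybe⁺ {f = f} {z ∷ xs} (there x∈) e with f z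
... | just _  = there (∈-mapMaybe⁺ x∈ e)
... | nothing = ∈-mapMaybe⁺ x∈ e

∈-mapMaybe⁻ : ∀ {f : A → Maybe B} xs {y} → y ∈ mapMaybe f xs → ∃ λ x → x ∈ xs × f x ≡ just y
∈-mapMaybe⁻ {f = f} (z ∷ xs) y∈ with f z in e
∈-mapMaybe⁻ (z ∷ xs) (here refl) | just _ = z , here refl , e
∈-mapMaybe⁻ (z ∷ xs) (there y∈)  | just _ = let (x , x∈ , e′) = ∈-mapMaybe⁻ xs y∈ in x , there x∈ , e′
∈-mapMaybe⁻ (z ∷ xs) y∈ | nothing = let (x , x∈ , e′) = ∈-mapMaybe⁻ xs y∈ in x , there x∈ , e′

unique-same-↭ : ∀ {xs ys : List A} → Unique xs → Unique ys → (∀ {x} → x ∈ xs → x ∈ ys) →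
                (∀ {x} → x ∈ ys → x ∈ xs) → xs ↭ ys
unique-same-↭ {xs = []} {[]}     _ _ _ _ = ↭-refl
unique-same-↭ {xs = []} {y ∷ ys} _ _ _ g = contradiction (g (here refl)) λ ()
unique-same-↭ {xs = x ∷ xs} (x∉ ∷ u) v f g with ∈-∃++ (f (here refl))
... | as , bs , refl = ↭-trans (↭.prep x (unique-same-↭ u (AllPairs.tail v′) f′ g′)) (↭-sym (↭.shift x as bs))
  where
  v′ : Unique (x ∷ as ++ bs)
  v′ = unique-resp-↭ (↭.shift x as bs) v
  f′ : ∀ {z} → z ∈ xs → z ∈ as ++ bs
  f′ z∈ with ↭.∈-resp-↭ (↭.shift x as bs) (f (there z∈))
  ... | here refl = contradiction z∈ (All.All¬⇒¬Any x∉)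
  ... | there q   = q
  g′ : ∀ {z} → z ∈ as ++ bs → z ∈ xs
  g′ z∈ with g (↭.∈-resp-↭ (↭-sym (↭.shift x as bs)) (there z∈))
  ... | here refl = contradiction z∈ (All.All¬⇒¬Any (AllPairs.head v′))
  ... | there q   = q

++-split : ∀ (as : List A) {bs cs ds} → as ++ bs ≡ cs ++ ds →
           (∃ λ ms → cs ≡ as ++ ms × bs ≡ ms ++ ds) ⊎ (∃ λ ms → as ≡ cs ++ ms × ds ≡ ms ++ bs)
++-split []       {cs = cs} e = inj₁ (cs , refl , e)
++-split (a ∷ as) {cs = []} e = inj₂ (a ∷ as , refl , sym e)
++-split (a ∷ as) {cs = c ∷ cs} e with List.∷-injective e
... | refl , e′ with ++-split as e′
...   | inj₁ (ms , p , q) = inj₁ (ms , cong (a ∷_) p , q)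
...   | inj₂ (ms , p , q) = inj₂ (ms , cong (a ∷_) p , q)

++-injective-length : ∀ (as : List A) {bs cs ds} → length as ≡ length bs → as ++ cs ≡ bs ++ ds → as ≡ bs × cs ≡ ds
++-injective-length []       {[]}     _ e = refl , e
++-injective-length (a ∷ as) {b ∷ bs} l e with List.∷-injective e
... | refl , e′ with ++-injective-length as {bs} (suc-injective l) e′
...   | refl , q = refl , q

shared-head : ∀ (as bs : List A) {cs ds a b} → a ∈ as → b ∈ bs → as ++ cs ≡ bs ++ ds → ∃ λ z → z ∈ as × z ∈ bs
shared-head (a ∷ as) (b ∷ bs) _ _ e with List.∷-injectiveˡ e
... | refl = a , here refl , here refl

reverse-concat : ∀ (xss : List (List A)) → reverse (concat xss) ≡ concat (reverse (map reverse xss))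
reverse-concat []         = refl
reverse-concat (xs ∷ xss) rewrite List.reverse-++ xs (concat xss) | List.unfold-reverse (reverse xs) (map reverse xss) =
  trans (cong (_++ reverse xs) (reverse-concat xss))
        (trans (cong (concat (reverse (map reverse xss)) ++_) (sym (List.++-identityʳ (reverse xs))))
               (List.concat-++ (reverse (map reverse xss)) (reverse xs ∷ [])))

reverse-constant : ∀ {x : A} xs → (∀ {y} → y ∈ xs → y ≡ x) → reverse xs ≡ xs
reverse-constant {x = x} [] _ = refl
reverse-constant {x = x} (y ∷ ys) all with all (here refl)
... | refl = trans (List.unfold-reverse y ys) (trans (cong (_∷ʳ y) (reverse-constant ys (all ∘ there))) (push ys (all ∘ there)))
  where
  push : ∀ ys → (∀ {z} → z ∈ ys → z ≡ y) → ys ∷ʳ y ≡ y ∷ ys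
  push []       _ = refl
  push (z ∷ zs) all with all (here refl)
  ... | refl = cong (z ∷_) (push zs (all ∘ there))

mirror : ∀ {t} {T : Graph t} → PlaneLayout T → PlaneLayout T
mirror L = record
  { order      = reverse ∘ order
  ; unique     = λ x → unique-resp-↭ (↭-sym (↭.↭-reverse (order x))) (unique x)
  ; neighbours = λ x y → mk⇔ (Equivalence.to (neighbours x y) ∘ Any.reverse⁻)
                              (Any.reverse⁺ ∘ Equivalence.from (neighbours x y))
  }
  where open PlaneLayout L

module KidsAndLayouts {t} {T : Graph t} {r} (R : Rooting T r) where
  open Graph T
  open Rooting R
  open Rooted R

  kidsᴸ : PlaneLayout T → Fin t → List (Fin t)
  kidsᴸ L x = Vec.lookup (kidsTable parent (PlaneLayout.order L)) x

  module _ (L : PlaneLayout T) where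
    open PlaneLayout L
    open LayoutFacts {n = 0} R L (λ ())

    kids-around : ∀ {x p as bs} → parent x ≡ just p → order x ≡ as ++ p ∷ bs → kidsᴸ L x ≡ bs ++ as
    kids-around {x} {p} {as} e eq with unique-split as (subst Unique eq (unique x)) (trans (sym eq) (order-around e))
    ... | p , q = trans (kids-just e) (cong₂ _++_ (sym q) (sym p))

    kids-root : ∀ {x} → parent x ≡ nothing → kidsᴸ L x ≡ order x
    kids-root = order-root

    around : ∀ {x p} → parent x ≡ just p → order x ≡ before p (order x) ++ p ∷ after p (order x)
    around = order-around

  kids-mirror : ∀ L x → kidsᴸ (mirror L) x ≡ reverse (kidsᴸ L x)
  kids-mirror L x = go (parent x) refl
    where
    open PlaneLayout L
    go : ∀ m → parent x ≡ m → kidsᴸ (mirror L) x ≡ reverse (kidsᴸ L x)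
    go nothing e = trans (kids-root (mirror L) e) (cong reverse (sym (kids-root L e)))
    go (just p) e = trans (kids-around (mirror L) e rev)
                     (trans (sym (List.reverse-++ (after p (order x)) (before p (order x))))
                            (cong reverse (sym (kids-around L e (around L e)))))
      where
      rev : reverse (order x) ≡ reverse (after p (order x)) ++ p ∷ reverse (before p (order x))
      rev = trans (cong reverse (around L e)) (trans (List.reverse-++ (before p (order x)) (p ∷ after p (order x)))
              (trans (cong (_++ reverse (before p (order x))) (List.unfold-reverse p (after p (order x))))
                     (List.++-assoc (reverse (after p (order x))) (p ∷ []) _)))

  -- Away from the root, both orders are the parent followed cyclically by the same list of
  -- children; `++-split` finds out which order cuts that list first.
  kids⇒↻ : ∀ K L → (∀ x → kidsᴸ K x ≡ kidsᴸ L x) → K ≈ᴸ L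
  kids⇒↻ K L same x = go (parent x) refl
    where
    module K = PlaneLayout K
    module L = PlaneLayout L
    go : ∀ m → parent x ≡ m → K.order x ↻ L.order x
    go nothing e = [] , K.order x , refl ,
      trans (trans (sym (kids-root L e)) (trans (sym (same x)) (kids-root K e))) (sym (List.++-identityʳ _))
    go (just p) e with ++-split (after p (K.order x))
           (trans (sym (kids-around K e (around K e))) (trans (same x) (kids-around L e (around L e))))
    ... | inj₁ (ms , a′ , b) = ms , before p (L.order x) ++ p ∷ after p (K.order x) ,
            trans (around K e) (trans (cong (_++ p ∷ after p (K.order x)) b) (List.++-assoc ms _ _)) ,
            trans (around L e) (trans (cong (λ z → before p (L.order x) ++ p ∷ z) a′) (sym (List.++-assoc (before p (L.order x)) _ ms)))
    ... | inj₂ (ms , a , b′) = before p (K.order x) ++ p ∷ after p (L.order x) , ms ,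
            trans (around K e) (trans (cong (λ z → before p (K.order x) ++ p ∷ z) a) (sym (List.++-assoc (before p (K.order x)) _ ms))) ,
            trans (around L e) (trans (cong (_++ p ∷ after p (L.order x)) b′) (List.++-assoc ms _ _))

  -- Away from the root the parent fixes the starting point of the cyclic order. At the root nothing
  -- does, and it helps that the order has at most one entry.
  ↻⇒kids : (∀ {a b} → a ~ r → b ~ r → a ≡ b) → ∀ K L → K ≈ᴸ L → ∀ x → kidsᴸ K x ≡ kidsᴸ L x
  ↻⇒kids leaf K L same x = go (parent x) refl
    where
    module K = PlaneLayout K
    module L = PlaneLayout L
    short : ∀ (ps qs : List (Fin t)) → (∀ {a b} → a ∈ ps ++ qs → b ∈ ps ++ qs → a ≡ b) → Unique (ps ++ qs) → ps ++ qs ≡ qs ++ ps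
    short [] qs _ _ = sym (List.++-identityʳ qs)
    short (p ∷ ps) [] _ _ = List.++-identityʳ _
    short (p ∷ ps) (q ∷ qs) all (u ∷ _) = contradiction (all (here refl) (there (∈-insert ps))) (All.lookup u (∈-insert ps))
    go : ∀ m → parent x ≡ m → kidsᴸ K x ≡ kidsᴸ L x
    go nothing e with root-only e | same x
    ... | refl | ps , qs , eK , eL = trans (kids-root K e) (trans eK (trans (short ps qs
            (λ a∈ b∈ → leaf (nbr a∈) (nbr b∈)) (subst Unique eK (K.unique x))) (trans (sym eL) (sym (kids-root L e)))))
      where
      nbr : ∀ {a} → a ∈ ps ++ qs → a ~ r
      nbr a∈ = ~-sym (Equivalence.to (K.neighbours x _) (subst (_ ∈_) (sym eK) a∈))
    go (just p) e with same x
    ... | ps , qs , eK , eL with ∈-++⁻ ps (subst (p ∈_) (trans (sym (around K e)) eK) (∈-insert (before p (K.order x))))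
    ...   | inj₁ p∈ with ∈-∃++ p∈
    ...     | as , bs , refl = trans (kids-around K e (trans eK (List.++-assoc as (p ∷ bs) qs)))
                (trans (List.++-assoc bs qs as) (sym (kids-around L e (trans eL (sym (List.++-assoc qs as (p ∷ bs)))))))
    go (just p) e | ps , qs , eK , eL | inj₂ p∈ with ∈-∃++ p∈
    ...     | as , bs , refl = trans (kids-around K e (trans eK (sym (List.++-assoc ps as (p ∷ bs)))))
                (trans (sym (List.++-assoc bs ps as)) (sym (kids-around L e (trans eL (List.++-assoc as (p ∷ bs) ps)))))

module DistinctTours {n} {G : Graph n} (M : PathTreeModel G) (nc : IsNonCrossing M)
                     (cm : IsCliqueModel M) (tc : TwoConnected G)
                     {r} (R : Rooting (PathTreeModel.tree M) r)
                     (leaf : ∀ {a b} → Graph._~_ (PathTreeModel.tree M) a r → Graph._~_ (PathTreeModel.tree M) b r → a ≡ b) where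
  open Models M
  open Rooting R
  open Rooted R
  open CliqueModels M nc cm tc R
  open Counting M nc cm tc R
  open KidsAndLayouts R
  private module H L = HomeFacts M R L
  private module N L = LayoutNodes R L path

  tourᴸ : PlaneLayout tree → List (Fin n)
  tourᴸ L = Tour.tour path r parent depth (kidsTable parent (PlaneLayout.order L))

  tour-cong : ∀ K L → (∀ x → kidsᴸ K x ≡ kidsᴸ L x) → tourᴸ K ≡ tourᴸ L
  tour-cong K L same = cong (Tour.tour path r parent depth) (Vec.tabulate-cong λ x →
    trans (sym (Vec.lookup∘tabulate _ x)) (trans (same x) (Vec.lookup∘tabulate _ x)))

  HasKid : Fin t → Set
  HasKid x = ∃ λ c → parent c ≡ just x

  hasKid? : ∀ x → Dec (HasKid x)
  hasKid? x = Fin.any? (λ c → Maybe.≡-dec Fin._≟_ (parent c) (just x))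

  -- A vertex that lives at a childless node alone marks that node in the tour. The root does not
  -- count, though it is a leaf of the tree, unless it is the only node.
  leafAt : Fin n → Maybe (Fin t)
  leafAt v = fromPath (path v)
    where
    fromPath : List (Fin t) → Maybe (Fin t)
    fromPath (x ∷ []) with hasKid? x
    ... | yes _ = nothing
    ... | no  _ = just x
    fromPath _ = nothing

  leafAt-just : ∀ {v x} → leafAt v ≡ just x → path v ≡ x ∷ [] × ¬ HasKid x
  leafAt-just {v} e with path v
  leafAt-just {v} () | []
  leafAt-just {v} e | y ∷ [] with hasKid? y
  leafAt-just {v} () | y ∷ [] | yes _
  leafAt-just {v} refl | y ∷ [] | no ¬k = refl , ¬k
  leafAt-just {v} () | _ ∷ _ ∷ _

  only-path : ∀ {v x} → v ∋ x → (∀ {z} → v ∋ z → z ≡ x) → path v ≡ x ∷ []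
  only-path {v} {x} v∋x only with path v | path-uniq v
  ... | y ∷ [] | _ with only (here refl)
  ...   | refl = refl
  only-path {v} {x} v∋x only | y ∷ z ∷ _ | (y≢z ∷ _) ∷ _ =
    contradiction (trans (only (here refl)) (sym (only (there (here refl))))) y≢z

  leafAt-≡ : ∀ {v x} → path v ≡ x ∷ [] → ¬ HasKid x → leafAt v ≡ just x
  leafAt-≡ {v} {x} e ¬k rewrite e with hasKid? x
  ... | yes k = contradiction k ¬k
  ... | no  _ = refl

  leafAt-single : ∀ L {v x} → H.home L v ≡ inj₁ x → HasKid x → leafAt v ≡ nothing
  leafAt-single L {v} {x} h k with leafAt v in e
  ... | nothing = refl
  ... | just y with leafAt-just {v} e
  ...   | p , ¬k with subst (x ∈_) p (proj₁ (H.home-single⁻ L h))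
  ...     | here refl = contradiction k ¬k

  leafAt-group : ∀ L {v c} → H.home L v ≡ inj₂ c → leafAt v ≡ nothing
  leafAt-group L {v} {c} h with leafAt v in e | H.home-group⁻ L {v} h
  ... | nothing | _ = refl
  ... | just y  | x , ec , v∋x , v∋c , _ with leafAt-just {v} e
  ...   | p , _ with subst (x ∈_) p v∋x | subst (c ∈_) p v∋c
  ...     | here refl | here refl = contradiction refl (parent-≢ ec)

  tip : PlaneLayout tree → Fin t → List (Fin t)
  tip L x = mapMaybe leafAt (H.singles L x)

  leaves : PlaneLayout tree → Fin t → List (Fin t)
  leaves L x = mapMaybe leafAt (H.inside L x left)

  -- Members of groups mark no leaf, since their paths have at least two nodes. What remains of the
  -- tour is the sequence of leaves as the layout shows them, whatever the sides.
  leaves-side : ∀ L x side → mapMaybe leafAt (H.inside L x side) ≡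
                concat (reverse (map (leaves L) (kidsᴸ L x))) ++ tip L x
  leaves-side L x side = go x side
    where
    open H L
    segment-leaves : ∀ {c} side → (∀ side → mapMaybe leafAt (inside c side) ≡ leaves L c) →
                     mapMaybe leafAt (segment side c) ≡ leaves L c
    segment-leaves {c} side same = seg (group c) side (λ v∈ → leafAt-group L (∈-group⁻ v∈))
      where
      seg : ∀ g side → (∀ {v} → v ∈ g → leafAt v ≡ nothing) →
            mapMaybe leafAt (segmentWith (inside c) (sideOf c) g side) ≡ leaves L c
      seg [] side none = same left
      seg (v ∷ []) left none = trans (mapMaybe-∷ʳ leafAt (inside c right) v)
        (trans (cong₂ _++_ (same right) (mapMaybe-none none)) (List.++-identityʳ _))
      seg (v ∷ []) right none rewrite none (here refl) = same left
      seg (f ∷ s ∷ vs) side none rewrite none (here refl) =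
        trans (List.mapMaybe-++ leafAt (inside c (sideOf c)) (s ∷ vs))
          (trans (cong₂ _++_ (same (sideOf c)) (mapMaybe-none (none ∘ there))) (List.++-identityʳ _))
    go : ∀ x side → mapMaybe leafAt (inside x side) ≡ concat (reverse (map (leaves L) (kidsᴸ L x))) ++ tip L x
    go = N.from-below L (λ x → ∀ side → mapMaybe leafAt (inside x side) ≡ concat (reverse (map (leaves L) (kidsᴸ L x))) ++ tip L x)
      λ x rec side → trans (cong (mapMaybe leafAt) (inside-≡ x side))
        (trans (List.mapMaybe-++ leafAt (concat (reverse (map (segment side) (kids x)))) (singles x))
          (cong (_++ tip L x) (trans (mapMaybe-concat leafAt (reverse (map (segment side) (kids x))))
            (cong concat (trans (List.reverse-map (mapMaybe leafAt) (map (segment side) (kids x)))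
              (cong reverse (trans (sym (List.map-∘ (kids x)))
                (List.map-cong-local (All.tabulate λ c∈ → segment-leaves side
                  (λ side → trans (rec (∈-kids⁻ c∈) side) (sym (rec (∈-kids⁻ c∈) left))))))))))))

  leaves-≡ : ∀ L x → leaves L x ≡ concat (reverse (map (leaves L) (kidsᴸ L x))) ++ tip L x
  leaves-≡ L x = leaves-side L x left

  tip-kid : ∀ L {x} → HasKid x → tip L x ≡ []
  tip-kid L k = mapMaybe-none (λ v∈ → leafAt-single L (H.∈-singles⁻ L v∈) k)

  ∈-tip⁻ : ∀ L x {z} → z ∈ tip L x → z ≡ x
  ∈-tip⁻ L x z∈ with ∈-mapMaybe⁻ (H.singles L x) z∈
  ... | v , v∈ , e with leafAt-just {v} e | H.home-single⁻ L (H.∈-singles⁻ L v∈)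
  ...   | p , _ | _ , only = only (subst (_ ∈_) (sym p) (here refl))

  leaf-vertex : ∀ {x} → ¬ HasKid x → ∃ λ v → v ∋ x × (∀ {z} → v ∋ z → z ≡ x)
  leaf-vertex {x} ¬k with topmost x
  ... | v , v∋x , all≼ = v , v∋x , only
    where
    only : ∀ {z} → v ∋ z → z ≡ x
    only {z} v∋z with z Fin.≟ x
    ... | yes e = e
    ... | no z≢x = let (c , e , _) = kid-towards (all≼ v∋z) z≢x in contradiction (c , e) ¬k

  tip-≢[] : ∀ L {x} → ¬ HasKid x → ∃ λ z → z ∈ tip L x
  tip-≢[] L {x} ¬k with leaf-vertex ¬k
  ... | v , v∋x , only = x , ∈-mapMaybe⁺ (H.∈-singles⁺ L (H.home-single⁺ L only)) (leafAt-≡ {v} (only-path v∋x only) ¬k)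

  singles-same : ∀ K L x → H.singles K x ≡ H.singles L x
  singles-same K L x = filters (H.vertices K)
    where
    to : ∀ K L {v} → H.home K v ≡ inj₁ x → H.home L v ≡ inj₁ x
    to K L h = H.home-single⁺ L (proj₂ (H.home-single⁻ K h))
    filters : ∀ vs → H.singlesIn K vs x ≡ H.singlesIn L vs x
    filters [] = refl
    filters (v ∷ vs) with H._≟ʰ_ K (H.home K v) (inj₁ x) | H._≟ʰ_ L (H.home L v) (inj₁ x)
    ... | yes _ | yes _ = cong (v ∷_) (filters vs)
    ... | no _  | no _  = filters vs
    ... | yes p | no ¬q = contradiction (to K L p) ¬q
    ... | no ¬p | yes q = contradiction (to L K q) ¬p

  tip-same : ∀ K L x → tip K x ≡ tip L x
  tip-same K L x = cong (mapMaybe leafAt) (singles-same K L x)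

  ∈-concat-kids : ∀ {f : Fin t → List (Fin t)} ks {z} → z ∈ concat (reverse (map f ks)) → ∃ λ c → c ∈ ks × z ∈ f c
  ∈-concat-kids {f} ks z∈ with find (∈-concat⁻ (map f ks) (↭.∈-resp-↭ (concat-↭ (↭.↭-reverse (map f ks))) z∈))
  ... | l , l∈ , z∈l with ∈-map⁻ f l∈
  ...   | c , c∈ , refl = c , c∈ , z∈l

  ∈-leaves⁻ : ∀ L x {z} → z ∈ leaves L x → z ≼ x
  ∈-leaves⁻ L = N.from-below L (λ x → ∀ {z} → z ∈ leaves L x → z ≼ x) λ x rec {z} z∈ →
    case ∈-++⁻ (concat (reverse (map (leaves L) (kidsᴸ L x)))) (subst (z ∈_) (leaves-≡ L x) z∈) of λ
      { (inj₁ p) → let (c , c∈ , z∈c) = ∈-concat-kids {leaves L} (kidsᴸ L x) p in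
                   rec (H.∈-kids⁻ L c∈) z∈c ◅◅ (H.∈-kids⁻ L c∈ ◅ ε)
      ; (inj₂ q) → subst (_≼ x) (sym (∈-tip⁻ L x q)) ε }

  leaves-≢[] : ∀ L x → ∃ λ z → z ∈ leaves L x
  leaves-≢[] L = N.from-below L (λ x → ∃ λ z → z ∈ leaves L x) λ x rec → nonempty x rec (hasKid? x)
    where
    nonempty : ∀ x → (∀ {c} → parent c ≡ just x → ∃ λ z → z ∈ leaves L c) → Dec (HasKid x) → ∃ λ z → z ∈ leaves L x
    nonempty x rec (yes (c , e)) = let (z , z∈) = rec e in
      z , subst (z ∈_) (sym (leaves-≡ L x)) (∈-++⁺ˡ (∈-concat⁺′ z∈ (Any.reverse⁺ (∈-map⁺ (leaves L) (H.∈-kids⁺ L e)))))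
    nonempty x rec (no ¬k) = let (z , z∈) = tip-≢[] L ¬k in
      z , subst (z ∈_) (sym (leaves-≡ L x)) (∈-++⁺ʳ (concat (reverse (map (leaves L) (kidsᴸ L x)))) z∈)

  leaves-↭ : ∀ K L x → leaves K x ↭ leaves L x
  leaves-↭ K L = N.from-below K (λ x → leaves K x ↭ leaves L x) λ x rec →
    ↭-trans (↭.↭-reflexive (leaves-≡ K x)) (↭-trans (↭.++⁺
      (↭-trans (concat-↭ (↭.↭-reverse (map (leaves K) (kidsᴸ K x))))
      (↭-trans (concat-map-↭ (kidsᴸ K x) (λ c∈ → rec (H.∈-kids⁻ K c∈)))
      (↭-trans (concat-↭ (↭.map⁺ (leaves L) (unique-same-↭ (H.unique-kids K x) (H.unique-kids L x)
                 (λ c∈ → H.∈-kids⁺ L (H.∈-kids⁻ K c∈)) (λ c∈ → H.∈-kids⁺ K (H.∈-kids⁻ L c∈)))))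
               (concat-↭ (↭-sym (↭.↭-reverse (map (leaves L) (kidsᴸ L x))))))))
      (↭.↭-reflexive (tip-same K L x))) (↭.↭-reflexive (sym (leaves-≡ L x))))

  -- Each child contributes a non-empty run of leaves of its own subtree. The first leaf therefore
  -- identifies the first child, and its run ends at the same place in both lists because its length
  -- depends on the subtree only.
  same-kids : ∀ K L x as bs → (∀ {c} → c ∈ as → parent c ≡ just x) → (∀ {c} → c ∈ bs → parent c ≡ just x) →
              concat (map (leaves K) as) ≡ concat (map (leaves L) bs) →
              as ≡ bs × (∀ {c} → c ∈ as → leaves K c ≡ leaves L c)
  same-kids K L x [] [] _ _ _ = refl , λ ()
  same-kids K L x [] (b ∷ bs) _ _ e with leaves L b | leaves-≢[] L b
  same-kids K L x [] (b ∷ bs) _ _ () | _ ∷ _ | _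
  same-kids K L x (a ∷ as) [] _ _ e with leaves K a | leaves-≢[] K a
  same-kids K L x (a ∷ as) [] _ _ () | _ ∷ _ | _
  same-kids K L x (a ∷ as) (b ∷ bs) pa pb e with first
    where
    first : a ≡ b
    first with shared-head (leaves K a) (leaves L b) (proj₂ (leaves-≢[] K a)) (proj₂ (leaves-≢[] L b)) e
    ... | z , z∈a , z∈b = kids-disjoint (pa (here refl)) (pb (here refl)) (∈-leaves⁻ K a z∈a) (∈-leaves⁻ L b z∈b)
  ... | refl with ++-injective-length (leaves K a) {leaves L a} (↭.↭-length (leaves-↭ K L a)) e
  ...   | e₁ , e₂ with same-kids K L x as bs (pa ∘ there) (pb ∘ there) e₂
  ...     | refl , rest = refl , λ { (here refl) → e₁ ; (there c∈) → rest c∈ }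

  leaves⇒kids : ∀ K L x → leaves K x ≡ leaves L x → ∀ {z} → z ≼ x → kidsᴸ K z ≡ kidsᴸ L z
  leaves⇒kids K L = N.from-below K (λ x → leaves K x ≡ leaves L x → ∀ {z} → z ≼ x → kidsᴸ K z ≡ kidsᴸ L z)
    λ x rec e → go x rec e
    where
    go : ∀ x → (∀ {c} → parent c ≡ just x → leaves K c ≡ leaves L c → ∀ {z} → z ≼ c → kidsᴸ K z ≡ kidsᴸ L z) →
         leaves K x ≡ leaves L x → ∀ {z} → z ≼ x → kidsᴸ K z ≡ kidsᴸ L z
    go x rec e {z} z≼x with same-kids K L x (reverse (kidsᴸ K x)) (reverse (kidsᴸ L x))
        (H.∈-kids⁻ K ∘ Any.reverse⁻) (H.∈-kids⁻ L ∘ Any.reverse⁻) concat-≡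
      where
      concat-≡ : concat (map (leaves K) (reverse (kidsᴸ K x))) ≡ concat (map (leaves L) (reverse (kidsᴸ L x)))
      concat-≡ rewrite List.reverse-map (leaves K) (kidsᴸ K x) | List.reverse-map (leaves L) (kidsᴸ L x) =
        List.++-cancelʳ (tip K x) _ _ (trans (sym (leaves-≡ K x)) (trans e (trans (leaves-≡ L x)
          (cong (concat (reverse (map (leaves L) (kidsᴸ L x))) ++_) (sym (tip-same K L x))))))
    ... | same , rest with z Fin.≟ x
    ...   | yes refl = List.reverse-injective same
    ...   | no z≢x = let (c , ec , z≼c) = kid-towards z≼x z≢x in rec ec (rest (Any.reverse⁺ (H.∈-kids⁺ K ec))) z≼c

  -- Reversing every list of children reverses the sequence of leaves. A tip may list its leaf
  -- several times, but a constant list is its own reverse.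
  leaves-mirror : ∀ L x → leaves (mirror L) x ≡ reverse (leaves L x)
  leaves-mirror L = N.from-below L (λ x → leaves (mirror L) x ≡ reverse (leaves L x)) λ x rec →
    trans (leaves-≡ (mirror L) x) (trans (both x rec (hasKid? x)) (cong reverse (sym (leaves-≡ L x))))
    where
    both : ∀ x → (∀ {c} → parent c ≡ just x → leaves (mirror L) c ≡ reverse (leaves L c)) → Dec (HasKid x) →
           concat (reverse (map (leaves (mirror L)) (kidsᴸ (mirror L) x))) ++ tip (mirror L) x ≡
           reverse (concat (reverse (map (leaves L) (kidsᴸ L x))) ++ tip L x)
    both x rec (yes k) rewrite tip-kid (mirror L) k | tip-kid L k =
      trans (List.++-identityʳ _) (trans rev (cong reverse (sym (List.++-identityʳ (concat (reverse (map (leaves L) ks)))))))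
      where
      ks = kidsᴸ L x
      rev : concat (reverse (map (leaves (mirror L)) (kidsᴸ (mirror L) x))) ≡ reverse (concat (reverse (map (leaves L) ks)))
      rev = trans (cong (concat ∘ reverse ∘ map (leaves (mirror L))) (kids-mirror L x))
        (trans (cong (concat ∘ reverse) (List.reverse-map (leaves (mirror L)) ks))
        (trans (cong concat (List.reverse-involutive (map (leaves (mirror L)) ks)))
        (trans (cong concat (trans (List.map-cong-local (All.tabulate λ c∈ → rec (H.∈-kids⁻ L c∈))) (List.map-∘ ks)))
        (trans (cong concat (sym (List.reverse-involutive (map reverse (map (leaves L) ks)))))
        (trans (cong (concat ∘ reverse) (sym (List.reverse-map reverse (map (leaves L) ks))))
               (sym (reverse-concat (reverse (map (leaves L) ks)))))))))
    both x rec (no ¬k) with kidsᴸ L x | kidsᴸ (mirror L) x | (λ {c} → H.∈-kids⁻ L {c} {x}) | (λ {c} → H.∈-kids⁻ (mirror L) {c} {x})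
    ... | [] | [] | _ | _ = trans (tip-same (mirror L) L x) (sym (reverse-constant (tip L x) (∈-tip⁻ L x)))
    ... | c ∷ _ | _ | f | _ = contradiction (c , f (here refl)) ¬k
    ... | _ | c ∷ _ | _ | f = contradiction (c , f (here refl)) ¬k

  -- By maximality some vertex lives at the root but not at its only neighbour. Hence every tour
  -- ends with singles of the root, and singles do not depend on the layout, so all tours have the
  -- same last vertex.
  root-single : ∃ λ v → ∀ {z} → v ∋ z → z ≡ r
  root-single with hasKid? r
  ... | no ¬k = let (v , _ , only) = leaf-vertex ¬k in v , only
  ... | yes (c , e) with bag-differs {r} {c} (≢-sym (parent-≢ e))
  ...   | v , v∋r , v∌c = v , only
    where
    only : ∀ {z} → v ∋ z → z ≡ r
    only {z} v∋z with z Fin.≟ r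
    ... | yes q = q
    ... | no z≢r with kid-towards (≼-root z) z≢r
    ...   | d , ed , z≼d with leaf (parent-edge ed) (parent-edge e)
    ...     | refl = contradiction (between (path-linked v) v∋r v∋z z≼d (ed ◅ ε)) v∌c

  front : PlaneLayout tree → List (Fin n)
  front L = concat (reverse (map (H.segment L left) (kidsᴸ L r)))

  tour-≡ : ∀ L → tourᴸ L ≡ front L ++ H.singles L r
  tour-≡ L = H.inside-≡ L r left

  tour-last : ∀ K L → ∃ λ ρ → ρ ∈ H.singles K r × ∃₂ λ l m → tourᴸ K ≡ l ∷ʳ ρ × tourᴸ L ≡ m ∷ʳ ρ
  tour-last K L = go (initLast (H.singles K r)) refl
    where
    go : ∀ {l} → InitLast l → H.singles K r ≡ l →
         ∃ λ ρ → ρ ∈ H.singles K r × ∃₂ λ l m → tourᴸ K ≡ l ∷ʳ ρ × tourᴸ L ≡ m ∷ʳ ρ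
    go [] e = case subst (_ ∈_) e (H.∈-singles⁺ K (H.home-single⁺ K (proj₂ root-single))) of λ ()
    go (m ∷ʳ′ ρ) e = ρ , subst (ρ ∈_) (sym e) (∈-insert m) , front K ++ m , front L ++ m ,
      trans (tour-≡ K) (trans (cong (front K ++_) e) (sym (List.++-assoc (front K) m (ρ ∷ [])))) ,
      trans (tour-≡ L) (trans (cong (front L ++_) (trans (singles-same L K r) e)) (sym (List.++-assoc (front L) m (ρ ∷ []))))

  unique-tourᴸ : ∀ L → Unique (tourᴸ L)
  unique-tourᴸ L = TourHamiltonian.unique-tour M R L

  tour-↻ : ∀ K L → tourᴸ K ↻ tourᴸ L ⇔ K ≈ᴸ L
  tour-↻ K L = mk⇔ to from
    where
    to : tourᴸ K ↻ tourᴸ L → K ≈ᴸ L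
    to rot with tour-last K L
    ... | ρ , _ , l , m , eK , eL = kids⇒↻ K L (λ x → leaves⇒kids K L r (cong (mapMaybe leafAt) tours) (≼-root x))
      where
      tours : tourᴸ K ≡ tourᴸ L
      tours = trans eK (trans (cong (_∷ʳ ρ) (↻-unique-last (subst Unique eK (unique-tourᴸ K)) (subst₂ _↻_ eK eL rot))) (sym eL))
    from : K ≈ᴸ L → tourᴸ K ↻ tourᴸ L
    from same = [] , tourᴸ K , refl , trans (sym (tour-cong K L (↻⇒kids leaf K L same))) (sym (List.++-identityʳ _))

  ↻-rotate : ∀ {xs ys : List A} {y} → xs ↻ (y ∷ ys) → xs ↻ (ys ∷ʳ y)
  ↻-rotate {y = y} (ps , [] , refl , refl) = y ∷ [] , _ , List.++-identityʳ _ , refl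
  ↻-rotate {y = y} (ps , q ∷ qs , refl , refl) = ps ∷ʳ y , qs , sym (List.++-assoc ps (y ∷ []) qs) , List.++-assoc qs ps (y ∷ [])

  -- Both tours end in the same vertex `ρ`. Once `ρ` is moved from the front of the reversed tour to
  -- its end, the rotation becomes an equality, and the leaves of `K` read as those of the mirror
  -- image of `L`.
  tour-mirror : ∀ K L → tourᴸ K ↻ reverse (tourᴸ L) → MirrorImages K L
  tour-mirror K L rot = kids⇒↻ K (mirror L) (by (hasKid? r))
    where
    by : Dec (HasKid r) → ∀ x → kidsᴸ K x ≡ kidsᴸ (mirror L) x
    -- In a one-node tree `ρ` itself marks a leaf and could not be dropped, but there are no
    -- children to compare.
    by (no ¬k) x with x Fin.≟ r
    ... | no x≢r = let (c , e , _) = kid-towards (≼-root x) x≢r in contradiction (c , e) ¬k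
    ... | yes refl with kidsᴸ K x | kidsᴸ (mirror L) x | (λ {c} → H.∈-kids⁻ K {c} {x}) | (λ {c} → H.∈-kids⁻ (mirror L) {c} {x})
    ...   | [] | [] | _ | _ = refl
    ...   | c ∷ _ | _ | f | _ = contradiction (c , f (here refl)) ¬k
    ...   | _ | c ∷ _ | _ | f = contradiction (c , f (here refl)) ¬k
    by (yes k) x with tour-last K L
    ... | ρ , ρ∈ , l , m , eK , eL =
          leaves⇒kids K (mirror L) r (trans leavesK (trans (cong reverse (sym leavesL)) (sym (leaves-mirror L r)))) (≼-root x)
      where
      l≡m : l ≡ reverse m
      l≡m = ↻-unique-last (subst Unique eK (unique-tourᴸ K))
        (↻-rotate (subst₂ _↻_ eK (trans (cong reverse eL) (List.reverse-++ m (ρ ∷ []))) rot))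
      drop-ρ : ∀ {L′ l} → tourᴸ L′ ≡ l ∷ʳ ρ → leaves L′ r ≡ mapMaybe leafAt l
      drop-ρ {L′} {l} e = trans (cong (mapMaybe leafAt) e) (trans (mapMaybe-∷ʳ leafAt l ρ)
        (trans (cong (mapMaybe leafAt l ++_) (mapMaybe-none {f = leafAt} {xs = ρ ∷ []} λ { (here refl) → leafAt-single K (H.∈-singles⁻ K ρ∈) k }))
               (List.++-identityʳ _)))
      leavesL : leaves L r ≡ mapMaybe leafAt m
      leavesL = drop-ρ {L} eL
      leavesK : leaves K r ≡ reverse (mapMaybe leafAt m)
      leavesK = trans (drop-ρ {K} eK) (trans (cong (mapMaybe leafAt) l≡m) (reverse-mapMaybe leafAt m))

-- Claw-free chordal graphs

perm-move : ∀ (ps : List A) ins {ss} → ps ++ ins ++ ss ↭ ins ++ ps ++ ss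
perm-move ps ins {ss} = ↭-trans (↭.↭-reflexive (sym (List.++-assoc ps ins ss)))
  (↭-trans (↭.++⁺ʳ ss (↭.++-comm ps ins)) (↭.↭-reflexive (List.++-assoc ins ps ss)))

Separates : List A → A → A → A → Set
Separates l m a b = ∃₂ λ as bs → l ≡ as ++ m ∷ bs × ((a ∈ as × b ∈ bs) ⊎ (b ∈ as × a ∈ bs))

one-separates : ∀ {x y z : A} l → x ∈ l → y ∈ l → z ∈ l → x ≢ y → x ≢ z → y ≢ z →
                Separates l x y z ⊎ Separates l y x z ⊎ Separates l z x y
one-separates {A = A} (h ∷ l) = go
  where
  weaken : ∀ {m a b} → Separates l m a b → Separates (h ∷ l) m a b
  weaken (as , bs , refl , inj₁ (p , q)) = h ∷ as , bs , refl , inj₁ (there p , q)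
  weaken (as , bs , refl , inj₂ (p , q)) = h ∷ as , bs , refl , inj₂ (there p , q)
  swapped : ∀ {l : List A} {m a b} → Separates l m a b → Separates l m b a
  swapped (as , bs , e , inj₁ p) = as , bs , e , inj₂ p
  swapped (as , bs , e , inj₂ p) = as , bs , e , inj₁ p
  from-head : ∀ {y z} → y ∈ l → z ∈ l → y ≢ z → Separates (h ∷ l) y h z ⊎ Separates (h ∷ l) z h y
  from-head {y} {z} y∈ z∈ y≢z with ∈-∃++ y∈
  ... | as , bs , refl with ∈-++⁻ as z∈
  ...   | inj₂ (here e) = contradiction (sym e) y≢z
  ...   | inj₂ (there z∈bs) = inj₁ (h ∷ as , bs , refl , inj₁ (here refl , z∈bs))
  ...   | inj₁ z∈as with ∈-∃++ z∈as
  ...     | cs , ds , refl = inj₂ (h ∷ cs , ds ++ y ∷ bs , cong (h ∷_) (List.++-assoc cs (z ∷ ds) (y ∷ bs)) , inj₁ (here refl , ∈-insert ds))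
  go : ∀ {x y z} → x ∈ h ∷ l → y ∈ h ∷ l → z ∈ h ∷ l → x ≢ y → x ≢ z → y ≢ z →
       Separates (h ∷ l) x y z ⊎ Separates (h ∷ l) y x z ⊎ Separates (h ∷ l) z x y
  go (here refl) (here refl) _ x≢y _ _ = contradiction refl x≢y
  go (here refl) _ (here refl) _ x≢z _ = contradiction refl x≢z
  go _ (here refl) (here refl) _ _ y≢z = contradiction refl y≢z
  go (here refl) (there y∈) (there z∈) _ _ y≢z with from-head y∈ z∈ y≢z
  ... | inj₁ s = inj₂ (inj₁ s)
  ... | inj₂ s = inj₂ (inj₂ s)
  go (there x∈) (here refl) (there z∈) _ x≢z _ with from-head x∈ z∈ x≢z
  ... | inj₁ s = inj₁ s
  ... | inj₂ s = inj₂ (inj₂ (swapped s))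
  go (there x∈) (there y∈) (here refl) x≢y _ _ with from-head x∈ y∈ x≢y
  ... | inj₁ s = inj₁ (swapped s)
  ... | inj₂ s = inj₂ (inj₁ (swapped s))
  go (there x∈) (there y∈) (there z∈) x≢y x≢z y≢z with one-separates l x∈ y∈ z∈ x≢y x≢z y≢z
  ... | inj₁ s = inj₁ (weaken s)
  ... | inj₂ (inj₁ s) = inj₂ (inj₁ (weaken s))
  ... | inj₂ (inj₂ s) = inj₂ (inj₂ (weaken s))

-- In a chordal claw-free graph, listed in the reverse of a perfect elimination
-- order, a new simplicial vertex v can be inserted into a Hamiltonian cycle C of
-- the later part: if no two neighbours of v are consecutive on C, take
-- neighbours u, w of v with a common neighbour z outside N(v).  Claw-freeness
-- allows to short-cut C at u and w and to reinsert u v w next to z or, if this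
-- fails, to short-cut C at z as well and to put w v u z in place of w.
module ClawFreeChordal {n} (G : Graph n) where
  open Graph G

  ClawFree : Set
  ClawFree = ∀ {c a b d} → c ~ a → c ~ b → c ~ d → a ≢ b → a ≢ d → b ≢ d → a ~ b ⊎ a ~ d ⊎ b ~ d

  -- The condition on two neighbours is what 2-connectedness contributes: no vertex hangs on the
  -- later ones by a single edge.
  data Elimination : List (Fin n) → Set where
    []  : Elimination []
    add : ∀ {v xs} → v ∉ xs →
          (∀ {a b} → a ∈ xs → b ∈ xs → v ~ a → v ~ b → a ≢ b → a ~ b) →
          (2 ≤ length xs → ∃₂ λ a b → a ∈ xs × b ∈ xs × a ≢ b × v ~ a × v ~ b) →
          Elimination xs → Elimination (v ∷ xs)

  two-elements : ∀ {xs : List (Fin n)} {a b} → a ∈ xs → b ∈ xs → a ≢ b → 2 ≤ length xs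
  two-elements {_ ∷ []} (here refl) (here refl) ne = contradiction refl ne
  two-elements {_ ∷ _ ∷ _} _ _ _ = s≤s (s≤s z≤n)

  open DecMembership (Fin._≟_ {n}) using (_∈?_)

  drop-head : ∀ {h x ys} {Q : Pred (Fin n) 0ℓ} → ¬ Q h → x ∈ h ∷ ys → Q x → x ∈ ys
  drop-head ¬qh (here refl) q = contradiction q ¬qh
  drop-head ¬qh (there p)   _ = p

  OuterNeighbour : List (Fin n) → Pred (Fin n) 0ℓ → Set
  OuterNeighbour xs Q =
    ∃₂ λ u w → u ∈ xs × w ∈ xs × u ≢ w × Q u × Q w × ∃ λ z → z ∈ xs × ¬ Q z × z ~ u × z ~ w

  weaken-outer : ∀ {h xs Q} → OuterNeighbour xs Q → OuterNeighbour (h ∷ xs) Q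
  weaken-outer (u , w , u∈ , w∈ , ne , qu , qw , z , z∈ , rest) =
    u , w , there u∈ , there w∈ , ne , qu , qw , z , there z∈ , rest

  outer-neighbour : ∀ {xs} {Q : Pred (Fin n) 0ℓ} → Decidable Q → Elimination xs →
                    (∀ {a b} → a ∈ xs → b ∈ xs → Q a → Q b → a ≢ b → a ~ b) →
                    (∃₂ λ a b → a ∈ xs × b ∈ xs × a ≢ b × Q a × Q b) → (∃ λ c → c ∈ xs × ¬ Q c) →
                    OuterNeighbour xs Q
  outer-neighbour {[]} _ _ _ (_ , _ , () , _) _
  outer-neighbour {h ∷ ys} {Q} Q? (add h∉ simplicial two el) clique (a , b , a∈ , b∈ , a≢b , qa , qb) (c , c∈ , ¬qc)
    with Q? h
  ... | no ¬qh with Fin.any? (λ x → (x ∈? ys) ×-dec ¬? (Q? x))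
  ...   | yes (x , x∈ , ¬qx) = weaken-outer (outer-neighbour Q? el (λ p q → clique (there p) (there q))
            (a , b , drop-head ¬qh a∈ qa , drop-head ¬qh b∈ qb , a≢b , qa , qb) (x , x∈ , ¬qx))
  ...   | no all with two (two-elements (drop-head ¬qh a∈ qa) (drop-head ¬qh b∈ qb) a≢b)
  ...     | u , w , u∈ , w∈ , ne , h~u , h~w =
            u , w , there u∈ , there w∈ , ne ,
            decidable-stable (Q? u) (λ ¬q → all (u , u∈ , ¬q)) ,
            decidable-stable (Q? w) (λ ¬q → all (w , w∈ , ¬q)) ,
            h , here refl , ¬qh , h~u , h~w
  outer-neighbour {h ∷ ys} {Q} Q? (add h∉ simplicial two el) clique (a , b , a∈ , b∈ , a≢b , qa , qb) (c , c∈ , ¬qc)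
    | yes qh = go (other a∈ b∈ a≢b qa qb)
    where
    c∈′ : c ∈ ys
    c∈′ = drop-head {Q = λ x → ¬ Q x} (λ ¬qh → ¬qh qh) c∈ ¬qc
    other : ∀ {a b} → a ∈ h ∷ ys → b ∈ h ∷ ys → a ≢ b → Q a → Q b → ∃ λ w → w ∈ ys × Q w
    other (there p)   _           _  qa _  = _ , p , qa
    other (here refl) (there p)   _  _  qb = _ , p , qb
    other (here refl) (here refl) ne _  _  = contradiction refl ne
    go : (∃ λ w → w ∈ ys × Q w) → OuterNeighbour (h ∷ ys) Q
    go (w , w∈ , qw) with Fin.any? (λ x → (x ∈? ys) ×-dec (Q? x ×-dec ¬? (w Fin.≟ x)))
    ... | yes (x , x∈ , qx , w≢x) = weaken-outer
            (outer-neighbour Q? el (λ p q → clique (there p) (there q)) (w , x , w∈ , x∈ , w≢x , qw , qx) (c , c∈′ , ¬qc))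
    go (w , w∈ , qw) | no none = pick (two (two-elements w∈ c∈′ (λ { refl → ¬qc qw })))
      where
      h≢w : h ≢ w
      h≢w refl = h∉ w∈
      h~w : h ~ w
      h~w = clique (here refl) (there w∈) qh qw h≢w
      found : ∀ z → z ∈ ys → h ~ z → z ≢ w → OuterNeighbour (h ∷ ys) Q
      found z z∈ h~z z≢w = h , w , here refl , there w∈ , h≢w , qh , qw , z , there z∈ ,
        (λ qz → none (z , z∈ , qz , ≢-sym z≢w)) , ~-sym h~z , simplicial z∈ w∈ h~z h~w z≢w
      pick : (∃₂ λ a b → a ∈ ys × b ∈ ys × a ≢ b × h ~ a × h ~ b) → OuterNeighbour (h ∷ ys) Q
      pick (p , q , p∈ , q∈ , p≢q , h~p , h~q) with p Fin.≟ w
      ... | no p≢w = found p p∈ h~p p≢w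
      ... | yes refl = found q q∈ h~q (≢-sym p≢q)

  -- Length and freeness from repetitions are left out, as a permutation of the vertex list supplies
  -- them.
  Closed : List (Fin n) → Set
  Closed []       = ⊤
  Closed (x ∷ xs) = Linked _~_ (x ∷ xs ∷ʳ x)

  closed-rotate : ∀ as bs → Closed (as ++ bs) → Closed (bs ++ as)
  closed-rotate [] bs c = subst Closed (sym (List.++-identityʳ bs)) c
  closed-rotate (a ∷ as) [] c = subst Closed (List.++-identityʳ (a ∷ as)) c
  closed-rotate (a ∷ as) (b ∷ bs) c = subst (Linked _~_) (cong (b ∷_) (sym (List.++-assoc bs (a ∷ as) (b ∷ []))))
    (linked-join (b ∷ bs) (linked-++ʳ (a ∷ as) c′)
      (linked-++ˡ (a ∷ as ++ b ∷ []) (subst (Linked _~_) (cong (a ∷_) (sym (List.++-assoc as (b ∷ []) (bs ++ a ∷ [])))) c′)))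
    where
    c′ : Linked _~_ (a ∷ as ++ b ∷ bs ++ a ∷ [])
    c′ = subst (Linked _~_) (cong (a ∷_) (List.++-assoc as (b ∷ bs) (a ∷ []))) c

  closing : ∀ {x ys α} → Linked _~_ (x ∷ ys ++ α ∷ []) → α ~ x → Closed (x ∷ ys ++ α ∷ [])
  closing {x} {ys} {α} l e = subst (Linked _~_) (cong (x ∷_) (sym (List.++-assoc ys (α ∷ []) (x ∷ []))))
    (linked-join (x ∷ ys) l (e ∷ [-]))

  -- A place `z` on a path, with neighbours `c` and `d`. The field `fill` puts any path from `c` to
  -- `d` there: an empty `ins` makes a short-cut, and one containing `z` inserts beside it.
  record Splice (ps : List (Fin n)) (z : Fin n) (ss : List (Fin n)) : Set where
    field
      {c d} : Fin n
      c∈    : c ∈ ps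
      d∈    : d ∈ ss
      c~z   : c ~ z
      z~d   : z ~ d
      fill  : ∀ ins → Linked _~_ (c ∷ ins ++ d ∷ []) → Linked _~_ (ps ++ ins ++ ss)

  last-view : ∀ x (xs : List (Fin n)) → ∃₂ λ ys y → x ∷ xs ≡ ys ∷ʳ y
  last-view x []       = [] , x , refl
  last-view x (y ∷ xs) = let (ys , z , e) = last-view y xs in x ∷ ys , z , cong (x ∷_) e

  splice : ∀ {x} ps {z} ss {α} → Linked _~_ (x ∷ ps ++ z ∷ ss ++ α ∷ []) → Splice (x ∷ ps) z (ss ++ α ∷ [])
  splice {x} ps {z} ss {α} l with last-view x ps | first ss
    where
    first : ∀ ss → ∃₂ λ d ss′ → ss ++ α ∷ [] ≡ d ∷ ss′
    first []       = α , [] , refl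
    first (d ∷ ss) = d , _ , refl
  ... | ps′ , c , e | d , ss′ , e′ = record
    { c∈ = subst (c ∈_) (sym e) (∈-insert ps′) ; d∈ = subst (d ∈_) (sym e′) (here refl)
    ; c~z = linked-mid ps′ l′ ; z~d = linked-mid (ps′ ∷ʳ c) (subst (Linked _~_) (sym (List.++-assoc ps′ (c ∷ []) _)) l′)
    ; fill = λ ins k → subst (Linked _~_)
        (trans (sym (List.++-assoc ps′ (c ∷ []) _)) (cong₂ (λ p q → p ++ ins ++ q) (sym e) (sym e′)))
        (linked-join ps′ (linked-++ˡ (ps′ ++ c ∷ []) (subst (Linked _~_) (sym (List.++-assoc ps′ (c ∷ []) _)) l′))
          (linked-join (c ∷ ins) k (Linked.tail (Linked.tail (linked-++ʳ ps′ l′))))) }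
    where
    l′ : Linked _~_ (ps′ ++ c ∷ z ∷ d ∷ ss′)
    l′ = subst (Linked _~_) (trans (cong₂ (λ p q → p ++ z ∷ q) e e′) (List.++-assoc ps′ (c ∷ []) _)) l

  module _ (claw-free : ClawFree) {v : Fin n} {xs C : List (Fin n)} where

    Extension : Set
    Extension = ∃ λ D → Closed D × D ↭ v ∷ xs

    close : ∀ {x l} ys {α} → l ≡ ys ++ α ∷ [] → Linked _~_ (x ∷ l) → α ~ x → x ∷ l ↭ v ∷ xs → Extension
    close ys refl l e p = _ , closing l e , p

    module _ (v∉ : v ∉ xs) {u w z : Fin n} (z∈ : z ∈ xs)
             (u≢w : u ≢ w) (v~u : v ~ u) (v~w : v ~ w) (v≁z : ¬ v ~ z) (z~u : z ~ u) (z~w : z ~ w) where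

      private
        no-v : ∀ {a} → a ∈ xs → v ≢ a
        no-v a∈ refl = v∉ a∈

        -- The form in which claw-freeness is mostly used: with `v` as one leg of the claw and the
        -- others outside its neighbourhood, only `a ~ b` remains.
        claw : ∀ {c a b} → c ~ v → c ~ a → c ~ b → a ∈ xs → b ∈ xs → ¬ v ~ a → ¬ v ~ b → a ≢ b → a ~ b
        claw c~v c~a c~b a∈ b∈ v≁a v≁b a≢b with claw-free c~v c~a c~b (no-v a∈) (no-v b∈) a≢b
        ... | inj₁ e = contradiction e v≁a
        ... | inj₂ (inj₁ e) = contradiction e v≁b
        ... | inj₂ (inj₂ e) = e

      -- Here `u` and `w` have been cut out, leaving a path from `β` to `α`, both adjacent to `w`. A
      -- claw at `w` shows that `α` and `β` are adjacent, so the path closes; `u`, `v`, `w` go next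
      -- to `z` if `u` or `w` is adjacent to a neighbour of `z` on it.
      reinsert : ∀ {β} ns {α} → Linked _~_ (β ∷ ns ++ α ∷ []) → w ∷ u ∷ β ∷ ns ++ α ∷ [] ↭ xs → Unique xs →
                 ¬ v ~ β → ¬ v ~ α → w ~ β → w ~ α → Extension
      reinsert {β} ns {α} l p uq v≁β v≁α w~β w~α = place (↭.∈-resp-↭ (↭-sym p) z∈)
        where
        uq′ : Unique (w ∷ u ∷ β ∷ ns ++ α ∷ [])
        uq′ = unique-resp-↭ (↭-sym p) uq
        in-xs : ∀ {a} → a ∈ β ∷ ns ++ α ∷ [] → a ∈ xs
        in-xs a∈ = ↭.∈-resp-↭ p (there (there a∈))
        not-u : ∀ {a} → a ∈ β ∷ ns ++ α ∷ [] → u ≢ a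
        not-u a∈ e = All.lookup (AllPairs.head (AllPairs.tail uq′)) a∈ e
        all-of : ∀ {l} → l ↭ w ∷ v ∷ u ∷ β ∷ ns ++ α ∷ [] → l ↭ v ∷ xs
        all-of q = ↭-trans q (↭-trans (↭.swap w v ↭-refl) (↭.prep v p))
        wvu uvw : List (Fin n)
        wvu = w ∷ v ∷ u ∷ []
        uvw = u ∷ v ∷ w ∷ []
        flip-↭ : ∀ {l} → uvw ++ l ↭ wvu ++ l
        flip-↭ = ↭-trans (↭.swap u v ↭-refl) (↭-trans (↭.prep v (↭.swap u w ↭-refl)) (↭.swap v w ↭-refl))

        inside : z ∈ ns → Extension
        inside z∈ns with ∈-∃++ z∈ns
        ... | as , bs , refl = choose (d ~? u) (d ~? w) (c ~? u) (c ~? w)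
          where
          l′ : Linked _~_ (β ∷ as ++ z ∷ bs ++ α ∷ [])
          l′ = subst (Linked _~_) (cong (β ∷_) (List.++-assoc as (z ∷ bs) (α ∷ []))) l
          open Splice (splice as bs l′)
          uq″ : Unique ((β ∷ as) ++ z ∷ bs ++ α ∷ [])
          uq″ = subst Unique (cong (β ∷_) (List.++-assoc as (z ∷ bs) (α ∷ []))) (AllPairs.tail (AllPairs.tail uq′))
          c≢d : c ≢ d
          c≢d e = unique-++-disjoint (β ∷ as) uq″ c∈ (there (subst (_∈ bs ++ α ∷ []) (sym e) d∈))
          mem : ∀ {a} → a ∈ (β ∷ as) ++ z ∷ bs ++ α ∷ [] → a ∈ β ∷ (as ++ z ∷ bs) ++ α ∷ []
          mem {a} = subst (a ∈_) (cong (β ∷_) (sym (List.++-assoc as (z ∷ bs) (α ∷ []))))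
          c∈′ = mem (∈-++⁺ˡ c∈)
          d∈′ = mem (∈-++⁺ʳ (β ∷ as) (there d∈))
          β~z : z ~ β
          β~z = claw (~-sym v~w) (~-sym z~w) w~β (in-xs (mem (∈-insert (β ∷ as)))) (in-xs (here refl)) v≁z v≁β
                  (λ { refl → unique-++-disjoint (β ∷ as) uq″ (here refl) (here refl) })
          α~β : α ~ β
          α~β = claw (~-sym v~w) w~α w~β (in-xs (there (∈-++⁺ʳ (as ++ z ∷ bs) (here refl)))) (in-xs (here refl)) v≁α v≁β
                  (λ { refl → unique-++-disjoint (α ∷ []) (AllPairs.tail (AllPairs.tail uq′)) (here refl) (∈-++⁺ʳ (as ++ z ∷ bs) (here refl)) })
          around : ∀ ins → (ins ++ (β ∷ as) ++ bs ++ α ∷ [] ↭ wvu ++ (β ∷ as) ++ z ∷ bs ++ α ∷ []) →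
                   Linked _~_ (c ∷ ins ++ d ∷ []) → Extension
          around ins q k = close (as ++ ins ++ bs)
            (trans (cong (as ++_) (sym (List.++-assoc ins bs (α ∷ [])))) (sym (List.++-assoc as (ins ++ bs) (α ∷ []))))
            (fill ins k) α~β
            (all-of (↭-trans (perm-move (β ∷ as) ins) (↭-trans q
              (↭.↭-reflexive (cong (λ y → wvu ++ β ∷ y) (sym (List.++-assoc as (z ∷ bs) (α ∷ []))))))))
          z-in : z ∷ (β ∷ as) ++ bs ++ α ∷ [] ↭ (β ∷ as) ++ z ∷ bs ++ α ∷ []
          z-in = ↭-sym (↭.shift z (β ∷ as) (bs ++ α ∷ []))
          choose : Dec (d ~ u) → Dec (d ~ w) → Dec (c ~ u) → Dec (c ~ w) → Extension
          choose (yes d~u) _ _ _ = around (z ∷ w ∷ v ∷ u ∷ [])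
            (↭-trans (↭-sym (↭.shift z wvu _)) (↭.++⁺ˡ wvu z-in)) (c~z ∷ z~w ∷ ~-sym v~w ∷ v~u ∷ ~-sym d~u ∷ [-])
          choose _ (yes d~w) _ _ = around (z ∷ u ∷ v ∷ w ∷ [])
            (↭-trans (↭-sym (↭.shift z uvw _)) (↭-trans (↭.++⁺ˡ uvw z-in) flip-↭)) (c~z ∷ z~u ∷ ~-sym v~u ∷ v~w ∷ ~-sym d~w ∷ [-])
          choose _ _ (yes c~u) _ = around (u ∷ v ∷ w ∷ z ∷ [])
            (↭-trans (↭.++⁺ˡ uvw z-in) flip-↭) (c~u ∷ ~-sym v~u ∷ v~w ∷ ~-sym z~w ∷ z~d ∷ [-])
          choose _ _ _ (yes c~w) = around (w ∷ v ∷ u ∷ z ∷ [])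
            (↭.++⁺ˡ wvu z-in) (c~w ∷ ~-sym v~w ∷ v~u ∷ ~-sym z~u ∷ z~d ∷ [-])
          -- The claw at `z` with legs `u`, `c`, `d` leaves only `c ~ d`. Then `z` is cut out as
          -- well, and `w`, `v`, `u`, `z` fill the place between `α` and `β`.
          choose (no d≁u) _ (no c≁u) _ with claw-free z~u (~-sym c~z) z~d (not-u c∈′) (not-u d∈′) c≢d
          ... | inj₁ e = contradiction (~-sym e) c≁u
          ... | inj₂ (inj₁ e) = contradiction (~-sym e) d≁u
          ... | inj₂ (inj₂ c~d) = close (as ++ bs ++ α ∷ w ∷ v ∷ u ∷ [])
                  (trans (cong (as ++_) (sym (List.++-assoc bs (α ∷ w ∷ v ∷ u ∷ []) (z ∷ [])))) (sym (List.++-assoc as _ (z ∷ []))))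
                  (subst (Linked _~_) (cong (β ∷_) (List.++-assoc as bs (α ∷ w ∷ v ∷ u ∷ z ∷ [])))
                    (linked-join (β ∷ as ++ bs) (subst (Linked _~_) (cong (β ∷_) (sym (List.++-assoc as bs (α ∷ [])))) (fill [] (c~d ∷ [-])))
                    (~-sym w~α ∷ ~-sym v~w ∷ v~u ∷ ~-sym z~u ∷ [-])))
                  β~z
                  (all-of (↭-trans (↭.↭-reflexive (trans (cong ((β ∷ as) ++_) (sym (List.++-assoc bs (α ∷ []) (w ∷ v ∷ u ∷ z ∷ []))))
                              (sym (List.++-assoc (β ∷ as) (bs ++ α ∷ []) (w ∷ v ∷ u ∷ z ∷ [])))))
                    (↭-trans (↭.++-comm ((β ∷ as) ++ bs ++ α ∷ []) (w ∷ v ∷ u ∷ z ∷ []))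
                    (↭-trans (↭.++⁺ˡ wvu z-in)
                    (↭.↭-reflexive (cong (λ y → wvu ++ β ∷ y) (sym (List.++-assoc as (z ∷ bs) (α ∷ [])))))))))

        at-end : ∀ a b → (∀ {l} → a ∷ v ∷ b ∷ l ↭ w ∷ v ∷ u ∷ l) → α ~ a → a ~ v → v ~ b → b ~ β → Extension
        at-end a b q α~a a~v v~b b~β = close (ns ++ α ∷ a ∷ v ∷ []) (sym (List.++-assoc ns _ (b ∷ [])))
          (linked-join (β ∷ ns) l (α~a ∷ a~v ∷ v~b ∷ [-])) b~β
          (all-of (↭-trans (↭.↭-reflexive (sym (List.++-assoc (β ∷ ns) (α ∷ []) _)))
            (↭-trans (↭.++-comm ((β ∷ ns) ++ α ∷ []) (a ∷ v ∷ b ∷ [])) q)))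

        place : z ∈ w ∷ u ∷ β ∷ ns ++ α ∷ [] → Extension
        place (here refl) = ⊥-elim (v≁z v~w)
        place (there (here refl)) = ⊥-elim (v≁z v~u)
        place (there (there (here refl))) = at-end w u ↭-refl (~-sym w~α) (~-sym v~w) v~u (~-sym z~u)
        place (there (there (there z∈))) with ∈-++⁻ ns z∈
        ... | inj₁ z∈ns = inside z∈ns
        ... | inj₂ (here refl) = at-end u w flip-↭ z~u (~-sym v~u) v~w w~β

      -- If `v` is adjacent to a neighbour of `w` or of `u` on the cycle, it goes between the two.
      -- Otherwise claws at `w` and `u` allow short-cuts at both, which is the situation of
      -- `reinsert`.
      detach : ∀ {β} ms {α} → Linked _~_ (w ∷ β ∷ ms ++ α ∷ []) → α ~ w → w ∷ β ∷ ms ++ α ∷ [] ↭ xs → Unique xs → u ∈ xs → Extension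
      detach {β} ms {α} (w~β ∷ l) α~w p uq u∈ = choose (v ~? β) (v ~? α)
        where
        uq′ : Unique (w ∷ β ∷ ms ++ α ∷ [])
        uq′ = unique-resp-↭ (↭-sym p) uq
        in-xs : ∀ {a} → a ∈ w ∷ β ∷ ms ++ α ∷ [] → a ∈ xs
        in-xs a∈ = ↭.∈-resp-↭ p a∈
        choose : Dec (v ~ β) → Dec (v ~ α) → Extension
        choose (yes v~β) _ = close (v ∷ β ∷ ms) refl (~-sym v~w ∷ v~β ∷ l) α~w
          (↭-trans (↭.swap w v ↭-refl) (↭.prep v p))
        choose _ (yes v~α) = close (β ∷ ms ++ α ∷ []) (cong (β ∷_) (sym (List.++-assoc ms (α ∷ []) (v ∷ []))))
          (linked-join (w ∷ β ∷ ms) (w~β ∷ l) (~-sym v~α ∷ [-])) v~w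
          (↭-trans (↭.↭-reflexive (sym (List.++-assoc (w ∷ β ∷ ms) (α ∷ []) (v ∷ []))))
            (↭-trans (↭.++-comm (w ∷ β ∷ ms ++ α ∷ []) (v ∷ [])) (↭.prep v p)))
        choose (no v≁β) (no v≁α) = middle (↭.∈-resp-↭ (↭-sym p) u∈)
          where
          middle : u ∈ w ∷ β ∷ ms ++ α ∷ [] → Extension
          middle (here e) = contradiction e u≢w
          middle (there (here refl)) = contradiction v~u v≁β
          middle (there (there u∈′)) with ∈-++⁻ ms u∈′
          ... | inj₂ (here refl) = contradiction v~u v≁α
          ... | inj₁ u∈ms with ∈-∃++ u∈ms
          ...   | as , bs , refl = next (v ~? c) (v ~? d)
            where
            l′ : Linked _~_ (β ∷ as ++ u ∷ bs ++ α ∷ [])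
            l′ = subst (Linked _~_) (cong (β ∷_) (List.++-assoc as (u ∷ bs) (α ∷ []))) l
            open Splice (splice as bs l′)
            uq″ : Unique ((β ∷ as) ++ u ∷ bs ++ α ∷ [])
            uq″ = subst Unique (cong (β ∷_) (List.++-assoc as (u ∷ bs) (α ∷ []))) (AllPairs.tail uq′)
            mem : ∀ {a} → a ∈ (β ∷ as) ++ u ∷ bs ++ α ∷ [] → a ∈ w ∷ β ∷ (as ++ u ∷ bs) ++ α ∷ []
            mem {a} a∈ = there (subst (a ∈_) (cong (β ∷_) (sym (List.++-assoc as (u ∷ bs) (α ∷ [])))) a∈)
            p′ : w ∷ u ∷ (β ∷ as) ++ bs ++ α ∷ [] ↭ xs
            p′ = ↭-trans (↭.prep w (↭-trans (↭-sym (↭.shift u (β ∷ as) (bs ++ α ∷ [])))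
                   (↭.↭-reflexive (cong (β ∷_) (sym (List.++-assoc as (u ∷ bs) (α ∷ []))))))) p
            around : ∀ a b → (∀ {l} → a ∷ b ∷ l ↭ v ∷ u ∷ l) → Linked _~_ (c ∷ a ∷ b ∷ d ∷ []) → Extension
            around a b q k = close ((β ∷ as) ++ a ∷ b ∷ bs) (sym (List.++-assoc (β ∷ as) (a ∷ b ∷ bs) (α ∷ [])))
              (w~β ∷ fill (a ∷ b ∷ []) k) α~w
              (↭-trans (↭.prep w (↭-trans (perm-move (β ∷ as) (a ∷ b ∷ [])) q)) (↭-trans (↭.swap w v ↭-refl) (↭.prep v p′)))
            next : Dec (v ~ c) → Dec (v ~ d) → Extension
            next (yes v~c) _ = around v u ↭-refl (~-sym v~c ∷ v~u ∷ z~d ∷ [-])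
            next _ (yes v~d) = around u v (↭.swap u v ↭-refl) (c~z ∷ ~-sym v~u ∷ v~d ∷ [-])
            next (no v≁c) (no v≁d) = reinsert (as ++ bs)
              (subst (Linked _~_) (cong (β ∷_) (sym (List.++-assoc as bs (α ∷ []))))
                (fill [] (claw (~-sym v~u) (~-sym c~z) z~d (in-xs (mem (∈-++⁺ˡ c∈))) (in-xs (mem (∈-++⁺ʳ (β ∷ as) (there d∈))))
                           v≁c v≁d (λ e → unique-++-disjoint (β ∷ as) uq″ c∈ (there (subst (_∈ bs ++ α ∷ []) (sym e) d∈))) ∷ [-])))
              (subst (λ y → w ∷ u ∷ β ∷ y ↭ xs) (sym (List.++-assoc as bs (α ∷ []))) p′) uq
              v≁β v≁α w~β (~-sym α~w)

    insert-simplicial : v ∉ xs → Unique xs → Elimination xs →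
      (∀ {a b} → a ∈ xs → b ∈ xs → v ~ a → v ~ b → a ≢ b → a ~ b) →
      (∃₂ λ a b → a ∈ xs × b ∈ xs × a ≢ b × v ~ a × v ~ b) →
      Closed C → C ↭ xs → 3 ≤ length C → Extension
    insert-simplicial v∉ uq el simplicial two closed p 3≤
      with Fin.any? (λ x → (x ∈? xs) ×-dec ¬? (v ~? x))
    ... | no all = everywhere C closed p 3≤
      where
      v~ : ∀ {x} → x ∈ xs → v ~ x
      v~ {x} x∈ = decidable-stable (v ~? x) (λ v≁x → all (x , x∈ , v≁x))
      everywhere : ∀ C → Closed C → C ↭ xs → 3 ≤ length C → Extension
      everywhere (x ∷ y ∷ C) (_ ∷ l) p _ = x ∷ v ∷ y ∷ C ,
        ~-sym (v~ (↭.∈-resp-↭ p (here refl))) ∷ v~ (↭.∈-resp-↭ p (there (here refl))) ∷ l ,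
        ↭-trans (↭.swap x v ↭-refl) (↭.prep v p)
      everywhere (_ ∷ []) _ _ (s≤s ())
    ... | yes outside with outer-neighbour (v ~?_) el simplicial two outside
    ...   | u , w , u∈ , w∈ , u≢w , v~u , v~w , z , z∈ , v≁z , z~u , z~w
            with ∈-∃++ (↭.∈-resp-↭ (↭-sym p) w∈)
    ...     | as , bs , refl = go (bs ++ as) refl
      where
      rotated : w ∷ bs ++ as ↭ xs
      rotated = ↭-trans (↭.++-comm (w ∷ bs) as) p
      go : ∀ D → D ≡ bs ++ as → Extension
      go [] e = contradiction (subst (3 ≤_) (trans (↭.↭-length (↭.++-comm as (w ∷ bs))) (cong (λ D → suc (length D)) (sym e))) 3≤) λ { (s≤s ()) }
      go (_ ∷ []) e = contradiction (subst (3 ≤_) (trans (↭.↭-length (↭.++-comm as (w ∷ bs))) (cong (λ D → suc (length D)) (sym e))) 3≤) λ { (s≤s (s≤s ())) }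
      go (β ∷ y ∷ D) e with last-view y D
      ... | ms , α , e′ = detach v∉ z∈ u≢w v~u v~w v≁z z~u z~w ms
              (linked-++ˡ (w ∷ β ∷ ms ++ α ∷ []) l) (linked-mid (w ∷ β ∷ ms) (subst (Linked _~_) (List.++-assoc (w ∷ β ∷ ms) (α ∷ []) (w ∷ [])) l))
              (subst (λ D → w ∷ D ↭ xs) (trans (sym e) (cong (β ∷_) e′)) rotated) uq u∈
        where
        l : Linked _~_ ((w ∷ β ∷ ms ++ α ∷ []) ++ w ∷ [])
        l = subst (λ D → Linked _~_ (w ∷ D ++ w ∷ [])) (trans (sym e) (cong (β ∷_) e′)) (closed-rotate as (w ∷ bs) closed)

  hamiltonian : ClawFree → ∀ {xs} → Unique xs → Elimination xs → 3 ≤ length xs → ∃ λ C → Closed C × C ↭ xs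
  hamiltonian claw-free {v ∷ xs@(_ ∷ _ ∷ _ ∷ _)} (_ ∷ uq) (add v∉ simplicial two el) _ with hamiltonian claw-free uq el (s≤s (s≤s (s≤s z≤n)))
  ... | C , closed , p = insert-simplicial claw-free v∉ uq el simplicial (two (s≤s (s≤s z≤n))) closed p
                           (subst (3 ≤_) (sym (↭.↭-length p)) (s≤s (s≤s (s≤s z≤n))))
  hamiltonian claw-free {v ∷ x ∷ y ∷ []} (_ ∷ (x≢y ∷ _) ∷ _) (add v∉ simplicial two el) _ with two (s≤s (s≤s z≤n))
  ... | a , b , here refl , here refl , a≢b , _ = contradiction refl a≢b
  ... | a , b , there (here refl) , there (here refl) , a≢b , _ = contradiction refl a≢b
  ... | a , b , here refl , there (here refl) , _ , v~x , v~y =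
    _ , v~x ∷ simplicial (here refl) (there (here refl)) v~x v~y x≢y ∷ ~-sym v~y ∷ [-] , ↭-refl
  ... | a , b , there (here refl) , here refl , _ , v~y , v~x =
    _ , v~x ∷ simplicial (here refl) (there (here refl)) v~x v~y x≢y ∷ ~-sym v~y ∷ [-] , ↭-refl
  hamiltonian claw-free {_ ∷ []} _ _ (s≤s ())
  hamiltonian claw-free {_ ∷ _ ∷ []} _ _ (s≤s (s≤s ()))

-- A Hamiltonian cycle forces 2-connectedness.

module _ {R : Rel A 0ℓ} (R-sym : ∀ {x y} → R x y → R y x) {S : Pred A 0ℓ} where

  linked-connected : ∀ {xs x y} → Linked R xs → All S xs → x ∈ xs → y ∈ xs → Star (λ a b → R a b × S a × S b) x y
  linked-connected {x ∷ xs} l s a∈ b∈ = Star.reverse (λ (e , p , q) → R-sym e , q , p) (from-head l s a∈) ◅◅ from-head l s b∈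
    where
    from-head : ∀ {x xs y} → Linked R (x ∷ xs) → All S (x ∷ xs) → y ∈ x ∷ xs → Star (λ a b → R a b × S a × S b) x y
    from-head l s (here refl) = ε
    from-head {xs = _ ∷ _} (e ∷ l) (p ∷ q ∷ s) (there y∈) = (e , p , q) ◅ from-head l (q ∷ s) y∈

-- Deleting a vertex opens the cycle into a path through all the others, so these remain connected.
hamiltonian⇒2-connected : ∀ {G : Graph n} → Connected G → (∃ λ C → IsHamiltonianCycle G C) → TwoConnected G × 3 ≤ n
hamiltonian⇒2-connected {n} {G} connected (x ∷ xs , (3≤ , uq , linked) , all∈) =
  (connected , λ v cut → cut (around v)) , ≤-trans 3≤ (unique-Fin-length uq)
  where
  open Graph G
  around : ∀ v → ConnectedOn _~_ (_≢ v)
  around v with ∈-∃++ (all∈ v)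
  ... | as , bs , e = λ y≢v z≢v → linked-connected ~-sym (opened as e linked)
          (All.tabulate (λ { w∈ refl → All.All¬⇒¬Any (AllPairs.head uq′) w∈ })) (rest y≢v) (rest z≢v)
    where
    uq′ : Unique (v ∷ bs ++ as)
    uq′ = unique-resp-↭ (↭-trans (↭.↭-reflexive e) (↭.++-comm as (v ∷ bs))) uq
    rest : ∀ {y} → y ≢ v → y ∈ bs ++ as
    rest {y} y≢v with ∈-++⁻ as (subst (y ∈_) e (all∈ y))
    ... | inj₁ p = ∈-++⁺ʳ bs p
    ... | inj₂ (here p) = contradiction p y≢v
    ... | inj₂ (there p) = ∈-++⁺ˡ p
    opened : ∀ as → x ∷ xs ≡ as ++ v ∷ bs → Linked _~_ (x ∷ xs ∷ʳ x) → Linked _~_ (bs ++ as)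
    opened [] refl l = subst (Linked _~_) (sym (List.++-identityʳ bs)) (linked-++ˡ bs (Linked.tail l))
    opened (a ∷ as) refl l = linked-join bs (Linked.tail (linked-++ʳ (a ∷ as) l′)) (linked-++ˡ (a ∷ as) l′)
      where
      l′ : Linked _~_ ((a ∷ as) ++ v ∷ bs ++ a ∷ [])
      l′ = subst (Linked _~_) (cong (a ∷_) (List.++-assoc as (v ∷ bs) (a ∷ []))) l

-- A perfect elimination order for any non-crossing model.

module Sorting {V : Set} (f : V → ℕ) where

  insertBy : V → List V → List V
  insertBy v []       = v ∷ []
  insertBy v (w ∷ ws) with f w ≤? f v
  ... | yes _ = v ∷ w ∷ ws
  ... | no  _ = w ∷ insertBy v ws

  sortBy : List V → List V
  sortBy = foldr insertBy []

  Descending : List V → Set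
  Descending = AllPairs (λ v w → f w ≤ f v)

  insertBy-↭ : ∀ v ws → insertBy v ws ↭ v ∷ ws
  insertBy-↭ v []       = ↭-refl
  insertBy-↭ v (w ∷ ws) with f w ≤? f v
  ... | yes _ = ↭-refl
  ... | no  _ = ↭-trans (↭.prep w (insertBy-↭ v ws)) (↭.swap w v ↭-refl)

  sortBy-↭ : ∀ vs → sortBy vs ↭ vs
  sortBy-↭ []       = ↭-refl
  sortBy-↭ (v ∷ vs) = ↭-trans (insertBy-↭ v (sortBy vs)) (↭.prep v (sortBy-↭ vs))

  insertBy-descending : ∀ v {ws} → Descending ws → Descending (insertBy v ws)
  insertBy-descending v [] = [] ∷ []
  insertBy-descending v {w ∷ ws} (p ∷ ps) with f w ≤? f v
  ... | yes w≤v = (w≤v ∷ All.map (λ q → ≤-trans q w≤v) p) ∷ p ∷ ps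
  ... | no w≰v  = ↭.All-resp-↭ (↭-sym (insertBy-↭ v ws)) (<⇒≤ (≰⇒> w≰v) ∷ p) ∷ insertBy-descending v ps

  sortBy-descending : ∀ vs → Descending (sortBy vs)
  sortBy-descending []       = []
  sortBy-descending (v ∷ vs) = insertBy-descending v (sortBy-descending vs)

module ModelHamiltonian {n} {G : Graph n} (M : PathTreeModel G) (nc : IsNonCrossing M)
                        (tc : TwoConnected G) (3≤n : 3 ≤ n) where
  open Graph G
  open Models M
  open NonCrossing nc
  open ClawFreeChordal G
  open DecMembership (Fin._≟_ {n}) using () renaming (_∈?_ to _∈ⱽ?_)

  private
    someVertex : Fin n
    someVertex = Fin.fromℕ< (≤-trans (s≤s z≤n) 3≤n)

    r : Fin t
    r = proj₁ (path-≢[] someVertex)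

  R : Rooting tree r
  R = rooting tree isTree r

  open Rooting R
  open Rooted R

  lowest : ∀ {xs : List (Fin t)} {x} → x ∈ xs → ∃ λ m → m ∈ xs × (∀ {z} → z ∈ xs → depth m ≤ depth z)
  lowest {y ∷ []} _ = y , here refl , λ { (here refl) → ≤-refl }
  lowest {y ∷ z ∷ xs} _ with lowest {z ∷ xs} (here refl)
  ... | m , m∈ , least with depth y ≤? depth m
  ...   | yes le = y , here refl , λ { (here refl) → ≤-refl ; (there w∈) → ≤-trans le (least w∈) }
  ...   | no ¬le = m , there m∈ , λ { (here refl) → <⇒≤ (≰⇒> ¬le) ; (there w∈) → least w∈ }

  top-of : ∀ v → ∃ λ m → v ∋ m × (∀ {z} → v ∋ z → z ≼ m)
  top-of v with lowest (proj₂ (path-≢[] v))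
  ... | m , m∈ , least = m , m∈ , top-all (path-linked v) m∈ (λ e p∈ → <⇒≱ (parent-< e) (least p∈))

  height : Fin n → ℕ
  height v = depth (proj₁ (top-of v))

  -- Adjacent vertices share a node, so their tops are comparable, and the deeper top lies between
  -- the shared node and the higher top. Listing the vertices by decreasing depth of their tops thus
  -- makes each of them simplicial among those that follow.
  earlier∋top : ∀ {a v} → a ~ v → height a ≤ height v → a ∋ proj₁ (top-of v)
  earlier∋top {a} {v} a~v le with ~⇒share a~v
  ... | z , a∋z , v∋z with ≼-chain (proj₂ (proj₂ (top-of a)) a∋z) (proj₂ (proj₂ (top-of v)) v∋z)
  ...   | inj₂ k≼m = between (path-linked a) (proj₁ (proj₂ (top-of a))) a∋z (proj₂ (proj₂ (top-of v)) v∋z) k≼m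
  ...   | inj₁ m≼k = subst (a ∋_) (≼-same-depth ε m≼k (≤-antisym le (≼-depth m≼k))) (proj₁ (proj₂ (top-of a)))

  apart : ∀ {u c p q m} → Separates (path c) m p q → u ∋ m → ¬ u ∋ p → ¬ u ∋ q → ⊥
  apart {u} (as , bs , e , inj₁ (p , q)) u∋m ¬p ¬q with nc-split {u} e p q u∋m
  ... | inj₁ x = ¬p x
  ... | inj₂ x = ¬q x
  apart {u} (as , bs , e , inj₂ (q , p)) u∋m ¬p ¬q with nc-split {u} e q p u∋m
  ... | inj₁ x = ¬q x
  ... | inj₂ x = ¬p x

  -- The three legs meet the path of the centre in three nodes. The leg that owns the middle one
  -- contains one of the outer two, since otherwise it would cross the path of the centre.
  claw-free : ClawFree
  claw-free {c} {a} {b} {d} c~a c~b c~d a≢b a≢d b≢d with a ~? b | a ~? d | b ~? d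
  ... | yes e | _ | _ = inj₁ e
  ... | no _ | yes e | _ = inj₂ (inj₁ e)
  ... | no _ | no _ | yes e = inj₂ (inj₂ e)
  ... | no a≁b | no a≁d | no b≁d with ~⇒share c~a | ~⇒share c~b | ~⇒share c~d
  ...   | x , c∋x , a∋x | y , c∋y , b∋y | z , c∋z , d∋z
      with one-separates (path c) c∋x c∋y c∋z (λ { refl → a≁b (share⇒~ a≢b a∋x b∋y) })
             (λ { refl → a≁d (share⇒~ a≢d a∋x d∋z) }) (λ { refl → b≁d (share⇒~ b≢d b∋y d∋z) })
  ...     | inj₁ s = ⊥-elim (apart {c = c} s a∋x (λ p → a≁b (share⇒~ a≢b p b∋y)) (λ p → a≁d (share⇒~ a≢d p d∋z)))
  ...     | inj₂ (inj₁ s) = ⊥-elim (apart {c = c} s b∋y (λ p → a≁b (share⇒~ a≢b a∋x p)) (λ p → b≁d (share⇒~ b≢d p d∋z)))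
  ...     | inj₂ (inj₂ s) = ⊥-elim (apart {c = c} s d∋z (λ p → a≁d (share⇒~ a≢d a∋x p)) (λ p → b≁d (share⇒~ b≢d b∋y p)))

  ConnectedWithout : List (Fin n) → Fin n → Set
  ConnectedWithout xs s = ∀ {a b} → a ∈ xs → b ∈ xs → a ≢ s → b ≢ s →
                          Star (λ x y → x ~ y × y ∈ xs × y ≢ s) a b

  -- A walk through a simplicial vertex can step directly between the two neighbours that it uses
  -- there.
  drop-simplicial : ∀ {v xs s} → v ∉ xs → (∀ {a b} → a ∈ xs → b ∈ xs → v ~ a → v ~ b → a ≢ b → a ~ b) →
                    ConnectedWithout (v ∷ xs) s → ConnectedWithout xs s
  drop-simplicial {v} {xs} {s} v∉ simplicial con a∈ b∈ a≢s b≢s = go a∈ b∈ (con (there a∈) (there b∈) a≢s b≢s)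
    where
    go : ∀ {a b} → a ∈ xs → b ∈ xs → Star (λ x y → x ~ y × y ∈ v ∷ xs × y ≢ s) a b →
         Star (λ x y → x ~ y × y ∈ xs × y ≢ s) a b
    go a∈ b∈ ε = ε
    go a∈ b∈ ((a~c , there c∈ , c≢s) ◅ w) = (a~c , c∈ , c≢s) ◅ go c∈ b∈ w
    go a∈ b∈ ((a~v , here refl , _) ◅ ε) = contradiction b∈ v∉
    go a∈ b∈ ((a~v , here refl , _) ◅ (v~d , here refl , _) ◅ w) = ⊥-elim (~-irrefl v~d)
    go {a} a∈ b∈ ((a~v , here refl , _) ◅ (_◅_ {j = d} (v~d , there d∈ , d≢s) w)) with a Fin.≟ d
    ... | yes refl = go d∈ b∈ w
    ... | no a≢d   = (simplicial a∈ d∈ (~-sym a~v) v~d a≢d , d∈ , d≢s) ◅ go d∈ b∈ w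

  -- Not being a cut-vertex yields connectedness only up to double negation. This suffices, because
  -- the existence of two neighbours is decidable.
  elimination : ∀ {xs} → Unique xs → Sorting.Descending height xs → (∀ s → ¬ ¬ ConnectedWithout xs s) → Elimination xs
  elimination {[]} _ _ _ = []
  elimination {v ∷ xs} (v∉ ∷ uq) (desc ∷ descs) con =
    add (All.All¬⇒¬Any v∉) simplicial two (elimination uq descs (λ s ¬c → con s (λ c → ¬c (drop-simplicial (All.All¬⇒¬Any v∉) simplicial c))))
    where
    simplicial : ∀ {a b} → a ∈ xs → b ∈ xs → v ~ a → v ~ b → a ≢ b → a ~ b
    simplicial a∈ b∈ v~a v~b a≢b = share⇒~ a≢b (earlier∋top (~-sym v~a) (All.lookup desc a∈)) (earlier∋top (~-sym v~b) (All.lookup desc b∈))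
    v≢ : ∀ {a} → a ∈ xs → v ≢ a
    v≢ a∈ refl = All.All¬⇒¬Any v∉ a∈
    first-step : ∀ {b s} → v ≢ b → Star (λ x y → x ~ y × y ∈ v ∷ xs × y ≢ s) v b → ∃ λ c → c ∈ xs × v ~ c × c ≢ s
    first-step v≢b ε = contradiction refl v≢b
    first-step v≢b ((v~c , here refl , _) ◅ _) = ⊥-elim (~-irrefl v~c)
    first-step v≢b ((v~c , there c∈ , c≢s) ◅ _) = _ , c∈ , v~c , c≢s
    two : 2 ≤ length xs → ∃₂ λ a b → a ∈ xs × b ∈ xs × a ≢ b × v ~ a × v ~ b
    two 2≤ with Fin.any? (λ a → Fin.any? (λ b → (a ∈ⱽ? xs) ×-dec ((b ∈ⱽ? xs) ×-dec (¬? (a Fin.≟ b) ×-dec ((v ~? a) ×-dec (v ~? b))))))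
    ... | yes found = found
    ... | no none with Fin.any? (λ a → (a ∈ⱽ? xs) ×-dec (v ~? a)) | pair xs 2≤ uq
      where
      pair : ∀ xs → 2 ≤ length xs → Unique xs → ∃₂ λ a b → a ∈ xs × b ∈ xs × a ≢ b
      pair (a ∷ b ∷ _) _ ((a≢b ∷ _) ∷ _) = a , b , here refl , there (here refl) , a≢b
      pair (_ ∷ []) (s≤s ()) _
    ...   | no ¬nbr | a , b , a∈ , b∈ , a≢b = ⊥-elim (con a (λ c →
              let (c , c∈ , v~c , _) = first-step (v≢ b∈) (c (here refl) (there b∈) (v≢ a∈) (≢-sym a≢b)) in ¬nbr (c , c∈ , v~c)))
    ...   | yes (x , x∈ , v~x) | a , b , a∈ , b∈ , a≢b = ⊥-elim (con x (λ c →
              let (y , y∈ , y≢x) = other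
                  (z , z∈ , v~z , z≢x) = first-step (v≢ y∈) (c (here refl) (there y∈) (v≢ x∈) y≢x)
              in none (x , z , x∈ , z∈ , ≢-sym z≢x , v~x , v~z)))
      where
      other : ∃ λ y → y ∈ xs × y ≢ x
      other with a Fin.≟ x
      ... | no a≢x = a , a∈ , a≢x
      ... | yes refl = b , b∈ , ≢-sym a≢b

  model-hamiltonian : ∃ λ C → IsHamiltonianCycle G C
  model-hamiltonian = go (hamiltonian claw-free uq (elimination uq (sortBy-descending (allFin n)) connected)
                         (subst (3 ≤_) (sym (trans (↭.↭-length perm) (List.length-tabulate {n = n} id))) 3≤n))
    where
    open Sorting height
    vs = sortBy (allFin n)
    perm : vs ↭ allFin n
    perm = sortBy-↭ (allFin n)
    uq : Unique vs
    uq = unique-resp-↭ (↭-sym perm) (Unique.tabulate⁺ id)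
    ∈vs : ∀ v → v ∈ vs
    ∈vs v = ↭.∈-resp-↭ (↭-sym perm) (∈-allFin v)
    connected : ∀ s → ¬ ¬ ConnectedWithout vs s
    connected s ¬c = proj₂ tc s (λ c → ¬c (λ {a} {b} _ _ a≢s b≢s → Star.map (λ (e , _ , q) → e , ∈vs _ , q) (c a≢s b≢s)))
    go : (∃ λ C → Closed C × C ↭ vs) → ∃ λ C → IsHamiltonianCycle G C
    go (C , closed , p) = C , cycle C closed p , λ v → ↭.∈-resp-↭ (↭-sym p) (∈vs v)
      where
      cycle : ∀ C → Closed C → C ↭ vs → IsCycle G C
      cycle [] _ p with ↭.∈-resp-↭ (↭-sym p) (∈vs someVertex)
      ... | ()
      cycle (x ∷ xs) l p = subst (3 ≤_) (sym (trans (↭.↭-length (↭-trans p perm)) (List.length-tabulate {n = n} id))) 3≤n ,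
                           unique-resp-↭ (↭-sym p) uq , l

-- Running programs

-- A Hoare triple with a step bound, for one concrete initial memory. The bound may overestimate, so
-- costs can be rounded up freely.
Runs : Program → Memory → ℕ → Pred Memory 0ℓ → Set
Runs P μ k Q = ∃₂ λ j ν → (P , μ ⇓[ j ] ν) × j ≤ k × Q ν

runs-weaken : ∀ {P μ k l} {Q Q′ : Pred Memory 0ℓ} → k ≤ l → (∀ {ν} → Q ν → Q′ ν) → Runs P μ k Q → Runs P μ l Q′
runs-weaken k≤l f (j , ν , ex , j≤k , q) = j , ν , ex , ≤-trans j≤k k≤l , f q

runs-skip : ∀ {μ} {Q : Pred Memory 0ℓ} → Q μ → Runs skip μ 1 Q
runs-skip q = 1 , _ , ⇓-skip , ≤-refl , q

runs-store : ∀ {b i e μ} {Q : Pred Memory 0ℓ} → Q (write b (⟦ i ⟧ μ) (⟦ e ⟧ μ) μ) → Runs (store b i e) μ 1 Q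
runs-store q = 1 , _ , ⇓-store , ≤-refl , q

runs-seq : ∀ {P P′ μ k l} {Q Q′ : Pred Memory 0ℓ} → Runs P μ k Q → (∀ {ν} → Q ν → Runs P′ ν l Q′) → Runs (P ⨟ P′) μ (k + l) Q′
runs-seq (j , ν , ex , j≤k , q) f with f q
... | j′ , ξ , ex′ , j′≤l , q′ = _ , ξ , ⇓-seq ex ex′ , +-mono-≤ j≤k j′≤l , q′

infixr 4 _then_
_then_ : ∀ {P P′ μ k l} {Q Q′ : Pred Memory 0ℓ} → Runs P μ k Q → (∀ {ν} → Q ν → Runs P′ ν l Q′) → Runs (P ⨟ P′) μ (k + l) Q′
_then_ = runs-seq

runs-store-then : ∀ {b i e P μ k} {Q : Pred Memory 0ℓ} → Runs P (write b (⟦ i ⟧ μ) (⟦ e ⟧ μ) μ) k Q →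
                  Runs (store b i e ⨟ P) μ (suc k) Q
runs-store-then {k = k} (j , ν , ex , j≤k , q) = _ , ν , ⇓-seq ⇓-store ex , s≤s j≤k , q

runs-if : ∀ {c P P′ μ k} {Q : Pred Memory 0ℓ} → (⟦ c ⟧ᵗ μ ≡ true → Runs P μ k Q) → (⟦ c ⟧ᵗ μ ≡ false → Runs P′ μ k Q) →
          Runs (if c P P′) μ (suc k) Q
runs-if {c} {μ = μ} f g with ⟦ c ⟧ᵗ μ in e
... | true  = let (j , ν , ex , le , q) = f refl in suc j , ν , ⇓-then e ex , s≤s le , q
... | false = let (j , ν , ex , le , q) = g refl in suc j , ν , ⇓-else e ex , s≤s le , q

runs-stop : ∀ {c P μ} {Q : Pred Memory 0ℓ} → ⟦ c ⟧ᵗ μ ≡ false → Q μ → Runs (while c P) μ 1 Q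
runs-stop e q = 1 , _ , ⇓-stop e , ≤-refl , q

runs-loop : ∀ {c P μ k l} {Q Q′ : Pred Memory 0ℓ} → ⟦ c ⟧ᵗ μ ≡ true → Runs P μ k Q →
            (∀ {ν} → Q ν → Runs (while c P) ν l Q′) → Runs (while c P) μ (suc (k + l)) Q′
runs-loop e (j , ν , ex , j≤k , q) f with f q
... | j′ , ξ , ex′ , j′≤l , q′ = _ , ξ , ⇓-loop e ex ex′ , s≤s (+-mono-≤ j≤k j′≤l) , q′

-- Amortised loops: every iteration is paid for by a drop of the potential.
runs-while : ∀ {c P} {S : Set} (I : S → Pred Memory 0ℓ) (potential : S → ℕ) {Q : Pred Memory 0ℓ} →
             (∀ s {μ} → I s μ →
               (⟦ c ⟧ᵗ μ ≡ false × Q μ) ⊎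
               (⟦ c ⟧ᵗ μ ≡ true × ∃ λ k → Runs P μ k (λ ν → ∃ λ s′ → I s′ ν × suc k + potential s′ ≤ potential s))) →
             ∀ s {μ} → I s μ → Runs (while c P) μ (suc (potential s)) Q
runs-while {c} {P} {S} I potential {Q} step s i = go (potential s) s ≤-refl i
  where
  go : ∀ m s {μ} → potential s ≤ m → I s μ → Runs (while c P) μ (suc (potential s)) Q
  go m s le i with step s i
  ... | inj₁ (e , q) = runs-weaken (s≤s z≤n) id (runs-stop e q)
  ... | inj₂ (e , k , j , ν , ex , j≤k , s′ , i′ , drop) with m
  ...   | zero = contradiction (≤-trans drop le) λ ()
  ...   | suc m with go m s′ (s≤s⁻¹ (≤-trans (s≤s (m≤n+m (potential s′) k)) (≤-trans drop le))) i′
  ...     | j′ , ξ , ex′ , j′≤ , q = _ , ξ , ⇓-loop e ex ex′ ,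
              s≤s (≤-trans (+-mono-≤ j≤k j′≤) (≤-trans (≤-reflexive (+-suc k (potential s′))) drop)) , q

at-same : ∀ {i j k m : ℕ} → i ≡ j → (if i ≡ᵇ j then k else m) ≡ k
at-same {i} {j} {k} {m} e = cong (if_then k else m) (T-true (≡⇒≡ᵇ i j e))
  where
  T-true : ∀ {b} → T b → b ≡ true
  T-true {true} _ = refl

at-other : ∀ {i j k m : ℕ} → i ≢ j → (if i ≡ᵇ j then k else m) ≡ m
at-other {i} {j} {k} {m} ne with i ≡ᵇ j in e
... | true  = contradiction (≡ᵇ⇒≡ i j (subst T (sym e) tt)) ne
... | false = refl

≡ᵇ-true : ∀ {i j} → (i ≡ᵇ j) ≡ true → i ≡ j
≡ᵇ-true {i} {j} e = ≡ᵇ⇒≡ i j (subst T (sym e) tt)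

≡ᵇ-false : ∀ {i j} → (i ≡ᵇ j) ≡ false → i ≢ j
≡ᵇ-false {i} {j} e q = subst T e (≡⇒≡ᵇ i j q)

true-≡ᵇ : ∀ {i j} → i ≡ j → (i ≡ᵇ j) ≡ true
true-≡ᵇ {i} {j} e with i ≡ᵇ j | ≡⇒≡ᵇ i j e
... | true | _ = refl

true-<ᵇ : ∀ {i j} → i < j → (i <ᵇ j) ≡ true
true-<ᵇ {i} {j} lt with i <ᵇ j | <⇒<ᵇ lt
... | true | _ = refl

false-<ᵇ : ∀ {i j} → j ≤ i → (i <ᵇ j) ≡ false
false-<ᵇ {i} {j} le with i <ᵇ j in e
... | false = refl
... | true  = contradiction (<ᵇ⇒< i j (subst T (sym e) tt)) (≤⇒≯ le)

-- Lists and families of lists in memory.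

data Stored (f : ℕ → ℕ) : ℕ → List (Fin k) → Set where
  []  : ∀ {i} → Stored f i ([] {A = Fin k})
  _∷_ : ∀ {i} {z : Fin k} {zs} → f i ≡ toℕ z → Stored f (suc i) zs → Stored f i (z ∷ zs)

stored-cong : ∀ {f g i} {zs : List (Fin k)} → (∀ j → j < i + length zs → f j ≡ g j) → Stored f i zs → Stored g i zs
stored-cong e [] = []
stored-cong {i = i} e (_∷_ {zs = zs} p s) =
  trans (sym (e i (m<m+n i (s≤s z≤n)))) p ∷ stored-cong (λ j lt → e j (subst (j <_) (sym (+-suc i (length zs))) lt)) s

stored-++⁻ : ∀ {f i} (as : List (Fin k)) {bs} → Stored f i (as ++ bs) → Stored f i as × Stored f (i + length as) bs
stored-++⁻ {f = f} {i} [] {bs} s = [] , subst (λ j → Stored f j bs) (sym (+-identityʳ i)) s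
stored-++⁻ {f = f} {i} (a ∷ as) {bs} (p ∷ s) with stored-++⁻ as s
... | s₁ , s₂ = p ∷ s₁ , subst (λ j → Stored f j bs) (sym (+-suc i (length as))) s₂

stored-∷ʳ : ∀ {f i} {zs : List (Fin k)} {z} → Stored f i zs → f (i + length zs) ≡ toℕ z → Stored f i (zs ∷ʳ z)
stored-∷ʳ {f = f} {i} [] e = trans (cong f (sym (+-identityʳ i))) e ∷ []
stored-∷ʳ {f = f} {i} (_∷_ {zs = zs} p s) e = p ∷ stored-∷ʳ s (trans (cong f (sym (+-suc i (length zs)))) e)

stored-applyUpTo : ∀ {f : ℕ → ℕ} {zs : List (Fin k)} i → Stored f i zs → applyUpTo (λ j → f (i + j)) (length zs) ≡ map toℕ zs
stored-applyUpTo i [] = refl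
stored-applyUpTo {f = f} i (_∷_ {zs = zs} p s) = cong₂ _∷_ (trans (cong f (+-identityʳ i)) p)
  (trans (applyUpTo-cong (λ j → cong f (+-suc i j)) (length zs)) (stored-applyUpTo (suc i) s))
  where
  applyUpTo-cong : ∀ {g h : ℕ → ℕ} → (∀ j → g j ≡ h j) → ∀ m → applyUpTo g m ≡ applyUpTo h m
  applyUpTo-cong e zero    = refl
  applyUpTo-cong e (suc m) = cong₂ _∷_ (e 0) (applyUpTo-cong (e ∘ suc) m)

cell-++ : ∀ as {bs} j → cell (as ++ bs) (length as + j) ≡ cell bs j
cell-++ []       j = refl
cell-++ (a ∷ as) j = cell-++ as j

cell-stored : ∀ (as : List ℕ) (zs : List (Fin k)) {bs} → Stored (cell (as ++ map toℕ zs ++ bs)) (length as) zs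
cell-stored as [] = []
cell-stored as (z ∷ zs) {bs} =
  trans (cong (cell (as ++ map toℕ (z ∷ zs) ++ bs)) (sym (+-identityʳ (length as)))) (cell-++ as 0) ∷
  subst₂ (λ l i → Stored (cell l) i zs) (List.++-assoc as (toℕ z ∷ []) _)
    (trans (List.length-++ as) (+-comm (length as) 1)) (cell-stored (as ∷ʳ toℕ z) zs)

cell-starts : ∀ a xss yss → cell (Scans.scanl _+_ a (map length (xss ++ yss))) (length xss) ≡ a + length (concat {A = ℕ} xss)
cell-starts a []         []        = sym (+-identityʳ a)
cell-starts a []         (ys ∷ yss) = sym (+-identityʳ a)
cell-starts a (xs ∷ xss) yss = trans (cell-starts (a + length xs) xss yss)
  (trans (+-assoc a (length xs) _) (cong (a +_) (sym (List.length-++ xs))))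

allFin-split : ∀ {A : Set} (f : Fin k → A) x → ∃₂ λ as bs → tabulate f ≡ as ++ f x ∷ bs × length as ≡ toℕ x
allFin-split f zero    = [] , _ , refl , refl
allFin-split f (suc x) with allFin-split (f ∘ suc) x
... | as , bs , e , e′ = f zero ∷ as , bs , cong (f zero ∷_) e , cong suc e′

-- The end of a list is read off as the start at the next index; for the last list this is the total
-- length, which the input stores as well.
Family : (starts entries : ℕ → ℕ) → (Fin k → List (Fin m)) → Set
Family starts entries f = ∀ x → starts (suc (toℕ x)) ≡ starts (toℕ x) + length (f x) ×
                                Stored entries (starts (toℕ x)) (f x)

familyBanks-family : ∀ (f : Fin k → List (Fin m)) →
                     Family (cell (Scans.scanl _+_ 0 (map length (map (map toℕ ∘ f) (allFin k)))))
                            (cell (concat (map (map toℕ ∘ f) (allFin k)))) f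
familyBanks-family {k} f x with allFin-split {k} id x
... | as , bs , e , e′ = subst
  (λ l → starts l (suc (toℕ x)) ≡ starts l (toℕ x) + length (f x) ×
         Stored (cell (concat (map g l))) (starts l (toℕ x)) (f x))
  (sym e) (step , subst₂ (λ l i → Stored (cell l) i (f x)) concat-≡ (sym start)
    (cell-stored (concat (map g as)) (f x)))
  where
  g = map toℕ ∘ f
  starts : List (Fin k) → ℕ → ℕ
  starts l = cell (Scans.scanl _+_ 0 (map length (map g l)))
  concat-≡ : concat (map g as) ++ g x ++ concat (map g bs) ≡ concat (map g (as ++ x ∷ bs))
  concat-≡ = trans (List.concat-++ (map g as) (map g (x ∷ bs))) (cong concat (sym (List.map-++ g as (x ∷ bs))))
  start : starts (as ++ x ∷ bs) (toℕ x) ≡ length (concat (map g as))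
  start = trans (cong₂ (λ l i → cell (Scans.scanl _+_ 0 (map length l)) i) (List.map-++ g as (x ∷ bs)) (trans (sym e′) (sym (List.length-map g as))))
                (cell-starts 0 (map g as) (map g (x ∷ bs)))
  next : starts (as ++ x ∷ bs) (suc (toℕ x)) ≡ length (concat (map g (as ∷ʳ x)))
  next = trans (cong₂ (λ l i → cell (Scans.scanl _+_ 0 (map length l)) i)
           (trans (cong (map g) (sym (List.++-assoc as (x ∷ []) bs))) (List.map-++ g (as ∷ʳ x) bs))
           (trans (cong suc (sym e′)) (trans (trans (+-comm 1 (length as)) (sym (List.length-++ as))) (sym (List.length-map g (as ∷ʳ x))))))
           (cell-starts 0 (map g (as ∷ʳ x)) (map g bs))
  step : starts (as ++ x ∷ bs) (suc (toℕ x)) ≡ starts (as ++ x ∷ bs) (toℕ x) + length (f x)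
  step = trans next (trans (cong length (trans (cong concat (List.map-++ g as (x ∷ []))) (sym (List.concat-++ (map g as) (g x ∷ [])))))
    (trans (List.length-++ (concat (map g as))) (cong₂ _+_ (sym start)
      (trans (cong length (List.++-identityʳ (g x))) (List.length-map toℕ (f x))))))

-- Scalars and arrays of the program; banks 0 to 6 hold the input, bank 7 the output.

pattern nodeᵛ    = 8
pattern parentᵛ  = 9
pattern posᵛ     = 10
pattern foundᵛ   = 11
pattern endᵛ     = 12
pattern itemᵛ    = 13
pattern topᵛ     = 14
pattern counterᵛ = 15
pattern vertexᵛ  = 16
pattern lowestᵛ  = 17
pattern secondᵛ  = 18
pattern keyᵛ     = 19
pattern headᵛ    = 20
pattern movedᵛ   = 21
pattern anchorᵛ  = 22
pattern outᵛ     = 23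
pattern sideᵛ    = 24
pattern parentᵃ  = 30
pattern rankᵃ    = 31
pattern kindᵃ    = 32
pattern valueᵃ   = 33
pattern singlesᵃ = 34
pattern groupᵃ   = 35
pattern nextᵃ    = 36
pattern keyᵃ     = 37

var : ℕ → Expr
var b = read b (lit 0)

set : ℕ → Expr → Program
set b e = store b (lit 0) e

forEach : ℕ → Program → Program
forEach bank body =
  while (var posᵛ ≺ var endᵛ)
    (set itemᵛ (read bank (var posᵛ)) ⨟ (body ⨟ set posᵛ (succ (var posᵛ))))

-- `J` is indexed by the entries still to come, which ties the position in memory to the recursion
-- on the list.
module ForEach (bank : ℕ) {k : ℕ} (body : Program) (B : ℕ)
  (J : List (Fin k) → Pred Memory 0ℓ)
  (J-item : ∀ {zs μ} m → J zs μ → J zs (write itemᵛ 0 m μ))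
  (J-pos  : ∀ {zs μ} m → J zs μ → J zs (write posᵛ 0 m μ))
  (bank-item : ∀ μ m j → write itemᵛ 0 m μ bank j ≡ μ bank j)
  (bank-pos  : ∀ μ m j → write posᵛ 0 m μ bank j ≡ μ bank j)
  (Q : Pred Memory 0ℓ)
  (Q-item : ∀ {μ} m → Q μ → Q (write itemᵛ 0 m μ))
  (Q-pos  : ∀ {μ} m → Q μ → Q (write posᵛ 0 m μ))
  (body-runs : ∀ {z zs μ} → J (z ∷ zs) μ → μ itemᵛ 0 ≡ toℕ z →
    Runs body μ B (λ ν → J zs ν × ν posᵛ 0 ≡ μ posᵛ 0 × ν endᵛ 0 ≡ μ endᵛ 0 × (∀ j → ν bank j ≡ μ bank j) × (Q μ → Q ν)))
  where

  -- Q is a property of the memory that every run of the body preserves.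
  forEach-runs : ∀ {zs i e μ} → Stored (μ bank) i zs → μ posᵛ 0 ≡ i → μ endᵛ 0 ≡ e → e ∸ i ≡ length zs → J zs μ → Q μ →
                 Runs (forEach bank body) μ (suc (length zs * (3 + B))) (λ ν → J [] ν × Q ν × (∀ j → ν bank j ≡ μ bank j))
  forEach-runs {[]} {i} {e} {μ} _ ei ee len j q = runs-stop (false-<ᵇ (subst₂ _≤_ (sym ee) (sym ei) (m∸n≡0⇒m≤n len))) (j , q , λ _ → refl)
  forEach-runs {z ∷ zs} {i} {e} {μ} (p ∷ s) ei ee len j q =
    runs-weaken (s≤s (≤-reflexive arith)) id (runs-loop (true-<ᵇ (subst₂ _<_ (sym ei) (sym ee) i<e))
      (runs-store-then (body-runs (J-item _ j) (trans (cong (μ bank) ei) p) then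
        λ {ν} (j′ , pos , end , same , keep) → runs-store {posᵛ} {lit 0} {succ (var posᵛ)} {ν}
          {λ ξ → J zs ξ × ξ posᵛ 0 ≡ suc i × ξ endᵛ 0 ≡ e × (∀ j → ξ bank j ≡ μ bank j) × Q ξ}
          (J-pos _ j′ , cong suc (trans pos ei) , trans end ee ,
           (λ j → trans (bank-pos ν _ j) (trans (same j) (bank-item μ _ j))) , Q-pos _ (keep (Q-item _ q)))))
      (λ { {ν} (j′ , pos , end , same , q′) →
        runs-weaken ≤-refl (λ (a , b , same′) → a , b , λ j → trans (same′ j) (same j))
          (forEach-runs (stored-cong (λ j _ → sym (same j)) s) pos end
            (trans (sym (pred[m∸n]≡m∸[1+n] e i)) (cong pred len)) j′ q′) }))
    where
    i<e : i < e
    i<e = ≰⇒> (λ e≤i → case trans (sym (m≤n⇒m∸n≡0 e≤i)) len of λ ())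
    arith : suc (B + 1) + suc (length zs * (3 + B)) ≡ 3 + B + length zs * (3 + B)
    arith = trans (cong suc (+-suc (B + 1) _)) (cong (λ m → suc (suc (m + length zs * (3 + B)))) (+-comm B 1))

findLoop : Program
findLoop =
  while (var posᵛ ≺ var endᵛ)
    (if (read 4 (var posᵛ) ≐ var parentᵛ) (set foundᵛ (var posᵛ)) skip ⨟ set posᵛ (succ (var posᵛ)))

-- Runs the body for the children of a node in cyclic order, starting after its
-- parent; no neighbour is the parent of the root.
forKids : Program → Program
forKids body =
  set parentᵛ (read parentᵃ (var nodeᵛ)) ⨟
  set posᵛ (read 3 (var nodeᵛ)) ⨟
  set endᵛ (read 3 (succ (var nodeᵛ))) ⨟
  set foundᵛ (var endᵛ) ⨟
  findLoop ⨟
  set posᵛ (succ (var foundᵛ)) ⨟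
  forEach 4 body ⨟
  set posᵛ (read 3 (var nodeᵛ)) ⨟
  set endᵛ (var foundᵛ) ⨟
  forEach 4 body

-- Nodes are numbered below `t`, so `t` can stand for an absent node; the program reads it from bank
-- 0.
code : ∀ {t} → Maybe (Fin t) → ℕ
code {t} nothing  = t
code     (just p) = toℕ p

-- Wherever this module is used, the closure conditions on `J` are met by the identity: bank numbers
-- are literals, so a write to one bank disappears by computation from what is read in another.
module ForKids {t : ℕ} (body : Program) (B : ℕ)
  (J : List (Fin t) → Pred Memory 0ℓ)
  (J-item   : ∀ {zs μ} m → J zs μ → J zs (write itemᵛ 0 m μ))
  (J-pos    : ∀ {zs μ} m → J zs μ → J zs (write posᵛ 0 m μ))
  (J-end    : ∀ {zs μ} m → J zs μ → J zs (write endᵛ 0 m μ))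
  (J-found  : ∀ {zs μ} m → J zs μ → J zs (write foundᵛ 0 m μ))
  (J-parent : ∀ {zs μ} m → J zs μ → J zs (write parentᵛ 0 m μ))
  where

  Same : Rel Memory 0ℓ
  Same μ ν = ν posᵛ 0 ≡ μ posᵛ 0 × ν endᵛ 0 ≡ μ endᵛ 0 × ν foundᵛ 0 ≡ μ foundᵛ 0 × ν nodeᵛ 0 ≡ μ nodeᵛ 0 ×
             (∀ j → ν 3 j ≡ μ 3 j) × (∀ j → ν 4 j ≡ μ 4 j)

  BodyRuns : Set
  BodyRuns = ∀ {z zs μ} → J (z ∷ zs) μ → μ itemᵛ 0 ≡ toℕ z → Runs body μ B (λ ν → J zs ν × Same μ ν)

  -- The content of `foundᵛ` after the search: the last matching position, or the default `f` if
  -- there is none.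
  findPos : ℕ → List (Fin t) → ℕ → ℕ → ℕ
  findPos c []       i f = f
  findPos c (z ∷ zs) i f = findPos c zs (suc i) (if toℕ z ≡ᵇ c then i else f)

  findPos-absent : ∀ {c zs} i {f} → (∀ {z} → z ∈ zs → toℕ z ≢ c) → findPos c zs i f ≡ f
  findPos-absent {zs = []} i ne = refl
  findPos-absent {c} {z ∷ zs} i {f} ne with toℕ z ≡ᵇ c in e
  ... | true  = contradiction (≡ᵇ-true e) (ne (here refl))
  ... | false = findPos-absent (suc i) (ne ∘ there)

  findPos-present : ∀ {p bs} as i {f} → p ∉ bs → findPos (toℕ p) (as ++ p ∷ bs) i f ≡ i + length as
  findPos-present {p} {bs} [] i {f} p∉ rewrite true-≡ᵇ {toℕ p} refl =
    trans (findPos-absent (suc i) (λ z∈ e → p∉ (subst (_∈ bs) (Fin.toℕ-injective e) z∈))) (sym (+-identityʳ i))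
  findPos-present (a ∷ as) i p∉ = trans (findPos-present as (suc i) p∉) (sym (+-suc i (length as)))

  find-runs : ∀ {zs ks i e c f μ} (K : Pred Memory 0ℓ) → (∀ {ν} m → K ν → K (write posᵛ 0 m ν)) →
              (∀ {ν} m → K ν → K (write foundᵛ 0 m ν)) →
              Stored (μ 4) i zs → μ posᵛ 0 ≡ i → μ endᵛ 0 ≡ e → e ≡ i + length zs → μ parentᵛ 0 ≡ c → μ foundᵛ 0 ≡ f →
              J ks μ → K μ →
              Runs findLoop μ (suc (length zs * 4)) (λ ν → J ks ν × K ν × ν endᵛ 0 ≡ e × ν foundᵛ 0 ≡ findPos c zs i f × (∀ j → ν 4 j ≡ μ 4 j))
  find-runs {[]} {i = i} K kp kf s ei ee len ec ef j k =
    runs-stop (false-<ᵇ (≤-reflexive (trans ee (trans len (trans (+-identityʳ i) (sym ei)))))) (j , k , ee , ef , λ _ → refl)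
  find-runs {z ∷ zs} {ks} {i} {e} {c} {f} {μ} K kp kf (p ∷ s) ei ee len ec ef j k =
    runs-loop (true-<ᵇ (subst₂ _<_ (sym ei) (sym (trans ee len)) (m<m+n i (s≤s z≤n))))
      (runs-if {Q = Next}
        (λ t → runs-store {b = foundᵛ} {e = var posᵛ} {Q = Next} (J-found _ j , kf _ k , ei , ee , ec ,
                  trans ei (sym (at (trans (cong (_≡ᵇ c) (sym at-z)) (trans (cong (μ 4 (μ posᵛ 0) ≡ᵇ_) (sym ec)) t)))) , λ _ → refl))
        (λ t → runs-skip {Q = Next} (j , k , ei , ee , ec ,
                  trans ef (sym (at (trans (cong (_≡ᵇ c) (sym at-z)) (trans (cong (μ 4 (μ posᵛ 0) ≡ᵇ_) (sym ec)) t)))) , λ _ → refl))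
       then λ {ν} (j′ , k′ , ei′ , ee′ , ec′ , ef′ , same) → runs-store {b = posᵛ} {e = succ (var posᵛ)} {Q = Loop}
         (J-pos _ j′ , kp _ k′ , cong suc ei′ , ee′ , ec′ , ef′ , same))
      (λ (j′ , k′ , ei′ , ee′ , ec′ , ef′ , same) →
        runs-weaken ≤-refl (λ (a , b , c , d , same′) → a , b , c , d , λ q → trans (same′ q) (same q))
          (find-runs K kp kf (stored-cong (λ q _ → sym (same q)) s) ei′ ee′ (trans len (+-suc i (length zs))) ec′ ef′ j′ k′))
    where
    f′ = if toℕ z ≡ᵇ c then i else f
    at-z : μ 4 (μ posᵛ 0) ≡ toℕ z
    at-z = trans (cong (μ 4) ei) p
    at : ∀ {b} → (toℕ z ≡ᵇ c) ≡ b → f′ ≡ (if b then i else f)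
    at = cong (if_then i else f)
    Next Loop : Pred Memory 0ℓ
    Next ν = J ks ν × K ν × ν posᵛ 0 ≡ i × ν endᵛ 0 ≡ e × ν parentᵛ 0 ≡ c × ν foundᵛ 0 ≡ f′ × (∀ j → ν 4 j ≡ μ 4 j)
    Loop ν = J ks ν × K ν × ν posᵛ 0 ≡ suc i × ν endᵛ 0 ≡ e × ν parentᵛ 0 ≡ c × ν foundᵛ 0 ≡ f′ × (∀ j → ν 4 j ≡ μ 4 j)

  module _ (body-runs : BodyRuns) where

    private
      each : ∀ rest s x {zs i e f μ} → Stored (μ 4) i zs → μ posᵛ 0 ≡ i → μ endᵛ 0 ≡ e → e ∸ i ≡ length zs →
             J (zs ++ rest) μ → μ foundᵛ 0 ≡ f × μ nodeᵛ 0 ≡ x × μ 3 x ≡ s →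
             Runs (forEach 4 body) μ (suc (length zs * (3 + B)))
               (λ ν → J rest ν × (ν foundᵛ 0 ≡ f × ν nodeᵛ 0 ≡ x × ν 3 x ≡ s) × (∀ j → ν 4 j ≡ μ 4 j))
      each rest s x {f = f} = ForEach.forEach-runs 4 body B (λ zs → J (zs ++ rest)) J-item J-pos (λ _ _ _ → refl) (λ _ _ _ → refl)
        (λ ν → ν foundᵛ 0 ≡ f × ν nodeᵛ 0 ≡ x × ν 3 x ≡ s) (λ _ q → q) (λ _ q → q)
        (λ j e → runs-weaken ≤-refl (λ (j′ , pos , end , found , node , three , four) →
          j′ , pos , end , four , λ (a , b , c) → trans found a , trans node b , trans (three x) c) (body-runs j e))

      parts-run : ∀ {as bs x s f e μ} → Stored (μ 4) s as → Stored (μ 4) (suc f) bs → e ∸ suc f ≡ length bs → f ≡ s + length as →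
              J (bs ++ as) μ → μ nodeᵛ 0 ≡ x → μ 3 x ≡ s → μ foundᵛ 0 ≡ f → μ endᵛ 0 ≡ e →
              Runs (set posᵛ (succ (var foundᵛ)) ⨟ forEach 4 body ⨟ set posᵛ (read 3 (var nodeᵛ)) ⨟ set endᵛ (var foundᵛ) ⨟ forEach 4 body)
                μ (5 + (length as + length bs) * (3 + B)) (J [])
      parts-run {as} {bs} {x} {s} {f} {e} {μ} sa sb len-b ef j node start found end =
        runs-weaken (≤-reflexive (cost (length as) (length bs) B)) id
          (runs-store-then (each as s x sb (cong suc found) end len-b (J-pos _ j) (found , node , start) then
            λ {ν} (j′ , (found′ , node′ , start′) , same) → runs-store-then (runs-store-then
              (runs-weaken ≤-refl proj₁ (each [] s x {zs = as} {i = s} {e = f} (stored-cong (λ q _ → sym (same q)) sa)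
                (trans (cong (ν 3) node′) start′) found′ (trans (cong (_∸ s) ef) (m+n∸m≡n s (length as)))
                (subst (λ l → J l _) (sym (List.++-identityʳ as)) (J-end _ (J-pos _ j′))) (found′ , node′ , start′))))))
        where
        cost : ∀ a b c → suc (suc (b * (3 + c)) + suc (suc (suc (a * (3 + c))))) ≡ 5 + (a + b) * (3 + c)
        cost = solve-∀

    forKids-runs : ∀ {order : Fin t → List (Fin t)} {x m μ} → Unique (order x) → (∀ {p} → m ≡ just p → p ∈ order x) →
                   Family (μ 3) (μ 4) order → μ nodeᵛ 0 ≡ toℕ x → μ parentᵃ (toℕ x) ≡ code m → J (rotation m (order x)) μ →
                   Runs (forKids body) μ (10 + length (order x) * (7 + B)) (J [])
    forKids-runs {order} {x} {m} {μ} uq present family node parent j =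
      runs-weaken le id (runs-store-then (runs-store-then (runs-store-then (runs-store-then
        (find-runs {zs = order x} K (λ _ z → z) (λ _ z → z) (proj₂ (family x)) (cong (μ 3) node) end₀ (proj₁ (family x))
          (trans (cong (μ parentᵃ) node) parent) end₀ (J-found _ (J-end _ (J-pos _ (J-parent _ j)))) (node , refl)
         then λ (j′ , (node′ , start) , end , found , four) → go m refl j′ node′ start end found four)))))
      where
      s = μ 3 (toℕ x)
      e = μ 3 (suc (toℕ x))
      K : Pred Memory 0ℓ
      K ν = ν nodeᵛ 0 ≡ toℕ x × ν 3 (toℕ x) ≡ s
      end₀ : μ 3 (suc (μ nodeᵛ 0)) ≡ e
      end₀ = cong (λ i → μ 3 (suc i)) node
      go : ∀ m′ → m ≡ m′ → ∀ {ν} → J (rotation m (order x)) ν → ν nodeᵛ 0 ≡ toℕ x → ν 3 (toℕ x) ≡ s → ν endᵛ 0 ≡ e →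
           ν foundᵛ 0 ≡ findPos (code m) (order x) s e → (∀ q → ν 4 q ≡ μ 4 q) →
           Runs (set posᵛ (succ (var foundᵛ)) ⨟ forEach 4 body ⨟ set posᵛ (read 3 (var nodeᵛ)) ⨟ set endᵛ (var foundᵛ) ⨟ forEach 4 body)
                ν (5 + length (order x) * (3 + B)) (J [])
      -- At the root nothing is found and the default, the end of the list, survives: the first pass
      -- starts behind the end and is empty, the second runs over the whole list.
      go nothing refl {ν} j node start end found four =
        runs-weaken (≤-reflexive (cong (λ l → 5 + l * (3 + B)) (+-identityʳ (length (order x))))) id
          (parts-run {order x} {[]} (stored-cong (λ q _ → sym (four q)) (proj₂ (family x))) [] (m≤n⇒m∸n≡0 (n≤1+n e)) (proj₁ (family x))
            j node start
            (trans found (findPos-absent {zs = order x} s (λ {z} _ q → <⇒≢ (Fin.toℕ<n z) q))) end)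
      go (just p) refl {ν} j node start end found four =
        runs-weaken (+-monoʳ-≤ 5 (*-monoˡ-≤ (3 + B) (≤-trans (+-monoʳ-≤ (length (before p (order x))) (n≤1+n _)) (≤-reflexive (sym length-≡))))) id
          (parts-run {before p (order x)} {after p (order x)}
            (stored-cong (λ q _ → sym (four q)) (proj₁ halves)) (tail-stored (proj₂ halves)) len refl j node start
            (trans found (trans (cong (λ l → findPos (toℕ p) l s e) around) (findPos-present (before p (order x)) s p∉))) end)
        where
        around = before-after (present refl)
        uq′ : Unique (before p (order x) ++ p ∷ after p (order x))
        uq′ = subst Unique around uq
        p∉ : p ∉ after p (order x)
        p∉ = All.All¬⇒¬Any (AllPairs.head (unique-++ʳ (before p (order x)) uq′))
        halves = stored-++⁻ (before p (order x)) (subst (Stored (μ 4) s) around (proj₂ (family x)))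
        tail-stored : ∀ {i} → Stored (μ 4) i (p ∷ after p (order x)) → Stored (ν 4) (suc i) (after p (order x))
        tail-stored (_ ∷ st) = stored-cong (λ q _ → sym (four q)) st
        length-≡ : length (order x) ≡ length (before p (order x)) + suc (length (after p (order x)))
        length-≡ = trans (cong length around) (List.length-++ (before p (order x)))
        len : e ∸ suc (s + length (before p (order x))) ≡ length (after p (order x))
        len = trans (cong (_∸ suc (s + length (before p (order x))))
                (trans (proj₁ (family x)) (trans (cong (s +_) length-≡)
                  (trans (sym (+-assoc s _ _)) (+-suc (s + length (before p (order x))) _)))))
                (m+n∸m≡n (suc (s + length (before p (order x)))) (length (after p (order x))))
      le : 4 + (suc (length (order x) * 4) + (5 + length (order x) * (3 + B))) ≤ 10 + length (order x) * (7 + B)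
      le = ≤-reflexive (cost (length (order x)) B)
        where
        cost : ∀ l b → 4 + (suc (l * 4) + (5 + l * (3 + b))) ≡ 10 + l * (7 + b)
        cost = solve-∀

-- The program

-- The degree of a node is the difference of two consecutive starts, so the loop stops at the first
-- node of degree at most one.
findLeaf : Program
findLeaf = while (succ (read 3 (var nodeᵛ)) ≺ read 3 (succ (var nodeᵛ))) (set nodeᵛ (succ (var nodeᵛ)))

rankKid : Program
rankKid =
  set counterᵛ (succ (var counterᵛ)) ⨟
  store rankᵃ (var itemᵛ) (var counterᵛ) ⨟
  store parentᵃ (var itemᵛ) (var nodeᵛ) ⨟
  store valueᵃ (var topᵛ) (var itemᵛ) ⨟
  set topᵛ (succ (var topᵛ))

rankAll : Program
rankAll =
  while (lit 0 ≺ var topᵛ)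
    (set topᵛ (prec (var topᵛ)) ⨟
     set nodeᵛ (read valueᵃ (var topᵛ)) ⨟
     set counterᵛ (read rankᵃ (var nodeᵛ)) ⨟
     forKids rankKid)

pattern rootᵛ = 25

rankTree : Program
rankTree =
  set rootᵛ (var nodeᵛ) ⨟
  store parentᵃ (var nodeᵛ) (read 0 (lit 1)) ⨟
  store rankᵃ (var nodeᵛ) (lit 0) ⨟
  store valueᵃ (lit 0) (var nodeᵛ) ⨟
  set topᵛ (lit 1) ⨟
  rankAll

-- Ranking the nodes, with amortised cost.

module Weights {n t} {T : Graph t} {r} (R : Rooting T r) (L : PlaneLayout T) (path : Fin n → List (Fin t)) where
  open Rooting R
  open PlaneLayout L
  open Tour path r parent depth (kidsTable parent order)
  open LayoutFacts R L path
  open LayoutNodes R L path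

  -- Pays a for every node of the subtree and b for every edge of it.
  weight : ℕ → ℕ → Fin t → ℕ
  weight a b x = a * length (nodes x) + b * length (below x)

  -- The balance of a depth-first search: the weight of a node pays for visiting it and handling its
  -- children, and leaves each child its own weight.
  weight-≡ : ∀ a b x → weight a b x ≡ a + b * length (kids x) + sum (map (weight a b) (kids x))
  weight-≡ a b x = trans (cong (λ l → a * length l + b * length (below x)) (nodes-≡ x))
    (trans (go (kids x)) refl)
    where
    step : ∀ a b p q k s → a * suc p + b * p ≡ a + b * k + s →
           a * suc (suc q + p) + b * (suc q + p) ≡ a + b * suc k + (a * suc q + b * q + s)
    step a b p q k s e = trans (lhs a b p q) (trans (cong (λ m → m + (a * suc q + b * q + b)) e) (rhs a b q k s))
      where
      lhs : ∀ a b p q → a * suc (suc q + p) + b * (suc q + p) ≡ (a * suc p + b * p) + (a * suc q + b * q + b)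
      lhs = solve-∀
      rhs : ∀ a b q k s → (a + b * k + s) + (a * suc q + b * q + b) ≡ a + b * suc k + (a * suc q + b * q + s)
      rhs = solve-∀
    go : ∀ ks → a * suc (length (concatMap nodes ks)) + b * length (concatMap nodes ks) ≡ a + b * length ks + sum (map (weight a b) ks)
    go [] = base a b
      where
      base : ∀ a b → a * 1 + b * 0 ≡ a + b * 0 + 0
      base = solve-∀
    go (c ∷ ks) = trans (cong (λ m → a * suc m + b * m) (trans (List.length-++ (nodes c)) (cong (_+ length (concatMap nodes ks)) len)))
      (trans (step a b (length (concatMap nodes ks)) (length (below c)) (length ks) _ (go ks))
        (cong (λ m → a + b * suc (length ks) + (a * m + b * length (below c) + sum (map (weight a b) ks))) (sym len)))
      where
      len : length (nodes c) ≡ suc (length (below c))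
      len = cong length (nodes-≡ c)

  weight-root : ∀ a b → weight a b r ≤ (a + b) * t
  weight-root a b = ≤-trans (+-monoʳ-≤ _ (*-monoʳ-≤ b (≤-trans (n≤1+n _) (≤-reflexive (cong length (sym (nodes-≡ r)))))))
    (≤-trans (≤-reflexive (sym (*-distribʳ-+ (length (nodes r)) a b))) (*-monoʳ-≤ (a + b) (length-nodes r)))

  length-order : ∀ x → length (order x) ≤ suc (length (kids x))
  length-order x = go (parent x) refl
    where
    go : ∀ m → parent x ≡ m → length (order x) ≤ suc (length (kids x))
    go nothing e = ≤-trans (≤-reflexive (cong length (sym (order-root e)))) (n≤1+n _)
    go (just p) e = ≤-reflexive (↭.↭-length (order-↭ e))

-- A stack is kept with its bottom in cell 0.
Stack : ∀ {k} → (ℕ → ℕ) → List (Fin k) → Set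
Stack f []       = ⊤
Stack f (z ∷ zs) = f (length zs) ≡ toℕ z × Stack f zs

stack-cong : ∀ {k f g} (zs : List (Fin k)) → (∀ j → j < length zs → f j ≡ g j) → Stack f zs → Stack g zs
stack-cong []       e _       = tt
stack-cong (z ∷ zs) e (p , s) = trans (sym (e _ ≤-refl)) p , stack-cong zs (λ j lt → e j (m≤n⇒m≤1+n lt)) s

module Machine {n} {G : Graph n} (M : PathTreeModel G) {r} (R : Rooting (PathTreeModel.tree M) r)
               (L : PlaneLayout (PathTreeModel.tree M)) where
  open Models M
  open Rooting R
  open Rooted R
  open PlaneLayout L
  open HomeFacts M R L
  open LayoutNodes R L path
  open Weights R L path

  Static : Pred Memory 0ℓ
  Static μ = μ 0 0 ≡ n × μ 0 1 ≡ t × Family (μ 3) (μ 4) order × Family (μ 5) (μ 6) path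

  Fresh : Pred Memory 0ℓ
  Fresh μ = (∀ j → μ singlesᵃ j ≡ 0) × (∀ j → μ groupᵃ j ≡ 0)

  findLeaf-runs : length (order r) ≤ 1 → (∀ x → toℕ x < toℕ r → 2 ≤ length (order x)) →
                  ∀ {μ} → Static μ → Fresh μ → μ nodeᵛ 0 ≡ 0 →
                  Runs findLeaf μ (1 + 2 * t) (λ ν → (Static ν × Fresh ν) × ν nodeᵛ 0 ≡ toℕ r)
  findLeaf-runs short long s f node =
    runs-weaken (s≤s (*-monoʳ-≤ 2 (<⇒≤ (Fin.toℕ<n r)))) id (go (toℕ r) 0 refl s f node)
    where
    go : ∀ k i → i + k ≡ toℕ r → ∀ {μ} → Static μ → Fresh μ → μ nodeᵛ 0 ≡ i →
         Runs findLeaf μ (1 + 2 * k) (λ ν → (Static ν × Fresh ν) × ν nodeᵛ 0 ≡ toℕ r)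
    go zero i e {μ} s@(_ , _ , layout , _) f node = runs-stop
      (false-<ᵇ (≤-trans (≤-reflexive (trans (cong (λ i → μ 3 (suc i)) node′) (proj₁ (layout r))))
        (≤-trans (+-monoʳ-≤ _ short) (≤-reflexive (trans (+-comm _ 1) (cong (λ i → suc (μ 3 i)) (sym node′))))))) ((s , f) , node′)
      where
      node′ : μ nodeᵛ 0 ≡ toℕ r
      node′ = trans node (trans (sym (+-identityʳ i)) e)
    go (suc k) i e {μ} s@(_ , _ , layout , _) f node = runs-weaken (≤-reflexive (cost k)) id
      (runs-loop (true-<ᵇ (≤-trans (s≤s (≤-reflexive (trans (cong (λ i → suc (μ 3 i)) node′) (sym (+-comm _ 1)))))
          (≤-trans (≤-reflexive (sym (+-suc _ 1))) (≤-trans (+-monoʳ-≤ _ (long x x<r))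
            (≤-reflexive (trans (sym (proj₁ (layout x))) (cong (λ i → μ 3 (suc i)) (sym node′))))))))
        (runs-store {nodeᵛ} {lit 0} {succ (var nodeᵛ)} {Q = λ ν → (Static ν × Fresh ν) × ν nodeᵛ 0 ≡ suc i} ((s , f) , cong suc node))
        (λ ((s′ , f′) , node″) → go k (suc i) (trans (sym (+-suc i k)) e) s′ f′ node″))
      where
      i<r : i < toℕ r
      i<r = subst (i <_) e (m<m+n i (s≤s z≤n))
      x : Fin t
      x = Fin.fromℕ< (<-trans i<r (Fin.toℕ<n r))
      x≡ : toℕ x ≡ i
      x≡ = Fin.toℕ-fromℕ< (<-trans i<r (Fin.toℕ<n r))
      x<r : toℕ x < toℕ r
      x<r = subst (_< toℕ r) (sym x≡) i<r
      node′ : μ nodeᵛ 0 ≡ toℕ x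
      node′ = trans node (sym x≡)
      cost : ∀ k → suc (1 + (1 + 2 * k)) ≡ 1 + 2 * suc k
      cost = solve-∀

  Correct : Memory → Pred (Fin t) 0ℓ
  Correct μ x = μ parentᵃ (toℕ x) ≡ code (parent x) × μ rankᵃ (toℕ x) ≡ rank x

  Base : Pred Memory 0ℓ
  Base μ = Static μ × Fresh μ × μ rootᵛ 0 ≡ toℕ r

  -- Progress of the search without a list of visited nodes: a node is done, or strictly below a
  -- node on the stack, or below a child not yet pushed. When stack and children are exhausted, only
  -- the first case remains.
  Covered : Memory → List (Fin t) → List (Fin t) → Fin t → Set
  Covered μ st ks y = Correct μ y ⊎ (∃ λ z → z ∈ st × y ≼ z × y ≢ z) ⊎ (∃ λ c → c ∈ ks × y ≼ c)

  StackInv : List (Fin t) → List (Fin t) → Pred Memory 0ℓ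
  StackInv st ks μ = Base μ × μ topᵛ 0 ≡ length st × Stack (μ valueᵃ) st ×
                     (∀ {z} → z ∈ st → Correct μ z) × (∀ y → Covered μ st ks y)

  -- One round of `rankAll` costs 14 steps and 12 more for each neighbour of the node. One neighbour
  -- may be the parent, which gives 26, and 12 per child.
  wt : Fin t → ℕ
  wt = weight 26 12

  potential : List (Fin t) → ℕ
  potential zs = sum (map wt zs)

  -- `ds` are the children already pushed. The counter started from the rank of `x` and has grown by
  -- one for each of them, so it holds the rank of the last.
  KidsInv : Fin t → ℕ → List (Fin t) → Pred Memory 0ℓ
  KidsInv x budget ks μ = ∃₂ λ ds st → kids x ≡ ds ++ ks × StackInv st ks μ × μ nodeᵛ 0 ≡ toℕ x ×
                          μ counterᵛ 0 ≡ rank x + length ds × potential st + potential ks ≤ budget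

  module RankKids (x : Fin t) (budget : ℕ) where
    open ForKids {t} rankKid 5 (KidsInv x budget) (λ _ j → j) (λ _ j → j) (λ _ j → j) (λ _ j → j) (λ _ j → j) public

    rankKid-runs : BodyRuns
    rankKid-runs {c} {ks} {μ} (ds , st , eq , (base , top , stack , correct , covered) , node , counter , pot) item =
      runs-store-then (runs-store-then (runs-store-then (runs-store-then (runs-store
        ((ds ∷ʳ c , c ∷ st , trans eq (sym (List.++-assoc ds (c ∷ []) ks)) ,
          (base , cong suc top , (trans (at-same top) item , stack-cong st (λ j lt → sym (at-other (λ e → <⇒≢ lt (sym (trans (sym top) e))))) stack) ,
           (λ { (here refl) → new ; (there z∈) → old (correct z∈) }) , λ y → cover y (covered y)) ,
          node , trans (cong suc counter) (trans (sym (+-suc (rank x) (length ds)))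
            (cong (rank x +_) (trans (+-comm 1 (length ds)) (sym (List.length-++ ds))))) ,
          ≤-trans (≤-reflexive (shuffle (wt c) (potential st) (potential ks))) pot) ,
         refl , refl , refl , refl , (λ _ → refl) , (λ _ → refl))))))
      where
      parent-c : parent c ≡ just x
      parent-c = ∈-kids⁻ (subst (c ∈_) (sym eq) (∈-insert ds))
      rank-c : suc (μ counterᵛ 0) ≡ rank c
      rank-c = trans (cong suc counter) (trans (sym (+-suc (rank x) (length ds)))
        (trans (cong (λ m → rank x + suc m) (sym (trans (cong (index c) eq)
          (index-≡ ds (λ c∈ → unique-++-disjoint ds (subst Unique eq (unique-kids x)) c∈ (here refl))))))
        (sym (rank-kid parent-c))))
      ν : Memory
      ν = write topᵛ 0 (suc (μ topᵛ 0)) (write valueᵃ (μ topᵛ 0) (μ itemᵛ 0)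
            (write parentᵃ (μ itemᵛ 0) (μ nodeᵛ 0) (write rankᵃ (μ itemᵛ 0) (suc (μ counterᵛ 0)) (write counterᵛ 0 (suc (μ counterᵛ 0)) μ))))
      new : Correct ν c
      new = trans (at-same item) (trans node (cong code (sym parent-c))) , trans (at-same item) rank-c
      old : ∀ {y} → Correct μ y → Correct ν y
      old {y} ok with y Fin.≟ c
      ... | yes refl = new
      ... | no y≢c = trans (at-other ne) (proj₁ ok) , trans (at-other ne) (proj₂ ok)
        where
        ne : μ itemᵛ 0 ≢ toℕ y
        ne e = y≢c (Fin.toℕ-injective (trans (sym e) item))
      cover : ∀ y → Covered μ st (c ∷ ks) y → Covered ν (c ∷ st) ks y
      cover y (inj₁ ok) = inj₁ (old ok)
      cover y (inj₂ (inj₁ (z , z∈ , p))) = inj₂ (inj₁ (z , there z∈ , p))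
      cover y (inj₂ (inj₂ (d , there d∈ , p))) = inj₂ (inj₂ (d , d∈ , p))
      cover y (inj₂ (inj₂ (d , here refl , p))) with y Fin.≟ c
      ... | yes refl = inj₁ new
      ... | no y≢c = inj₂ (inj₁ (c , here refl , p , y≢c))
      shuffle : ∀ a b c → a + b + c ≡ b + (a + c)
      shuffle = solve-∀

  rankAll-runs : ∀ st {μ} → StackInv st [] μ →
                 Runs rankAll μ (suc (potential st)) (λ ν → Base ν × (∀ x → Correct ν x))
  rankAll-runs = runs-while (λ st → StackInv st []) potential step
    where
    step : ∀ st {μ} → StackInv st [] μ → _ ⊎ _
    step [] {μ} (base , top , _ , _ , covered) = inj₁ (false-<ᵇ (≤-reflexive top) , base , λ x → done (covered x))
      where
      done : ∀ {x} → Covered μ [] [] x → Correct μ x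
      done (inj₁ ok) = ok
      done (inj₂ (inj₁ (_ , () , _)))
      done (inj₂ (inj₂ (_ , () , _)))
    step (x ∷ st) {μ} (base@((_ , _ , layout , _) , _) , top , (at , stack) , correct , covered) =
      inj₂ (true-<ᵇ (subst (0 <_) (sym top) (s≤s z≤n)) , _ ,
        runs-weaken {Q = KidsInv x budget []} ≤-refl (λ {ν} → finish {ν})
          (runs-store-then (runs-store-then (runs-store-then
            (RankKids.forKids-runs x budget (RankKids.rankKid-runs x budget) {order} {x} {parent x} (unique x)
              (λ e → Equivalence.from (neighbours x _) (parent-edge e)) layout node (proj₁ ok)
              (subst (λ ks → KidsInv x budget ks popped) kids-rotation
                ([] , st , refl , (base , cong pred top , stack , correct ∘ there , λ y → cover y (covered y)) , node ,
                 trans (trans (cong (μ rankᵃ) node) (proj₂ ok)) (sym (+-identityʳ (rank x))) , ≤-refl)))))))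
      where
      budget : ℕ
      budget = potential st + potential (kids x)
      popped : Memory
      popped = write counterᵛ 0 (μ rankᵃ (μ valueᵃ (pred (μ topᵛ 0))))
                 (write nodeᵛ 0 (μ valueᵃ (pred (μ topᵛ 0))) (write topᵛ 0 (pred (μ topᵛ 0)) μ))
      ok = correct (here refl)
      node : μ valueᵃ (pred (μ topᵛ 0)) ≡ toℕ x
      node = trans (cong (λ i → μ valueᵃ (pred i)) top) at
      kids-rotation : kids x ≡ rotation (parent x) (order x)
      kids-rotation = Vec.lookup∘tabulate _ x
      cover : ∀ y → Covered μ (x ∷ st) [] y → Covered μ st (kids x) y
      cover y (inj₁ p) = inj₁ p
      cover y (inj₂ (inj₁ (z , there z∈ , p))) = inj₂ (inj₁ (z , z∈ , p))
      cover y (inj₂ (inj₁ (z , here refl , y≼x , y≢x))) with kid-towards y≼x y≢x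
      ... | c , e , y≼c = inj₂ (inj₂ (c , ∈-kids⁺ e , y≼c))
      finish : ∀ {ν} → KidsInv x budget [] ν → ∃ λ st′ → StackInv st′ [] ν ×
               suc (3 + (10 + length (order x) * 12)) + potential st′ ≤ wt x + potential st
      finish (_ , st′ , _ , inv , _ , _ , pot) = st′ , inv , (begin
        14 + length (order x) * 12 + potential st′ ≤⟨ +-mono-≤ (+-monoʳ-≤ 14 (*-monoˡ-≤ 12 (length-order x)))
            (≤-trans (≤-reflexive (sym (+-identityʳ _))) pot) ⟩
        14 + suc (length (kids x)) * 12 + budget   ≡⟨ arith (length (kids x)) (potential st) (potential (kids x)) ⟩
        26 + 12 * length (kids x) + potential (kids x) + potential st ≡⟨ cong (_+ potential st) (sym (weight-≡ 26 12 x)) ⟩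
        wt x + potential st ∎)
        where
        open ≤-Reasoning
        arith : ∀ k s p → 14 + suc k * 12 + (s + p) ≡ 26 + 12 * k + p + s
        arith = solve-∀

  rankTree-runs : ∀ {μ} → Static μ → Fresh μ → μ nodeᵛ 0 ≡ toℕ r →
                  Runs rankTree μ (6 + 38 * t) (λ ν → Base ν × (∀ x → Correct ν x))
  rankTree-runs {μ} s@(_ , t≡ , _) f node = runs-weaken
    (+-monoʳ-≤ 6 (≤-trans (≤-reflexive (+-identityʳ _)) (weight-root 26 12))) id
    (runs-store-then (runs-store-then (runs-store-then (runs-store-then (runs-store-then
      (rankAll-runs (r ∷ []) ((s , f , node) , refl , (node , tt) ,
        (λ { (here refl) → root-ok }) , λ y → cover y)))))))
    where
    root-ok : (if μ nodeᵛ 0 ≡ᵇ toℕ r then μ 0 1 else μ parentᵃ (toℕ r)) ≡ code (parent r) ×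
              (if μ nodeᵛ 0 ≡ᵇ toℕ r then 0 else μ rankᵃ (toℕ r)) ≡ rank r
    root-ok = trans (at-same node) (trans t≡ (cong code (sym parent-root))) , trans (at-same node) (sym rank-root)
      where
      rank-root : rank r ≡ 0
      rank-root with depth r
      ... | zero = refl
      ... | suc k with parent r | parent-root
      ...   | nothing | _ = refl
    cover : ∀ y → _ ⊎ _
    cover y with y Fin.≟ r
    ... | yes refl = inj₁ root-ok
    ... | no y≢r = inj₂ (inj₁ (r , here refl , ≼-root y , y≢r))

-- Distributing the vertices over nodes and edges.

scanNode : Program
scanNode =
  if (read rankᵃ (var itemᵛ) ≺ read rankᵃ (var lowestᵛ))
     (set secondᵛ (var lowestᵛ) ⨟ set lowestᵛ (var itemᵛ))
     (if (var secondᵛ ≐ read 0 (lit 1))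
         (set secondᵛ (var itemᵛ))
         (if (read rankᵃ (var itemᵛ) ≺ read rankᵃ (var secondᵛ)) (set secondᵛ (var itemᵛ)) skip)) ⨟
  if (var keyᵛ ≺ read rankᵃ (var itemᵛ)) (set keyᵛ (read rankᵃ (var itemᵛ))) skip

addSingle : Program
addSingle =
  store nextᵃ (var vertexᵛ) (read singlesᵃ (var lowestᵛ)) ⨟
  store singlesᵃ (var lowestᵛ) (succ (var vertexᵛ))

-- A new vertex that becomes the head inherits the tail of the old head, which is then out of the
-- list and must be placed second; otherwise the new vertex itself must be.
placeHead : Program
placeHead =
  if (read keyᵃ (var headᵛ) ≺ read keyᵃ (var vertexᵛ))
     (store nextᵃ (var vertexᵛ) (read nextᵃ (var headᵛ)) ⨟
      store groupᵃ (var secondᵛ) (succ (var vertexᵛ)) ⨟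
      set movedᵛ (var headᵛ) ⨟
      set headᵛ (var vertexᵛ))
     (set movedᵛ (var vertexᵛ))

-- The anchor is the vertex behind which the moved one goes: the head, or the present second vertex
-- if its key is smaller than that of the moved one.
placeSecond : Program
placeSecond =
  set anchorᵛ (var headᵛ) ⨟
  if (read nextᵃ (var headᵛ) ≐ lit 0) skip
     (if (read keyᵃ (prec (read nextᵃ (var headᵛ))) ≺ read keyᵃ (var movedᵛ))
         (set anchorᵛ (prec (read nextᵃ (var headᵛ)))) skip) ⨟
  store nextᵃ (var movedᵛ) (read nextᵃ (var anchorᵛ)) ⨟
  store nextᵃ (var anchorᵛ) (succ (var movedᵛ))

addGroup : Program
addGroup =
  set headᵛ (read groupᵃ (var secondᵛ)) ⨟
  if (var headᵛ ≐ lit 0)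
     (store nextᵃ (var vertexᵛ) (lit 0) ⨟ store groupᵃ (var secondᵛ) (succ (var vertexᵛ)))
     (set headᵛ (prec (var headᵛ)) ⨟ placeHead ⨟ placeSecond)

addVertex : Program
addVertex =
  set posᵛ (read 5 (var vertexᵛ)) ⨟
  set endᵛ (read 5 (succ (var vertexᵛ))) ⨟
  set lowestᵛ (read 6 (var posᵛ)) ⨟
  set secondᵛ (read 0 (lit 1)) ⨟
  set keyᵛ (read rankᵃ (var lowestᵛ)) ⨟
  set posᵛ (succ (var posᵛ)) ⨟
  forEach 6 scanNode ⨟
  store keyᵃ (var vertexᵛ) (var keyᵛ) ⨟
  if (var secondᵛ ≐ read 0 (lit 1)) addSingle addGroup ⨟
  set vertexᵛ (succ (var vertexᵛ))

groupVertices : Program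
groupVertices =
  set vertexᵛ (lit 0) ⨟
  while (var vertexᵛ ≺ read 0 (lit 0)) addVertex

-- Linked lists: a link is 0 at the end and otherwise the successor of an entry.
LinkedList : ∀ {k} → (ℕ → ℕ) → ℕ → List (Fin k) → Set
LinkedList next h []       = h ≡ 0
LinkedList next h (v ∷ vs) = h ≡ suc (toℕ v) × LinkedList next (next (toℕ v)) vs

linkedList-cong : ∀ {k} {next next′ : ℕ → ℕ} {h} (vs : List (Fin k)) → (∀ {v} → v ∈ vs → next′ (toℕ v) ≡ next (toℕ v)) →
                  LinkedList next h vs → LinkedList next′ h vs
linkedList-cong []       e p = p
linkedList-cong {next = next} {next′} (v ∷ vs) e (p , l) =
  p , subst (λ h → LinkedList next′ h vs) (sym (e (here refl))) (linkedList-cong vs (e ∘ there) l)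

-- The links after the two stores that end `placeSecond`, with the later store outermost.
insertAfter : ℕ → ℕ → (ℕ → ℕ) → ℕ → ℕ
insertAfter a u next j = if a ≡ᵇ j then suc u else (if u ≡ᵇ j then next a else next j)

insertAfter-other : ∀ {k} {a u : ℕ} next {v : Fin k} → toℕ v ≢ a → toℕ v ≢ u → insertAfter a u next (toℕ v) ≡ next (toℕ v)
insertAfter-other next va vu = trans (at-other (≢-sym va)) (at-other (≢-sym vu))

insertAfter-list : ∀ {k} {next : ℕ → ℕ} {h} {a u : Fin k} bs → Unique (a ∷ bs) → u ∉ a ∷ bs → LinkedList next h (a ∷ bs) →
                   LinkedList (insertAfter (toℕ a) (toℕ u) next) h (a ∷ u ∷ bs)
insertAfter-list {next = next} {a = a} {u} bs (a∉ ∷ _) u∉ (p , l) = p , at-same {toℕ a} refl ,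
  subst (λ h → LinkedList (insertAfter (toℕ a) (toℕ u) next) h bs) (sym at-u)
    (linkedList-cong bs (λ {v} v∈ → insertAfter-other next {v = v} (λ e → All.All¬⇒¬Any a∉ (subst (_∈ bs) (Fin.toℕ-injective e) v∈))
      (λ e → u∉ (there (subst (_∈ bs) (Fin.toℕ-injective e) v∈)))) l)
  where
  at-u : insertAfter (toℕ a) (toℕ u) next (toℕ u) ≡ next (toℕ a)
  at-u = trans (at-other {toℕ a} {toℕ u} (λ e → u∉ (here (sym (Fin.toℕ-injective e))))) (at-same {toℕ u} refl)

module Buckets {n} {G : Graph n} (M : PathTreeModel G) {r} (R : Rooting (PathTreeModel.tree M) r)
               (L : PlaneLayout (PathTreeModel.tree M)) where
  open Models M
  open Rooting R
  open PlaneLayout L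
  open HomeFacts M R L
  open Machine M R L
  open Scan

  Ready : Pred Memory 0ℓ
  Ready μ = (Static μ × μ rootᵛ 0 ≡ toℕ r) × (∀ x → Correct μ x)

  Singles : List (Fin n) → Pred Memory 0ℓ
  Singles vs μ = ∀ x → LinkedList (μ nextᵃ) (μ singlesᵃ (toℕ x)) (singlesIn vs x)

  GroupAt : Memory → Fin t → List (Fin n) → Set
  GroupAt μ c g = LinkedList (μ nextᵃ) (μ groupᵃ (toℕ c)) g

  Keys : List (Fin n) → Pred Memory 0ℓ
  Keys vs μ = ∀ {u} → u ∈ vs → μ keyᵃ (toℕ u) ≡ keyOf u

  Filled : List (Fin n) → Pred Memory 0ℓ
  Filled vs μ = Ready μ × Singles vs μ × (∀ c → GroupAt μ c (groupIn vs c)) × Keys vs μ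

  ∈-groupIn⁻ : ∀ {vs c v} → v ∈ groupIn vs c → v ∈ vs × home v ≡ inj₂ c
  ∈-groupIn⁻ {vs} {c} v∈ = ∈-filter⁻ (λ v → home v ≟ʰ inj₂ c) {xs = vs} (↭.∈-resp-↭ (foldr-insert-↭ _) v∈)

  ∈-singlesIn⁻ : ∀ {vs x v} → v ∈ singlesIn vs x → v ∈ vs × home v ≡ inj₁ x
  ∈-singlesIn⁻ {vs} {x} v∈ = ∈-filter⁻ (λ v → home v ≟ʰ inj₁ x) {xs = vs} v∈

  unique-groupIn : ∀ {vs} c → Unique vs → Unique (groupIn vs c)
  unique-groupIn c u = unique-resp-↭ (↭-sym (foldr-insert-↭ _)) (AllPairs.filter⁺ (λ v → home v ≟ʰ inj₂ c) u)

  singlesIn-yes : ∀ {v vs x} → home v ≡ inj₁ x → singlesIn (v ∷ vs) x ≡ v ∷ singlesIn vs x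
  singlesIn-yes {x = x} = List.filter-accept (λ v → home v ≟ʰ inj₁ x)

  singlesIn-no : ∀ {v vs x} → home v ≢ inj₁ x → singlesIn (v ∷ vs) x ≡ singlesIn vs x
  singlesIn-no {x = x} = List.filter-reject (λ v → home v ≟ʰ inj₁ x)

  groupIn-yes : ∀ {v vs c} → home v ≡ inj₂ c → groupIn (v ∷ vs) c ≡ insert v (groupIn vs c)
  groupIn-yes {c = c} e = cong (foldr insert []) (List.filter-accept (λ v → home v ≟ʰ inj₂ c) e)

  groupIn-no : ∀ {v vs c} → home v ≢ inj₂ c → groupIn (v ∷ vs) c ≡ groupIn vs c
  groupIn-no {c = c} ne = cong (foldr insert []) (List.filter-reject (λ v → home v ≟ʰ inj₂ c) ne)

  Scanned : Scan → Pred Memory 0ℓ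
  Scanned s μ = μ lowestᵛ 0 ≡ toℕ (lowest s) × μ secondᵛ 0 ≡ code (second s) × μ keyᵛ 0 ≡ key s

  module _ {v : Fin n} {vs : List (Fin n)} where

    Pending : Pred Memory 0ℓ
    Pending μ = Filled vs μ × μ vertexᵛ 0 ≡ toℕ v

    ScanInv : Scan → List (Fin t) → Pred Memory 0ℓ
    ScanInv final ks μ = ∃ λ s → foldl scanStep s ks ≡ final × Scanned s μ × Pending μ

    scanNode-runs : ∀ {final c ks μ} → ScanInv final (c ∷ ks) μ → μ itemᵛ 0 ≡ toℕ c →
      Runs scanNode μ 6 (λ ν → ScanInv final ks ν × ν posᵛ 0 ≡ μ posᵛ 0 × ν endᵛ 0 ≡ μ endᵛ 0 × (∀ j → ν 6 j ≡ μ 6 j) × (⊤ → ⊤))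
    scanNode-runs {final} {c} {ks} {μ} (s@(scanned a b k) , fold , (low , sec , ky) , pending@((((static , _) , ok) , _) , _)) item =
      runs-if {Q = Mid}
        (λ e → runs-weaken (s≤s (s≤s z≤n)) id (runs-store-then {Q = Mid} (runs-store {Q = Mid}
          (trans item (cong (λ b → toℕ (if b then c else a)) (sym (tested e))) ,
           trans low (cong (λ x → code (if x then just a else scanSecond b c)) (sym (tested e))) , ky , item , pending , refl , refl , λ _ → refl))))
        (λ e → other b sec refl (tested e))
      then λ {ν} mid → updateKey mid
      where
      tested : ∀ {x} → (μ rankᵃ (μ itemᵛ 0) <ᵇ μ rankᵃ (μ lowestᵛ 0)) ≡ x → (rank c <ᵇ rank a) ≡ x
      tested e = trans (sym (cong₂ _<ᵇ_ (trans (cong (μ rankᵃ) item) (proj₂ (ok c))) (trans (cong (μ rankᵃ) low) (proj₂ (ok a))))) e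
      Mid Goal : Pred Memory 0ℓ
      Mid ν = ν lowestᵛ 0 ≡ toℕ (if rank c <ᵇ rank a then c else a) ×
              ν secondᵛ 0 ≡ code (if rank c <ᵇ rank a then just a else scanSecond b c) ×
              ν keyᵛ 0 ≡ k × ν itemᵛ 0 ≡ toℕ c × Pending ν × ν posᵛ 0 ≡ μ posᵛ 0 × ν endᵛ 0 ≡ μ endᵛ 0 × (∀ j → ν 6 j ≡ μ 6 j)
      Goal ν = ScanInv final ks ν × ν posᵛ 0 ≡ μ posᵛ 0 × ν endᵛ 0 ≡ μ endᵛ 0 × (∀ j → ν 6 j ≡ μ 6 j) × (⊤ → ⊤)
      keep : (rank c <ᵇ rank a) ≡ false → μ lowestᵛ 0 ≡ toℕ (if rank c <ᵇ rank a then c else a)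
      keep e = trans low (cong (λ b → toℕ (if b then c else a)) (sym e))
      pass : ∀ {m} b → (rank c <ᵇ rank a) ≡ false → m ≡ code (scanSecond b c) → m ≡ code (if rank c <ᵇ rank a then just a else scanSecond b c)
      pass b e p = trans p (cong (λ x → code (if x then just a else scanSecond b c)) (sym e))
      none : μ 0 1 ≡ t
      none = proj₁ (proj₂ static)
      other : ∀ b′ → μ secondᵛ 0 ≡ code b′ → b ≡ b′ → (rank c <ᵇ rank a) ≡ false →
              Runs (if (var secondᵛ ≐ read 0 (lit 1)) (set secondᵛ (var itemᵛ))
                     (if (read rankᵃ (var itemᵛ) ≺ read rankᵃ (var secondᵛ)) (set secondᵛ (var itemᵛ)) skip)) μ 3 Mid
      other nothing sec refl e = runs-if {Q = Mid}
        (λ _ → runs-weaken (s≤s z≤n) id (runs-store {Q = Mid} (keep e , pass nothing e item , ky , item , pending , refl , refl , λ _ → refl)))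
        (λ e′ → contradiction (trans sec (sym none)) (≡ᵇ-false e′))
      other (just d) sec refl e = runs-if {Q = Mid}
        (λ e′ → contradiction (trans (sym sec) (trans (≡ᵇ-true e′) none)) (<⇒≢ (Fin.toℕ<n d)))
        (λ _ → runs-if {Q = Mid}
          (λ e′ → runs-store {Q = Mid} (keep e , pass (just d) e (trans item (cong (λ x → code (if x then just c else just d)) (sym (tested′ e′)))) ,
                    ky , item , pending , refl , refl , λ _ → refl))
          (λ e′ → runs-skip {Q = Mid} (keep e , pass (just d) e (trans sec (cong (λ x → code (if x then just c else just d)) (sym (tested′ e′)))) ,
                    ky , item , pending , refl , refl , λ _ → refl)))
        where
        tested′ : ∀ {x} → (μ rankᵃ (μ itemᵛ 0) <ᵇ μ rankᵃ (μ secondᵛ 0)) ≡ x → (rank c <ᵇ rank d) ≡ x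
        tested′ q = trans (sym (cong₂ _<ᵇ_ (trans (cong (μ rankᵃ) item) (proj₂ (ok c))) (trans (cong (μ rankᵃ) sec) (proj₂ (ok d))))) q
      updateKey : ∀ {ν} → Mid ν → Runs (if (var keyᵛ ≺ read rankᵃ (var itemᵛ)) (set keyᵛ (read rankᵃ (var itemᵛ))) skip) ν 2 Goal
      updateKey {ν} (low′ , sec′ , ky′ , item′ , pending′@((((_ , ok′) , _)) , _) , pos , end , same) = runs-if {Q = Goal}
        (λ e → runs-store {Q = Goal} ((scanStep s c , fold , (low′ , sec′ ,
            trans rank-c (cong (λ x → if x then rank c else k) (sym (tested″ e)))) , pending′) , pos , end , same , id))
        (λ e → runs-skip {Q = Goal} ((scanStep s c , fold , (low′ , sec′ ,
            trans ky′ (cong (λ x → if x then rank c else k) (sym (tested″ e)))) , pending′) , pos , end , same , id))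
        where
        rank-c : ν rankᵃ (ν itemᵛ 0) ≡ rank c
        rank-c = trans (cong (ν rankᵃ) item′) (proj₂ (ok′ c))
        tested″ : ∀ {x} → (ν keyᵛ 0 <ᵇ ν rankᵃ (ν itemᵛ 0)) ≡ x → (k <ᵇ rank c) ≡ x
        tested″ q = trans (sym (cong₂ _<ᵇ_ ky′ rank-c)) q

    scan-runs : ∀ {x xs i μ} → path v ≡ x ∷ xs → Stored (μ 6) i xs → μ posᵛ 0 ≡ i → μ endᵛ 0 ≡ i + length xs →
                Scanned (scanned x nothing (rank x)) μ → Pending μ →
                Runs (forEach 6 scanNode) μ (suc (length xs * 9)) (λ ν → Scanned (scan (path v)) ν × Pending ν)
    scan-runs {x} {xs} {i} {μ} e st pos end sc pending = runs-weaken {Q = Out} ≤-refl (λ {ν} → finish {ν})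
      (ForEach.forEach-runs 6 scanNode 6 (ScanInv (scan (path v))) (λ _ j → j) (λ _ j → j) (λ _ _ _ → refl) (λ _ _ _ → refl)
        (λ _ → ⊤) (λ _ q → q) (λ _ q → q) (λ {z} {zs} {μ} j item → scanNode-runs {scan (path v)} {z} {zs} {μ} j item) st pos end (m+n∸m≡n i (length xs))
        (scanned x nothing (rank x) , sym (cong scan e) , sc , pending) tt)
      where
      Out : Pred Memory 0ℓ
      Out ν = ScanInv (scan (path v)) [] ν × ⊤ × (∀ j → ν 6 j ≡ μ 6 j)
      finish : ∀ {ν} → Out ν → Scanned (scan (path v)) ν × Pending ν
      finish ((s , refl , sc , pending) , _) = sc , pending

    module _ (v∉ : v ∉ vs) (uq : Unique vs) where

      Added : Pred Memory 0ℓ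
      Added μ = Filled (v ∷ vs) μ × μ vertexᵛ 0 ≡ toℕ v

      Prepared : Pred Memory 0ℓ
      Prepared μ = Ready μ × Singles vs μ × (∀ c → GroupAt μ c (groupIn vs c)) × Keys (v ∷ vs) μ × μ vertexᵛ 0 ≡ toℕ v

      differs : ∀ {u w : Fin n} {h} → home u ≡ h → home w ≢ h → toℕ w ≢ toℕ u
      differs {u} e ne q = ne (trans (cong home (Fin.toℕ-injective q)) e)

      not-v : ∀ {w} → w ∈ vs → toℕ v ≢ toℕ w
      not-v w∈ e = v∉ (subst (_∈ vs) (sym (Fin.toℕ-injective e)) w∈)

      addSingle-runs : ∀ {a μ} → home v ≡ inj₁ a → μ lowestᵛ 0 ≡ toℕ a → Prepared μ → Runs addSingle μ 2 Added
      addSingle-runs {a} {μ} h low (ready , singles , groups , keys , vx) =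
        runs-store-then (runs-store {Q = Added} ((ready , singles′ , groups′ , keys) , vx))
        where
        link : ∀ {w} → w ∈ vs → (if μ vertexᵛ 0 ≡ᵇ toℕ w then μ singlesᵃ (μ lowestᵛ 0) else μ nextᵃ (toℕ w)) ≡ μ nextᵃ (toℕ w)
        link w∈ = at-other (λ e → not-v w∈ (trans (sym vx) e))
        next′ : ℕ → ℕ
        next′ j = if μ vertexᵛ 0 ≡ᵇ j then μ singlesᵃ (μ lowestᵛ 0) else μ nextᵃ j
        singles′ : ∀ x → LinkedList next′ (if μ lowestᵛ 0 ≡ᵇ toℕ x then suc (μ vertexᵛ 0) else μ singlesᵃ (toℕ x)) (singlesIn (v ∷ vs) x)
        singles′ x with x Fin.≟ a
        ... | yes refl rewrite singlesIn-yes {v} {vs} h = trans (at-same low) (cong suc vx) ,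
                subst (λ h → LinkedList next′ h (singlesIn vs x)) (sym (trans (at-same vx) (cong (μ singlesᵃ) low)))
                  (linkedList-cong (singlesIn vs x) (λ w∈ → link (proj₁ (∈-singlesIn⁻ w∈))) (singles x))
        ... | no x≢a rewrite singlesIn-no {v} {vs} {x} (λ q → x≢a (Sum.inj₁-injective (trans (sym q) h))) =
                subst (λ h → LinkedList next′ h (singlesIn vs x)) (sym (at-other (λ e → x≢a (sym (Fin.toℕ-injective (trans (sym low) e))))))
                  (linkedList-cong (singlesIn vs x) (λ w∈ → link (proj₁ (∈-singlesIn⁻ w∈))) (singles x))
        groups′ : ∀ c → LinkedList next′ (μ groupᵃ (toℕ c)) (groupIn (v ∷ vs) c)
        groups′ c rewrite groupIn-no {v} {vs} {c} (λ q → case trans (sym h) q of λ ()) =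
          linkedList-cong (groupIn vs c) (λ w∈ → link (proj₁ (∈-groupIn⁻ w∈))) (groups c)

      module _ {c : Fin t} (h : home v ≡ inj₂ c) where

        -- Only the group of `c` is under change, and `g` describes its present content; all other
        -- lists are still those for `vs`.
        Around : List (Fin n) → Pred Memory 0ℓ
        Around g μ = Ready μ × Singles vs μ × (∀ d → d ≢ c → GroupAt μ d (groupIn vs d)) × GroupAt μ c g ×
                     Keys (v ∷ vs) μ × μ vertexᵛ 0 ≡ toℕ v

        around⇒added : ∀ {g μ} → g ≡ groupIn (v ∷ vs) c → Around g μ → Added μ
        around⇒added {g} {μ} e (ready , singles , groups , group-c , keys , vx) =
          (ready , (λ x → subst (LinkedList (μ nextᵃ) (μ singlesᵃ (toℕ x))) (sym (singlesIn-no {v} {vs} {x} (λ q → case trans (sym h) q of λ ()))) (singles x)) ,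
           groups′ , keys) , vx
          where
          groups′ : ∀ d → GroupAt μ d (groupIn (v ∷ vs) d)
          groups′ d with d Fin.≟ c
          ... | yes refl = subst (GroupAt μ d) e group-c
          ... | no d≢c = subst (GroupAt μ d) (sym (groupIn-no {v} {vs} (λ q → d≢c (Sum.inj₂-injective (trans (sym q) h))))) (groups d d≢c)

        single-≢ : ∀ {w x} → w ∈ singlesIn vs x → home w ≢ inj₂ c
        single-≢ {w} {x} w∈ q = case trans (sym (proj₂ (∈-singlesIn⁻ {vs} {x} w∈))) q of λ ()

        group-≢ : ∀ {w d} → d ≢ c → w ∈ groupIn vs d → home w ≢ inj₂ c
        group-≢ {w} {d} d≢c w∈ q = d≢c (Sum.inj₂-injective (trans (sym (proj₂ (∈-groupIn⁻ {vs} {d} w∈))) q))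

        -- The head `f` is final; `u` is outside the stored list and remains to be put into its tail
        -- `rest`.
        Halfway : Pred Memory 0ℓ
        Halfway μ = ∃₂ λ f u → ∃ λ rest → f ∷ insertSecond u rest ≡ insert v (groupIn vs c) × Around (f ∷ rest) μ ×
                    μ headᵛ 0 ≡ toℕ f × μ movedᵛ 0 ≡ toℕ u × Unique (f ∷ rest) × u ∉ f ∷ rest ×
                    (∀ {w} → w ∈ u ∷ f ∷ rest → w ∈ v ∷ vs × home w ≡ inj₂ c)

        placeHead-runs : ∀ {f rest μ} → groupIn vs c ≡ f ∷ rest → μ headᵛ 0 ≡ toℕ f → μ secondᵛ 0 ≡ toℕ c →
                         Around (f ∷ rest) μ → Runs placeHead μ 5 Halfway
        placeHead-runs {f} {rest} {μ} e hd sec (ready , singles , groups , (p , l) , keys , vx) = runs-if {Q = Halfway}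
          (λ q → runs-store-then (runs-store-then (runs-store-then (runs-store {Q = Halfway}
            (v , f , rest , chosen true (tested q) ,
             (ready ,
              (λ x → linkedList-cong (singlesIn vs x) (λ w∈ → link (proj₁ (∈-singlesIn⁻ w∈))) (singles x)) ,
              (λ d d≢c → subst (λ h → LinkedList next′ h (groupIn vs d)) (sym (at-other (λ q → d≢c (sym (Fin.toℕ-injective (trans (sym sec) q))))))
                 (linkedList-cong (groupIn vs d) (λ w∈ → link (proj₁ (∈-groupIn⁻ w∈))) (groups d d≢c))) ,
              (trans (at-same sec) (cong suc vx) ,
               subst (λ h → LinkedList next′ h rest) (sym (trans (at-same vx) (cong (μ nextᵃ) hd)))
                 (linkedList-cong rest (λ w∈ → link (in-vs (there w∈))) l)) ,
              keys , vx) ,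
             vx , hd , (All.¬Any⇒All¬ _ (λ v∈ → v∉ (in-vs (there v∈))) ∷ AllPairs.tail u-g) ,
             (λ { (here refl) → v∉ (in-vs (here refl)) ; (there f∈) → All.All¬⇒¬Any (AllPairs.head u-g) f∈ }) ,
             (λ { (here refl) → there (in-vs (here refl)) , home-of (here refl) ; (there (here refl)) → here refl , h
                ; (there (there w∈)) → there (in-vs (there w∈)) , home-of (there w∈) }))))))
          (λ q → runs-weaken (s≤s z≤n) id (runs-store {Q = Halfway}
            (f , v , rest , chosen false (tested q) , (ready , singles , groups , (p , l) , keys , vx) , hd , vx , u-g , (λ v∈ → v∉ (in-vs v∈)) ,
             λ { (here refl) → here refl , h ; (there w∈) → there (in-vs w∈) , home-of w∈ })))
          where
          in-vs : ∀ {w} → w ∈ f ∷ rest → w ∈ vs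
          in-vs w∈ = proj₁ (∈-groupIn⁻ (subst (_ ∈_) (sym e) w∈))
          home-of : ∀ {w} → w ∈ f ∷ rest → home w ≡ inj₂ c
          home-of w∈ = proj₂ (∈-groupIn⁻ {vs} (subst (_ ∈_) (sym e) w∈))
          u-g : Unique (f ∷ rest)
          u-g = subst Unique e (unique-groupIn c uq)
          next′ : ℕ → ℕ
          next′ j = if μ vertexᵛ 0 ≡ᵇ j then μ nextᵃ (μ headᵛ 0) else μ nextᵃ j
          link : ∀ {w} → w ∈ vs → next′ (toℕ w) ≡ μ nextᵃ (toℕ w)
          link w∈ = at-other (λ q → not-v w∈ (trans (sym vx) q))
          tested : ∀ {b} → (μ keyᵃ (μ headᵛ 0) <ᵇ μ keyᵃ (μ vertexᵛ 0)) ≡ b → (keyOf f <ᵇ keyOf v) ≡ b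
          tested q = trans (sym (cong₂ _<ᵇ_ (trans (cong (μ keyᵃ) hd) (keys (there (in-vs (here refl))))) (trans (cong (μ keyᵃ) vx) (keys (here refl))))) q
          chosen : ∀ b → (keyOf f <ᵇ keyOf v) ≡ b → (if b then v ∷ insertSecond f rest else f ∷ insertSecond v rest) ≡ insert v (groupIn vs c)
          chosen b q = trans (cong (if_then v ∷ insertSecond f rest else f ∷ insertSecond v rest) (sym q)) (cong (insert v) (sym e))

        placeSecond-runs : ∀ {μ} → Halfway μ → Runs placeSecond μ 6 Added
        placeSecond-runs {μ} (f , u , rest , chosen , (ready , singles , groups , group-c , keys , vx) , hd , mv , u-g , u∉ , known) =
          runs-store-then (anchor rest refl then λ {ν} q → insert-runs {ν} q)
          where
          μ′ : Memory
          μ′ = write anchorᵛ 0 (μ headᵛ 0) μ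
          -- The moved vertex goes after a, the last element of as ++ a ∷ [].
          Anchored : Pred Memory 0ℓ
          Anchored ν = ∃₂ λ as a → ∃ λ bs → f ∷ rest ≡ as ++ a ∷ bs × as ++ a ∷ u ∷ bs ≡ insert v (groupIn vs c) ×
                       Around (f ∷ rest) ν × ν anchorᵛ 0 ≡ toℕ a × ν movedᵛ 0 ≡ toℕ u
          anchor : ∀ rest′ → rest ≡ rest′ → Runs (if (read nextᵃ (var headᵛ) ≐ lit 0) skip
            (if (read keyᵃ (prec (read nextᵃ (var headᵛ))) ≺ read keyᵃ (var movedᵛ)) (set anchorᵛ (prec (read nextᵃ (var headᵛ)))) skip)) μ′ 3 Anchored
          anchor [] refl = runs-if {Q = Anchored}
            (λ _ → runs-weaken (s≤s z≤n) id (runs-skip {Q = Anchored} ([] , f , [] , refl , chosen , (ready , singles , groups , group-c , keys , vx) , hd , mv)))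
            (λ q → contradiction (trans (cong (μ nextᵃ) hd) (proj₂ group-c)) (≡ᵇ-false q))
          anchor (s ∷ ss) refl = runs-if {Q = Anchored}
            (λ q → contradiction (trans (sym next-f) (≡ᵇ-true q)) λ ())
            (λ _ → runs-if {Q = Anchored}
              (λ q → runs-store {Q = Anchored} (f ∷ [] , s , ss , refl , trans (branch true (tested q)) chosen ,
                       (ready , singles , groups , group-c , keys , vx) , cong pred next-f , mv))
              (λ q → runs-skip {Q = Anchored} ([] , f , s ∷ ss , refl , trans (branch false (tested q)) chosen ,
                       (ready , singles , groups , group-c , keys , vx) , hd , mv)))
            where
            next-f : μ nextᵃ (μ headᵛ 0) ≡ suc (toℕ s)
            next-f = trans (cong (μ nextᵃ) hd) (proj₁ (proj₂ group-c))
            tested : ∀ {b} → (μ keyᵃ (pred (μ nextᵃ (μ headᵛ 0))) <ᵇ μ keyᵃ (μ movedᵛ 0)) ≡ b → (keyOf s <ᵇ keyOf u) ≡ b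
            tested q = trans (sym (cong₂ _<ᵇ_ (trans (cong (λ i → μ keyᵃ (pred i)) next-f) (keys (proj₁ (known (there (there (here refl)))))))
                          (trans (cong (μ keyᵃ) mv) (keys (proj₁ (known (here refl))))))) q
            branch : ∀ b → (keyOf s <ᵇ keyOf u) ≡ b →
                     _≡_ {A = List (Fin n)} (f ∷ (if b then s ∷ u ∷ ss else u ∷ s ∷ ss)) (f ∷ insertSecond u (s ∷ ss))
            branch b q = cong (λ b → f ∷ (if b then s ∷ u ∷ ss else u ∷ s ∷ ss)) (sym q)
          insert-runs : ∀ {ν} → Anchored ν → Runs (store nextᵃ (var movedᵛ) (read nextᵃ (var anchorᵛ)) ⨟ store nextᵃ (var anchorᵛ) (succ (var movedᵛ))) ν 2 Added
          insert-runs {ν} (as , a , bs , split , result , (ready , singles , groups , group-c , keys , vx) , an , mv′) =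
            runs-store-then (runs-store {Q = Added} (around⇒added {as ++ a ∷ u ∷ bs} {final} (trans result (sym (groupIn-yes h)))
              (ready ,
               (λ x → linkedList-cong (singlesIn vs x) (λ w∈ → away (single-≢ w∈)) (singles x)) ,
               (λ d d≢c → linkedList-cong (groupIn vs d) (λ w∈ → away (group-≢ d≢c w∈)) (groups d d≢c)) ,
               linkedList-cong (as ++ a ∷ u ∷ bs) (λ {w} _ → shape w)
                 (place as (subst Unique split u-g) (subst (u ∉_) split u∉) (subst (GroupAt ν c) split group-c)) ,
               keys , vx)))
            where
            final : Memory
            final = write nextᵃ (ν anchorᵛ 0) (suc (ν movedᵛ 0)) (write nextᵃ (ν movedᵛ 0) (ν nextᵃ (ν anchorᵛ 0)) ν)
            next′ : ℕ → ℕ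
            next′ j = if ν anchorᵛ 0 ≡ᵇ j then suc (ν movedᵛ 0) else (if ν movedᵛ 0 ≡ᵇ j then ν nextᵃ (ν anchorᵛ 0) else ν nextᵃ j)
            shape : ∀ w → next′ (toℕ w) ≡ insertAfter (toℕ a) (toℕ u) (ν nextᵃ) (toℕ w)
            shape w = cong₂ (λ a u → insertAfter a u (ν nextᵃ) (toℕ w)) an mv′
            a∈ : a ∈ u ∷ f ∷ rest
            a∈ = there (subst (a ∈_) (sym split) (∈-insert as))
            -- The two altered links belong to vertices with home `c`, so every list of vertices
            -- with another home survives.
            away : ∀ {w} → home w ≢ inj₂ c → next′ (toℕ w) ≡ ν nextᵃ (toℕ w)
            away {w} ne = trans (shape w) (insertAfter-other (ν nextᵃ) {v = w} (differs (proj₂ (known a∈)) ne) (differs (proj₂ (known (here refl))) ne))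
            place : ∀ as {h} → Unique (as ++ a ∷ bs) → u ∉ as ++ a ∷ bs → LinkedList (ν nextᵃ) h (as ++ a ∷ bs) →
                    LinkedList (insertAfter (toℕ a) (toℕ u) (ν nextᵃ)) h (as ++ a ∷ u ∷ bs)
            place [] uq u∉ l = insertAfter-list bs uq u∉ l
            place (z ∷ as) (z∉ ∷ uq) u∉ (p , l) = p , subst (λ h → LinkedList (insertAfter (toℕ a) (toℕ u) (ν nextᵃ)) h (as ++ a ∷ u ∷ bs))
              (sym (insertAfter-other (ν nextᵃ) {v = z} (λ q → All.All¬⇒¬Any z∉ (subst (_∈ as ++ a ∷ bs) (sym (Fin.toℕ-injective q)) (∈-insert as)))
                                      (λ q → u∉ (here (sym (Fin.toℕ-injective q))))))
              (place as uq (u∉ ∘ there) l)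

        addGroup-runs : ∀ {μ} → μ secondᵛ 0 ≡ toℕ c → Prepared μ → Runs addGroup μ 14 Added
        addGroup-runs {μ} sec (ready , singles , groups , keys , vx) = runs-store-then (go (groupIn vs c) refl)
          where
          μ′ : Memory
          μ′ = write headᵛ 0 (μ groupᵃ (μ secondᵛ 0)) μ
          go : ∀ g → groupIn vs c ≡ g → Runs (if (var headᵛ ≐ lit 0)
                 (store nextᵃ (var vertexᵛ) (lit 0) ⨟ store groupᵃ (var secondᵛ) (succ (var vertexᵛ)))
                 (set headᵛ (prec (var headᵛ)) ⨟ placeHead ⨟ placeSecond)) μ′ 13 Added
          go [] e = runs-if {Q = Added}
            (λ _ → runs-weaken (s≤s (s≤s z≤n)) id (runs-store-then (runs-store {Q = Added}
              (around⇒added {v ∷ []} {final} (trans (cong (insert v) (sym e)) (sym (groupIn-yes h)))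
              (ready ,
               (λ x → linkedList-cong (singlesIn vs x) (λ w∈ → link (proj₁ (∈-singlesIn⁻ w∈))) (singles x)) ,
               (λ d d≢c → subst (λ h → LinkedList next′ h (groupIn vs d)) (sym (at-other (λ q → d≢c (sym (Fin.toℕ-injective (trans (sym sec) q))))))
                 (linkedList-cong (groupIn vs d) (λ w∈ → link (proj₁ (∈-groupIn⁻ w∈))) (groups d))) ,
               (trans (at-same sec) (cong suc vx) , at-same vx) , keys , vx)))))
            (λ q → contradiction (trans (cong (μ groupᵃ) sec) (subst (GroupAt μ c) e (groups c))) (≡ᵇ-false q))
            where
            final : Memory
            final = write groupᵃ (μ secondᵛ 0) (suc (μ vertexᵛ 0)) (write nextᵃ (μ vertexᵛ 0) 0 μ′)
            next′ : ℕ → ℕ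
            next′ j = if μ vertexᵛ 0 ≡ᵇ j then 0 else μ nextᵃ j
            link : ∀ {w} → w ∈ vs → next′ (toℕ w) ≡ μ nextᵃ (toℕ w)
            link w∈ = at-other (λ q → not-v w∈ (trans (sym vx) q))
          go (f ∷ rest) e = runs-if {Q = Added}
            (λ q → contradiction (trans (sym head-≡) (≡ᵇ-true q)) λ ())
            (λ _ → runs-store-then (runs-weaken {Q = Added} (≤-refl {11}) id
              (placeHead-runs {f} {rest} {write headᵛ 0 (pred (μ groupᵃ (μ secondᵛ 0))) μ′} e (cong pred head-≡) sec
                (ready , singles , (λ d _ → groups d) , group-c , keys , vx)
              then λ {ν} q → placeSecond-runs {ν} q)))
            where
            group-c : GroupAt μ c (f ∷ rest)
            group-c = subst (GroupAt μ c) e (groups c)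
            head-≡ : μ groupᵃ (μ secondᵛ 0) ≡ suc (toℕ f)
            head-≡ = trans (cong (μ groupᵃ) sec) (proj₁ group-c)

-- Writing out the tour from a stack.

push : ℕ → Expr → Program
push k e = store kindᵃ (var topᵛ) (lit k) ⨟ store valueᵃ (var topᵛ) e ⨟ set topᵛ (succ (var topᵛ))

emit : Expr → Program
emit e = store outputBank (var outᵛ) e ⨟ set outᵛ (succ (var outᵛ))

-- Stack items of kind 0 are vertices, items of kind 1 linked lists, and items of
-- kinds 2 and 3 what the tour lists inside a node, for either side.
pushSegment : Program
pushSegment =
  set headᵛ (read groupᵃ (var itemᵛ)) ⨟
  if (var headᵛ ≐ lit 0)
     (push 2 (var itemᵛ))
     (set headᵛ (prec (var headᵛ)) ⨟
      set anchorᵛ (read nextᵃ (var headᵛ)) ⨟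
      if (var anchorᵛ ≐ lit 0)
         (if (var sideᵛ ≐ lit 2)
             (push 0 (var headᵛ) ⨟ push 3 (var itemᵛ))
             (push 2 (var itemᵛ) ⨟ push 0 (var headᵛ)))
         (push 1 (var anchorᵛ) ⨟
          if (succ (succ (read 3 (var itemᵛ))) ≺ read 3 (succ (var itemᵛ)))
             (push 3 (var itemᵛ)) (push 2 (var itemᵛ)) ⨟
          push 0 (var headᵛ)))

popItem : Program
popItem =
  set topᵛ (prec (var topᵛ)) ⨟
  set nodeᵛ (read valueᵃ (var topᵛ)) ⨟
  set sideᵛ (read kindᵃ (var topᵛ)) ⨟
  if (var sideᵛ ≐ lit 0)
     (emit (var nodeᵛ))
     (if (var sideᵛ ≐ lit 1)
         (if (var nodeᵛ ≐ lit 0) skip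
             (emit (prec (var nodeᵛ)) ⨟ push 1 (read nextᵃ (prec (var nodeᵛ)))))
         (push 1 (read singlesᵃ (var nodeᵛ)) ⨟ forKids pushSegment))

emitTour : Program
emitTour =
  set topᵛ (lit 0) ⨟
  set outᵛ (lit 0) ⨟
  push 2 (var rootᵛ) ⨟
  while (lit 0 ≺ var topᵛ) popItem

tourProgram : Program
tourProgram = findLeaf ⨟ rankTree ⨟ groupVertices ⨟ emitTour

sideCode : Side → ℕ
sideCode left  = 2
sideCode right = 3

module Emission {n} {G : Graph n} (M : PathTreeModel G) {r} (R : Rooting (PathTreeModel.tree M) r)
                (L : PlaneLayout (PathTreeModel.tree M)) where
  open Models M
  open Rooting R
  open PlaneLayout L
  open HomeFacts M R L
  open LayoutNodes R L path
  open Weights R L path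
  open Machine M R L using (Static; Fresh; Base; Correct; findLeaf-runs; rankTree-runs)
  open Buckets M R L

  addVertex-runs : ∀ {v vs μ} → v ∉ vs → Unique vs → Filled vs μ → μ vertexᵛ 0 ≡ toℕ v →
                   Runs addVertex μ (24 + 9 * length (path v)) (λ ν → Filled (v ∷ vs) ν × ν vertexᵛ 0 ≡ suc (toℕ v))
  addVertex-runs {v} {vs} {μ} v∉ uq filled@((((_ , none , _ , family) , _) , ok) , _) vx = go (path v) refl
    where
    Done : Pred Memory 0ℓ
    Done ν = Filled (v ∷ vs) ν × ν vertexᵛ 0 ≡ suc (toℕ v)
    bucketed : ∀ sc → scan (path v) ≡ sc → ∀ {ν} → Scanned sc ν → Prepared {v} {vs} v∉ uq ν →
               Runs (if (var secondᵛ ≐ read 0 (lit 1)) addSingle addGroup) ν 15 (Added {v} {vs} v∉ uq)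
    bucketed (scanned a nothing k) e {ν} (low , sec , _) prep@((((_ , none , _) , _) , _) , _) =
      runs-if {Q = Added v∉ uq} (λ _ → runs-weaken {Q = Added v∉ uq} (s≤s (s≤s z≤n)) id (addSingle-runs v∉ uq {a} {ν} (cong homeOf e) low prep))
        (λ q → contradiction (trans sec (sym none)) (≡ᵇ-false q))
    bucketed (scanned a (just c) k) e {ν} (low , sec , _) prep@((((_ , none , _) , _) , _) , _) =
      runs-if {Q = Added v∉ uq} (λ q → contradiction (trans (sym sec) (trans (≡ᵇ-true q) none)) (<⇒≢ (Fin.toℕ<n c)))
        (λ _ → addGroup-runs v∉ uq (cong homeOf e) {ν} sec prep)
    go : ∀ l → path v ≡ l → Runs addVertex μ (24 + 9 * length (path v)) Done
    go [] e = case subst (proj₁ (path-≢[] v) ∈_) e (proj₂ (path-≢[] v)) of λ ()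
    go (x ∷ xs) e with subst (Stored (μ 6) (μ 5 (toℕ v))) e (proj₂ (family v))
    ... | first ∷ rest = runs-weaken {Q = Done} (≤-trans (≤-reflexive (cost (length xs))) (+-monoʳ-≤ 24 (*-monoʳ-≤ 9 (≤-trans (n≤1+n _) (≤-reflexive (cong length (sym e))))))) id
      (runs-store-then (runs-store-then (runs-store-then (runs-store-then (runs-store-then (runs-store-then
        (scan-runs {v} {vs} {x} {xs} {suc (μ 5 (toℕ v))} {scanning} e rest (cong suc start)
          (trans (trans (cong (λ i → μ 5 (suc i)) vx) (proj₁ (family v))) (trans (cong (λ l → μ 5 (toℕ v) + length l) e) (+-suc _ (length xs))))
          (low , none , trans (cong (μ rankᵃ) low) (proj₂ (ok x))) (filled , vx)
        then λ {ν} (sc , ((ready , singles , groups , keys) , vx′)) → runs-store-then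
          (bucketed (scan (path v)) refl {write keyᵃ (ν vertexᵛ 0) (ν keyᵛ 0) ν} sc
            (ready , singles , groups , (λ { (here refl) → trans (at-same vx′) (proj₂ (proj₂ sc))
                                           ; (there u∈) → trans (at-other (λ q → v∉ (subst (_∈ vs) (sym (Fin.toℕ-injective (trans (sym vx′) q))) u∈))) (keys u∈) }) , vx′)
          then λ (filled′ , vx″) → runs-store {Q = Done} (filled′ , cong suc vx″)))))))))
      where
      start : μ 5 (μ vertexᵛ 0) ≡ μ 5 (toℕ v)
      start = cong (μ 5) vx
      low : μ 6 (μ 5 (μ vertexᵛ 0)) ≡ toℕ x
      low = trans (cong (μ 6) start) first
      s1 = write posᵛ 0 (μ 5 (μ vertexᵛ 0)) μ
      s2 = write endᵛ 0 (μ 5 (suc (μ vertexᵛ 0))) s1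
      s3 = write lowestᵛ 0 (μ 6 (μ 5 (μ vertexᵛ 0))) s2
      s4 = write secondᵛ 0 (μ 0 1) s3
      s5 = write keyᵛ 0 (μ rankᵃ (μ 6 (μ 5 (μ vertexᵛ 0)))) s4
      scanning : Memory
      scanning = write posᵛ 0 (suc (μ 5 (μ vertexᵛ 0))) s5
      cost : ∀ l → 6 + (suc (l * 9) + (suc (15 + 1))) ≡ 24 + 9 * l
      cost = solve-∀

  -- The 24 steps of `addVertex`, its 9 steps per node of the path, and one step for the loop.
  cost-all : List (Fin n) → ℕ
  cost-all vs = sum (map (λ v → 25 + 9 * length (path v)) vs)

  groupVertices-runs : ∀ {μ} → Ready μ → Fresh μ → Runs groupVertices μ (2 + cost-all (allFin n)) (Filled vertices)
  groupVertices-runs {μ} ready (s0 , g0) = runs-store-then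
    (go [] (allFin n) refl {write vertexᵛ 0 0 μ} (ready , (λ x → s0 (toℕ x)) , (λ c → g0 (toℕ c)) , λ ()) refl)
    where
    go : ∀ done todo → allFin n ≡ done ++ todo → ∀ {μ} → Filled (reverse done) μ → μ vertexᵛ 0 ≡ length done →
         Runs (while (var vertexᵛ ≺ read 0 (lit 0)) addVertex) μ (1 + cost-all todo) (Filled vertices)
    go done [] e {μ} filled@((((count , _) , _) , _) , _) vx = runs-stop
      (false-<ᵇ (≤-reflexive (trans count (trans (sym (List.length-tabulate {n = n} id)) (trans (cong length whole) (sym vx))))))
      (subst (λ l → Filled (reverse l) μ) (sym whole) filled)
      where
      whole : allFin n ≡ done
      whole = trans e (List.++-identityʳ done)
    go done (v ∷ todo) e {μ} filled@((((count , _) , _) , _) , _) vx =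
      runs-weaken {Q = Filled vertices} (≤-reflexive (cost (length (path v)) (cost-all todo))) id
      (runs-loop (true-<ᵇ (subst₂ _<_ (sym vx′) (sym count) (Fin.toℕ<n v)))
        (addVertex-runs {v} {reverse done} {μ} (λ v∈ → unique-++-disjoint done uq (Any.reverse⁻ v∈) (here refl))
          (unique-resp-↭ (↭-sym (↭.↭-reverse done)) (unique-++ˡ done uq)) filled vx′)
        (λ {ν} (filled′ , vx″) → go (done ∷ʳ v) todo (trans e (sym (List.++-assoc done (v ∷ []) todo))) {ν}
          (subst (λ l → Filled l ν) (sym (List.reverse-++ done (v ∷ []))) filled′)
          (trans vx″ (trans (cong suc position) (trans (+-comm 1 (length done)) (sym (List.length-++ done)))))))
      where
      uq : Unique (done ++ v ∷ todo)
      uq = subst Unique e (Unique.tabulate⁺ id)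
      position : toℕ v ≡ length done
      position with allFin-split {n} id v
      ... | as , bs , e′ , len = trans (sym len) (cong length (sym (proj₁ (unique-split done uq (trans (sym e) e′)))))
      vx′ : μ vertexᵛ 0 ≡ toℕ v
      vx′ = trans vx (sym position)
      cost : ∀ p c → suc ((24 + 9 * p) + (1 + c)) ≡ 1 + ((25 + 9 * p) + c)
      cost = solve-∀

  -- Lengths do not depend on the side, so the potential of a stack item may be computed with
  -- `left`.
  inside-side : ∀ x side → inside x side ↭ inside x left
  inside-side = from-below (λ x → ∀ side → inside x side ↭ inside x left) λ x rec side →
    ↭-trans (↭.↭-reflexive (inside-≡ x side)) (↭-trans (↭.++⁺ʳ (singles x) (↭-trans (concat-↭ (↭.↭-reverse (map (segment side) (kids x))))
      (↭-trans (concat-map-↭ (kids x) (λ {c} c∈ → ↭-trans (segmentWith-↭ (sideOf c) (group c) side (rec (∈-kids⁻ c∈)))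
                                               (↭-sym (segmentWith-↭ (sideOf c) (group c) left (rec (∈-kids⁻ c∈))))))
               (↭-sym (concat-↭ (↭.↭-reverse (map (segment left) (kids x)))))))) (↭.↭-reflexive (sym (inside-≡ x left))))

  length-inside : ∀ x → length (inside x left) ≡ sum (map (λ c → length (group c) + length (inside c left)) (kids x)) + length (singles x)
  length-inside x = trans (cong length (inside-≡ x left)) (trans (List.length-++ (concat (reverse (map (segment left) (kids x)))))
    (cong (_+ length (singles x)) (trans (↭.↭-length (concat-↭ (↭.↭-reverse (map (segment left) (kids x))))) (go (kids x)))))
    where
    go : ∀ ks → length (concat (map (segment left) ks)) ≡ sum (map (λ c → length (group c) + length (inside c left)) ks)
    go [] = refl
    go (c ∷ ks) = trans (List.length-++ (segment left c)) (cong₂ _+_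
      (trans (↭.↭-length (segmentWith-↭ (sideOf c) (group c) left (inside-side c))) (List.length-++ (group c))) (go ks))

  data Item : Set where
    vert : Fin n → Item
    list : List (Fin n) → Item
    sub  : Fin t → Side → Item

  denotes : Item → List (Fin n)
  denotes (vert v)     = v ∷ []
  denotes (list vs)    = vs
  denotes (sub x side) = inside x side

  -- Handling an item `sub` costs 41 steps, and 22 for each child. The list of singles needs 12
  -- more, and each child 12 for its group, whence 53 and 34. Every vertex still to be listed
  -- carries 12 steps of its own.
  potentialOf : Item → ℕ
  potentialOf (vert v)  = 12
  potentialOf (list vs) = 12 + 12 * length vs
  potentialOf (sub x _) = weight 53 34 x + 12 * length (inside x left)

  potential : List Item → ℕ
  potential = sum ∘ map potentialOf

  kidPotential : Fin t → ℕ
  kidPotential c = 12 + 12 * length (group c) + potentialOf (sub c left)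

  sub-potential : ∀ x → potentialOf (sub x left) ≡
                  41 + 22 * length (kids x) + (12 + 12 * length (singles x)) + sum (map kidPotential (kids x))
  sub-potential x = trans (cong₂ (λ w l → w + 12 * l) (weight-≡ 53 34 x) (length-inside x))
    (trans (cong (λ m → 53 + 34 * length (kids x) + sum (map (weight 53 34) (kids x)) + m) (*-distribˡ-+ 12 (sum (map inner (kids x))) (length (singles x))))
    (trans (rearrange (length (kids x)) (sum (map (weight 53 34) (kids x))) (12 * sum (map inner (kids x))) (12 * length (singles x)))
      (cong (41 + 22 * length (kids x) + (12 + 12 * length (singles x)) +_) (go (kids x)))))
    where
    inner : Fin t → ℕ
    inner c = length (group c) + length (inside c left)
    rearrange : ∀ k w i s → 53 + 34 * k + w + (i + s) ≡ 41 + 22 * k + (12 + s) + (12 * k + w + i)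
    rearrange = solve-∀
    go : ∀ ks → 12 * length ks + sum (map (weight 53 34) ks) + 12 * sum (map inner ks) ≡ sum (map kidPotential ks)
    go [] = refl
    go (c ∷ ks) = trans (one (length ks) (weight 53 34 c) (sum (map (weight 53 34) ks)) (length (group c)) (length (inside c left)) (sum (map inner ks)))
                        (cong (kidPotential c +_) (go ks))
      where
      one : ∀ k w ws g i s → 12 * suc k + (w + ws) + 12 * ((g + i) + s) ≡ (12 + 12 * g + (w + 12 * i)) + (12 * k + ws + 12 * s)
      one = solve-∀

  ItemAt : (kind value next : ℕ → ℕ) → ℕ → Item → Set
  ItemAt kind value next i (vert v)     = kind i ≡ 0 × value i ≡ toℕ v
  ItemAt kind value next i (list vs)    = kind i ≡ 1 × LinkedList next (value i) vs
  ItemAt kind value next i (sub x side) = kind i ≡ sideCode side × value i ≡ toℕ x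

  Items : (kind value next : ℕ → ℕ) → List Item → Set
  Items kind value next []        = ⊤
  Items kind value next (it ∷ st) = ItemAt kind value next (length st) it × Items kind value next st

  items-cong : ∀ {kind kind′ value value′ next} st → (∀ j → j < length st → kind′ j ≡ kind j) →
               (∀ j → j < length st → value′ j ≡ value j) → Items kind value next st → Items kind′ value′ next st
  items-cong [] _ _ _ = tt
  items-cong {kind} {kind′} {value} {value′} {next} (it ∷ st) k v (p , s) =
    item it p , items-cong st (λ j lt → k j (m≤n⇒m≤1+n lt)) (λ j lt → v j (m≤n⇒m≤1+n lt)) s
    where
    item : ∀ it → ItemAt kind value next (length st) it → ItemAt kind′ value′ next (length st) it
    item (vert _)  (p , q) = trans (k _ ≤-refl) p , trans (v _ ≤-refl) q
    item (list vs) (p , q) = trans (k _ ≤-refl) p , subst (λ h → LinkedList next h vs) (sym (v _ ≤-refl)) q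
    item (sub _ _) (p , q) = trans (k _ ≤-refl) p , trans (v _ ≤-refl) q

  Lists : Pred Memory 0ℓ
  Lists μ = Ready μ × Singles vertices μ × (∀ c → GroupAt μ c (group c))

  OnStack : List Item → Pred Memory 0ℓ
  OnStack st μ = μ topᵛ 0 ≡ length st × Items (μ kindᵃ) (μ valueᵃ) (μ nextᵃ) st

  Output : List (Fin n) → Pred Memory 0ℓ
  Output os μ = Stored (μ outputBank) 0 os × μ outᵛ 0 ≡ length os

  pushed : ℕ → ℕ → Memory → Memory
  pushed k m μ = write topᵛ 0 (suc (μ topᵛ 0)) (write valueᵃ (μ topᵛ 0) m (write kindᵃ (μ topᵛ 0) k μ))

  item-pushed : ∀ {k m st μ} it → μ topᵛ 0 ≡ length st → ItemAt (λ _ → k) (λ _ → m) (μ nextᵃ) 0 it → OnStack st μ →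
                OnStack (it ∷ st) (pushed k m μ)
  item-pushed {k} {m} {st} {μ} it top p (_ , items) = cong suc top , new it p ,
    items-cong st (λ j lt → at-other (λ e → <⇒≢ lt (sym (trans (sym top) e)))) (λ j lt → at-other (λ e → <⇒≢ lt (sym (trans (sym top) e)))) items
    where
    new : ∀ it → ItemAt (λ _ → k) (λ _ → m) (μ nextᵃ) 0 it → ItemAt (pushed k m μ kindᵃ) (pushed k m μ valueᵃ) (μ nextᵃ) (length st) it
    new (vert _)  (p , q) = trans (at-same top) p , trans (at-same top) q
    new (list vs) (p , q) = trans (at-same top) p , subst (λ h → LinkedList (μ nextᵃ) h vs) (sym (at-same top)) q
    new (sub _ _) (p , q) = trans (at-same top) p , trans (at-same top) q

  push-then : ∀ {k e P μ l Q} → Runs P (pushed k (⟦ e ⟧ (write kindᵃ (μ topᵛ 0) k μ)) μ) l Q → Runs (push k e ⨟ P) μ (3 + l) Q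
  push-then {k} {e} {P} {μ} (j , ν , ex , le , q) =
    3 + j , ν , ⇓-seq (⇓-seq ⇓-store (⇓-seq ⇓-store ⇓-store)) ex , s≤s (s≤s (s≤s le)) , q

  push-runs : ∀ {k e μ} {Q : Pred Memory 0ℓ} → Q (pushed k (⟦ e ⟧ (write kindᵃ (μ topᵛ 0) k μ)) μ) → Runs (push k e) μ 3 Q
  push-runs q = 3 , _ , ⇓-seq ⇓-store (⇓-seq ⇓-store ⇓-store) , ≤-refl , q

  module PushKids (x : Fin t) (side : Side) (os rest : List (Fin n)) (budget : ℕ) where

    -- The stack denotes the segments of the children treated so far, the latest on top, above the
    -- singles and the older items; this agrees with the reversal in `insideIn`.
    KidsInv : List (Fin t) → Pred Memory 0ℓ
    KidsInv ks μ = ∃₂ λ ds st → kids x ≡ ds ++ ks × Lists μ × OnStack st μ × Output os μ × μ nodeᵛ 0 ≡ toℕ x ×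
                   μ sideᵛ 0 ≡ sideCode side × concatMap denotes st ≡ concat (reverse (map (segment side) ds)) ++ rest ×
                   potential st + sum (map kidPotential ks) ≤ budget

    open ForKids {t} pushSegment 15 KidsInv (λ _ j → j) (λ _ j → j) (λ _ j → j) (λ _ j → j) (λ _ j → j) public

    pushSegment-runs : BodyRuns
    pushSegment-runs {c} {ks} {μ} (ds , st , eq , lists@(((((_ , _ , layout , _) , _)) , _) , _ , groups) , onStack@(top , items) , out , node , sd , den , pot) item =
      runs-store-then (go (group c) refl)
      where
      μ₁ : Memory
      μ₁ = write headᵛ 0 (μ groupᵃ (μ itemᵛ 0)) μ
      Goal : Pred Memory 0ℓ
      Goal ν = KidsInv ks ν × Same μ ν
      parent-c : parent c ≡ just x
      parent-c = ∈-kids⁻ (subst (c ∈_) (sym eq) (∈-insert ds))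
      kids-eq : kids x ≡ (ds ∷ʳ c) ++ ks
      kids-eq = trans eq (sym (List.++-assoc ds (c ∷ []) ks))
      den-eq : ∀ {l} → l ≡ segment side c → l ++ concatMap denotes st ≡ concat (reverse (map (segment side) (ds ∷ʳ c))) ++ rest
      den-eq refl = trans (cong (segment side c ++_) den) (trans (sym (List.++-assoc (segment side c) _ rest))
        (cong (_++ rest) (sym (trans (cong (concat ∘ reverse) (List.map-++ (segment side) ds (c ∷ [])))
          (cong concat (List.reverse-++ (map (segment side) ds) (segment side c ∷ [])))))))
      head-≡ : ∀ {f g} → group c ≡ f ∷ g → μ groupᵃ (μ itemᵛ 0) ≡ suc (toℕ f) × LinkedList (μ nextᵃ) (μ nextᵃ (toℕ f)) g
      head-≡ {f} {g} e = trans (cong (μ groupᵃ) item) (proj₁ l) , proj₂ l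
        where l = subst (GroupAt μ c) e (groups c)
      budget-≤ : ∀ q → q ≤ 12 + 12 * length (group c) → q + potentialOf (sub c left) + potential st + sum (map kidPotential ks) ≤ budget
      budget-≤ q q≤ = ≤-trans (+-monoˡ-≤ (sum (map kidPotential ks)) (+-monoˡ-≤ (potential st) (+-monoˡ-≤ (potentialOf (sub c left)) q≤)))
        (≤-trans (≤-reflexive (shuffle (kidPotential c) (potential st) (sum (map kidPotential ks)))) pot)
        where
        shuffle : ∀ a b d → a + b + d ≡ b + (a + d)
        shuffle = solve-∀
      order-c : length (order c) ≡ suc (length (kids c))
      order-c = ↭.↭-length (order-↭ parent-c)
      go : ∀ g → group c ≡ g → Runs (if (var headᵛ ≐ lit 0) (push 2 (var itemᵛ)) (set headᵛ (prec (var headᵛ)) ⨟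
             set anchorᵛ (read nextᵃ (var headᵛ)) ⨟
             if (var anchorᵛ ≐ lit 0)
               (if (var sideᵛ ≐ lit 2) (push 0 (var headᵛ) ⨟ push 3 (var itemᵛ)) (push 2 (var itemᵛ) ⨟ push 0 (var headᵛ)))
               (push 1 (var anchorᵛ) ⨟ if (succ (succ (read 3 (var itemᵛ))) ≺ read 3 (succ (var itemᵛ))) (push 3 (var itemᵛ)) (push 2 (var itemᵛ)) ⨟
                push 0 (var headᵛ)))) μ₁ 14 Goal
      go [] e = runs-if {Q = Goal}
        (λ _ → runs-weaken {Q = Goal} (m≤m+n 3 10) id (push-runs {2} {var itemᵛ} {μ₁} {Goal}
          ((ds ∷ʳ c , sub c left ∷ st , kids-eq , lists , item-pushed {2} {μ itemᵛ 0} {st} {μ₁} (sub c left) top (refl , item) onStack , out , node , sd ,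
            den-eq (cong (λ g → segmentWith (inside c) (sideOf c) g side) (sym e)) , budget-≤ 0 z≤n) ,
           refl , refl , refl , refl , (λ _ → refl) , λ _ → refl)))
        (λ q → contradiction (trans (cong (μ groupᵃ) item) (subst (GroupAt μ c) e (groups c))) (≡ᵇ-false q))
      go (f ∷ g) e = runs-if {Q = Goal}
        (λ q → contradiction (trans (sym (proj₁ (head-≡ e))) (≡ᵇ-true q)) λ ())
        (λ _ → runs-store-then (runs-store-then (with-tail g e)))
        where
        μ₂ μ₃ : Memory
        μ₂ = write headᵛ 0 (pred (μ₁ headᵛ 0)) μ₁
        μ₃ = write anchorᵛ 0 (μ nextᵃ (pred (μ₁ headᵛ 0))) μ₂
        head-f : pred (μ groupᵃ (μ itemᵛ 0)) ≡ toℕ f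
        head-f = cong pred (proj₁ (head-≡ e))
        with-tail : ∀ g → group c ≡ f ∷ g → Runs (if (var anchorᵛ ≐ lit 0)
               (if (var sideᵛ ≐ lit 2) (push 0 (var headᵛ) ⨟ push 3 (var itemᵛ)) (push 2 (var itemᵛ) ⨟ push 0 (var headᵛ)))
               (push 1 (var anchorᵛ) ⨟ if (succ (succ (read 3 (var itemᵛ))) ≺ read 3 (succ (var itemᵛ))) (push 3 (var itemᵛ)) (push 2 (var itemᵛ)) ⨟
                push 0 (var headᵛ))) μ₃ 11 Goal
        with-tail [] e′ = runs-if {Q = Goal}
          (λ _ → runs-weaken {Q = Goal} (m≤m+n 7 3) id (one side refl))
          (λ q → contradiction (trans (cong (μ nextᵃ) head-f) (proj₂ (head-≡ e′))) (≡ᵇ-false q))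
          where
          one : ∀ side′ → side ≡ side′ → Runs (if (var sideᵛ ≐ lit 2) (push 0 (var headᵛ) ⨟ push 3 (var itemᵛ)) (push 2 (var itemᵛ) ⨟ push 0 (var headᵛ))) μ₃ 7 Goal
          one left refl = runs-if {Q = Goal}
            (λ _ → push-then {0} {var headᵛ} (push-runs {3} {var itemᵛ} {Q = Goal}
              ((ds ∷ʳ c , sub c right ∷ vert f ∷ st , kids-eq , lists ,
                item-pushed {3} {μ itemᵛ 0} {vert f ∷ st} {pushed 0 (pred (μ₁ headᵛ 0)) μ₃} (sub c right) (cong suc top) (refl , item) (item-pushed {0} {pred (μ₁ headᵛ 0)} {st} {μ₃} (vert f) top (refl , head-f) onStack) ,
                out , node , sd , trans (sym (List.++-assoc (inside c right) (f ∷ []) _)) (den-eq (cong (λ g → segmentWith (inside c) (sideOf c) g left) (sym e′))) ,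
                ≤-trans (≤-reflexive (cong (_+ sum (map kidPotential ks)) (swap (potentialOf (sub c left)) (potential st))))
                  (budget-≤ 12 (m≤m+n 12 _))) ,
               refl , refl , refl , refl , (λ _ → refl) , λ _ → refl)))
            (λ q → contradiction sd (≡ᵇ-false q))
            where
            swap : ∀ a b → a + (12 + b) ≡ 12 + a + b
            swap = solve-∀
          one right refl = runs-if {Q = Goal}
            (λ q → contradiction (trans (sym sd) (≡ᵇ-true q)) λ ())
            (λ _ → push-then {2} {var itemᵛ} (push-runs {0} {var headᵛ} {Q = Goal}
              ((ds ∷ʳ c , vert f ∷ sub c left ∷ st , kids-eq , lists ,
                item-pushed {0} {pred (μ₁ headᵛ 0)} {sub c left ∷ st} {pushed 2 (μ itemᵛ 0) μ₃} (vert f) (cong suc top) (refl , head-f) (item-pushed {2} {μ itemᵛ 0} {st} {μ₃} (sub c left) top (refl , item) onStack) ,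
                out , node , sd , den-eq (cong (λ g → segmentWith (inside c) (sideOf c) g right) (sym e′)) ,
                ≤-trans (≤-reflexive (cong (_+ sum (map kidPotential ks)) (sym (+-assoc 12 (potentialOf (sub c left)) (potential st)))))
                  (budget-≤ 12 (m≤m+n 12 _))) ,
               refl , refl , refl , refl , (λ _ → refl) , λ _ → refl)))
        with-tail (s ∷ vs) e′ = runs-if {Q = Goal}
          (λ q → contradiction (trans (sym link-s) (≡ᵇ-true q)) λ ())
          -- The tail of the linked list of the group is itself a linked list, so one item stands
          -- for all members after the head.
          (λ _ → push-then {1} {var anchorᵛ} (many (kids c) refl then λ {ν} (c-side , inv) → push-runs {0} {var headᵛ} {ν} {Goal} (final c-side {ν} inv)))
          where
          link-s : μ nextᵃ (pred (μ₁ headᵛ 0)) ≡ suc (toℕ s)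
          link-s = trans (cong (μ nextᵃ) head-f) (proj₁ (proj₂ (head-≡ e′)))
          μ₄ : Memory
          μ₄ = pushed 1 (μ nextᵃ (pred (μ₁ headᵛ 0))) μ₃
          on₄ : OnStack (list (s ∷ vs) ∷ st) μ₄
          on₄ = item-pushed {1} {μ nextᵃ (pred (μ₁ headᵛ 0))} {st} {μ₃} (list (s ∷ vs)) top
                  (refl , link-s , proj₂ (proj₂ (head-≡ e′))) onStack
          Mid : Pred Memory 0ℓ
          Mid ν = OnStack (sub c (sideOf c) ∷ list (s ∷ vs) ∷ st) ν × Lists ν × Output os ν × ν nodeᵛ 0 ≡ toℕ x × ν sideᵛ 0 ≡ sideCode side ×
                  ν headᵛ 0 ≡ toℕ f × Same μ ν
          many : ∀ ks → kids c ≡ ks → Runs (if (succ (succ (read 3 (var itemᵛ))) ≺ read 3 (succ (var itemᵛ))) (push 3 (var itemᵛ)) (push 2 (var itemᵛ))) μ₄ 4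
                 (λ ν → ⊤ × Mid ν)
          many ks ek = runs-if {Q = λ ν → ⊤ × Mid ν}
            (λ q → push-runs {3} {var itemᵛ} {μ₄} {λ ν → ⊤ × Mid ν} (tt , item-pushed {3} {μ itemᵛ 0} {list (s ∷ vs) ∷ st} {μ₄} (sub c (sideOf c)) (cong suc top) (cong sideCode (sym (is-right q)) , item) on₄ ,
              lists , out , node , sd , head-f , refl , refl , refl , refl , (λ _ → refl) , λ _ → refl))
            (λ q → push-runs {2} {var itemᵛ} {μ₄} {λ ν → ⊤ × Mid ν} (tt , item-pushed {2} {μ itemᵛ 0} {list (s ∷ vs) ∷ st} {μ₄} (sub c (sideOf c)) (cong suc top) (cong sideCode (sym (is-left q)) , item) on₄ ,
              lists , out , node , sd , head-f , refl , refl , refl , refl , (λ _ → refl) , λ _ → refl))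
            where
            -- One neighbour of `c` is its parent, so a degree above two means at least two
            -- children, which is the distinction made by `sideOf`.
            degree : μ 3 (suc (μ itemᵛ 0)) ≡ μ 3 (μ itemᵛ 0) + suc (length (kids c))
            degree = trans (cong (λ i → μ 3 (suc i)) item) (trans (proj₁ (layout c)) (cong₂ _+_ (cong (μ 3) (sym item)) order-c))
            is-right : (suc (suc (μ 3 (μ itemᵛ 0))) <ᵇ μ 3 (suc (μ itemᵛ 0))) ≡ true → sideOf c ≡ right
            is-right q = by (kids c) refl (+-cancelˡ-< (μ 3 (μ itemᵛ 0)) 2 _ (≤-trans (≤-reflexive (cong suc (+-comm (μ 3 (μ itemᵛ 0)) 2)))
                (≤-trans (<ᵇ-true q) (≤-reflexive degree))))
              where
              by : ∀ ks → kids c ≡ ks → 2 < suc (length (kids c)) → sideOf c ≡ right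
              by (_ ∷ _ ∷ _) e lt = sideOf-right e
              by [] e lt = contradiction (subst (λ l → 2 < suc (length l)) e lt) λ { (s≤s ()) }
              by (_ ∷ []) e lt = contradiction (subst (λ l → 2 < suc (length l)) e lt) λ { (s≤s (s≤s ())) }
            is-left : (suc (suc (μ 3 (μ itemᵛ 0))) <ᵇ μ 3 (suc (μ itemᵛ 0))) ≡ false → sideOf c ≡ left
            is-left q = by (kids c) refl (+-cancelˡ-≤ (μ 3 (μ itemᵛ 0)) _ 2 (≤-trans (≤-reflexive (sym degree)) (≤-trans (<ᵇ-false q) (≤-reflexive (+-comm 2 _)))))
              where
              by : ∀ ks → kids c ≡ ks → suc (length (kids c)) ≤ 2 → sideOf c ≡ left
              by [] e _ with kids c
              by [] refl _ | _ = refl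
              by (_ ∷ []) e _ = sideOf-left e
              by (_ ∷ _ ∷ _) e le = contradiction (subst (λ l → suc (length l) ≤ 2) e le) λ { (s≤s (s≤s ())) }
          final : ⊤ → ∀ {ν} → Mid ν → Goal (pushed 0 (ν headᵛ 0) ν)
          final _ {ν} (on , lists′ , out′ , node′ , sd′ , hd , same) =
            (ds ∷ʳ c , vert f ∷ sub c (sideOf c) ∷ list (s ∷ vs) ∷ st , kids-eq , lists′ ,
              item-pushed {0} {ν headᵛ 0} {sub c (sideOf c) ∷ list (s ∷ vs) ∷ st} {ν} (vert f) (proj₁ on) (refl , hd) on , out′ , node′ , sd′ ,
              trans (cong (f ∷_) (sym (List.++-assoc (inside c (sideOf c)) (s ∷ vs) _)))
                (den-eq (cong (λ g → segmentWith (inside c) (sideOf c) g side) (sym e′))) ,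
              ≤-trans (≤-reflexive (cong (_+ sum (map kidPotential ks)) (swap (potentialOf (sub c left)) (12 * suc (length vs)) (potential st))))
                (budget-≤ (24 + 12 * suc (length vs)) (≤-reflexive (trans (expand (length vs)) (cong (λ l → 12 + 12 * length l) (sym e′)))))) , same
            where
            swap : ∀ a b d → 12 + (a + ((12 + b) + d)) ≡ 24 + b + a + d
            swap = solve-∀
            expand : ∀ l → 24 + 12 * suc l ≡ 12 + 12 * suc (suc l)
            expand = solve-∀

-- The total running time.

-- With `t` at most `n` and `p` at most `n + e`, and the constant 15 absorbed because `n + e` is
-- positive, the coefficients 15, 127, 37 and 9 add up to 188, rounded up to 200.
linear-cost : ∀ t n p e → t ≤ n → p ≤ n + e → 3 ≤ n →
  (1 + 2 * t) + ((6 + 38 * t) + ((2 + (25 * n + 9 * p)) + (6 + (87 * t + 12 * n)))) ≤ 200 * (n + e)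
linear-cost t n p e t≤n p≤ 3≤n = begin
    (1 + 2 * t) + ((6 + 38 * t) + ((2 + (25 * n + 9 * p)) + (6 + (87 * t + 12 * n)))) ≡⟨ collect t n p ⟩
    15 + 127 * t + 37 * n + 9 * p
      ≤⟨ +-mono-≤ (+-mono-≤ (+-mono-≤ (*-monoʳ-≤ 15 1≤s) (*-monoʳ-≤ 127 (≤-trans t≤n n≤s))) (*-monoʳ-≤ 37 n≤s)) (*-monoʳ-≤ 9 p≤) ⟩
    15 * (n + e) + 127 * (n + e) + 37 * (n + e) + 9 * (n + e) ≡⟨ gather (n + e) ⟩
    188 * (n + e) ≤⟨ *-monoˡ-≤ (n + e) (m≤m+n 188 12) ⟩
    200 * (n + e) ∎
    where
    open ≤-Reasoning
    n≤s : n ≤ n + e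
    n≤s = m≤m+n n _
    1≤s : 1 ≤ n + e
    1≤s = ≤-trans (s≤s z≤n) (≤-trans 3≤n n≤s)
    collect : ∀ t n p → (1 + 2 * t) + ((6 + 38 * t) + ((2 + (25 * n + 9 * p)) + (6 + (87 * t + 12 * n)))) ≡ 15 + 127 * t + 37 * n + 9 * p
    collect = solve-∀
    gather : ∀ s → 15 * s + 127 * s + 37 * s + 9 * s ≡ 188 * s
    gather = solve-∀

module EmissionLoop {n} {G : Graph n} (M : PathTreeModel G) {r} (R : Rooting (PathTreeModel.tree M) r)
                    (L : PlaneLayout (PathTreeModel.tree M)) where
  open Models M
  open Rooting R
  open PlaneLayout L
  open HomeFacts M R L
  open LayoutNodes R L path
  open Weights R L path
  open Machine M R L using (Static; Fresh; Base; Correct; findLeaf-runs; rankTree-runs)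
  open Buckets M R L
  open Emission M R L
  open TourHamiltonian M R L using (length-tour)

  -- What has been written, followed by what the stack denotes, is always the whole tour; once the
  -- stack is empty the output is complete.
  TourInv : List Item → Pred Memory 0ℓ
  TourInv st μ = Lists μ × OnStack st μ × ∃ λ os → Output os μ × os ++ concatMap denotes st ≡ tour

  output-∷ʳ : ∀ {os v m μ} → m ≡ toℕ v → Output os μ →
              Stored (λ j → if μ outᵛ 0 ≡ᵇ j then m else μ outputBank j) 0 (os ∷ʳ v) × suc (μ outᵛ 0) ≡ length (os ∷ʳ v)
  output-∷ʳ {os} e (stored , out) =
    stored-∷ʳ (stored-cong (λ j lt → sym (at-other (λ q → <⇒≢ lt (sym (trans (sym out) q))))) stored) (trans (at-same out) e) ,
    trans (cong suc out) (trans (+-comm 1 (length os)) (sym (List.length-++ os)))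

  popItem-runs : ∀ it st {μ} → TourInv (it ∷ st) μ →
                 ∃ λ k → Runs popItem μ k (λ ν → ∃ λ st′ → TourInv st′ ν × suc k + potential st′ ≤ potential (it ∷ st))
  popItem-runs it st {μ} (lists , (top , at , items) , os , out , den) = _ , runs-store-then (runs-store-then (runs-store-then (case-of it at den)))
    where
    popped : Memory
    popped = write sideᵛ 0 (μ kindᵃ (pred (μ topᵛ 0))) (write nodeᵛ 0 (μ valueᵃ (pred (μ topᵛ 0))) (write topᵛ 0 (pred (μ topᵛ 0)) μ))
    Goal : Item → ℕ → Pred Memory 0ℓ
    Goal it k ν = ∃ λ st′ → TourInv st′ ν × suc k + potential st′ ≤ potentialOf it + potential st
    cost : Item → ℕ
    cost (vert v)  = 3
    cost (list vs) = 8
    cost (sub x _) = 15 + length (order x) * 22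
    top′ : pred (μ topᵛ 0) ≡ length st
    top′ = cong pred top
    rest-of : Program
    rest-of = if (var sideᵛ ≐ lit 0) (emit (var nodeᵛ))
     (if (var sideᵛ ≐ lit 1)
         (if (var nodeᵛ ≐ lit 0) skip (emit (prec (var nodeᵛ)) ⨟ push 1 (read nextᵃ (prec (var nodeᵛ)))))
         (push 1 (read singlesᵃ (var nodeᵛ)) ⨟ forKids pushSegment))
    case-of : ∀ it → ItemAt (μ kindᵃ) (μ valueᵃ) (μ nextᵃ) (length st) it → os ++ concatMap denotes (it ∷ st) ≡ tour →
              Runs rest-of popped (cost it) (Goal it (3 + cost it))
    case-of (vert v) (kind , value) den = runs-if {Q = Goal (vert v) 6}
      (λ _ → runs-store-then (runs-store {Q = Goal (vert v) 6} (st , (lists , (top′ , items) , os ∷ʳ v , output-∷ʳ {μ = μ} (trans (cong (μ valueᵃ) top′) value) out ,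
        trans (List.++-assoc os (v ∷ []) _) den) , +-monoˡ-≤ (potential st) (m≤m+n 7 5))))
      (λ q → contradiction (trans (cong (μ kindᵃ) top′) kind) (≡ᵇ-false q))
    case-of (list []) (kind , link) den = runs-if {Q = Goal (list []) 11}
      (λ q → case trans (sym (trans (cong (μ kindᵃ) top′) kind)) (≡ᵇ-true q) of λ ())
      (λ _ → runs-if {Q = Goal (list []) 11}
        (λ _ → runs-if {Q = Goal (list []) 11} (λ _ → runs-weaken {Q = Goal (list []) 11} (s≤s z≤n) id (runs-skip {Q = Goal (list []) 11}
            (st , (lists , (top′ , items) , os , out , den) , ≤-refl)))
          (λ q → contradiction (trans (cong (μ valueᵃ) top′) link) (≡ᵇ-false q)))
        (λ q → contradiction (trans (cong (μ kindᵃ) top′) kind) (≡ᵇ-false q)))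
    case-of (list (v ∷ vs)) (kind , link , next) den = runs-if {Q = Goal (list (v ∷ vs)) 11}
      (λ q → case trans (sym (trans (cong (μ kindᵃ) top′) kind)) (≡ᵇ-true q) of λ ())
      (λ _ → runs-if {Q = Goal (list (v ∷ vs)) 11}
        (λ _ → runs-if {Q = Goal (list (v ∷ vs)) 11}
          (λ q → case trans (sym (trans (cong (μ valueᵃ) top′) link)) (≡ᵇ-true q) of λ ())
          (λ _ → (runs-store-then (runs-store {Q = _≡ emitted} refl)) then λ { refl → push-runs {1} {read nextᵃ (prec (var nodeᵛ))} {emitted} {Goal (list (v ∷ vs)) 11}
            (list vs ∷ st , (lists , item-pushed {1} {_} {st} {emitted} (list vs) top′
                (refl , subst (λ h → LinkedList (μ nextᵃ) h vs) (cong (μ nextᵃ) (sym value)) next) (top′ , items) ,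
              os ∷ʳ v , output-∷ʳ {μ = μ} value out , trans (List.++-assoc os (v ∷ []) _) den) ,
             ≤-reflexive (released (length vs) (potential st))) }))
        (λ q → contradiction (trans (cong (μ kindᵃ) top′) kind) (≡ᵇ-false q)))
      where
      value : pred (μ valueᵃ (pred (μ topᵛ 0))) ≡ toℕ v
      value = cong pred (trans (cong (μ valueᵃ) top′) link)
      emitted : Memory
      emitted = write outᵛ 0 (suc (μ outᵛ 0)) (write outputBank (μ outᵛ 0) (pred (μ valueᵃ (pred (μ topᵛ 0)))) popped)
      released : ∀ l p → 12 + ((12 + 12 * l) + p) ≡ 12 + 12 * suc l + p
      released = solve-∀
    case-of (sub x side) (kind , value) den = runs-if {Q = Goal (sub x side) (3 + cost (sub x side))}
      (λ q → ⊥-elim (not-0 side (trans (sym kind) (trans (cong (μ kindᵃ) (sym top′)) (≡ᵇ-true q)))))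
      (λ _ → runs-if {Q = Goal (sub x side) (3 + cost (sub x side))}
        (λ q → ⊥-elim (not-1 side (trans (sym kind) (trans (cong (μ kindᵃ) (sym top′)) (≡ᵇ-true q)))))
        (λ _ → push-then {1} {read singlesᵃ (var nodeᵛ)} (runs-weaken {Q = KidsInv []} ≤-refl (λ {ν} → finish {ν})
          (forKids-runs (λ {z} {zs} {ν} → pushSegment-runs {z} {zs} {ν}) {order} {x} {parent x} {start} (unique x)
            (λ e → Equivalence.from (neighbours x _) (Rooting.parent-edge R e)) (proj₁ (proj₂ (proj₂ (proj₁ (proj₁ (proj₁ lists))))))
            node (proj₁ (proj₂ (proj₁ lists) x))
            (subst (λ ks → KidsInv ks start) (Vec.lookup∘tabulate _ x)
              ([] , list (singles x) ∷ st , refl , lists ,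
               item-pushed {1} {μ singlesᵃ (μ valueᵃ (pred (μ topᵛ 0)))} {st} {popped} (list (singles x)) top′
                 (refl , subst (λ i → LinkedList (μ nextᵃ) (μ singlesᵃ i) (singles x)) (sym node) (proj₁ (proj₂ lists) x)) (top′ , items) ,
               out , node , trans (cong (μ kindᵃ) top′) kind , refl , ≤-refl))))))
      where
      not-0 : ∀ side → sideCode side ≢ 0
      not-0 left ()
      not-0 right ()
      not-1 : ∀ side → sideCode side ≢ 1
      not-1 left ()
      not-1 right ()
      budget : ℕ
      budget = potential (list (singles x) ∷ st) + sum (map kidPotential (kids x))
      open PushKids x side os (singles x ++ concatMap denotes st) budget
      node : μ valueᵃ (pred (μ topᵛ 0)) ≡ toℕ x
      node = trans (cong (μ valueᵃ) top′) value
      start : Memory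
      start = pushed 1 (μ singlesᵃ (μ valueᵃ (pred (μ topᵛ 0)))) popped
      finish : ∀ {ν} → KidsInv [] ν → Goal (sub x side) (3 + cost (sub x side)) ν
      finish {ν} (ds , st′ , eq , lists′ , on , out′ , _ , _ , den′ , pot) = st′ , (lists′ , on , os , out′ ,
          trans (cong (os ++_) (trans den′ (trans (sym (List.++-assoc (concat (reverse (map (segment side) ds))) (singles x) _))
            (cong (_++ concatMap denotes st) (trans (cong (λ ks → concat (reverse (map (segment side) ks)) ++ singles x) (sym (trans eq (List.++-identityʳ ds))))
              (sym (inside-≡ x side))))))) den) , (begin
          19 + length (order x) * 22 + potential st′ ≤⟨ +-mono-≤ (+-monoʳ-≤ 19 (*-monoˡ-≤ 22 (length-order x))) (≤-trans (≤-reflexive (sym (+-identityʳ _))) pot) ⟩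
          19 + suc (length (kids x)) * 22 + budget ≡⟨ arith (length (kids x)) (12 * length (singles x)) (potential st) (sum (map kidPotential (kids x))) ⟩
          41 + 22 * length (kids x) + (12 + 12 * length (singles x)) + sum (map kidPotential (kids x)) + potential st ≡⟨ cong (_+ potential st) (sym (sub-potential x)) ⟩
          potentialOf (sub x side) + potential st ∎)
        where
        open ≤-Reasoning
        arith : ∀ k s p q → 19 + suc k * 22 + ((12 + s + p) + q) ≡ 41 + 22 * k + (12 + s) + q + p
        arith = solve-∀

  emitTour-runs : ∀ {μ} → Filled vertices μ → Runs emitTour μ (6 + (87 * t + 12 * n)) (Output tour)
  emitTour-runs {μ} (ready@((_ , root) , _) , singles′ , groups′ , _) =
    runs-weaken {Q = Output tour} (+-monoʳ-≤ 6 (≤-trans (≤-reflexive (+-identityʳ _))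
        (+-mono-≤ (weight-root 53 34) (*-monoʳ-≤ 12 (≤-reflexive length-tour))))) id
    (runs-store-then (runs-store-then (push-then {2} {var rootᵛ}
      (runs-while {popItem′} {popItem} TourInv potential {Output tour} step (sub r left ∷ [])
        ((ready , singles′ , groups′) , item-pushed {2} {μ rootᵛ 0} {[]} {reset} (sub r left) refl (refl , root) (refl , tt) , [] , ([] , refl) , List.++-identityʳ _)))))
    where
    popItem′ : Test
    popItem′ = lit 0 ≺ var topᵛ
    reset : Memory
    reset = write outᵛ 0 0 (write topᵛ 0 0 μ)
    step : ∀ st {μ} → TourInv st μ → (⟦ popItem′ ⟧ᵗ μ ≡ false × Output tour μ) ⊎
      (⟦ popItem′ ⟧ᵗ μ ≡ true × ∃ λ k → Runs popItem μ k (λ ν → ∃ λ st′ → TourInv st′ ν × suc k + potential st′ ≤ potential st))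
    step [] {μ} (_ , (top , _) , os , out , den) = inj₁ (false-<ᵇ (≤-reflexive top) , subst (λ l → Output l μ) (trans (sym (List.++-identityʳ os)) den) out)
    step (it ∷ st) {μ} inv@(_ , (top , _) , _) = inj₂ (true-<ᵇ (subst (0 <_) (sym top) (s≤s z≤n)) , popItem-runs it st {μ} inv)

  -- The two assumptions on degrees say that `r` is the node at which `findLeaf` stops.
  tourProgram-runs : length (order r) ≤ 1 → (∀ x → toℕ x < toℕ r → 2 ≤ length (order x)) →
                     ∀ {μ} → Static μ → Fresh μ → μ nodeᵛ 0 ≡ 0 →
                     Runs tourProgram μ ((1 + 2 * t) + ((6 + 38 * t) + ((2 + cost-all (allFin n)) + (6 + (87 * t + 12 * n))))) (Output tour)
  tourProgram-runs short long {μ} s f node =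
    findLeaf-runs short long {μ} s f node then λ {μ₁} ((s₁ , f₁) , node₁) →
    rankTree-runs {μ₁} s₁ f₁ node₁ then λ {μ₂} ((s₂ , f₂ , root) , correct) →
    groupVertices-runs {μ₂} ((s₂ , root) , correct) f₂ then λ {μ₃} filled →
    emitTour-runs {μ₃} filled

  cost-all-≡ : ∀ vs → cost-all vs ≡ 25 * length vs + 9 * sum (map (length ∘ path) vs)
  cost-all-≡ [] = refl
  cost-all-≡ (v ∷ vs) = trans (cong (25 + 9 * length (path v) +_) (cost-all-≡ vs)) (one (length (path v)) (length vs) (sum (map (length ∘ path) vs)))
    where
    one : ∀ p l s → 25 + 9 * p + (25 * l + 9 * s) ≡ 25 * suc l + 9 * (p + s)
    one = solve-∀

  total-cost : t ≤ n → sum (map (length ∘ path) (allFin n)) ≤ size G → 3 ≤ n →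
               (1 + 2 * t) + ((6 + 38 * t) + ((2 + cost-all (allFin n)) + (6 + (87 * t + 12 * n)))) ≤ 200 * size G
  total-cost t≤n incidences 3≤n = subst
    (λ c → (1 + 2 * t) + ((6 + 38 * t) + ((2 + c) + (6 + (87 * t + 12 * n)))) ≤ 200 * size G)
    (sym (trans (cost-all-≡ (allFin n)) (cong (λ l → 25 * l + 9 * sum (map (length ∘ path) (allFin n))) (List.length-tabulate {n = n} id))))
    (linear-cost t n (sum (map (length ∘ path) (allFin n))) (length (edges G)) t≤n incidences 3≤n)

-- The choice of the root, and the final assembly.

module LeafRoot {t} (T : Graph t) (isTree : IsTree T) (x₀ : Fin t) where
  open Graph T

  nbrs : Fin t → List (Fin t)
  nbrs x = filter (x ~?_) (allFin t)

  degree : Fin t → ℕ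
  degree x = length (nbrs x)

  ∈-nbrs⁺ : ∀ {x y} → x ~ y → y ∈ nbrs x
  ∈-nbrs⁺ {x} {y} = ∈-filter⁺ (x ~?_) (∈-allFin y)

  ∈-nbrs⁻ : ∀ {x y} → y ∈ nbrs x → x ~ y
  ∈-nbrs⁻ {x} y∈ = proj₂ (∈-filter⁻ (x ~?_) {xs = allFin t} y∈)

  unique-nbrs : ∀ x → Unique (nbrs x)
  unique-nbrs x = AllPairs.filter⁺ (x ~?_) (Unique.tabulate⁺ id)

  length-order-≡ : ∀ (L : PlaneLayout T) x → length (PlaneLayout.order L x) ≡ degree x
  length-order-≡ L x = unique-same-length (unique x) (unique-nbrs x)
    (λ y∈ → ∈-nbrs⁺ (Equivalence.to (neighbours x _) y∈)) (λ y∈ → Equivalence.from (neighbours x _) (∈-nbrs⁻ y∈))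
    where open PlaneLayout L

  private
    R₀ = rooting T isTree x₀
    open Rooting R₀

    childless : ∀ k x → t ≤ depth x + k → ∃ λ y → ∀ c → parent c ≢ just y
    childless k x le with Fin.any? (λ c → Maybe.≡-dec Fin._≟_ (parent c) (just x))
    ... | no none = x , λ c e → none (c , e)
    childless zero x le | yes _ = contradiction (≤-trans le (≤-reflexive (+-identityʳ (depth x)))) (<⇒≱ (depth< x))
    childless (suc k) x le | yes (c , e) = childless k c (≤-trans le (≤-reflexive (trans (+-suc (depth x) k) (cong (_+ k) (sym (depth-suc e))))))

    -- In an auxiliary rooting there is a childless node, and its only possible neighbour is its
    -- parent.
    low-degree : ¬ (∀ x → 2 ≤ degree x)
    low-degree all with childless t x₀ (m≤n+m t (depth x₀))
    ... | y , none = go (nbrs y) (unique-nbrs y) ∈-nbrs⁻ (all y)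
      where
      up : ∀ {a} → y ~ a → parent y ≡ just a
      up y~a with edge y~a
      ... | inj₁ e = e
      ... | inj₂ e = contradiction e (none _)
      go : ∀ l → Unique l → (∀ {a} → a ∈ l → y ~ a) → ¬ 2 ≤ length l
      go [] _ _ ()
      go (_ ∷ []) _ _ (s≤s ())
      go (a ∷ b ∷ _) ((a≢b ∷ _) ∷ _) nbr _ = a≢b (Maybe.just-injective (trans (sym (up (nbr (here refl)))) (up (nbr (there (here refl))))))

    -- The smallest such node is taken because it is the one that the program finds.
    first = Fin.¬∀⟶∃¬-smallest t (λ x → 2 ≤ degree x) (λ x → 2 ≤? degree x) low-degree

  root : Fin t
  root = proj₁ first

  root-degree : degree root ≤ 1
  root-degree = s≤s⁻¹ (≰⇒> (proj₁ (proj₂ first)))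

  earlier-degree : ∀ x → toℕ x < toℕ root → 2 ≤ degree x
  earlier-degree x lt = subst (λ y → 2 ≤ degree y)
    (Fin.toℕ-injective (trans (Fin.toℕ-inject {i = root} (Fin.fromℕ< lt)) (Fin.toℕ-fromℕ< lt)))
    (proj₂ (proj₂ first) (Fin.fromℕ< lt))

  root-leaf : ∀ {a b} → a ~ root → b ~ root → a ≡ b
  root-leaf a~r b~r = go (nbrs root) root-degree (∈-nbrs⁺ (~-sym a~r)) (∈-nbrs⁺ (~-sym b~r))
    where
    go : ∀ {a b} l → length l ≤ 1 → a ∈ l → b ∈ l → a ≡ b
    go (_ ∷ []) _ (here refl) (here refl) = refl
    go (_ ∷ _ ∷ _) (s≤s ()) _ _

runs⇒outputs : ∀ {n A μ s} {C : List (Fin n)} {o : Memory → ℕ} →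
               Runs A μ s (λ ν → Stored (ν outputBank) 0 C × o ν ≡ length C) → A Outputs C From μ Within s
runs⇒outputs (k , ν , run , k≤ , stored , _) = k , ν , run , k≤ , stored-applyUpTo 0 stored

module Solution {n} (G : Graph n) (tc : TwoConnected G) (3≤n : 3 ≤ n)
                (M : PathTreeModel G) (nc : IsNonCrossing M) (cm : IsCliqueModel M) where
  open PathTreeModel M
  module Leaf = LeafRoot tree isTree (proj₁ (Models.path-≢[] M (Fin.fromℕ< (≤-trans (s≤s z≤n) 3≤n))))

  -- The root depends on the tree alone, so tours of different layouts are comparable.
  R : Rooting tree Leaf.root
  R = rooting tree isTree Leaf.root

  open DistinctTours M nc cm tc R Leaf.root-leaf public using (tourᴸ; tour-↻; tour-mirror)

  static : ∀ L → Machine.Static M R L (input G M L)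
  static L = refl , refl , familyBanks-family (PlaneLayout.order L) , familyBanks-family path

  fresh : ∀ L → Machine.Fresh M R L (input G M L)
  fresh L = (λ _ → refl) , (λ _ → refl)

  runs : ∀ L → Runs tourProgram (input G M L) (200 * size G) (Emission.Output M R L (tourᴸ L))
  runs L = runs-weaken {tourProgram} {input G M L} {Q = Emission.Output M R L (tourᴸ L)}
    (EmissionLoop.total-cost M R L (Counting.nodes≤vertices M nc cm tc R) (Counting.incidences≤size M nc cm tc R) 3≤n) id
    (EmissionLoop.tourProgram-runs M R L
      (subst (_≤ 1) (sym (Leaf.length-order-≡ L Leaf.root)) Leaf.root-degree)
      (λ x lt → subst (2 ≤_) (sym (Leaf.length-order-≡ L x)) (Leaf.earlier-degree x lt))
      -- Cells outside the input hold 0, so the search for the root starts at node 0.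
      {input G M L} (static L) (fresh L) refl)

  outputs : ∀ L → tourProgram Outputs tourᴸ L From input G M L Within (200 * size G)
  outputs L = runs⇒outputs {A = tourProgram} {input G M L} {200 * size G} {tourᴸ L} {λ ν → ν outᵛ 0} (runs L)

  hamiltonian-cycle : ∀ L → IsHamiltonianCycle G (tourᴸ L)
  hamiltonian-cycle L = TourHamiltonian.tour-hamiltonian M R L nc cm tc 3≤n Leaf.root-leaf

construction : ∀ {n} (G : Graph n) → TwoConnected G → 3 ≤ n →
  (M : PathTreeModel G) → IsNonCrossing M → IsCliqueModel M →
  Σ (PlaneLayout (PathTreeModel.tree M) → List (Fin n)) λ H →
  (∀ L → IsHamiltonianCycle G (H L)
  × tourProgram Outputs H L From input G M L Within (200 * size G))
  × (∀ L L′ → (H L ↻ H L′) ⇔ (L ≈ᴸ L′))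
  × (∀ L L′ → H L ↻ reverse (H L′) → MirrorImages L L′)
construction G tc 3≤n M nc cm = tourᴸ , (λ L → hamiltonian-cycle L , outputs L) , tour-↻ , tour-mirror
  where open Solution G tc 3≤n M nc cm

theorem7 : (∀ {n} (G : Graph n) → Connected G → IsNCPathTreeGraph G →
    (∃ λ C → IsHamiltonianCycle G C) ⇔ (TwoConnected G × 3 ≤ n))
    ×
    (Σ Program λ A → Σ ℕ λ c →
    ∀ {n} (G : Graph n) → TwoConnected G → 3 ≤ n →
    (M : PathTreeModel G) → IsNonCrossing M → IsCliqueModel M →
    Σ (PlaneLayout (PathTreeModel.tree M) → List (Fin n)) λ H →
    (∀ L → IsHamiltonianCycle G (H L)
    × A Outputs H L From input G M L Within (c * size G))
    × (∀ L L′ → (H L ↻ H L′) ⇔ (L ≈ᴸ L′))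
    × (∀ L L′ → H L ↻ reverse (H L′) → MirrorImages L L′))
theorem7 =
  (λ G connected (M , nc) → mk⇔ (hamiltonian⇒2-connected connected)
                                (λ (tc , 3≤n) → ModelHamiltonian.model-hamiltonian M nc tc 3≤n)) ,
  tourProgram , 200 , construction
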